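{- Let $\lambda=(\lambda_1,\lambda_2,2^\ell,1^{n-2\ell-\lambda_1-\lambda_2})\vdash n$ with $\lambda_1\ge\lambda_2\ge2$ and $\ell\ge0$, and set $m:=n-2\ell-\lambda_1-\lambda_2+2$. If $\lambda_1=\lambda_2$, then \[\langle\mathrm{Frob}(R_n^{(0,2)};u,v),s_\lambda\rangle=(uv)^{\ell+\lambda_2-1}\big(uv[m-2]_{u,v}+[m]_{u,v}+[m-1]_{u,v}\big).\] If $\lambda_1>\lambda_2$, then \[\langle\mathrm{Frob}(R_n^{(0,2)};u,v),s_\lambda\rangle=(uv)^{\ell+\lambda_2-1}\big(uv[m-1]_{u,v}+uv[m-2]_{u,v}+[m]_{u,v}+[m-1]_{u,v}\big).\]
   Context: $R_n^{(0,2)}$ is the quotient of the exterior algebra $\mathbb{Q}[\theta_1,\dots,\theta_n,\xi_1,\dots,\xi_n]$ (all $2n$ generators pairwise anticommuting) by the ideal generated by the elements with zero constant term invariant under the diagonal $\mathfrak{S}_n$-action $\sigma(\theta_i)=\theta_{\sigma(i)}$, $\sigma(\xi_i)=\xi_{\sigma(i)}$. It is bigraded by $\theta$-degree and $\xi$-degree, and $\mathrm{Frob}(R_n^{(0,2)};u,v)=\sum_{a,b}F\,\mathrm{char}((R_n^{(0,2)})_{a,b})u^av^b$ with $F$ the Frobenius characteristic; $\langle\cdot,\cdot\rangle$ is the Hall inner product and $s_\lambda$ the Schur function. $[k]_{u,v}=u^{k-1}+u^{k-2}v+\cdots+v^{k-1}$ for $k\ge1$, $[0]_{u,v}=0$.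 -}

module Defs where

open import Data.Nat as ℕ using (ℕ; zero; suc; _+_; _∸_; _<ᵇ_; _≡ᵇ_; _≤ᵇ_; _!)
open import Data.Integer as ℤ using (ℤ; +_)
open import Data.Rational as ℚ using (ℚ; 0ℚ; 1ℚ)
open import Data.List using (List; []; _∷_; _++_; map; concatMap; foldl; foldr; length; replicate; upTo; zip)
open import Data.Bool using (Bool; true; false; if_then_else_; _∧_; _∨_; not)
open import Data.Maybe using (Maybe; just; nothing)
open import Data.Product using (_×_; _,_; proj₁; proj₂)
open import Relation.Nullary using (yes; no; does)

lookupD : List ℕ → ℕ → ℕ
lookupD [] _ = 0
lookupD (x ∷ xs) zero = x
lookupD (x ∷ xs) (suc i) = lookupD xs i

filterB : {A : Set} → (A → Bool) → List A → List A
filterB p [] = []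
filterB p (x ∷ xs) = if p x then x ∷ filterB p xs else filterB p xs

countB : {A : Set} → (A → Bool) → List A → ℕ
countB p xs = length (filterB p xs)

allB : {A : Set} → (A → Bool) → List A → Bool
allB p [] = true
allB p (x ∷ xs) = p x ∧ allB p xs

elemB : ℕ → List ℕ → Bool
elemB x [] = false
elemB x (y ∷ ys) = (x ≡ᵇ y) ∨ elemB x ys

eqListB : List ℕ → List ℕ → Bool
eqListB [] [] = true
eqListB (x ∷ xs) (y ∷ ys) = (x ≡ᵇ y) ∧ eqListB xs ys
eqListB _ _ = false

ℕtoℚ : ℕ → ℚ
ℕtoℚ k = (+ k) ℚ./ 1

ℤtoℚ : ℤ → ℚ
ℤtoℚ z = z ℚ./ 1

sumℚ : List ℚ → ℚ
sumℚ = foldr ℚ._+_ 0ℚ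

sumℤ : List ℤ → ℤ
sumℤ = foldr ℤ._+_ (+ 0)

-- inverse of a rational, with the convention 0⁻¹ = 0 (only used on nonzero values)
invℚ : ℚ → ℚ
invℚ c with c ℚ.≟ 0ℚ
... | yes _ = 0ℚ
... | no ne = ℚ.1/_ c {{ℚ.≢-nonZero ne}}

isZeroℚ : ℚ → Bool
isZeroℚ c = does (c ℚ.≟ 0ℚ)

-- The exterior algebra ℚ[θ₁..θₙ, ξ₁..ξₙ] (all generators anticommuting).
-- Generators are numbered 0..2n-1:  θ_{i+1} ↦ i,  ξ_{i+1} ↦ n + i.
-- A basis monomial is a strictly increasing list of generators (the product
-- of those generators in increasing order).  An element is a formal
-- ℚ-linear combination of basis monomials (list of terms).

Mono : Set
Mono = List ℕ

Elem : Set
Elem = List (ℚ × Mono)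

inversions : List ℕ → ℕ
inversions [] = 0
inversions (x ∷ xs) = countB (λ y → y <ᵇ x) xs + inversions xs

hasDup : List ℕ → Bool
hasDup [] = false
hasDup (x ∷ xs) = elemB x xs ∨ hasDup xs

insertSorted : ℕ → List ℕ → List ℕ
insertSorted x [] = x ∷ []
insertSorted x (y ∷ ys) = if x <ᵇ y then x ∷ y ∷ ys else y ∷ insertSorted x ys

sortℕ : List ℕ → List ℕ
sortℕ = foldr insertSorted []

evenB : ℕ → Bool
evenB zero = true
evenB (suc k) = not (evenB k)

normWord : List ℕ → ℚ × Mono
normWord w = if hasDup w then (0ℚ , [])
             else ((if evenB (inversions w) then 1ℚ else ℚ.-_ 1ℚ) , sortℕ w)

mulTerm : ℚ × Mono → ℚ × Mono → ℚ × Mono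
mulTerm (c , m) (d , m') with normWord (m ++ m')
... | (s , w) = (c ℚ.* d ℚ.* s , w)

mulElem : Elem → Elem → Elem
mulElem x y = concatMap (λ t → map (mulTerm t) y) x

sublists : List ℕ → List (List ℕ)
sublists [] = [] ∷ []
sublists (x ∷ xs) = map (x ∷_) (sublists xs) ++ sublists xs

allMonos : ℕ → List Mono
allMonos n = sublists (upTo (n + n))

isNonEmpty : Mono → Bool
isNonEmpty [] = false
isNonEmpty (_ ∷ _) = true

θdeg : ℕ → Mono → ℕ
θdeg n m = countB (λ g → g <ᵇ n) m

ξdeg : ℕ → Mono → ℕ
ξdeg n m = countB (λ g → n ≤ᵇ g) m

basis : ℕ → ℕ → ℕ → List Mono
basis n a b = filterB (λ m → (θdeg n m ≡ᵇ a) ∧ (ξdeg n m ≡ᵇ b)) (allMonos n)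

coordOf : Elem → Mono → ℚ
coordOf x β = sumℚ (map proj₁ (filterB (λ t → eqListB (proj₂ t) β) x))

Vec' : Set
Vec' = List ℚ

coords : ℕ → ℕ → ℕ → Elem → Vec'
coords n a b x = map (coordOf x) (basis n a b)

toElem : ℕ → ℕ → ℕ → Vec' → Elem
toElem n a b v = zip v (basis n a b)

-- The symmetric group 𝔖ₙ acting diagonally.
-- A permutation of {0..n-1} is given in one-line notation as a list.

insertions : ℕ → List ℕ → List (List ℕ)
insertions x [] = (x ∷ []) ∷ []
insertions x (y ∷ ys) = (x ∷ y ∷ ys) ∷ map (y ∷_) (insertions x ys)

perms : ℕ → List (List ℕ)
perms zero = [] ∷ []
perms (suc k) = concatMap (insertions k) (perms k)

actGen : ℕ → List ℕ → ℕ → ℕ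
actGen n σ g = if g <ᵇ n then lookupD σ g else n + lookupD σ (g ∸ n)

actElem : ℕ → List ℕ → Elem → Elem
actElem n σ x = map f x
  where
  f : ℚ × Mono → ℚ × Mono
  f (c , m) with normWord (map (actGen n σ) m)
  ... | (s , w) = (c ℚ.* s , w)

-- Reynolds operator (without the 1/n! factor): its values on basis
-- monomials span the invariants.
reynolds : ℕ → Mono → Elem
reynolds n m = concatMap (λ σ → actElem n σ ((1ℚ , m) ∷ [])) (perms n)

-- The ideal I generated by the 𝔖ₙ-invariants with zero constant term.
-- Its (a,b)-piece is spanned by the (a,b)-components of R(m)·m' with m a
-- nonempty monomial and m' any monomial.

idealGens : ℕ → ℕ → ℕ → List Vec'
idealGens n a b =
  concatMap (λ m → map (λ m' → coords n a b (mulElem (reynolds n m) ((1ℚ , m') ∷ [])))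
                       (allMonos n))
            (filterB isNonEmpty (allMonos n))

indexℚ : Vec' → ℕ → ℚ
indexℚ [] _ = 0ℚ
indexℚ (x ∷ xs) zero = x
indexℚ (x ∷ xs) (suc i) = indexℚ xs i

vsub : Vec' → Vec' → Vec'
vsub [] _ = []
vsub (x ∷ xs) [] = x ∷ xs
vsub (x ∷ xs) (y ∷ ys) = (x ℚ.- y) ∷ vsub xs ys

vscale : ℚ → Vec' → Vec'
vscale c = map (c ℚ.*_)

firstNZ : Vec' → Maybe ℕ
firstNZ [] = nothing
firstNZ (x ∷ xs) with isZeroℚ x | firstNZ xs
... | false | _ = just 0
... | true | just i = just (suc i)
... | true | nothing = nothing

-- a reduced basis: rows bᵢ with pivots pᵢ such that bᵢ[pⱼ] = δᵢⱼ
RBasis : Set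
RBasis = List (Vec' × ℕ)

reduceBy : RBasis → Vec' → Vec'
reduceBy B v = foldl (λ w bp → vsub w (vscale (indexℚ w (proj₂ bp)) (proj₁ bp))) v B

insertVec : RBasis → Vec' → RBasis
insertVec B v with reduceBy B v
... | v' with firstNZ v'
...   | nothing = B
...   | just p = (v'' , p) ∷ map (λ bq → (vsub (proj₁ bq) (vscale (indexℚ (proj₁ bq) p) v'') , proj₂ bq)) B
  where
  v'' : Vec'
  v'' = vscale (invℚ (indexℚ v' p)) v'

spanBasis : List Vec' → RBasis
spanBasis = foldl insertVec []

-- trace of σ on the σ-stable subspace W of E_{a,b} with reduced basis B:
-- tr(σ|W) = tr(σ ∘ P) with P(v) = Σ v[pᵢ] bᵢ the projection onto W.
traceSub : ℕ → ℕ → ℕ → List ℕ → RBasis → ℚ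
traceSub n a b σ B =
  sumℚ (map (λ bp → indexℚ (coords n a b (actElem n σ (toElem n a b (proj₁ bp)))) (proj₂ bp)) B)

traceE : ℕ → ℕ → ℕ → List ℕ → ℚ
traceE n a b σ = sumℚ (map (λ β → coordOf (actElem n σ ((1ℚ , β) ∷ [])) β) (basis n a b))

-- character of the (a,b)-piece of R_n^{(0,2)} = E / I
charR : ℕ → ℕ → ℕ → List ℕ → ℚ
charR n a b σ = traceE n a b σ ℚ.- traceSub n a b σ (spanBasis (idealGens n a b))

iterP : List ℕ → ℕ → ℕ → ℕ
iterP σ zero i = i
iterP σ (suc k) i = lookupD σ (iterP σ k i)

-- length of the cycle through i (n bounds it)
cycLen : ℕ → List ℕ → ℕ → ℕ
cycLen n σ i = go n 1
  where
  go : ℕ → ℕ → ℕ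
  go zero k = k
  go (suc f) k = if iterP σ k i ≡ᵇ i then k else go f (suc k)

isCycMin : ℕ → List ℕ → ℕ → Bool
isCycMin n σ i = allB (λ k → i ≤ᵇ iterP σ k i) (upTo n)

cycleType : ℕ → List ℕ → List ℕ
cycleType n σ = concatMap (λ i → if isCycMin n σ i then cycLen n σ i ∷ [] else []) (upTo n)

-- Irreducible characters χ^λ of 𝔖ₙ (Murnaghan–Nakayama rule on β-sets).

betaSet : List ℕ → List ℕ
betaSet p = go p (length p)
  where
  go : List ℕ → ℕ → List ℕ
  go [] _ = []
  go (x ∷ xs) r = (x + (r ∸ 1)) ∷ go xs (r ∸ 1)

replaceℕ : ℕ → ℕ → List ℕ → List ℕ
replaceℕ b c = map (λ x → if x ≡ᵇ b then c else x)

mn : List ℕ → List ℕ → ℤ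
mn β [] = if allB (λ x → x <ᵇ length β) β then + 1 else + 0
mn β (k ∷ μ) = sumℤ (map term β)
  where
  term : ℕ → ℤ
  term b = if (k ≤ᵇ b) ∧ not (elemB (b ∸ k) β)
           then ((if evenB (countB (λ c → ((b ∸ k) <ᵇ c) ∧ (c <ᵇ b)) β) then + 1 else ℤ.-_ (+ 1))
                 ℤ.* mn (replaceℕ b (b ∸ k) β) μ)
           else + 0

irrChar : List ℕ → List ℕ → ℤ
irrChar p μ = mn (betaSet p) μ

-- ⟨Frob(R_n^{(0,2)};u,v), s_λ⟩, coefficient of u^a v^b:
--   ⟨F char V, s_λ⟩ = (1/n!) Σ_{σ∈𝔖ₙ} χ_V(σ) χ^λ(σ)   with V = (R_n^{(0,2)})_{a,b}.

frobSchurCoeff : ℕ → List ℕ → ℕ → ℕ → ℚ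
frobSchurCoeff n p a b =
  invℚ (ℕtoℚ (n !)) ℚ.* sumℚ (map (λ σ → charR n a b σ ℚ.* ℤtoℚ (irrChar p (cycleType n σ))) (perms n))

-- Polynomials in u,v with ℕ coefficients, represented by coefficient functions.

Poly : Set
Poly = ℕ → ℕ → ℕ

-- [k]_{u,v} = u^{k-1} + u^{k-2} v + ⋯ + v^{k-1},  [0]_{u,v} = 0
qint : ℕ → Poly
qint zero a b = 0
qint (suc j) a b = if (a + b) ≡ᵇ j then 1 else 0

_⊕_ : Poly → Poly → Poly
(P ⊕ Q) a b = P a b + Q a b
infixl 6 _⊕_

uvPow* : ℕ → Poly → Poly
uvPow* e P a b = if (e ≤ᵇ a) ∧ (e ≤ᵇ b) then P (a ∸ e) (b ∸ e) else 0

hookPartition : ℕ → ℕ → ℕ → ℕ → List ℕ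
hookPartition n ℓ λ₁ λ₂ = λ₁ ∷ λ₂ ∷ (replicate ℓ 2 ++ replicate (n ∸ (2 ℕ.* ℓ + λ₁ + λ₂)) 1)

{-# OPTIONS --safe #-}
-- Write E for the exterior algebra on θ₁ , … , θₙ , ξ₁ , … , ξₙ, realised as
-- functions on Vec Bool (2 n) with creation and annihilation operators.  The
-- ideal of positive-degree invariants is generated by t = Σ θᵢ, s = Σ ξᵢ and
-- L = Σ θᵢ ξᵢ.  Dividing by t and s removes a factor (1 + u) (1 + v) from the
-- bigraded trace of a permutation; on that quotient L and its adjoint form an
-- 𝔰𝔩₂-pair, so L is injective below the middle degree and surjective above
-- it, and the trace in bidegree (a , b) is g a b - g (a - 1) (b - 1) when
-- a + b < n and 0 otherwise.
--
-- The bigraded trace on E of a permutation of cycle type μ is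
-- Π (1 - (-u)^μᵢ) (1 - (-v)^μᵢ), so its average against χ^λ is the Schur
-- function s_λ of the superalphabet (1 , u v ∣ u , v).  The Murnaghan–Nakayama
-- recursion identifies it with the top coefficient of a wedge product of beads;
-- for (λ₁ , λ₂ , 2^ℓ , 1^d) this is a 2 × 2 determinant of hook Schur functions
-- (Giambelli), which factorises.  The coefficients are recovered from the
-- values at all integers u > v ≥ 2.

module Submission where

open import Defs
open import Data.Nat using (ℕ; zero; suc; _+_; _*_; _∸_; _≤_; _<_; _≡ᵇ_; _<ᵇ_; _≤ᵇ_; z≤n; s≤s; _!)
open import Data.Rational using (ℚ; 0ℚ; 1ℚ)
open import Data.Bool using (Bool; true; false; if_then_else_; _∧_; _∨_; not)
open import Data.List using (List; []; _∷_; _++_; map; concatMap; foldl; length; replicate; upTo; applyUpTo; zip; concat)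
open import Data.Vec using (Vec; []; _∷_)
open import Data.Maybe using (Maybe; just; nothing)
open import Data.Product using (_×_; _,_; proj₁; proj₂; Σ; ∃-syntax)
open import Data.Sum using (_⊎_; inj₁; inj₂)
open import Data.Empty using (⊥; ⊥-elim)
open import Function using (_∘_; id; case_of_)
open import Relation.Nullary using (yes; no)
open import Relation.Binary.PropositionalEquality using (_≡_; _≢_; refl; sym; trans; cong; cong₂; subst; subst₂; module ≡-Reasoning)
open import Tactic.RingSolver.Core.AlmostCommutativeRing using (AlmostCommutativeRing; fromCommutativeRing)
open import Tactic.RingSolver using (solve-∀)
open import Algebra.Bundles using (CommutativeRing)
open import Level using (0ℓ)
import Data.Nat.Properties as ℕₚ
import Data.Rational as ℚ
import Data.Rational.Properties as ℚₚ
import Data.Rational.Unnormalised as ℚᵘ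
import Data.Rational.Unnormalised.Properties as ℚᵘₚ
import Data.Integer as ℤ
import Data.Integer.Properties as ℤₚ
open import Data.List.Relation.Unary.All using (All; []; _∷_)
open import Data.List.Relation.Unary.Any using (here; there)
open import Data.List.Relation.Unary.AllPairs using (AllPairs; []; _∷_)
open import Data.List.Relation.Unary.Unique.Propositional using (Unique)
open import Data.List.Membership.Propositional using (_∈_)
open import Data.List.Relation.Binary.Permutation.Propositional using (_↭_; ↭-refl; ↭-sym; ↭-trans)
import Data.List.Relation.Unary.All as All
import Data.List.Relation.Unary.All.Properties as Allₚ
import Data.List.Relation.Binary.Permutation.Propositional as Perm
import Data.List.Relation.Binary.Permutation.Propositional.Properties as Permₚ
import Data.List.Membership.Propositional.Properties as ∈ₚ
import Data.List.Properties as Listₚ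
import Data.Bool.Properties as Boolₚ
open import Data.List.Relation.Binary.BagAndSetEquality using (∼bag⇒↭)
open import Data.List.Membership.Propositional.Properties.WithK using (unique∧set⇒bag)
open import Data.List using (initLast; _∷ʳ′_; _∷ʳ_)
open import Function.Bundles using (mk⇔)
import Data.List.Relation.Unary.Unique.Propositional.Properties as Uniqueₚ
import Data.Nat as ℕ
import Data.Nat.Tactic.RingSolver as ℕSolver
open import Data.Nat.ListAction using (sum)
open import Data.Nat.ListAction.Properties using (sum-↭)
open import Relation.Binary.Definitions using (tri<; tri≈; tri>)
open ≡-Reasoning

-- The character in the statement comes out of Gaussian elimination on coordinate lists. It is
-- replaced by the trace of an explicit projection: an operator that kills the ideal, differs from
-- the identity by elements of the ideal and commutes with the group has the character of the
-- quotient as its graded trace. Such traces are compared through tr (X Y) = tr (Y X), without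
-- decomposing representations.
--
-- The truncation to a + b < n obstructs generating functions, so the coefficients before truncation
-- are used. With k = λ₁ - λ₂ and d the number of ones, their generating function is (1 + u) (1 + v)
-- [d + 1] times a power of u v times 1 - (u v)^(k + 1). The part carrying (u v)^(k + 1) begins in
-- degree n + k and is cut off. The other part ends in degree n - k: it survives whole if k > 0 and
-- loses exactly its top degree if k = 0, whence the two cases of the theorem.
--
-- The closed forms divide by u - v and by 1 - u v; at integers u > v ≥ 2 both are nonzero, and so
-- is (1 + u) (1 + v).

infixl 6 _⊹_ _−_
infixl 7 _·_
infix 8 −_

infixr 6 _∙_

_∙_ : ∀ {A : Set} {x y z : A} → x ≡ y → y ≡ z → x ≡ z
_∙_ = trans

-- Opaque copies of the operations of ℚ: they are rigid for unification,
-- so that the arguments of ring identities can be inferred.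
opaque
  _⊹_ _·_ : ℚ → ℚ → ℚ
  _⊹_ = ℚ._+_
  _·_ = ℚ._*_

  −_ : ℚ → ℚ
  −_ = ℚ.-_

_−_ : ℚ → ℚ → ℚ
x − y = x ⊹ − y

opaque
  unfolding _⊹_

  ℚ-commutativeRing : CommutativeRing 0ℓ 0ℓ
  ℚ-commutativeRing = record
    { Carrier = ℚ ; _≈_ = _≡_ ; _+_ = _⊹_ ; _*_ = _·_ ; -_ = −_ ; 0# = 0ℚ ; 1# = 1ℚ
    ; isCommutativeRing = ℚₚ.+-*-isCommutativeRing }

  isZero : ∀ x → Maybe (0ℚ ≡ x)
  isZero x with 0ℚ ℚₚ.≟ x
  ... | yes p = just p
  ... | no _ = nothing

  ℚ-ring : AlmostCommutativeRing 0ℓ 0ℓ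
  ℚ-ring = fromCommutativeRing ℚ-commutativeRing isZero

  ⊹-comm : ∀ x y → x ⊹ y ≡ y ⊹ x
  ⊹-comm = ℚₚ.+-comm

  ⊹-assoc : ∀ x y z → (x ⊹ y) ⊹ z ≡ x ⊹ (y ⊹ z)
  ⊹-assoc = ℚₚ.+-assoc

  ⊹-identityˡ : ∀ x → 0ℚ ⊹ x ≡ x
  ⊹-identityˡ = ℚₚ.+-identityˡ

  ⊹-identityʳ : ∀ x → x ⊹ 0ℚ ≡ x
  ⊹-identityʳ = ℚₚ.+-identityʳ

  −-inverse : ∀ x → x − x ≡ 0ℚ
  −-inverse = ℚₚ.+-inverseʳ

  ·-comm : ∀ x y → x · y ≡ y · x
  ·-comm = ℚₚ.*-comm

  ·-assoc : ∀ x y z → (x · y) · z ≡ x · (y · z)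
  ·-assoc = ℚₚ.*-assoc

  ·-identityˡ : ∀ x → 1ℚ · x ≡ x
  ·-identityˡ = ℚₚ.*-identityˡ

  ·-identityʳ : ∀ x → x · 1ℚ ≡ x
  ·-identityʳ = ℚₚ.*-identityʳ

  ·-zeroˡ : ∀ x → 0ℚ · x ≡ 0ℚ
  ·-zeroˡ = ℚₚ.*-zeroˡ

  ·-zeroʳ : ∀ x → x · 0ℚ ≡ 0ℚ
  ·-zeroʳ = ℚₚ.*-zeroʳ

  ·-distribˡ-⊹ : ∀ x y z → x · (y ⊹ z) ≡ x · y ⊹ x · z
  ·-distribˡ-⊹ = ℚₚ.*-distribˡ-+

  ·-inverseˡ : ∀ c → c ≢ 0ℚ → invℚ c · c ≡ 1ℚ
  ·-inverseˡ c c≢0 with c ℚₚ.≟ 0ℚ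
  ... | yes eq = ⊥-elim (c≢0 eq)
  ... | no ne = ℚₚ.*-inverseˡ c {{ℚ.≢-nonZero ne}}

  −0≡0 : − 0ℚ ≡ 0ℚ
  −0≡0 = refl

  interchange : ∀ a b c d → (a ⊹ b) ⊹ (c ⊹ d) ≡ (a ⊹ c) ⊹ (b ⊹ d)
  interchange = solve-∀ ℚ-ring

  −≡-1· : ∀ x → − x ≡ (− 1ℚ) · x
  −≡-1· = solve-∀ ℚ-ring

  ℤtoℚ-⊹ : ∀ x y → ℤtoℚ (x ℤ.+ y) ≡ ℤtoℚ x ⊹ ℤtoℚ y
  ℤtoℚ-⊹ x y = ℚₚ.toℚᵘ-injective begin′
    where
    module R = ℚᵘₚ.≃-Reasoning
    begin′ : ℚ.toℚᵘ (ℤtoℚ (x ℤ.+ y)) ℚᵘ.≃ ℚ.toℚᵘ (ℤtoℚ x ⊹ ℤtoℚ y)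
    begin′ = R.begin
      ℚ.toℚᵘ (ℤtoℚ (x ℤ.+ y)) R.≈⟨ ℚₚ.toℚᵘ-fromℚᵘ (ℚᵘ.mkℚᵘ (x ℤ.+ y) 0) ⟩
      ℚᵘ.mkℚᵘ (x ℤ.+ y) 0 R.≈⟨ ℚᵘ.*≡* (cong (ℤ._* ℤ.1ℤ) (cong₂ ℤ._+_ (sym (ℤₚ.*-identityʳ x)) (sym (ℤₚ.*-identityʳ y)))) ⟩
      ℚᵘ.mkℚᵘ x 0 ℚᵘ.+ ℚᵘ.mkℚᵘ y 0 R.≈⟨ ℚᵘₚ.+-cong (ℚᵘₚ.≃-sym (ℚₚ.toℚᵘ-fromℚᵘ (ℚᵘ.mkℚᵘ x 0))) (ℚᵘₚ.≃-sym (ℚₚ.toℚᵘ-fromℚᵘ (ℚᵘ.mkℚᵘ y 0))) ⟩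
      ℚ.toℚᵘ (ℤtoℚ x) ℚᵘ.+ ℚ.toℚᵘ (ℤtoℚ y) R.≈⟨ ℚᵘₚ.≃-sym (ℚₚ.toℚᵘ-homo-+ (ℤtoℚ x) (ℤtoℚ y)) ⟩
      ℚ.toℚᵘ (ℤtoℚ x ⊹ ℤtoℚ y) R.∎

  ℤtoℚ-· : ∀ x y → ℤtoℚ (x ℤ.* y) ≡ ℤtoℚ x · ℤtoℚ y
  ℤtoℚ-· x y = ℚₚ.toℚᵘ-injective begin′
    where
    module R = ℚᵘₚ.≃-Reasoning
    begin′ : ℚ.toℚᵘ (ℤtoℚ (x ℤ.* y)) ℚᵘ.≃ ℚ.toℚᵘ (ℤtoℚ x · ℤtoℚ y)
    begin′ = R.begin
      ℚ.toℚᵘ (ℤtoℚ (x ℤ.* y)) R.≈⟨ ℚₚ.toℚᵘ-fromℚᵘ (ℚᵘ.mkℚᵘ (x ℤ.* y) 0) ⟩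
      ℚᵘ.mkℚᵘ x 0 ℚᵘ.* ℚᵘ.mkℚᵘ y 0 R.≈⟨ ℚᵘₚ.*-cong (ℚᵘₚ.≃-sym (ℚₚ.toℚᵘ-fromℚᵘ (ℚᵘ.mkℚᵘ x 0))) (ℚᵘₚ.≃-sym (ℚₚ.toℚᵘ-fromℚᵘ (ℚᵘ.mkℚᵘ y 0))) ⟩
      ℚ.toℚᵘ (ℤtoℚ x) ℚᵘ.* ℚ.toℚᵘ (ℤtoℚ y) R.≈⟨ ℚᵘₚ.≃-sym (ℚₚ.toℚᵘ-homo-* (ℤtoℚ x) (ℤtoℚ y)) ⟩
      ℚ.toℚᵘ (ℤtoℚ x · ℤtoℚ y) R.∎

-- Ring identities
opaque
  unfolding ℚ-ring

  ring1 : ∀ c m → c ⊹ m · c ≡ (1ℚ ⊹ m) · c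
  ring1 = solve-∀ ℚ-ring
  ring2 : ∀ c d x → c · (d · x) ≡ d · (c · x)
  ring2 = solve-∀ ℚ-ring
  ring3 : ∀ a b c d → (a ⊹ b) − (c ⊹ d) ≡ (a − c) ⊹ (b − d)
  ring3 = solve-∀ ℚ-ring
  ring4 : ∀ c a b → c · a − c · b ≡ c · (a − b)
  ring4 = solve-∀ ℚ-ring
  ring5 : ∀ w a b c d → w · (a ⊹ b) − (c ⊹ d) ≡ (w · a − c) ⊹ (w · b − d)
  ring5 = solve-∀ ℚ-ring
  ring6 : ∀ w c a b → w · (c · a) − c · b ≡ c · (w · a − b)
  ring6 = solve-∀ ℚ-ring
  ring7 : ∀ w a b c d → w · (a ⊹ b) ⊹ (c ⊹ d) ≡ (w · a ⊹ c) ⊹ (w · b ⊹ d)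
  ring7 = solve-∀ ℚ-ring
  ring8 : ∀ a b → − (a ⊹ b) ≡ − a ⊹ − b
  ring8 = solve-∀ ℚ-ring
  ring9 : ∀ w c a b → w · (c · a) ⊹ c · b ≡ c · (w · a ⊹ b)
  ring9 = solve-∀ ℚ-ring
  ring10 : ∀ c a → − (c · a) ≡ c · (− a)
  ring10 = solve-∀ ℚ-ring
  ring11 : ∀ a b c → a − (b − − c) ≡ − (b − (a − c))
  ring11 = solve-∀ ℚ-ring
  ring12 : ∀ w z a b c → w · (− a) ⊹ (z · b ⊹ − c) ≡ − (z · (− b) ⊹ (w · a ⊹ c))
  ring12 = solve-∀ ℚ-ring
  ring13 : ∀ a → 0ℚ · a − 0ℚ ≡ 0ℚ
  ring13 = solve-∀ ℚ-ring
  ring14 : ∀ w z a b d e → w · (z · a − b) ⊹ (d · a − e) ≡ (w · z ⊹ d) · a − (w · b ⊹ e)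
  ring14 = solve-∀ ℚ-ring
  ring15 : ∀ w z a b d e → − (z · a − (d · b − e)) ≡ (w · z ⊹ d) · b − (z · (w · b ⊹ a) − − e)
  ring15 = solve-∀ ℚ-ring
  ring16 : ∀ x → (1ℚ ⊹ 1ℚ) · x ≡ x ⊹ x
  ring16 = solve-∀ ℚ-ring
  ring17 : ∀ x → x ⊹ − x ≡ (1ℚ ⊹ 1ℚ) · 0ℚ
  ring17 = solve-∀ ℚ-ring
  ring18 : ∀ w z a b c → (w ⊹ z) · a − (b ⊹ c) ≡ (w · a − b) ⊹ (z · a − c)
  ring18 = solve-∀ ℚ-ring
  ring19 : ∀ k w a b → (k · w) · a − k · b ≡ k · (w · a − b)
  ring19 = solve-∀ ℚ-ring
  ring20 : ∀ w z a b c → (w ⊹ z) · a ⊹ (b ⊹ c) ≡ (w · a ⊹ b) ⊹ (z · a ⊹ c)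
  ring20 = solve-∀ ℚ-ring
  ring21 : ∀ a → 0ℚ · a ⊹ 0ℚ ≡ 0ℚ
  ring21 = solve-∀ ℚ-ring
  ring22 : ∀ a s m → (1ℚ · (1ℚ · a ⊹ 0ℚ) − 0ℚ) ⊹ s ⊹ m · a ≡ s ⊹ (1ℚ ⊹ m) · a
  ring22 = solve-∀ ℚ-ring
  ring23 : ∀ a b → 0ℚ · a − − b ≡ b
  ring23 = solve-∀ ℚ-ring
  ring24 : ∀ a b k → (a ⊹ b) · k ≡ a · k ⊹ b · k
  ring24 = solve-∀ ℚ-ring
  ring25 : ∀ a → 1ℚ · a − 0ℚ ≡ a
  ring25 = solve-∀ ℚ-ring
  ring26 : ∀ w a → 0ℚ ⊹ w · a ≡ w · (a ⊹ w · 0ℚ)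
  ring26 = solve-∀ ℚ-ring
  ring27 : ∀ w v a b → w · a ⊹ v · (w · b) ≡ w · (a ⊹ v · b)
  ring27 = solve-∀ ℚ-ring
  ring28 : ∀ a b → 0ℚ · a − b ≡ (− 1ℚ) · b
  ring28 = solve-∀ ℚ-ring
  ring29 : ∀ w b → (− 1ℚ) · (w · − b) ≡ w · b
  ring29 = solve-∀ ℚ-ring
  ring30 : ∀ w → 0ℚ ⊹ w · − 0ℚ ≡ 0ℚ
  ring30 = solve-∀ ℚ-ring
  ring31 : ∀ a → 1ℚ · a ⊹ 0ℚ ≡ a
  ring31 = solve-∀ ℚ-ring
  ring32 : ∀ w a → w · (a ⊹ w · 0ℚ) ≡ 0ℚ ⊹ w · (a − 0ℚ)
  ring32 = solve-∀ ℚ-ring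
  ring33 : ∀ a b → 0ℚ · a ⊹ b ≡ b
  ring33 = solve-∀ ℚ-ring
  ring34 : ∀ v w a b → v · (a ⊹ w · − b) ≡ v · a ⊹ w · − (v · b)
  ring34 = solve-∀ ℚ-ring
  ring35 : ∀ a b s → a ⊹ (b ⊹ s) ≡ b ⊹ (a ⊹ s)
  ring35 = solve-∀ ℚ-ring
  ring36 : ∀ a b → − (a · b) ≡ (− a) · b
  ring36 = solve-∀ ℚ-ring
  ring37 : ∀ a → (− a) · (− a) ≡ a · a
  ring37 = solve-∀ ℚ-ring
  ring38 : ∀ a b → (− a) · b ≡ − (a · b)
  ring38 = solve-∀ ℚ-ring
  ring39 : ∀ a b d → a · (b · d) ≡ (b · a) · d
  ring39 = solve-∀ ℚ-ring
  ring40 : ∀ a b i x → a · (b · (i · x)) ≡ (i · (b · a)) · x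
  ring40 = solve-∀ ℚ-ring
  ring41 : ∀ i a x → (i · a) · x ≡ a · (i · x)
  ring41 = solve-∀ ℚ-ring
  ring42 : ∀ x y → x ≡ 0ℚ · y ⊹ x
  ring42 = solve-∀ ℚ-ring
  ring43 : ∀ x y → x ≡ x ⊹ 0ℚ · y
  ring43 = solve-∀ ℚ-ring
  ring44 : ∀ a b x → a · x ⊹ b · x ≡ (a ⊹ b) · x
  ring44 = solve-∀ ℚ-ring
  ring45 : ∀ a → 1ℚ · (1ℚ · a ⊹ 0ℚ) − 0ℚ ≡ a
  ring45 = solve-∀ ℚ-ring
  ring46 : ∀ a b → (a ⊹ b) − a ≡ b
  ring46 = solve-∀ ℚ-ring
  ring47 : ∀ a → − − a ≡ a
  ring47 = solve-∀ ℚ-ring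
  ring48 : ∀ a b → b ≡ (a ⊹ b) − a
  ring48 = solve-∀ ℚ-ring
  ring49 : ∀ f t → f · t ⊹ t ≡ (1ℚ ⊹ f) · t
  ring49 = solve-∀ ℚ-ring
  ring50 : ∀ a b → (a ⊹ b) − b ≡ a
  ring50 = solve-∀ ℚ-ring
  ring51 : ∀ d h x u → d · x ⊹ (u ⊹ h · x) ≡ (d ⊹ h) · x ⊹ u
  ring51 = solve-∀ ℚ-ring
  ring52 : ∀ d h y u → ((d ⊹ h) · y ⊹ u) − (u ⊹ h · y) ≡ d · y
  ring52 = solve-∀ ℚ-ring
  ring53 : ∀ a b → (a − b) ⊹ b ≡ a
  ring53 = solve-∀ ℚ-ring
  ring54 : ∀ a b → 0ℚ · a − b ≡ − b
  ring54 = solve-∀ ℚ-ring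
  ring55 : ∀ a b d → a − (b − d) ≡ d ⊹ (a − b)
  ring55 = solve-∀ ℚ-ring
  ring56 : ∀ a b → 1ℚ · a − 0ℚ · b ≡ a
  ring56 = solve-∀ ℚ-ring
  ring57 : ∀ a b → 0ℚ · a − 1ℚ · b ≡ − b
  ring57 = solve-∀ ℚ-ring
  ring58 : ∀ a b → a − 0ℚ · b ≡ a
  ring58 = solve-∀ ℚ-ring
  ring59 : ∀ l u y v → (l − u) ⊹ (y − v) ≡ l ⊹ (y − (u ⊹ v))
  ring59 = solve-∀ ℚ-ring
  ring60 : ∀ a b → a ⊹ 0ℚ · b ≡ a
  ring60 = solve-∀ ℚ-ring
  ring61 : ∀ a → a − 0ℚ ≡ a
  ring61 = solve-∀ ℚ-ring
  ring62 : ∀ ν n y → (0ℚ ⊹ y) − ν · (n · y) ≡ (1ℚ − ν · n) · y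
  ring62 = solve-∀ ℚ-ring
  ring63 : ∀ ν n y → (0ℚ − y) − ν · (− (n · y)) ≡ − ((1ℚ − ν · n) · y)
  ring63 = solve-∀ ℚ-ring
  ring64 : ∀ y → (1ℚ − 1ℚ) · y ≡ 0ℚ
  ring64 = solve-∀ ℚ-ring
  ring65 : ∀ l n x m ν z → (l ⊹ (n · x − m)) − ν · (z ⊹ n · x) ≡ (l − ν · z) ⊹ (n · x − (ν · n) · x − m)
  ring65 = solve-∀ ℚ-ring
  ring66 : ∀ m m′ x y k → (m − m′) ⊹ (x − y) ⊹ k · (x − y) ≡ (m ⊹ x ⊹ k · x) − (m′ ⊹ y ⊹ k · y)
  ring66 = solve-∀ ℚ-ring
  ring67 : ∀ m m′ x y → (m − m′) ⊹ (x − y) ≡ (m ⊹ x) − (m′ ⊹ y)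
  ring67 = solve-∀ ℚ-ring
  ring68 : ∀ n k x y → (n · x ⊹ k · x) − (n · y ⊹ k · y) ≡ n · (x − y) ⊹ k · (x − y)
  ring68 = solve-∀ ℚ-ring
  ring69 : ∀ m x k j → j · m ⊹ j · x ⊹ k · (j · x) ≡ j · (m ⊹ x ⊹ k · x)
  ring69 = solve-∀ ℚ-ring
  ring70 : ∀ m x j → j · m ⊹ j · x ≡ j · (m ⊹ x)
  ring70 = solve-∀ ℚ-ring
  ring71 : ∀ j n k x → j · (n · x ⊹ k · x) ≡ n · (j · x) ⊹ k · (j · x)
  ring71 = solve-∀ ℚ-ring
  ring72 : ∀ m y d k → m ⊹ y ⊹ (d ⊹ k) · y ≡ (m ⊹ d · y) ⊹ y ⊹ k · y
  ring72 = solve-∀ ℚ-ring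
  ring73 : ∀ m y d k → (m ⊹ d · y) ⊹ y ⊹ k · y ≡ m ⊹ y ⊹ (d ⊹ k) · y
  ring73 = solve-∀ ℚ-ring
  ring74 : ∀ m y k → (m ⊹ y ⊹ k) − y − m ≡ k
  ring74 = solve-∀ ℚ-ring
  ring75 : ∀ m y d → (m ⊹ d · y) ⊹ y ≡ (m ⊹ y) ⊹ d · y
  ring75 = solve-∀ ℚ-ring
  ring76 : ∀ n y k d → (n · y ⊹ k · y) ⊹ d · y ≡ n · y ⊹ (d ⊹ k) · y
  ring76 = solve-∀ ℚ-ring
  ring77 : ∀ m y d → m ⊹ y ≡ ((m ⊹ d · y) ⊹ y) − d · y
  ring77 = solve-∀ ℚ-ring
  ring78 : ∀ n y k d → (n · y ⊹ (d ⊹ k) · y) − d · y ≡ n · y ⊹ k · y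
  ring78 = solve-∀ ℚ-ring
  ring79 : ∀ l n y m k → (l ⊹ (n − y − m)) ⊹ k ≡ l ⊹ ((n ⊹ k) − (m ⊹ y))
  ring79 = solve-∀ ℚ-ring
  ring80 : ∀ l u → l ⊹ (u − u) ≡ l
  ring80 = solve-∀ ℚ-ring
  ring81 : ∀ ν n x y → (ν · n) · x ≡ ν · (n · x − y) ⊹ ν · y
  ring81 = solve-∀ ℚ-ring
  ring82 : ∀ ν y → ν · − − y ≡ ν · y
  ring82 = solve-∀ ℚ-ring
  ring83 : ∀ a k → a ⊹ (0ℚ ⊹ 0ℚ) ≡ a − k · 0ℚ
  ring83 = solve-∀ ℚ-ring
  ring84 : ∀ a k → a − k · 0ℚ ≡ a
  ring84 = solve-∀ ℚ-ring
  ring85 : ∀ m y k → m · y ⊹ y ⊹ k · y ≡ (1ℚ ⊹ (m ⊹ k)) · y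
  ring85 = solve-∀ ℚ-ring
  ring86 : ∀ x q l → (x − q) ⊹ l ≡ x − (q − l)
  ring86 = solve-∀ ℚ-ring
  ring87 : ∀ x q → (x − q) ⊹ q ≡ x − 0ℚ
  ring87 = solve-∀ ℚ-ring
  ring88 : ∀ s y → s · − y ≡ (− s) · y
  ring88 = solve-∀ ℚ-ring
  ring89 : ∀ k s y → (k · 1ℚ · s) · y ⊹ 0ℚ ≡ k · (s · y)
  ring89 = solve-∀ ℚ-ring
  ring90 : ∀ s y → (1ℚ · s) · y ⊹ 0ℚ ≡ s · y
  ring90 = solve-∀ ℚ-ring
  ring91 : ∀ a b → a ≡ 0ℚ · b ⊹ 1ℚ · a
  ring91 = solve-∀ ℚ-ring
  ring92 : ∀ a b → a ≡ 1ℚ · a ⊹ 0ℚ · b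
  ring92 = solve-∀ ℚ-ring
  ring93 : ∀ a → a ≡ a − 0ℚ
  ring93 = solve-∀ ℚ-ring
  ring94 : ∀ a b c → (a − b) − c ≡ a − (b ⊹ c)
  ring94 = solve-∀ ℚ-ring
  ring95 : ∀ a → a · 1ℚ ⊹ 0ℚ ≡ a
  ring95 = solve-∀ ℚ-ring
  ring96 : ∀ a b → a · 0ℚ ⊹ b ≡ b
  ring96 = solve-∀ ℚ-ring
  ring97 : ∀ j k v u → j · (k · v ⊹ u) ≡ (j · k) · v ⊹ j · u
  ring97 = solve-∀ ℚ-ring
  ring98 : ∀ k v r u → k · (v · r) ⊹ u · r ≡ (k · v ⊹ u) · r
  ring98 = solve-∀ ℚ-ring
  ring99 : ∀ a → a − a · 1ℚ ≡ 0ℚ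
  ring99 = solve-∀ ℚ-ring
  ring100 : ∀ a b c w → a · (b − c · w) ≡ a · b ⊹ (− w) · (a · c)
  ring100 = solve-∀ ℚ-ring
  ring101 : ∀ a w s t → a · w ⊹ (s ⊹ (− w) · t) ≡ s ⊹ (a − t) · w
  ring101 = solve-∀ ℚ-ring
  ring102 : ∀ a b w → a ⊹ (b − b) · w ≡ a
  ring102 = solve-∀ ℚ-ring
  ring103 : ∀ a b → a ⊹ (b − a) ≡ b
  ring103 = solve-∀ ℚ-ring
  ring104 : ∀ a b → a ≡ (a − b) ⊹ b
  ring104 = solve-∀ ℚ-ring
  ring105 : ∀ k a e x → (k · a) · e ⊹ k · x ≡ k · (a · e ⊹ x)
  ring105 = solve-∀ ℚ-ring
  ring106 : ∀ k → k · 0ℚ ⊹ 0ℚ ≡ 0ℚ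
  ring106 = solve-∀ ℚ-ring
  ring107 : ∀ a b → a − (a ⊹ (− 1ℚ) · b) ≡ b
  ring107 = solve-∀ ℚ-ring
  ring108 : ∀ p f a y → p · (f ⊹ a · y) ≡ p · f ⊹ a · (p · y)
  ring108 = solve-∀ ℚ-ring
  ring109 : ∀ a b c → (a ⊹ b) ⊹ c ≡ (a ⊹ c) ⊹ b
  ring109 = solve-∀ ℚ-ring
  ring110 : ∀ x m a g → x ⊹ (1ℚ ⊹ m) · (a · g) ≡ x ⊹ (a · g ⊹ a · (m · g))
  ring110 = solve-∀ ℚ-ring
  ring111 : ∀ x a g y z → x ⊹ (a · g ⊹ a · (y ⊹ z)) ≡ (x ⊹ a · y) ⊹ (a · g ⊹ a · z)
  ring111 = solve-∀ ℚ-ring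
  ring112 : ∀ c f → (− c) · f ⊹ (− c) · 0ℚ ≡ − (c · f)
  ring112 = solve-∀ ℚ-ring
  ring113 : ∀ c f g → (− c) · (f ⊹ c · g) ⊹ (− c) · (− (c · g)) ≡ − (c · f)
  ring113 = solve-∀ ℚ-ring
  ring114 : ∀ x m c f → x ⊹ (1ℚ ⊹ m) · (c · f) ≡ (x ⊹ c · (m · f)) ⊹ − − (c · f)
  ring114 = solve-∀ ℚ-ring
  ring115 : ∀ x y a b → (x · y) · (a · b) ≡ (x · a) · (y · b)
  ring115 = solve-∀ ℚ-ring
  ring116 : ∀ x s a → (− x) · (s · a) ≡ (− s) · (x · a)
  ring116 = solve-∀ ℚ-ring
  ring117 : ∀ s a b → (((0ℚ ⊹ a · b) ⊹ 1ℚ) − (− s) · b) − (− s) · a ≡ 1ℚ ⊹ s · a ⊹ s · b ⊹ a · b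
  ring117 = solve-∀ ℚ-ring
  ring118 : ∀ s a b → (1ℚ ⊹ s · a) · (1ℚ ⊹ s · b) ≡ 1ℚ ⊹ s · a ⊹ s · b ⊹ (s · s) · (a · b)
  ring118 = solve-∀ ℚ-ring
  ring119 : ∀ s a b → (((0ℚ ⊹ b) ⊹ a) − (− s) · (a · b)) − (− s) · 1ℚ ≡ s ⊹ a ⊹ b ⊹ s · (a · b)
  ring119 = solve-∀ ℚ-ring
  ring120 : ∀ s a b → s · ((1ℚ ⊹ s · a) · (1ℚ ⊹ s · b)) ≡ s ⊹ (s · s) · a ⊹ (s · s) · b ⊹ (s · s) · (s · (a · b))
  ring120 = solve-∀ ℚ-ring
  ring121 : ∀ s a b → s ⊹ 1ℚ · a ⊹ 1ℚ · b ⊹ 1ℚ · (s · (a · b)) ≡ s ⊹ a ⊹ b ⊹ s · (a · b)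
  ring121 = solve-∀ ℚ-ring
  ring122 : ∀ w → (1ℚ − w) · 1ℚ ≡ 1ℚ − w · 1ℚ
  ring122 = solve-∀ ℚ-ring
  ring123 : ∀ w x s → (1ℚ − w) · (w · x ⊹ 1ℚ · s) ≡ (1ℚ − w) · (w · x) ⊹ (1ℚ − w) · s
  ring123 = solve-∀ ℚ-ring
  ring124 : ∀ w x → (1ℚ − w) · (w · x) ⊹ (1ℚ − w · x) ≡ 1ℚ − w · (w · x)
  ring124 = solve-∀ ℚ-ring
  ring125 : ∀ u v → (u − v) · 1ℚ ≡ u · 1ℚ − v · 1ℚ
  ring125 = solve-∀ ℚ-ring
  ring126 : ∀ u v x s → (u − v) · (v · x ⊹ u · s) ≡ (u − v) · (v · x) ⊹ u · ((u − v) · s)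
  ring126 = solve-∀ ℚ-ring
  ring127 : ∀ u v x y → (u − v) · (v · y) ⊹ u · (u · x − v · y) ≡ u · (u · x) − v · (v · y)
  ring127 = solve-∀ ℚ-ring
  ring128 : ∀ u v w s → w · (s ⊹ v · 1ℚ ⊹ u · 1ℚ) ≡ w · s ⊹ w · (u ⊹ v)
  ring128 = solve-∀ ℚ-ring
  ring129 : ∀ u v → (1ℚ − (u · v) · ((u · v) · 1ℚ)) ⊹ (1ℚ − u · v) · (u ⊹ v) ≡ (1ℚ ⊹ u) · (1ℚ ⊹ v) · (1ℚ − (u · v) · 1ℚ)
  ring129 = solve-∀ ℚ-ring
  ring130 : ∀ u v w a b d → w · ((a ⊹ v · b) ⊹ u · (b ⊹ v · d)) ≡ w · a ⊹ (u ⊹ v) · (w · b) ⊹ (u · v) · (w · d)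
  ring130 = solve-∀ ℚ-ring
  ring131 : ∀ u v x → (1ℚ − (u · v) · ((u · v) · ((u · v) · x))) ⊹ (u ⊹ v) · (1ℚ − (u · v) · ((u · v) · x)) ⊹ (u · v) · (1ℚ − (u · v) · x) ≡ (1ℚ ⊹ u) · (1ℚ ⊹ v) · (1ℚ − (u · v) · ((u · v) · x))
  ring131 = solve-∀ ℚ-ring
  ring132 : ∀ u v w s → w · (s ⊹ (u · v) · 1ℚ ⊹ 1ℚ · 1ℚ) ≡ w · s ⊹ w · (1ℚ ⊹ u · v)
  ring132 = solve-∀ ℚ-ring
  ring133 : ∀ u v → (u · (u · 1ℚ) − v · (v · 1ℚ)) ⊹ (u − v) · (1ℚ ⊹ u · v) ≡ (1ℚ ⊹ u) · (1ℚ ⊹ v) · (u · 1ℚ − v · 1ℚ)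
  ring133 = solve-∀ ℚ-ring
  ring134 : ∀ u v w a b d → w · ((a ⊹ (u · v) · b) ⊹ 1ℚ · (b ⊹ (u · v) · d)) ≡ w · a ⊹ (1ℚ ⊹ u · v) · (w · b) ⊹ (u · v) · (w · d)
  ring134 = solve-∀ ℚ-ring
  ring135 : ∀ u v x y → (u · (u · (u · x)) − v · (v · (v · y))) ⊹ (1ℚ ⊹ u · v) · (u · (u · x) − v · (v · y)) ⊹ (u · v) · (u · x − v · y) ≡ (1ℚ ⊹ u) · (1ℚ ⊹ v) · (u · (u · x) − v · (v · y))
  ring135 = solve-∀ ℚ-ring
  ring136 : ∀ i j u v X → (i · j · ((1ℚ ⊹ u) · (1ℚ ⊹ v))) · ((u · (1ℚ ⊹ v)) · 1ℚ − (v · (1ℚ ⊹ u)) · 1ℚ ⊹ (u · v) · X · ((1ℚ ⊹ v) · 1ℚ − (1ℚ ⊹ u) · 1ℚ)) ≡ (j · (u − v)) · (i · ((1ℚ ⊹ u) · (1ℚ ⊹ v) · (1ℚ − (u · v) · X)))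
  ring136 = solve-∀ ℚ-ring
  ring137 : ∀ i j u v U V → (i · j · ((1ℚ ⊹ u) · (1ℚ ⊹ v))) · ((u · (1ℚ ⊹ v)) · U − (v · (1ℚ ⊹ u)) · V ⊹ (u · v) · 1ℚ · ((1ℚ ⊹ v) · V − (1ℚ ⊹ u) · U)) ≡ (i · (1ℚ − u · v)) · (j · ((1ℚ ⊹ u) · (1ℚ ⊹ v) · (u · U − v · V)))
  ring137 = solve-∀ ℚ-ring
  ring138 : ∀ i j u v X U V → (i · j · ((1ℚ ⊹ u) · (1ℚ ⊹ v))) · ((u · (1ℚ ⊹ v)) · (u · U) − (v · (1ℚ ⊹ u)) · (v · V) ⊹ (u · v) · X · ((1ℚ ⊹ v) · (v · V) − (1ℚ ⊹ u) · (u · U))) ≡ (i · ((1ℚ ⊹ u) · (1ℚ ⊹ v) · (1ℚ − (u · v) · X))) · (j · ((1ℚ ⊹ u) · (1ℚ ⊹ v) · (u · U − v · V))) − (i · j · ((1ℚ ⊹ u) · (1ℚ ⊹ v))) · ((u · (1ℚ ⊹ v)) · U − (v · (1ℚ ⊹ u)) · V ⊹ (u · v) · ((u · v) · X) · ((1ℚ ⊹ v) · V − (1ℚ ⊹ u) · U))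
  ring138 = solve-∀ ℚ-ring
  ring139 : ∀ a b → a ⊹ b · 1ℚ ≡ a ⊹ 0ℚ ⊹ 1ℚ · b
  ring139 = solve-∀ ℚ-ring
  ring140 : ∀ m a b → m · (a − b) ≡ m · a − m · b
  ring140 = solve-∀ ℚ-ring
  ring141 : ∀ m n h e a b c → (m ⊹ n) · (h · e) − (a ⊹ b ⊹ c) ≡ ((m · h) · e − a) ⊹ (h · (n · e) − b) ⊹ − c
  ring141 = solve-∀ ℚ-ring
  ring142 : ∀ a p e → a ⊹ p · (1ℚ · e − e) ≡ a
  ring142 = solve-∀ ℚ-ring
  ring143 : ∀ h s q → h · (s ⊹ q · 1ℚ) ≡ h · s ⊹ q · h
  ring143 = solve-∀ ℚ-ring
  ring144 : ∀ a b c → (a ⊹ b) − c ≡ (a − c) ⊹ b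
  ring144 = solve-∀ ℚ-ring
  ring145 : ∀ t s m b n → ((t · s) · m) · (b · n) ≡ (t · b) · ((s · m) · n)
  ring145 = solve-∀ ℚ-ring
  ring146 : ∀ t s → t · (t · s) ≡ (t · t) · s
  ring146 = solve-∀ ℚ-ring
  ring147 : ∀ s a b p d → s · (a ⊹ b ⊹ s · p) ⊹ d ≡ s · a ⊹ (s · s) · p ⊹ (s · b ⊹ d)
  ring147 = solve-∀ ℚ-ring
  ring148 : ∀ a p d → a ⊹ 1ℚ · p ⊹ (− d ⊹ d) ≡ a ⊹ p
  ring148 = solve-∀ ℚ-ring
  ring149 : ∀ k t p g → (k · (− t)) · ((k · p) · g) ≡ (k · k) · (− (p · (t · g)))
  ring149 = solve-∀ ℚ-ring
  ring150 : ∀ c d → c ≡ d − (d − c)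
  ring150 = solve-∀ ℚ-ring
  ring151 : ∀ a g c d → a · g ⊹ c ≡ (a ⊹ d) · g − (d · g − c)
  ring151 = solve-∀ ℚ-ring
  ring152 : ∀ w n d c → w · (n · d − c) ≡ n · (w · d) ⊹ − (w · c)
  ring152 = solve-∀ ℚ-ring
  ring153 : ∀ a b → a − − b ≡ a ⊹ b
  ring153 = solve-∀ ℚ-ring
  ring154 : ∀ a → a · 1ℚ − 0ℚ ≡ a
  ring154 = solve-∀ ℚ-ring
  ring155 : ∀ b s w d e → (b · w − d) ⊹ (s · w − e) ≡ (b ⊹ s) · w − (d ⊹ e)
  ring155 = solve-∀ ℚ-ring
  ring156 : ∀ a b → a − b ≡ a ⊹ (− 1ℚ) · b
  ring156 = solve-∀ ℚ-ring
  ring157 : ∀ n t p → (n ⊹ t) · p − t · p ≡ n · p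
  ring157 = solve-∀ ℚ-ring
  ring158 : ∀ i → i · (1ℚ · 1ℚ ⊹ 0ℚ) ≡ i · 1ℚ
  ring158 = solve-∀ ℚ-ring
  ring159 : ∀ p d e f → p · (d · (e · f)) ≡ e · (d · (p · f))
  ring159 = solve-∀ ℚ-ring
  ring160 : ∀ s e f → s · ((s · e) · f) ≡ (s · s) · (1ℚ · (e · f))
  ring160 = solve-∀ ℚ-ring
  ring161 : ∀ e → 1ℚ · (e · 0ℚ) ≡ 0ℚ
  ring161 = solve-∀ ℚ-ring
  ring162 : ∀ a → a · 1ℚ − 0ℚ ≡ 1ℚ · a
  ring162 = solve-∀ ℚ-ring
  ring163 : ∀ a s b → a · 0ℚ − s · b ≡ (− s) · b
  ring163 = solve-∀ ℚ-ring
  ring164 : ∀ s w z w′ z′ → w · (s · z′) − z · (s · w′) ≡ s · (w · z′ − z · w′)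
  ring164 = solve-∀ ℚ-ring
  ring165 : ∀ a b → a · 0ℚ − b ≡ (− 1ℚ) · b
  ring165 = solve-∀ ℚ-ring
  ring166 : ∀ a b → a · 0ℚ − (− 1ℚ) · b ≡ b
  ring166 = solve-∀ ℚ-ring
  ring167 : ∀ s t a b a′ b′ → s · ((t · a) · ((t · − s) · b′) − (t · b) · ((t · − s) · a′)) ≡ ((s · s) · (t · t)) · (a′ · b − a · b′)
  ring167 = solve-∀ ℚ-ring
  ring168 : ∀ a → (1ℚ · 1ℚ) · a ≡ a
  ring168 = solve-∀ ℚ-ring
  ring169 : ∀ u v X Y U V′ S T → ((u · (1ℚ ⊹ v)) · U − (v · (1ℚ ⊹ u)) · V′ ⊹ (u · v) · X · ((1ℚ ⊹ v) · V′ − (1ℚ ⊹ u) · U)) · ((u · (1ℚ ⊹ v)) · S − (v · (1ℚ ⊹ u)) · T ⊹ (u · v) · Y · ((1ℚ ⊹ v) · T − (1ℚ ⊹ u) · S)) − ((u · (1ℚ ⊹ v)) · S − (v · (1ℚ ⊹ u)) · T ⊹ (u · v) · X · ((1ℚ ⊹ v) · T − (1ℚ ⊹ u) · S)) · ((u · (1ℚ ⊹ v)) · U − (v · (1ℚ ⊹ u)) · V′ ⊹ (u · v) · Y · ((1ℚ ⊹ v) · V′ − (1ℚ ⊹ u) · U)) ≡ ((u · v) · (Y − X)) · ((U · T − V′ · S) · ((u − v) · (1ℚ − u · v)))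
  ring169 = solve-∀ ℚ-ring
  ring170 : ∀ D k a b c d → D · ((k · a) · (k · b) − (k · c) · (k · d)) ≡ D · ((k · k) · (a · b − c · d))
  ring170 = solve-∀ ℚ-ring
  ring171 : ∀ m n i j E w D M → (m · n) · (((i · j · E) · (i · j · E)) · ((w · D) · (M · (m · n)))) ≡ ((i · n) · (j · m) · ((i · n) · (j · m))) · (E · E · ((w · D) · M))
  ring171 = solve-∀ ℚ-ring
  ring172 : ∀ E w Y k S T a b → (1ℚ · 1ℚ · (1ℚ · 1ℚ)) · (E · E · ((w · (Y − Y · k)) · ((S · a) · T − (T · b) · S))) ≡ E · E · (w · ((S · T) · Y) · (1ℚ − k) · (a − b))
  ring172 = solve-∀ ℚ-ring
  ring173 : ∀ x p s → 0ℚ ⊹ x · (p · s) ≡ (x · p) · s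
  ring173 = solve-∀ ℚ-ring
  ring174 : ∀ a x ρ → a · 1ℚ ⊹ 0ℚ ≡ (a · 1ℚ ⊹ 0ℚ) ⊹ (x − ρ) · 0ℚ
  ring174 = solve-∀ ℚ-ring
  ring175 : ∀ a x ρ p q → a ⊹ x · (p ⊹ (x − ρ) · q) ≡ (a ⊹ ρ · p) ⊹ (x − ρ) · (p ⊹ x · q)
  ring175 = solve-∀ ℚ-ring
  ring176 : ∀ a b → a ≡ (a ⊹ b) − b
  ring176 = solve-∀ ℚ-ring
  ring177 : ∀ r → 0ℚ − r · 0ℚ ≡ 0ℚ
  ring177 = solve-∀ ℚ-ring
  ring178 : ∀ x → 0ℚ − 0ℚ ≡ x · 0ℚ
  ring178 = solve-∀ ℚ-ring
  ring179 : ∀ v a b → a · (v · b) ≡ v · (a · b)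
  ring179 = solve-∀ ℚ-ring
  ring180 : ∀ a → a ≡ (1ℚ · 1ℚ) · a
  ring180 = solve-∀ ℚ-ring
  ring181 : ∀ p q t → (p · q) · t ≡ p · (t · q)
  ring181 = solve-∀ ℚ-ring
  ring182 : ∀ p q d e x → (p · q) · ((d · e) · x) ≡ (x · (d · p)) · (e · q)
  ring182 = solve-∀ ℚ-ring
  ring183 : ∀ p q x → (p · q) · x ≡ (x · p) · q
  ring183 = solve-∀ ℚ-ring
  ring184 : ∀ u v g → (1ℚ ⊹ u) · (1ℚ ⊹ v) · (g ⊹ (− 1ℚ) · (u · (v · g))) ≡ (1ℚ − u · v) · ((g ⊹ u · g) ⊹ v · (g ⊹ u · g))
  ring184 = solve-∀ ℚ-ring
  ring185 : ∀ v → 1ℚ ⊹ v · 0ℚ ≡ 1ℚ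
  ring185 = solve-∀ ℚ-ring
  ring186 : ∀ x → x · 0ℚ ≡ 1ℚ − 1ℚ
  ring186 = solve-∀ ℚ-ring
  ring187 : ∀ u v p s → (u − v) · (p ⊹ u · s) ≡ (u − v) · p ⊹ u · ((u − v) · s)
  ring187 = solve-∀ ℚ-ring
  ring188 : ∀ u v p q → (u − v) · q ⊹ u · (p − q) ≡ u · p − v · q
  ring188 = solve-∀ ℚ-ring
  ring189 : ∀ m w a b s t → m · (((w · 1ℚ) · a ⊹ (w · 1ℚ) · b) ⊹ s ⊹ t) ≡ w · (m · a) ⊹ w · (m · b) ⊹ m · s ⊹ m · t
  ring189 = solve-∀ ℚ-ring
  ring190 : ∀ u v p q → (u · v) · (u · p − v · q) ⊹ (u · v) · (p − q) ⊹ (u · (u · p) − v · (v · q)) ⊹ (u · p − v · q) ≡ ((1ℚ ⊹ u) · (1ℚ ⊹ v)) · (u · p − v · q)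
  ring190 = solve-∀ ℚ-ring
  ring191 : ∀ x w f → x · (w · f) ≡ w · (f · x)
  ring191 = solve-∀ ℚ-ring
  ring192 : ∀ x a b t → x · (a ⊹ (− 1ℚ) · (b ⊹ (− 1ℚ) · t)) ≡ x · a − (x · b − x · t)
  ring192 = solve-∀ ℚ-ring
  ring193 : ∀ E p q D x → E · (p · (1ℚ − q) · D) − (p · (E · D) − (p · q) · (E · D)) ≡ x · 0ℚ
  ring193 = solve-∀ ℚ-ring
  ring194 : ∀ x p q → x ≡ (x ⊹ (− 1ℚ) · (p ⊹ (− 1ℚ) · q)) ⊹ (p ⊹ (− 1ℚ) · q)
  ring194 = solve-∀ ℚ-ring
  ring195 : ∀ p → 0ℚ ⊹ (p ⊹ (− 1ℚ) · 0ℚ) ≡ p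
  ring195 = solve-∀ ℚ-ring

-- Natural numbers inside ℚ and cancellation.

ℕtoℚ-⊹ : ∀ m n → ℕtoℚ (m + n) ≡ ℕtoℚ m ⊹ ℕtoℚ n
ℕtoℚ-⊹ m n = cong ℤtoℚ (ℤₚ.pos-+ m n) ∙ ℤtoℚ-⊹ (ℤ.+ m) (ℤ.+ n)

ℕtoℚ-· : ∀ m n → ℕtoℚ (m * n) ≡ ℕtoℚ m · ℕtoℚ n
ℕtoℚ-· m n = cong ℤtoℚ (ℤₚ.pos-* m n) ∙ ℤtoℚ-· (ℤ.+ m) (ℤ.+ n)

ℕtoℚ-suc : ∀ n → ℕtoℚ (suc n) ≡ 1ℚ ⊹ ℕtoℚ n
ℕtoℚ-suc n = ℕtoℚ-⊹ 1 n

ℕtoℚ-injective : ∀ {m n} → ℕtoℚ m ≡ ℕtoℚ n → m ≡ n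
ℕtoℚ-injective {m} {n} eq = ℤₚ.+-injective (begin
  ℤ.+ m ≡⟨ sym (ℤₚ.*-identityʳ (ℤ.+ m)) ⟩
  ℤ.+ m ℤ.* ℤ.+ 1 ≡⟨ unwrap (ℚᵘₚ.≃-trans (ℚᵘₚ.≃-sym (ℚₚ.toℚᵘ-fromℚᵘ (ℚᵘ.mkℚᵘ (ℤ.+ m) 0)))
                                (ℚᵘₚ.≃-trans (ℚₚ.toℚᵘ-cong eq) (ℚₚ.toℚᵘ-fromℚᵘ (ℚᵘ.mkℚᵘ (ℤ.+ n) 0)))) ⟩
  ℤ.+ n ℤ.* ℤ.+ 1 ≡⟨ ℤₚ.*-identityʳ (ℤ.+ n) ⟩
  _ ∎)
  where
  unwrap : ∀ {p q} → p ℚᵘ.≃ q → ℚᵘ.↥ p ℤ.* ℚᵘ.↧ q ≡ ℚᵘ.↥ q ℤ.* ℚᵘ.↧ p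
  unwrap (ℚᵘ.*≡* e) = e

ℕtoℚ-suc≢0 : ∀ n → ℕtoℚ (suc n) ≢ 0ℚ
ℕtoℚ-suc≢0 n eq with ℕtoℚ-injective {suc n} {0} eq
... | ()

·-cancelˡ : ∀ c {x y} → c ≢ 0ℚ → c · x ≡ c · y → x ≡ y
·-cancelˡ c {x} {y} c≢0 eq = begin
  x ≡⟨ sym (·-identityˡ x) ⟩
  1ℚ · x ≡⟨ cong (_· x) (sym (·-inverseˡ c c≢0)) ⟩
  (invℚ c · c) · x ≡⟨ ·-assoc (invℚ c) c x ⟩
  invℚ c · (c · x) ≡⟨ cong (invℚ c ·_) eq ⟩
  invℚ c · (c · y) ≡⟨ sym (·-assoc (invℚ c) c y) ⟩
  (invℚ c · c) · y ≡⟨ cong (_· y) (·-inverseˡ c c≢0) ⟩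
  1ℚ · y ≡⟨ ·-identityˡ y ⟩
  _ ∎

-- Finite sums over initial segments and over bit vectors.

Σ< : ℕ → (ℕ → ℚ) → ℚ
Σ< zero f = 0ℚ
Σ< (suc n) f = f 0 ⊹ Σ< n (λ i → f (suc i))

Σ<-cong< : ∀ n {f g} → (∀ i → i < n → f i ≡ g i) → Σ< n f ≡ Σ< n g
Σ<-cong< zero eq = refl
Σ<-cong< (suc n) eq = cong₂ _⊹_ (eq 0 (s≤s z≤n)) (Σ<-cong< n (λ i i<n → eq (suc i) (s≤s i<n)))

Σ<-cong : ∀ n {f g} → (∀ i → f i ≡ g i) → Σ< n f ≡ Σ< n g
Σ<-cong n eq = Σ<-cong< n (λ i _ → eq i)

Σ<-zero : ∀ n {f} → (∀ i → i < n → f i ≡ 0ℚ) → Σ< n f ≡ 0ℚ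
Σ<-zero zero eq = refl
Σ<-zero (suc n) eq = (cong₂ _⊹_ (eq 0 (s≤s z≤n)) (Σ<-zero n (λ i i<n → eq (suc i) (s≤s i<n)))) ∙ ⊹-identityˡ 0ℚ

Σ<-⊹ : ∀ n f g → Σ< n (λ i → f i ⊹ g i) ≡ Σ< n f ⊹ Σ< n g
Σ<-⊹ zero f g = sym (⊹-identityˡ 0ℚ)
Σ<-⊹ (suc n) f g = cong ((f 0 ⊹ g 0) ⊹_) (Σ<-⊹ n (λ i → f (suc i)) (λ i → g (suc i))) ∙ interchange (f 0) (g 0) _ _

Σ<-· : ∀ n c f → Σ< n (λ i → c · f i) ≡ c · Σ< n f
Σ<-· zero c f = sym (·-zeroʳ c)
Σ<-· (suc n) c f = cong (c · f 0 ⊹_) (Σ<-· n c (λ i → f (suc i))) ∙ sym (·-distribˡ-⊹ c (f 0) _)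

Σ<-neg : ∀ n f → Σ< n (λ i → − f i) ≡ − Σ< n f
Σ<-neg n f = Σ<-cong n (λ i → −≡-1· (f i)) ∙ Σ<-· n (− 1ℚ) f ∙ sym (−≡-1· _)

Σ<-const : ∀ n c → Σ< n (λ _ → c) ≡ ℕtoℚ n · c
Σ<-const zero c = sym (·-zeroˡ c)
Σ<-const (suc n) c = cong (c ⊹_) (Σ<-const n c) ∙ ring1 c (ℕtoℚ n) ∙ cong (_· c) (sym (ℕtoℚ-suc n))

Σ<-swap : ∀ m n (f : ℕ → ℕ → ℚ) → Σ< m (λ i → Σ< n (f i)) ≡ Σ< n (λ j → Σ< m (λ i → f i j))
Σ<-swap zero n f = sym (Σ<-zero n (λ _ _ → refl))
Σ<-swap (suc m) n f = cong (Σ< n (f 0) ⊹_) (Σ<-swap m n (λ i → f (suc i))) ∙ sym (Σ<-⊹ n (f 0) _)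

Σ<-snoc : ∀ n f → Σ< (suc n) f ≡ Σ< n f ⊹ f n
Σ<-snoc zero f = ⊹-comm (f 0) 0ℚ
Σ<-snoc (suc n) f = cong (f 0 ⊹_) (Σ<-snoc n (λ i → f (suc i))) ∙ sym (⊹-assoc (f 0) _ _)

Σ<-+ : ∀ m n f → Σ< (m + n) f ≡ Σ< m f ⊹ Σ< n (λ i → f (m + i))
Σ<-+ zero n f = sym (⊹-identityˡ _)
Σ<-+ (suc m) n f = cong (f 0 ⊹_) (Σ<-+ m n (λ i → f (suc i))) ∙ sym (⊹-assoc (f 0) _ _)

δ : ℕ → ℕ → ℚ
δ i j = if i ≡ᵇ j then 1ℚ else 0ℚ

δ-refl : ∀ i → δ i i ≡ 1ℚ
δ-refl zero = refl
δ-refl (suc i) = δ-refl i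

δ-≢ : ∀ {i j} → i ≢ j → δ i j ≡ 0ℚ
δ-≢ {zero} {zero} ne = ⊥-elim (ne refl)
δ-≢ {zero} {suc j} ne = refl
δ-≢ {suc i} {zero} ne = refl
δ-≢ {suc i} {suc j} ne = δ-≢ (λ eq → ne (cong suc eq))

δ-sym : ∀ i j → δ i j ≡ δ j i
δ-sym zero zero = refl
δ-sym zero (suc j) = refl
δ-sym (suc i) zero = refl
δ-sym (suc i) (suc j) = δ-sym i j

Σ<-δ : ∀ n {i} f → i < n → Σ< n (λ j → δ i j · f j) ≡ f i
Σ<-δ (suc n) {zero} f _ = (cong₂ _⊹_ (·-identityˡ (f 0)) (Σ<-zero n (λ i _ → ·-zeroˡ (f (suc i))))) ∙ ⊹-identityʳ (f 0)
Σ<-δ (suc n) {suc i} f (s≤s i<n) = (cong₂ _⊹_ (·-zeroˡ (f 0)) (Σ<-δ n (λ j → f (suc j)) i<n)) ∙ ⊹-identityˡ _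

sumV : ∀ {N} → (Vec Bool N → ℚ) → ℚ
sumV {zero} f = f []
sumV {suc N} f = sumV (λ β → f (false ∷ β)) ⊹ sumV (λ β → f (true ∷ β))

sumV-cong : ∀ {N} {f g : Vec Bool N → ℚ} → (∀ β → f β ≡ g β) → sumV f ≡ sumV g
sumV-cong {zero} eq = eq []
sumV-cong {suc N} eq = cong₂ _⊹_ (sumV-cong (λ β → eq (false ∷ β))) (sumV-cong (λ β → eq (true ∷ β)))

sumV-zero : ∀ {N} {f : Vec Bool N → ℚ} → (∀ β → f β ≡ 0ℚ) → sumV f ≡ 0ℚ
sumV-zero {zero} eq = eq []
sumV-zero {suc N} eq = (cong₂ _⊹_ (sumV-zero (λ β → eq (false ∷ β))) (sumV-zero (λ β → eq (true ∷ β)))) ∙ ⊹-identityˡ 0ℚ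

sumV-⊹ : ∀ {N} (f g : Vec Bool N → ℚ) → sumV (λ β → f β ⊹ g β) ≡ sumV f ⊹ sumV g
sumV-⊹ {zero} f g = refl
sumV-⊹ {suc N} f g = (cong₂ _⊹_ (sumV-⊹ (λ β → f (false ∷ β)) (λ β → g (false ∷ β))) (sumV-⊹ (λ β → f (true ∷ β)) (λ β → g (true ∷ β))))
  ∙ interchange (sumV (λ β → f (false ∷ β))) _ _ _

sumV-· : ∀ {N} c (f : Vec Bool N → ℚ) → sumV (λ β → c · f β) ≡ c · sumV f
sumV-· {zero} c f = refl
sumV-· {suc N} c f = (cong₂ _⊹_ (sumV-· c (λ β → f (false ∷ β))) (sumV-· c (λ β → f (true ∷ β)))) ∙ sym (·-distribˡ-⊹ c _ _)

sumV-swap : ∀ {M N} (f : Vec Bool M → Vec Bool N → ℚ) → sumV (λ β → sumV (f β)) ≡ sumV (λ γ → sumV (λ β → f β γ))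
sumV-swap {zero} f = refl
sumV-swap {suc M} f = (cong₂ _⊹_ (sumV-swap (λ β → f (false ∷ β))) (sumV-swap (λ β → f (true ∷ β))))
  ∙ sym (sumV-⊹ (λ γ → sumV (λ β → f (false ∷ β) γ)) (λ γ → sumV (λ β → f (true ∷ β) γ)))

-- The exterior algebra on N generators: coordinates with respect to the
-- monomials, a monomial being the characteristic vector of its generators.
V : ℕ → Set
V N = Vec Bool N → ℚ

-- Vectors up to pointwise equality, and linear operators.

infix 4 _≈_
_≈_ : ∀ {N} → V N → V N → Set
x ≈ y = ∀ β → x β ≡ y β

≈-sym : ∀ {N} {x y : V N} → x ≈ y → y ≈ x
≈-sym p β = sym (p β)

≈-trans : ∀ {N} {x y z : V N} → x ≈ y → y ≈ z → x ≈ z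
≈-trans p q β = p β ∙ q β

infixl 6 _+ᵥ_ _-ᵥ_
infixr 7 _·ᵥ_
0ᵥ : ∀ {N} → V N
0ᵥ _ = 0ℚ
_+ᵥ_ _-ᵥ_ : ∀ {N} → V N → V N → V N
(x +ᵥ y) β = x β ⊹ y β
(x -ᵥ y) β = x β − y β
_·ᵥ_ : ∀ {N} → ℚ → V N → V N
(c ·ᵥ x) β = c · x β

-- Vectors are functions compared pointwise and function extensionality is not assumed, so
-- compatibility with `_≈_` has to be a field.
record Linear {M N} (X : V M → V N) : Set where
  field
    resp : ∀ {x y} → x ≈ y → X x ≈ X y
    add : ∀ x y → X (x +ᵥ y) ≈ X x +ᵥ X y
    mul : ∀ c x → X (c ·ᵥ x) ≈ c ·ᵥ X x

  zer : X 0ᵥ ≈ 0ᵥ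
  zer β = resp (λ γ → sym (·-zeroˡ 0ℚ)) β ∙ mul 0ℚ 0ᵥ β ∙ ·-zeroˡ _

  vanish : ∀ {x} → x ≈ 0ᵥ → X x ≈ 0ᵥ
  vanish p = ≈-trans (resp p) zer

  sub : ∀ x y → X (x -ᵥ y) ≈ X x -ᵥ X y
  sub x y β = resp (λ γ → cong (x γ ⊹_) (−≡-1· (y γ))) β
    ∙ add x ((− 1ℚ) ·ᵥ y) β ∙ cong (X x β ⊹_) (mul (− 1ℚ) y β ∙ sym (−≡-1· _))

  neg : ∀ x → X (λ β → − x β) ≈ (λ β → − X x β)
  neg x β = resp (λ γ → −≡-1· (x γ)) β ∙ mul (− 1ℚ) x β ∙ sym (−≡-1· _)

  sumΣ< : ∀ n (f : ℕ → V M) → X (λ β → Σ< n (λ i → f i β)) ≈ (λ β → Σ< n (λ i → X (f i) β))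
  sumΣ< zero f = zer
  sumΣ< (suc n) f β = add (f 0) _ β ∙ cong (X (f 0) β ⊹_) (sumΣ< n (λ i → f (suc i)) β)

open Linear public

Linear-∘ : ∀ {K M N} {X : V M → V N} {Y : V K → V M} → Linear X → Linear Y → Linear (X ∘ Y)
Linear-∘ lX lY = record
  { resp = λ p → resp lX (resp lY p)
  ; add = λ x y → ≈-trans (resp lX (add lY x y)) (add lX _ _)
  ; mul = λ c x → ≈-trans (resp lX (mul lY c x)) (mul lX c _) }

Linear-id : ∀ {N} → Linear {N} id
Linear-id = record { resp = id ; add = λ _ _ _ → refl ; mul = λ _ _ _ → refl }

Linear-+ : ∀ {M N} {X Y : V M → V N} → Linear X → Linear Y → Linear (λ x → X x +ᵥ Y x)
Linear-+ lX lY = record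
  { resp = λ p β → cong₂ _⊹_ (resp lX p β) (resp lY p β)
  ; add = λ x y β → trans (cong₂ _⊹_ (add lX x y β) (add lY x y β)) (interchange _ _ _ _)
  ; mul = λ c x β → trans (cong₂ _⊹_ (mul lX c x β) (mul lY c x β)) (sym (·-distribˡ-⊹ c _ _)) }

Linear-· : ∀ {M N} {X : V M → V N} c → Linear X → Linear (λ x → c ·ᵥ X x)
Linear-· c lX = record
  { resp = λ p β → cong (c ·_) (resp lX p β)
  ; add = λ x y β → trans (cong (c ·_) (add lX x y β)) (·-distribˡ-⊹ c _ _)
  ; mul = λ d x β → trans (cong (c ·_) (mul lX d x β)) (ring2 c d _) }

Linear-− : ∀ {M N} {X Y : V M → V N} → Linear X → Linear Y → Linear (λ x → X x -ᵥ Y x)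
Linear-− {X = X} {Y} lX lY = record
  { resp = λ p β → cong₂ _−_ (resp lX p β) (resp lY p β)
  ; add = λ x y β → trans (cong₂ _−_ (add lX x y β) (add lY x y β)) (ring3 _ _ _ _)
  ; mul = λ c x β → trans (cong₂ _−_ (mul lX c x β) (mul lY c x β)) (ring4 c _ _) }

Linear-Σ< : ∀ {M N} n {X : ℕ → V M → V N} → (∀ i → Linear (X i)) → Linear (λ x β → Σ< n (λ i → X i x β))
Linear-Σ< n lX = record
  { resp = λ p β → Σ<-cong n (λ i → resp (lX i) p β)
  ; add = λ x y β → trans (Σ<-cong n (λ i → add (lX i) x y β)) (Σ<-⊹ n _ _)
  ; mul = λ c x β → trans (Σ<-cong n (λ i → mul (lX i) c x β)) (Σ<-· n c _) }

-- Creation and annihilation operators: C w multiplies on the left by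
-- Σ w_g x_g, A w is the dual contraction.
C A : ∀ {N} → (ℕ → ℚ) → V N → V N
C {zero} w x _ = 0ℚ
C {suc N} w x (false ∷ β) = C (w ∘ suc) (x ∘ (false ∷_)) β
C {suc N} w x (true ∷ β) = w 0 · x (false ∷ β) − C (w ∘ suc) (x ∘ (true ∷_)) β

A {zero} w x _ = 0ℚ
A {suc N} w x (false ∷ β) = w 0 · x (true ∷ β) ⊹ A (w ∘ suc) (x ∘ (false ∷_)) β
A {suc N} w x (true ∷ β) = − A (w ∘ suc) (x ∘ (true ∷_)) β

C-Linear : ∀ {N} w → Linear (C {N} w)
C-Linear {zero} w = record { resp = λ _ _ → refl ; add = λ _ _ _ → sym (⊹-identityˡ 0ℚ) ; mul = λ c _ _ → sym (·-zeroʳ c) }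
C-Linear {suc N} w = record
  { resp = λ { p (false ∷ β) → resp IH (p ∘ (false ∷_)) β
             ; p (true ∷ β) → cong₂ (λ a b → w 0 · a − b) (p (false ∷ β)) (resp IH (p ∘ (true ∷_)) β) }
  ; add = λ { x y (false ∷ β) → add IH _ _ β
            ; x y (true ∷ β) → trans (cong (λ z → w 0 · (x (false ∷ β) ⊹ y (false ∷ β)) − z) (add IH _ _ β))
                                     (ring5 (w 0) (x (false ∷ β)) (y (false ∷ β)) _ _) }
  ; mul = λ { c x (false ∷ β) → mul IH c _ β
            ; c x (true ∷ β) → trans (cong (λ z → w 0 · (c · x (false ∷ β)) − z) (mul IH c _ β))
                                     (ring6 (w 0) c (x (false ∷ β)) _) } }
  where
  IH : Linear (C {N} (w ∘ suc))
  IH = C-Linear (w ∘ suc)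

A-Linear : ∀ {N} w → Linear (A {N} w)
A-Linear {zero} w = record { resp = λ _ _ → refl ; add = λ _ _ _ → sym (⊹-identityˡ 0ℚ) ; mul = λ c _ _ → sym (·-zeroʳ c) }
A-Linear {suc N} w = record
  { resp = λ { p (false ∷ β) → cong₂ (λ a b → w 0 · a ⊹ b) (p (true ∷ β)) (resp IH (p ∘ (false ∷_)) β)
             ; p (true ∷ β) → cong −_ (resp IH (p ∘ (true ∷_)) β) }
  ; add = λ { x y (false ∷ β) → trans (cong (w 0 · (x (true ∷ β) ⊹ y (true ∷ β)) ⊹_) (add IH _ _ β))
                                      (ring7 (w 0) (x (true ∷ β)) (y (true ∷ β)) _ _)
            ; x y (true ∷ β) → trans (cong −_ (add IH _ _ β)) (ring8 _ _) }
  ; mul = λ { c x (false ∷ β) → trans (cong (w 0 · (c · x (true ∷ β)) ⊹_) (mul IH c _ β)) (ring9 (w 0) c (x (true ∷ β)) _)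
            ; c x (true ∷ β) → trans (cong −_ (mul IH c _ β)) (ring10 c _) } }
  where
  IH : Linear (A {N} (w ∘ suc))
  IH = A-Linear (w ∘ suc)

dot : ℕ → (ℕ → ℚ) → (ℕ → ℚ) → ℚ
dot N w z = Σ< N (λ i → w i · z i)

-- With `AA-anti` and `AC-anti` these are the canonical anticommutation relations. Each is checked
-- by splitting off the first generator; the minus signs in `C` and `A` are the cost of passing it.
CC-anti : ∀ {N} w z (x : V N) → C w (C z x) ≈ (λ β → − C z (C w x) β)
CC-anti {zero} w z x β = sym −0≡0
CC-anti {suc N} w z x (false ∷ β) = CC-anti (w ∘ suc) (z ∘ suc) (x ∘ (false ∷_)) β
CC-anti {suc N} w z x (true ∷ β) = cong (λ t → w 0 · C z′ x₀ β − t) (sub (C-Linear w′) (z 0 ·ᵥ x₀) (C z′ x₁) β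
      ∙ (cong₂ _−_ (mul (C-Linear w′) (z 0) x₀ β) (CC-anti w′ z′ x₁ β)))
  ∙ ring11 (w 0 · C z′ x₀ β) (z 0 · C w′ x₀ β) (C z′ (C w′ x₁) β)
  ∙ cong (λ t → − (z 0 · C w′ x₀ β − t)) (sym (sub (C-Linear z′) (w 0 ·ᵥ x₀) (C w′ x₁) β
      ∙ cong (_− C z′ (C w′ x₁) β) (mul (C-Linear z′) (w 0) x₀ β)))
  where
  w′ z′ : ℕ → ℚ
  w′ = w ∘ suc
  z′ = z ∘ suc
  x₀ x₁ : V N
  x₀ = x ∘ (false ∷_)
  x₁ = x ∘ (true ∷_)

AA-anti : ∀ {N} w z (x : V N) → A w (A z x) ≈ (λ β → − A z (A w x) β)
AA-anti {zero} w z x β = sym −0≡0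
AA-anti {suc N} w z x (true ∷ β) = begin
  − A w′ (λ γ → − A z′ x₁ γ) β ≡⟨ cong −_ (neg (A-Linear w′) (A z′ x₁) β) ⟩
  − − A w′ (A z′ x₁) β ≡⟨ cong (λ t → − − t) (AA-anti w′ z′ x₁ β) ⟩
  − − − A z′ (A w′ x₁) β ≡⟨ cong (λ t → − − t) (sym (neg (A-Linear z′) (A w′ x₁) β)) ⟩
  _ ∎
  where
  w′ z′ : ℕ → ℚ
  w′ = w ∘ suc
  z′ = z ∘ suc
  x₁ : V N
  x₁ = x ∘ (true ∷_)
AA-anti {suc N} w z x (false ∷ β) = cong (w 0 · (− A z′ x₁ β) ⊹_) (add (A-Linear w′) (z 0 ·ᵥ x₁) (A z′ x₀) β
      ∙ (cong₂ _⊹_ (mul (A-Linear w′) (z 0) x₁ β) (AA-anti w′ z′ x₀ β)))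
  ∙ ring12 (w 0) (z 0) (A z′ x₁ β) (A w′ x₁ β) _
  ∙ cong (λ t → − (z 0 · (− A w′ x₁ β) ⊹ t)) (sym (add (A-Linear z′) (w 0 ·ᵥ x₁) (A w′ x₀) β
      ∙ cong (_⊹ A z′ (A w′ x₀) β) (mul (A-Linear z′) (w 0) x₁ β)))
  where
  w′ z′ : ℕ → ℚ
  w′ = w ∘ suc
  z′ = z ∘ suc
  x₀ x₁ : V N
  x₀ = x ∘ (false ∷_)
  x₁ = x ∘ (true ∷_)

AC-anti : ∀ {N} w z (x : V N) → A w (C z x) ≈ (λ β → dot N w z · x β − C z (A w x) β)
AC-anti {zero} w z x β = sym (ring13 (x β))
AC-anti {suc N} w z x (false ∷ β) = cong (w 0 · (z 0 · x₀ β − C z′ x₁ β) ⊹_) (AC-anti w′ z′ x₀ β)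
  ∙ ring14 (w 0) (z 0) (x₀ β) (C z′ x₁ β) (dot N w′ z′) _
  ∙ cong (λ t → (w 0 · z 0 ⊹ dot N w′ z′) · x₀ β − t) (sym (add (C-Linear z′) (w 0 ·ᵥ x₁) (A w′ x₀) β
      ∙ cong (_⊹ C z′ (A w′ x₀) β) (mul (C-Linear z′) (w 0) x₁ β)))
  where
  w′ z′ : ℕ → ℚ
  w′ = w ∘ suc
  z′ = z ∘ suc
  x₀ x₁ : V N
  x₀ = x ∘ (false ∷_)
  x₁ = x ∘ (true ∷_)
AC-anti {suc N} w z x (true ∷ β) = cong −_ (sub (A-Linear w′) (z 0 ·ᵥ x₀) (C z′ x₁) β
      ∙ (cong₂ _−_ (mul (A-Linear w′) (z 0) x₀ β) (AC-anti w′ z′ x₁ β)))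
  ∙ ring15 (w 0) (z 0) (A w′ x₀ β) (x₁ β) (dot N w′ z′) _
  ∙ cong (λ t → (w 0 · z 0 ⊹ dot N w′ z′) · x₁ β − (z 0 · (w 0 · x₁ β ⊹ A w′ x₀ β) − t))
      (sym (neg (C-Linear z′) (A w′ x₁) β))
  where
  w′ z′ : ℕ → ℚ
  w′ = w ∘ suc
  z′ = z ∘ suc
  x₀ x₁ : V N
  x₀ = x ∘ (false ∷_)
  x₁ = x ∘ (true ∷_)

self-neg⇒0 : ∀ {x} → x ≡ − x → x ≡ 0ℚ
self-neg⇒0 {x} eq = ·-cancelˡ (ℕtoℚ 2) (ℕtoℚ-suc≢0 1) (begin
  ℕtoℚ 2 · x ≡⟨ cong (_· x) (ℕtoℚ-suc 1) ⟩
  (1ℚ ⊹ 1ℚ) · x ≡⟨ ring16 x ⟩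
  x ⊹ x ≡⟨ cong (x ⊹_) eq ⟩
  x ⊹ − x ≡⟨ ring17 x ⟩
  (1ℚ ⊹ 1ℚ) · 0ℚ ≡⟨ cong (_· 0ℚ) (sym (ℕtoℚ-suc 1)) ⟩
  _ ∎)

CC-zero : ∀ {N} w (x : V N) → C w (C w x) ≈ 0ᵥ
CC-zero w x β = self-neg⇒0 (CC-anti w w x β)

AA-zero : ∀ {N} w (x : V N) → A w (A w x) ≈ 0ᵥ
AA-zero w x β = self-neg⇒0 (AA-anti w w x β)

c a : ∀ {N} → ℕ → V N → V N
c g = C (δ g)
a g = A (δ g)

C-weight-cong : ∀ {N w z} → (∀ i → i < N → w i ≡ z i) → (x : V N) → C w x ≈ C z x
C-weight-cong {zero} eq x β = refl
C-weight-cong {suc N} eq x (false ∷ β) = C-weight-cong (λ i i<N → eq (suc i) (s≤s i<N)) _ β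
C-weight-cong {suc N} eq x (true ∷ β) = cong₂ (λ t s → t · x (false ∷ β) − s) (eq 0 (s≤s z≤n)) (C-weight-cong (λ i i<N → eq (suc i) (s≤s i<N)) _ β)

C-weight-⊹ : ∀ {N} w z (x : V N) → C (λ i → w i ⊹ z i) x ≈ C w x +ᵥ C z x
C-weight-⊹ {zero} w z x β = sym (⊹-identityˡ 0ℚ)
C-weight-⊹ {suc N} w z x (false ∷ β) = C-weight-⊹ (w ∘ suc) (z ∘ suc) _ β
C-weight-⊹ {suc N} w z x (true ∷ β) = cong (λ t → (w 0 ⊹ z 0) · x (false ∷ β) − t) (C-weight-⊹ (w ∘ suc) (z ∘ suc) _ β) ∙ ring18 _ _ _ _ _

C-weight-· : ∀ {N} k w (x : V N) → C (λ i → k · w i) x ≈ k ·ᵥ C w x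
C-weight-· {zero} k w x β = sym (·-zeroʳ k)
C-weight-· {suc N} k w x (false ∷ β) = C-weight-· k (w ∘ suc) _ β
C-weight-· {suc N} k w x (true ∷ β) = cong (λ t → (k · w 0) · x (false ∷ β) − t) (C-weight-· k (w ∘ suc) _ β) ∙ ring19 _ _ _ _

C-weight-0 : ∀ {N} (x : V N) → C (λ _ → 0ℚ) x ≈ 0ᵥ
C-weight-0 x β = C-weight-cong {z = λ i → 0ℚ · 0ℚ} (λ _ _ → sym (·-zeroˡ 0ℚ)) x β ∙ C-weight-· 0ℚ (λ _ → 0ℚ) x β ∙ ·-zeroˡ _

C-weight-Σ< : ∀ {N} n (w : ℕ → ℕ → ℚ) (x : V N) → C (λ i → Σ< n (λ k → w k i)) x ≈ (λ β → Σ< n (λ k → C (w k) x β))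
C-weight-Σ< zero w x = C-weight-0 x
C-weight-Σ< (suc n) w x β = C-weight-⊹ (w 0) _ x β ∙ cong (C (w 0) x β ⊹_) (C-weight-Σ< n (λ k → w (suc k)) x β)

A-weight-cong : ∀ {N w z} → (∀ i → i < N → w i ≡ z i) → (x : V N) → A w x ≈ A z x
A-weight-cong {zero} eq x β = refl
A-weight-cong {suc N} eq x (false ∷ β) = cong₂ (λ t s → t · x (true ∷ β) ⊹ s) (eq 0 (s≤s z≤n)) (A-weight-cong (λ i i<N → eq (suc i) (s≤s i<N)) _ β)
A-weight-cong {suc N} eq x (true ∷ β) = cong −_ (A-weight-cong (λ i i<N → eq (suc i) (s≤s i<N)) _ β)

A-weight-⊹ : ∀ {N} w z (x : V N) → A (λ i → w i ⊹ z i) x ≈ A w x +ᵥ A z x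
A-weight-⊹ {zero} w z x β = sym (⊹-identityˡ 0ℚ)
A-weight-⊹ {suc N} w z x (true ∷ β) = (cong −_ (A-weight-⊹ (w ∘ suc) (z ∘ suc) _ β)) ∙ ring8 _ _
A-weight-⊹ {suc N} w z x (false ∷ β) = cong ((w 0 ⊹ z 0) · x (true ∷ β) ⊹_) (A-weight-⊹ (w ∘ suc) (z ∘ suc) _ β) ∙ ring20 _ _ _ _ _

A-weight-0 : ∀ {N} (x : V N) → A (λ _ → 0ℚ) x ≈ 0ᵥ
A-weight-0 {zero} x β = refl
A-weight-0 {suc N} x (false ∷ β) = cong (0ℚ · x (true ∷ β) ⊹_) (A-weight-0 _ β) ∙ ring21 (x (true ∷ β))
A-weight-0 {suc N} x (true ∷ β) = (cong −_ (A-weight-0 _ β)) ∙ −0≡0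

A-weight-Σ< : ∀ {N} n (w : ℕ → ℕ → ℚ) (x : V N) → A (λ i → Σ< n (λ k → w k i)) x ≈ (λ β → Σ< n (λ k → A (w k) x β))
A-weight-Σ< zero w x = A-weight-0 x
A-weight-Σ< (suc n) w x β = A-weight-⊹ (w 0) _ x β ∙ cong (A (w 0) x β ⊹_) (A-weight-Σ< n (λ k → w (suc k)) x β)

-- Linear forms, expansion in the monomial basis, and the trace.

record LinearForm {N} (φ : V N → ℚ) : Set where
  field
    respᶠ : ∀ {x y} → x ≈ y → φ x ≡ φ y
    addᶠ : ∀ x y → φ (x +ᵥ y) ≡ φ x ⊹ φ y
    mulᶠ : ∀ k x → φ (k ·ᵥ x) ≡ k · φ x

open LinearForm public

coordinate : ∀ {M N} {X : V M → V N} → Linear X → ∀ β → LinearForm (λ x → X x β)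
coordinate lX β = record { respᶠ = λ p → resp lX p β ; addᶠ = λ x y → add lX x y β ; mulᶠ = λ k x → mul lX k x β }

e : ∀ {N} → Vec Bool N → V N
e [] [] = 1ℚ
e (false ∷ β) (false ∷ γ) = e β γ
e (true ∷ β) (true ∷ γ) = e β γ
e (false ∷ β) (true ∷ γ) = 0ℚ
e (true ∷ β) (false ∷ γ) = 0ℚ

low high : ∀ {N} → V N → V (suc N)
low x (false ∷ β) = x β
low x (true ∷ β) = 0ℚ
high x (false ∷ β) = 0ℚ
high x (true ∷ β) = x β

low-Linear : ∀ {N} → Linear (low {N})
low-Linear = record
  { resp = λ { p (false ∷ β) → p β ; p (true ∷ β) → refl }
  ; add = λ { x y (false ∷ β) → refl ; x y (true ∷ β) → sym (⊹-identityˡ 0ℚ) }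
  ; mul = λ { k x (false ∷ β) → refl ; k x (true ∷ β) → sym (·-zeroʳ k) } }

high-Linear : ∀ {N} → Linear (high {N})
high-Linear = record
  { resp = λ { p (true ∷ β) → p β ; p (false ∷ β) → refl }
  ; add = λ { x y (true ∷ β) → refl ; x y (false ∷ β) → sym (⊹-identityˡ 0ℚ) }
  ; mul = λ { k x (true ∷ β) → refl ; k x (false ∷ β) → sym (·-zeroʳ k) } }

LinearForm-∘ : ∀ {M N} {φ : V N → ℚ} {X : V M → V N} → LinearForm φ → Linear X → LinearForm (φ ∘ X)
LinearForm-∘ lφ lX = record
  { respᶠ = λ p → respᶠ lφ (resp lX p)
  ; addᶠ = λ x y → trans (respᶠ lφ (add lX x y)) (addᶠ lφ _ _)
  ; mulᶠ = λ k x → trans (respᶠ lφ (mul lX k x)) (mulᶠ lφ k _) }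

expand : ∀ {N} {φ : V N → ℚ} → LinearForm φ → ∀ x → φ x ≡ sumV (λ γ → x γ · φ (e γ))
expand {zero} {φ} lφ x = respᶠ lφ (λ { [] → sym (·-identityʳ (x [])) }) ∙ mulᶠ lφ (x []) (e [])
expand {suc N} {φ} lφ x = respᶠ lφ (λ { (false ∷ β) → sym (⊹-identityʳ _) ; (true ∷ β) → sym (⊹-identityˡ _) })
  ∙ addᶠ lφ _ _
  ∙ cong₂ _⊹_ (expand (LinearForm-∘ lφ low-Linear) (x ∘ (false ∷_))) (expand (LinearForm-∘ lφ high-Linear) (x ∘ (true ∷_)))
  ∙ cong₂ _⊹_ (sumV-cong (λ γ → cong (x (false ∷ γ) ·_) (respᶠ lφ (λ { (false ∷ β) → refl ; (true ∷ β) → refl }))))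
      (sumV-cong (λ γ → cong (x (true ∷ γ) ·_) (respᶠ lφ (λ { (false ∷ β) → refl ; (true ∷ β) → refl }))))

tr : ∀ {N} → (V N → V N) → ℚ
tr X = sumV (λ β → X (e β) β)

tr-cong : ∀ {N} {X Y : V N → V N} → (∀ x → X x ≈ Y x) → tr X ≡ tr Y
tr-cong eq = sumV-cong (λ β → eq (e β) β)

tr-+ : ∀ {N} (X Y : V N → V N) → tr (λ x → X x +ᵥ Y x) ≡ tr X ⊹ tr Y
tr-+ X Y = sumV-⊹ (λ β → X (e β) β) (λ β → Y (e β) β)

tr-· : ∀ {N} k (X : V N → V N) → tr (λ x → k ·ᵥ X x) ≡ k · tr X
tr-· k X = sumV-· k (λ β → X (e β) β)

-- Expand both compositions in the basis `e` and exchange the two sums. Later this carries a trace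
-- from one bidegree to another, by cycling an operator that shifts degrees.
tr-cyclic : ∀ {M N} {X : V M → V N} {Y : V N → V M} → Linear X → Linear Y → tr (X ∘ Y) ≡ tr (Y ∘ X)
tr-cyclic {X = X} {Y} lX lY = sumV-cong (λ β → expand (coordinate lX β) (Y (e β)))
  ∙ sumV-swap (λ β γ → Y (e β) γ · X (e γ) β)
  ∙ sumV-cong (λ γ → trans (sumV-cong {g = λ β → X (e γ) β · Y (e β) γ} (λ β → ·-comm _ _)) (sym (expand (coordinate lY γ) (X (e γ)))))

-- Each generator g has a kind κ g (true for θ, false for ξ); diag κ q scales
-- a monomial with i generators of kind true and j of kind false by q i j.
bump : Bool → (ℕ → ℕ → ℚ) → (ℕ → ℕ → ℚ)
bump true q i j = q (suc i) j
bump false q i j = q i (suc j)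

diag : ∀ {N} → (ℕ → Bool) → (ℕ → ℕ → ℚ) → V N → V N
diag {zero} κ q x β = q 0 0 · x β
diag {suc N} κ q x (false ∷ β) = diag (κ ∘ suc) q (x ∘ (false ∷_)) β
diag {suc N} κ q x (true ∷ β) = diag (κ ∘ suc) (bump (κ 0) q) (x ∘ (true ∷_)) β

#kind : ∀ {N} → Bool → (ℕ → Bool) → Vec Bool N → ℕ
#kind k κ [] = 0
#kind k κ (false ∷ β) = #kind k (κ ∘ suc) β
#kind true κ (true ∷ β) = if κ 0 then suc (#kind true (κ ∘ suc) β) else #kind true (κ ∘ suc) β
#kind false κ (true ∷ β) = if κ 0 then #kind false (κ ∘ suc) β else suc (#kind false (κ ∘ suc) β)

diag-scales : ∀ {N} κ q (x : V N) β → diag κ q x β ≡ q (#kind true κ β) (#kind false κ β) · x β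
diag-scales κ q x [] = refl
diag-scales κ q x (false ∷ β) = diag-scales (κ ∘ suc) q (x ∘ (false ∷_)) β
diag-scales κ q x (true ∷ β) with κ 0
... | true = diag-scales (κ ∘ suc) (bump true q) (x ∘ (true ∷_)) β
... | false = diag-scales (κ ∘ suc) (bump false q) (x ∘ (true ∷_)) β

diag-Linear : ∀ {N} κ q → Linear (diag {N} κ q)
diag-Linear κ q = record
  { resp = λ {x} {y} p β → trans (diag-scales κ q x β) (cong (_ ·_) (p β) ∙ sym (diag-scales κ q y β))
  ; add = λ x y β → trans (diag-scales κ q _ β) (·-distribˡ-⊹ _ _ _ ∙ sym (cong₂ _⊹_ (diag-scales κ q x β) (diag-scales κ q y β)))
  ; mul = λ k x β → trans (diag-scales κ q _ β) (ring2 _ k _ ∙ cong (k ·_) (sym (diag-scales κ q x β))) }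

diag-cong : ∀ {N} κ {p q} → (∀ i j → p i j ≡ q i j) → (x : V N) → diag κ p x ≈ diag κ q x
diag-cong κ {p} {q} eq x β = diag-scales κ p x β ∙ cong (_· x β) (eq _ _) ∙ sym (diag-scales κ q x β)

diag-∘ : ∀ {N} κ p q (x : V N) → diag κ p (diag κ q x) ≈ diag κ (λ i j → p i j · q i j) x
diag-∘ κ p q x β = diag-scales κ p _ β ∙ cong (_ ·_) (diag-scales κ q x β)
  ∙ sym (·-assoc _ _ _) ∙ sym (diag-scales κ _ x β)

diag-0 : ∀ {N} κ (x : V N) → diag κ (λ _ _ → 0ℚ) x ≈ 0ᵥ
diag-0 κ x β = diag-scales κ _ x β ∙ ·-zeroˡ _

OfKind : Bool → (ℕ → Bool) → (ℕ → ℚ) → Set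
OfKind k κ w = ∀ i → κ i ≢ k → w i ≡ 0ℚ

bump-comm : ∀ {N} k l q κ (x : V N) → diag κ (bump k (bump l q)) x ≈ diag κ (bump l (bump k q)) x
bump-comm true true q κ x β = refl
bump-comm true false q κ x β = refl
bump-comm false true q κ x β = refl
bump-comm false false q κ x β = refl

-- Reconciles the bump dictated by the kind of the first generator with the bump by k: they can
-- differ only where the weight is 0.
kind-weight : ∀ k l (w : ℚ) (f : Bool → ℚ) → (l ≢ k → w ≡ 0ℚ) → w · f l ≡ w · f k
kind-weight true true w f h = refl
kind-weight false false w f h = refl
kind-weight true false w f h = cong (_· _) (h (λ ())) ∙ ·-zeroˡ _ ∙ sym (cong (_· _) (h (λ ())) ∙ ·-zeroˡ _)
kind-weight false true w f h = cong (_· _) (h (λ ())) ∙ ·-zeroˡ _ ∙ sym (cong (_· _) (h (λ ())) ∙ ·-zeroˡ _)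

-- When the weights sit on one kind of generator, `C w` raises exactly one of the two degrees by
-- one; scaling after it is scaling before it with that index bumped.
diag-C : ∀ {N} k κ q w → OfKind k κ w → (x : V N) → diag κ q (C w x) ≈ C w (diag κ (bump k q) x)
diag-C {zero} k κ q w h x β = ·-zeroʳ _
diag-C {suc N} k κ q w h x (false ∷ β) = diag-C k (κ ∘ suc) q (w ∘ suc) (h ∘ suc) (x ∘ (false ∷_)) β
diag-C {suc N} k κ q w h x (true ∷ β) = sub (diag-Linear κ′ _) (w 0 ·ᵥ x₀) (C w′ x₁) β
  ∙ cong₂ _−_ (mul (diag-Linear κ′ _) (w 0) x₀ β ∙ kind-weight k (κ 0) (w 0) (λ l → diag κ′ (bump l q) x₀ β) (h 0))
      (diag-C k κ′ (bump (κ 0) q) w′ (h ∘ suc) x₁ β ∙ resp (C-Linear w′) (bump-comm k (κ 0) q κ′ x₁) β)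
  where
  κ′ : ℕ → Bool
  κ′ = κ ∘ suc
  w′ : ℕ → ℚ
  w′ = w ∘ suc
  x₀ x₁ : V N
  x₀ = x ∘ (false ∷_)
  x₁ = x ∘ (true ∷_)

diag-A : ∀ {N} k κ q w → OfKind k κ w → (x : V N) → diag κ (bump k q) (A w x) ≈ A w (diag κ q x)
diag-A {zero} k κ q w h x β = ·-zeroʳ _
diag-A {suc N} k κ q w h x (true ∷ β) = neg (diag-Linear (κ ∘ suc) _) _ β
  ∙ cong −_ (bump-comm (κ 0) k q (κ ∘ suc) _ β ∙ diag-A k (κ ∘ suc) (bump (κ 0) q) (w ∘ suc) (h ∘ suc) _ β)
diag-A {suc N} k κ q w h x (false ∷ β) = add (diag-Linear κ′ _) (w 0 ·ᵥ x₁) (A w′ x₀) β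
  ∙ cong₂ _⊹_ (mul (diag-Linear κ′ _) (w 0) x₁ β ∙ sym (kind-weight k (κ 0) (w 0) (λ l → diag κ′ (bump l q) x₁ β) (h 0)))
      (diag-A k κ′ q w′ (h ∘ suc) x₀ β)
  where
  κ′ : ℕ → Bool
  κ′ = κ ∘ suc
  w′ : ℕ → ℚ
  w′ = w ∘ suc
  x₀ x₁ : V N
  x₀ = x ∘ (false ∷_)
  x₁ = x ∘ (true ∷_)

-- The offset m makes the induction close: a first generator that is present is counted once and
-- passed on as `suc m`.
number-operator : ∀ {N} κ (x : V N) m →
  (λ β → Σ< N (λ g → c g (a g x) β) ⊹ ℕtoℚ m · x β) ≈ diag κ (λ i j → ℕtoℚ (m + (i + j))) x
number-operator {zero} κ x m [] = ⊹-identityˡ _ ∙ cong (λ k → ℕtoℚ k · x []) (sym (ℕₚ.+-identityʳ m))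
number-operator {suc N} κ x m (false ∷ β) = cong (λ t → t ⊹ S ⊹ ℕtoℚ m · x₀ β) (C-weight-0 _ β)
  ∙ cong (_⊹ ℕtoℚ m · x₀ β) (⊹-identityˡ S)
  ∙ cong (_⊹ ℕtoℚ m · x₀ β) (Σ<-cong N (λ g → resp (C-Linear (δ g)) (λ γ → trans (cong (_⊹ a g x₀ γ) (·-zeroˡ _)) (⊹-identityˡ _)) β))
  ∙ number-operator (κ ∘ suc) x₀ m β
  where
  x₀ : V N
  x₀ = x ∘ (false ∷_)
  S : ℚ
  S = Σ< N (λ g → c (suc g) (a (suc g) x) (false ∷ β))
number-operator {suc N} κ x m (true ∷ β) = cong₂ (λ p q → (1ℚ · (1ℚ · x₁ β ⊹ p) − q) ⊹ S ⊹ ℕtoℚ m · x₁ β) (A-weight-0 _ β) (C-weight-0 _ β)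
  ∙ ring22 (x₁ β) S (ℕtoℚ m)
  ∙ cong₂ (λ p q → p ⊹ q · x₁ β) (Σ<-cong N step) (sym (ℕtoℚ-suc m))
  ∙ number-operator (κ ∘ suc) x₁ (suc m) β
  ∙ shift (κ 0)
  where
  x₁ : V N
  x₁ = x ∘ (true ∷_)
  S : ℚ
  S = Σ< N (λ g → c (suc g) (a (suc g) x) (true ∷ β))
  step : ∀ g → c (suc g) (a (suc g) x) (true ∷ β) ≡ c g (a g x₁) β
  step g = cong (λ t → 0ℚ · a (suc g) x (false ∷ β) − t) (neg (C-Linear (δ g)) (a g x₁) β) ∙ ring23 _ _
  shift : ∀ k → diag (κ ∘ suc) (λ i j → ℕtoℚ (suc m + (i + j))) x₁ β ≡ diag (κ ∘ suc) (bump k (λ i j → ℕtoℚ (m + (i + j)))) x₁ β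
  shift true = diag-cong (κ ∘ suc) (λ i j → cong ℕtoℚ (sym (ℕₚ.+-suc m (i + j)))) x₁ β
  shift false = diag-cong (κ ∘ suc) (λ i j → cong ℕtoℚ (sym (ℕₚ.+-suc m (i + j)) ∙ cong (m +_) (sym (ℕₚ.+-suc i j)))) x₁ β

vac : ∀ {N} → V N
vac {zero} [] = 1ℚ
vac {suc N} (false ∷ β) = vac β
vac {suc N} (true ∷ β) = 0ℚ

A-vac : ∀ {N} w → A w (vac {N}) ≈ 0ᵥ
A-vac {zero} w β = refl
A-vac {suc N} w (false ∷ β) = (cong₂ _⊹_ (·-zeroʳ (w 0)) (A-vac (w ∘ suc) β)) ∙ ⊹-identityˡ 0ℚ
A-vac {suc N} w (true ∷ β) = (cong −_ (vanish (A-Linear (w ∘ suc)) (λ _ → refl) β)) ∙ −0≡0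

diag-vac : ∀ {N} κ q → diag κ q (vac {N}) ≈ q 0 0 ·ᵥ vac
diag-vac {zero} κ q β = refl
diag-vac {suc N} κ q (false ∷ β) = diag-vac (κ ∘ suc) q β
diag-vac {suc N} κ q (true ∷ β) = vanish (diag-Linear (κ ∘ suc) _) (λ _ → refl) β ∙ sym (·-zeroʳ _)

dot-δ : ∀ N {g} w → g < N → dot N (δ g) w ≡ w g
dot-δ N w g<N = Σ<-δ N w g<N

dot-δδ-≢ : ∀ N {g h} → g ≢ h → dot N (δ g) (δ h) ≡ 0ℚ
dot-δδ-≢ N {g} {h} g≢h = Σ<-zero N λ i _ → aux i
  where
  aux : ∀ i → δ g i · δ h i ≡ 0ℚ
  aux i with g ℕₚ.≟ i
  ... | yes refl = cong (δ g g ·_) (δ-≢ (λ eq → g≢h (sym eq))) ∙ ·-zeroʳ _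
  ... | no g≢i = cong (_· δ h i) (δ-≢ g≢i) ∙ ·-zeroˡ _

ac-same : ∀ {N g} → g < N → (x : V N) → a g (c g x) ≈ x -ᵥ c g (a g x)
ac-same {N} {g} g<N x β = AC-anti (δ g) (δ g) x β
  ∙ cong (_− c g (a g x) β) (cong (_· x β) (dot-δ N (δ g) g<N ∙ δ-refl g) ∙ ·-identityˡ _)

ac-diff : ∀ {N g h} → g ≢ h → (x : V N) → a g (c h x) ≈ (λ β → − c h (a g x) β)
ac-diff {N} {g} {h} g≢h x β = AC-anti (δ g) (δ h) x β
  ∙ cong (_− c h (a g x) β) (cong (_· x β) (dot-δδ-≢ N g≢h) ∙ ·-zeroˡ _) ∙ ⊹-identityˡ _

-- The algebra map sending the generator g to w g times the generator h g.
hat : ∀ {M} N → (ℕ → ℕ) → (ℕ → ℚ) → V N → V M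
hat zero h w x = x [] ·ᵥ vac
hat (suc N) h w x = hat N (h ∘ suc) (w ∘ suc) (x ∘ (false ∷_)) +ᵥ w 0 ·ᵥ c (h 0) (hat N (h ∘ suc) (w ∘ suc) (x ∘ (true ∷_)))

hat-Linear : ∀ {M} N h w → Linear (hat {M} N h w)
hat-Linear zero h w = record
  { resp = λ p β → cong (_· vac β) (p [])
  ; add = λ x y β → ring24 _ _ _
  ; mul = λ k x β → ·-assoc k _ _ }
hat-Linear (suc N) h w = record { resp = λ p → resp L (λ β → p β) ; add = add L ; mul = mul L }
  where
  restrict : ∀ b → Linear (λ (x : V (suc N)) → x ∘ (b ∷_))
  restrict b = record { resp = λ p β → p (b ∷ β) ; add = λ _ _ _ → refl ; mul = λ _ _ _ → refl }
  L : Linear (hat (suc N) h w)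
  L = Linear-+ (Linear-∘ (hat-Linear N (h ∘ suc) (w ∘ suc)) (restrict false))
        (Linear-· (w 0) (Linear-∘ (C-Linear (δ (h 0))) (Linear-∘ (hat-Linear N (h ∘ suc) (w ∘ suc)) (restrict true))))

hat-vac : ∀ {M} N h w → hat {M} N h w vac ≈ vac
hat-vac zero h w β = ·-identityˡ _
hat-vac (suc N) h w β = (cong₂ _⊹_ (hat-vac N (h ∘ suc) (w ∘ suc) β)
    (cong (w 0 ·_) (vanish (C-Linear (δ (h 0))) (vanish (hat-Linear N _ _) (λ _ → refl)) β) ∙ ·-zeroʳ _))
  ∙ ⊹-identityʳ _

hat-c : ∀ {M} N h w g → g < N → (x : V N) → hat {M} N h w (c g x) ≈ w g ·ᵥ c (h g) (hat N h w x)
hat-c (suc N) h w zero _ x β = cong₂ (λ p q → p ⊹ w 0 · q) (vanish lh (C-weight-0 x₀) β)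
      (resp lc (resp lh (λ γ → trans (cong (λ t → 1ℚ · x₀ γ − t) (C-weight-0 x₁ γ)) (ring25 _))) β)
  ∙ ring26 (w 0) _
  -- The image of the part of x that already contains the generator is put back as `c (h 0)` applied
  -- twice, which is 0; this completes the image of all of x.
  ∙ cong (λ t → w 0 · (c (h 0) (hat N h′ w′ x₀) β ⊹ w 0 · t)) (sym (CC-zero (δ (h 0)) _ β))
  ∙ cong (w 0 ·_) (sym (add lc _ _ β ∙ cong (c (h 0) (hat N h′ w′ x₀) β ⊹_) (mul lc (w 0) _ β)))
  where
  h′ : ℕ → ℕ
  h′ = h ∘ suc
  w′ : ℕ → ℚ
  w′ = w ∘ suc
  x₀ x₁ : V N
  x₀ = x ∘ (false ∷_)
  x₁ = x ∘ (true ∷_)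
  lh = hat-Linear N h′ w′
  lc = C-Linear (δ (h 0))
hat-c (suc N) h w (suc g) (s≤s g<N) x β = cong₂ (λ p q → p ⊹ w 0 · q) (hat-c N h′ w′ g g<N x₀ β) (inner β)
  ∙ ring27 (w′ g) (w 0) _ _
  ∙ cong (w′ g ·_) (sym (add lc _ _ β ∙ cong (c (h′ g) (hat N h′ w′ x₀) β ⊹_) (mul lc (w 0) _ β)))
  where
  h′ : ℕ → ℕ
  h′ = h ∘ suc
  w′ : ℕ → ℚ
  w′ = w ∘ suc
  x₀ x₁ : V N
  x₀ = x ∘ (false ∷_)
  x₁ = x ∘ (true ∷_)
  lc = C-Linear (δ (h′ g))
  l₀ = C-Linear (δ (h 0))
  inner : ∀ β → c (h 0) (hat N h′ w′ (λ γ → 0ℚ · x₀ γ − c g x₁ γ)) β ≡ w′ g · c (h′ g) (c (h 0) (hat N h′ w′ x₁)) β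
  inner β = resp l₀ (λ γ → trans (resp (hat-Linear N h′ w′) (λ ζ → ring28 _ _) γ) (mul (hat-Linear N h′ w′) (− 1ℚ) (c g x₁) γ)) β
    ∙ mul l₀ (− 1ℚ) _ β ∙ cong ((− 1ℚ) ·_) (resp l₀ (hat-c N h′ w′ g g<N x₁) β ∙ mul l₀ (w′ g) _ β)
    ∙ cong (λ t → (− 1ℚ) · (w′ g · t)) (CC-anti (δ (h 0)) (δ (h′ g)) _ β)
    ∙ ring29 (w′ g) _

hat-avoids : ∀ {M} N h w g → (∀ i → i < N → g ≢ h i) → (x : V N) → a g (hat {M} N h w x) ≈ 0ᵥ
hat-avoids zero h w g ne x β = mul (A-Linear (δ g)) (x []) vac β ∙ cong (x [] ·_) (A-vac (δ g) β) ∙ ·-zeroʳ _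
hat-avoids (suc N) h w g ne x β = trans (add la _ _ β) (cong (a g (hat N h′ w′ x₀) β ⊹_) (mul la (w 0) _ β))
  ∙ cong₂ (λ p q → p ⊹ w 0 · q) (IH x₀ β) (ac-diff (ne 0 (s≤s z≤n)) _ β
      ∙ (cong −_ (vanish (C-Linear (δ (h 0))) (IH x₁) β)))
  ∙ ring30 (w 0)
  where
  h′ : ℕ → ℕ
  h′ = h ∘ suc
  w′ : ℕ → ℚ
  w′ = w ∘ suc
  x₀ x₁ : V N
  x₀ = x ∘ (false ∷_)
  x₁ = x ∘ (true ∷_)
  la = A-Linear (δ g)
  IH = hat-avoids N h′ w′ g (λ i i<N → ne (suc i) (s≤s i<N))

InjectiveBelow : ℕ → (ℕ → ℕ) → Set
InjectiveBelow N h = ∀ i j → i < N → j < N → h i ≡ h j → i ≡ j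

injective-tail : ∀ {N h} → InjectiveBelow (suc N) h → InjectiveBelow N (h ∘ suc)
injective-tail inj i j i<N j<N eq = ℕₚ.suc-injective (inj (suc i) (suc j) (s≤s i<N) (s≤s j<N) eq)

-- The weight may be 0, so it stands on the left instead of being divided out. Injectivity
-- guarantees that annihilating `h g` meets only the letter that came from g.
hat-a : ∀ {M} N h w g → g < N → InjectiveBelow N h → (∀ i → i < N → h i < M) → (x : V N) →
  w g ·ᵥ hat {M} N h w (a g x) ≈ a (h g) (hat N h w x)
hat-a {M} (suc N) h w zero _ inj bd x β = cong₂ (λ p q → w 0 · (p ⊹ w 0 · q)) (resp lh (λ γ → trans (cong (1ℚ · x₁ γ ⊹_) (A-weight-0 x₀ γ)) (ring31 _)) β)
      (vanish (C-Linear (δ (h 0))) (vanish lh (λ γ → trans (cong −_ (A-weight-0 x₁ γ)) −0≡0)) β)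
  ∙ ring32 (w 0) _
  ∙ cong₂ (λ p q → p ⊹ w 0 · (y₁ β − q)) (sym (av x₀ β)) (sym (vanish (C-Linear (δ (h 0))) (av x₁) β))
  ∙ cong (λ t → a (h 0) (hat N h′ w′ x₀) β ⊹ w 0 · t) (sym (ac-same (bd 0 (s≤s z≤n)) y₁ β))
  ∙ sym (add la _ _ β ∙ cong (a (h 0) (hat N h′ w′ x₀) β ⊹_) (mul la (w 0) _ β))
  where
  h′ : ℕ → ℕ
  h′ = h ∘ suc
  w′ : ℕ → ℚ
  w′ = w ∘ suc
  x₀ x₁ : V N
  x₀ = x ∘ (false ∷_)
  x₁ = x ∘ (true ∷_)
  lh = hat-Linear {M} N h′ w′
  la = A-Linear {M} (δ (h 0))
  y₁ : V M
  y₁ = hat N h′ w′ x₁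
  av : ∀ z → a (h 0) (hat {M} N h′ w′ z) ≈ 0ᵥ
  av = hat-avoids N h′ w′ (h 0) (λ i i<N eq → case inj 0 (suc i) (s≤s z≤n) (s≤s i<N) eq of λ ())
hat-a {M} (suc N) h w (suc g) (s≤s g<N) inj bd x β = cong₂ (λ p q → w′ g · (p ⊹ w 0 · q)) (resp lh (λ γ → ring33 _ _) β)
      (resp lc (neg lh (a g x₁)) β ∙ neg lc (hat N h′ w′ (a g x₁)) β)
  ∙ ring34 (w′ g) (w 0) _ _
  ∙ cong₂ (λ p q → p ⊹ w 0 · − q) (IH x₀ β) (sym (mul lc (w′ g) _ β) ∙ resp lc (IH x₁) β)
  ∙ cong (λ t → a (h′ g) (hat N h′ w′ x₀) β ⊹ w 0 · t) (sym (ac-diff ne (hat N h′ w′ x₁) β))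
  ∙ sym (add la _ _ β ∙ cong (a (h′ g) (hat N h′ w′ x₀) β ⊹_) (mul la (w 0) _ β))
  where
  h′ : ℕ → ℕ
  h′ = h ∘ suc
  w′ : ℕ → ℚ
  w′ = w ∘ suc
  x₀ x₁ : V N
  x₀ = x ∘ (false ∷_)
  x₁ = x ∘ (true ∷_)
  lh = hat-Linear {M} N h′ w′
  lc = C-Linear {M} (δ (h 0))
  la = A-Linear {M} (δ (h′ g))
  IH = hat-a {M} N h′ w′ g g<N (injective-tail inj) (λ i i<N → bd (suc i) (s≤s i<N))
  ne : h′ g ≢ h 0
  ne eq = case inj (suc g) 0 (s≤s g<N) (s≤s z≤n) eq of λ ()

-- Sums over lists.

sumL : ∀ {A : Set} → (A → ℚ) → List A → ℚ
sumL f [] = 0ℚ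
sumL f (x ∷ xs) = f x ⊹ sumL f xs

sumL-cong∈ : ∀ {A : Set} {f g : A → ℚ} xs → (∀ x → x ∈ xs → f x ≡ g x) → sumL f xs ≡ sumL g xs
sumL-cong∈ [] eq = refl
sumL-cong∈ (x ∷ xs) eq = cong₂ _⊹_ (eq x (here refl)) (sumL-cong∈ xs (λ y y∈ → eq y (there y∈)))

sumL-cong : ∀ {A : Set} {f g : A → ℚ} xs → (∀ x → f x ≡ g x) → sumL f xs ≡ sumL g xs
sumL-cong xs eq = sumL-cong∈ xs (λ x _ → eq x)

sumL-zero∈ : ∀ {A : Set} {f : A → ℚ} xs → (∀ x → x ∈ xs → f x ≡ 0ℚ) → sumL f xs ≡ 0ℚ
sumL-zero∈ [] eq = refl
sumL-zero∈ (x ∷ xs) eq = (cong₂ _⊹_ (eq x (here refl)) (sumL-zero∈ xs (λ y y∈ → eq y (there y∈)))) ∙ ⊹-identityˡ 0ℚ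

sumL-⊹ : ∀ {A : Set} (f g : A → ℚ) xs → sumL (λ x → f x ⊹ g x) xs ≡ sumL f xs ⊹ sumL g xs
sumL-⊹ f g [] = sym (⊹-identityˡ 0ℚ)
sumL-⊹ f g (x ∷ xs) = cong (_ ⊹_) (sumL-⊹ f g xs) ∙ interchange _ _ _ _

sumL-· : ∀ {A : Set} k (f : A → ℚ) xs → sumL (λ x → k · f x) xs ≡ k · sumL f xs
sumL-· k f [] = sym (·-zeroʳ k)
sumL-· k f (x ∷ xs) = cong (_ ⊹_) (sumL-· k f xs) ∙ sym (·-distribˡ-⊹ k _ _)

sumL-++ : ∀ {A : Set} (f : A → ℚ) xs ys → sumL f (xs ++ ys) ≡ sumL f xs ⊹ sumL f ys
sumL-++ f [] ys = sym (⊹-identityˡ _)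
sumL-++ f (x ∷ xs) ys = cong (f x ⊹_) (sumL-++ f xs ys) ∙ sym (⊹-assoc _ _ _)

sumL-map : ∀ {A B : Set} (f : B → ℚ) (g : A → B) xs → sumL f (map g xs) ≡ sumL (f ∘ g) xs
sumL-map f g [] = refl
sumL-map f g (x ∷ xs) = cong (f (g x) ⊹_) (sumL-map f g xs)

sumL-concatMap : ∀ {A B : Set} (f : B → ℚ) (g : A → List B) xs → sumL f (concatMap g xs) ≡ sumL (λ x → sumL f (g x)) xs
sumL-concatMap f g [] = refl
sumL-concatMap f g (x ∷ xs) = sumL-++ f (g x) _ ∙ cong (sumL f (g x) ⊹_) (sumL-concatMap f g xs)

sumL-Σ< : ∀ {A : Set} n (f : ℕ → A → ℚ) xs → sumL (λ x → Σ< n (λ i → f i x)) xs ≡ Σ< n (λ i → sumL (f i) xs)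
sumL-Σ< n f [] = sym (Σ<-zero n (λ _ _ → refl))
sumL-Σ< n f (x ∷ xs) = cong (_ ⊹_) (sumL-Σ< n f xs) ∙ sym (Σ<-⊹ n _ _)

sumL-applyUpTo : ∀ {A : Set} (f : A → ℚ) (g : ℕ → A) n → sumL f (applyUpTo g n) ≡ Σ< n (f ∘ g)
sumL-applyUpTo f g zero = refl
sumL-applyUpTo f g (suc n) = cong (f (g 0) ⊹_) (sumL-applyUpTo f (g ∘ suc) n)

sumL-↭ : ∀ {A : Set} (f : A → ℚ) {xs ys} → xs ↭ ys → sumL f xs ≡ sumL f ys
sumL-↭ f Perm.refl = refl
sumL-↭ f (Perm.prep x p) = cong (f x ⊹_) (sumL-↭ f p)
sumL-↭ f (Perm.swap x y p) = cong (λ t → f x ⊹ (f y ⊹ t)) (sumL-↭ f p) ∙ ring35 _ _ _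
sumL-↭ f (Perm.trans p q) = sumL-↭ f p ∙ sumL-↭ f q

Linear-sumL : ∀ {A : Set} {M N} {X : A → V M → V N} xs → (∀ i → Linear (X i)) → Linear (λ x β → sumL (λ i → X i x β) xs)
Linear-sumL xs lX = record
  { resp = λ p β → sumL-cong xs (λ i → resp (lX i) p β)
  ; add = λ x y β → trans (sumL-cong xs (λ i → add (lX i) x y β)) (sumL-⊹ _ _ xs)
  ; mul = λ k x β → trans (sumL-cong xs (λ i → mul (lX i) k x β)) (sumL-· k _ xs) }

opaque
  unfolding ℚ-ring

  sumℚ≡sumL : ∀ {A : Set} (f : A → ℚ) xs → sumℚ (map f xs) ≡ sumL f xs
  sumℚ≡sumL f [] = refl
  sumℚ≡sumL f (x ∷ xs) = cong (f x ⊹_) (sumℚ≡sumL f xs)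

-- Signs, and words of generators acting from the left.

sgn : ℕ → ℚ
sgn zero = 1ℚ
sgn (suc k) = − sgn k

sgn-+ : ∀ j k → sgn (j + k) ≡ sgn j · sgn k
sgn-+ zero k = sym (·-identityˡ _)
sgn-+ (suc j) k = (cong −_ (sgn-+ j k)) ∙ ring36 _ _

sgn-square : ∀ k → sgn k · sgn k ≡ 1ℚ
sgn-square zero = ·-identityˡ 1ℚ
sgn-square (suc k) = ring37 _ ∙ sgn-square k

cw : ∀ {N} → List ℕ → V N → V N
cw [] x = x
cw (g ∷ w) x = c g (cw w x)

cw-Linear : ∀ {N} w → Linear (cw {N} w)
cw-Linear [] = Linear-id
cw-Linear (g ∷ w) = Linear-∘ (C-Linear (δ g)) (cw-Linear w)

cw-++ : ∀ {N} v w (x : V N) → cw (v ++ w) x ≈ cw v (cw w x)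
cw-++ [] w x β = refl
cw-++ (g ∷ v) w x = resp (C-Linear (δ g)) (cw-++ v w x)

c-cw-comm : ∀ {N} g w (x : V N) → c g (cw w x) ≈ sgn (length w) ·ᵥ cw w (c g x)
c-cw-comm g [] x β = sym (·-identityˡ _)
c-cw-comm g (h ∷ w) x β = begin
  c g (c h (cw w x)) β ≡⟨ CC-anti (δ g) (δ h) _ β ⟩
  − c h (c g (cw w x)) β ≡⟨ cong −_ (resp (C-Linear (δ h)) (c-cw-comm g w x) β) ⟩
  − c h (sgn (length w) ·ᵥ cw w (c g x)) β ≡⟨ cong −_ (mul (C-Linear (δ h)) (sgn (length w)) (cw w (c g x)) β) ⟩
  − (sgn (length w) · c h (cw w (c g x)) β) ≡⟨ ring36 _ _ ⟩
  _ ∎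

mono : ∀ {N} → Vec Bool N → List ℕ
mono [] = []
mono (false ∷ β) = map suc (mono β)
mono (true ∷ β) = 0 ∷ map suc (mono β)

c-suc-low : ∀ {N} g (x : V N) → c (suc g) (low x) ≈ low (c g x)
c-suc-low g x (false ∷ β) = refl
c-suc-low g x (true ∷ β) = cong (λ t → 0ℚ · x β − t) (vanish (C-Linear (δ g)) (λ _ → refl) β) ∙ ring13 _

c-zero-low : ∀ {N} (x : V N) → c 0 (low x) ≈ high x
c-zero-low x (false ∷ β) = C-weight-0 x β
c-zero-low x (true ∷ β) = cong (λ t → 1ℚ · x β − t) (C-weight-0 _ β) ∙ ring25 _

cw-suc-low : ∀ {N} w (x : V N) → cw (map suc w) (low x) ≈ low (cw w x)
cw-suc-low [] x β = refl
cw-suc-low (g ∷ w) x = ≈-trans (resp (C-Linear (δ (suc g))) (cw-suc-low w x)) (c-suc-low g (cw w x))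

vac≈low : ∀ {N} → vac {suc N} ≈ low vac
vac≈low (false ∷ β) = refl
vac≈low (true ∷ β) = refl

e≈cw-mono : ∀ {N} (β : Vec Bool N) → e β ≈ cw (mono β) vac
e≈cw-mono [] [] = refl
e≈cw-mono (false ∷ β) = ≈-trans (λ { (false ∷ γ) → refl ; (true ∷ γ) → refl }) (≈-trans (resp low-Linear (e≈cw-mono β))
  (≈-trans (≈-sym (cw-suc-low (mono β) vac)) (resp (cw-Linear (map suc (mono β))) (≈-sym vac≈low))))
e≈cw-mono (true ∷ β) = ≈-trans (λ { (false ∷ γ) → refl ; (true ∷ γ) → refl }) (≈-trans (≈-sym (c-zero-low (e β)))
  (resp (C-Linear (δ 0)) (≈-trans (resp low-Linear (e≈cw-mono β))
  (≈-trans (≈-sym (cw-suc-low (mono β) vac)) (resp (cw-Linear (map suc (mono β))) (≈-sym vac≈low))))))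

-- Boolean tests, sorting and normal forms of words.

≡ᵇ⇒≡ : ∀ m n → (m ≡ᵇ n) ≡ true → m ≡ n
≡ᵇ⇒≡ zero zero _ = refl
≡ᵇ⇒≡ (suc m) (suc n) eq = cong suc (≡ᵇ⇒≡ m n eq)

≡ᵇ-false⇒≢ : ∀ m n → (m ≡ᵇ n) ≡ false → m ≢ n
≡ᵇ-false⇒≢ (suc m) .(suc m) eq refl = ≡ᵇ-false⇒≢ m m eq refl

≡ᵇ-refl : ∀ m → (m ≡ᵇ m) ≡ true
≡ᵇ-refl zero = refl
≡ᵇ-refl (suc m) = ≡ᵇ-refl m

≢⇒≡ᵇ-false : ∀ {m n} → m ≢ n → (m ≡ᵇ n) ≡ false
≢⇒≡ᵇ-false {m} {n} ne with m ≡ᵇ n in eq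
... | true = ⊥-elim (ne (≡ᵇ⇒≡ m n eq))
... | false = refl

<ᵇ⇒< : ∀ m n → (m <ᵇ n) ≡ true → m < n
<ᵇ⇒< zero (suc n) _ = s≤s z≤n
<ᵇ⇒< (suc m) (suc n) eq = s≤s (<ᵇ⇒< m n eq)

<⇒<ᵇ : ∀ {m n} → m < n → (m <ᵇ n) ≡ true
<⇒<ᵇ {zero} (s≤s _) = refl
<⇒<ᵇ {suc m} (s≤s p) = <⇒<ᵇ p

<ᵇ-false⇒≥ : ∀ m n → (m <ᵇ n) ≡ false → n ≤ m
<ᵇ-false⇒≥ m zero _ = z≤n
<ᵇ-false⇒≥ (suc m) (suc n) eq = s≤s (<ᵇ-false⇒≥ m n eq)

≥⇒<ᵇ-false : ∀ {m n} → n ≤ m → (m <ᵇ n) ≡ false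
≥⇒<ᵇ-false z≤n = refl
≥⇒<ᵇ-false (s≤s p) = ≥⇒<ᵇ-false p

≤ᵇ≡not<ᵇ : ∀ m n → (m ≤ᵇ n) ≡ not (n <ᵇ m)
≤ᵇ≡not<ᵇ zero n = refl
≤ᵇ≡not<ᵇ (suc m) zero = refl
≤ᵇ≡not<ᵇ (suc zero) (suc n) = refl
≤ᵇ≡not<ᵇ (suc (suc m)) (suc n) = ≤ᵇ≡not<ᵇ (suc m) n

c-cw-elem : ∀ {N} g w (x : V N) → elemB g w ≡ true → c g (cw w x) ≈ 0ᵥ
c-cw-elem g (h ∷ w) x eq β with g ≡ᵇ h in g≡h
... | true with refl ← ≡ᵇ⇒≡ g h g≡h = CC-zero (δ g) (cw w x) β
... | false = CC-anti (δ g) (δ h) (cw w x) β ∙ (cong −_ (vanish (C-Linear (δ h)) (c-cw-elem g w x eq) β)) ∙ −0≡0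

cw-dup : ∀ {N} w (x : V N) → hasDup w ≡ true → cw w x ≈ 0ᵥ
cw-dup (g ∷ w) x eq β with elemB g w in eqg
... | true = c-cw-elem g w x eqg β
... | false = vanish (C-Linear (δ g)) (cw-dup w x eq) β

elemB-false : ∀ g w → elemB g w ≡ false → All (g ≢_) w
elemB-false g [] eq = []
elemB-false g (h ∷ w) eq with g ≡ᵇ h in g≡h
... | false = ≡ᵇ-false⇒≢ g h g≡h ∷ elemB-false g w eq

hasDup-false : ∀ w → hasDup w ≡ false → Unique w
hasDup-false [] eq = []
hasDup-false (g ∷ w) eq with elemB g w in eqg
... | false = elemB-false g w eqg ∷ hasDup-false w eq

Unique-↭ : ∀ {A : Set} {xs ys : List A} → xs ↭ ys → Unique xs → Unique ys
Unique-↭ Perm.refl u = u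
Unique-↭ (Perm.prep x p) (h ∷ u) = Permₚ.All-resp-↭ p h ∷ Unique-↭ p u
Unique-↭ (Perm.swap x y p) ((x≢y ∷ h) ∷ (h′ ∷ u)) =
  ((λ eq → x≢y (sym eq)) ∷ Permₚ.All-resp-↭ p h′) ∷ (Permₚ.All-resp-↭ p h ∷ Unique-↭ p u)
Unique-↭ (Perm.trans p q) u = Unique-↭ q (Unique-↭ p u)

countB-∷ : ∀ {A : Set} (p : A → Bool) x xs → countB p (x ∷ xs) ≡ (if p x then 1 else 0) + countB p xs
countB-∷ p x xs with p x
... | true = refl
... | false = refl

countB-↭ : ∀ {A : Set} (p : A → Bool) {xs ys} → xs ↭ ys → countB p xs ≡ countB p ys
countB-↭ p Perm.refl = refl
countB-↭ p {_ ∷ xs} {_ ∷ ys} (Perm.prep x q) =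
  trans (countB-∷ p x xs) (cong ((if p x then 1 else 0) +_) (countB-↭ p q) ∙ sym (countB-∷ p x ys))
countB-↭ p {_ ∷ _ ∷ xs} {_ ∷ _ ∷ ys} (Perm.swap x y q) with p x | p y
... | true | true = cong (λ t → suc (suc t)) (countB-↭ p q)
... | true | false = cong suc (countB-↭ p q)
... | false | true = cong suc (countB-↭ p q)
... | false | false = countB-↭ p q
countB-↭ p (Perm.trans q r) = countB-↭ p q ∙ countB-↭ p r

countB-none : ∀ {A : Set} (p : A → Bool) {xs} → All (λ x → p x ≡ false) xs → countB p xs ≡ 0
countB-none p [] = refl
countB-none p {x ∷ xs} (px ∷ pxs) = countB-∷ p x xs ∙ cong (λ b → (if b then 1 else 0) + countB p xs) px ∙ countB-none p pxs

insertSorted-↭ : ∀ g w → insertSorted g w ↭ g ∷ w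
insertSorted-↭ g [] = ↭-refl
insertSorted-↭ g (h ∷ w) with g <ᵇ h
... | true = ↭-refl
... | false = ↭-trans (Perm.prep h (insertSorted-↭ g w)) (Perm.swap h g ↭-refl)

sortℕ-↭ : ∀ w → sortℕ w ↭ w
sortℕ-↭ [] = ↭-refl
sortℕ-↭ (g ∷ w) = ↭-trans (insertSorted-↭ g (sortℕ w)) (Perm.prep g (sortℕ-↭ w))

Increasing : List ℕ → Set
Increasing = AllPairs _<_

≢⇒<⊎> : ∀ {m n} → m ≢ n → n ≤ m → n < m
≢⇒<⊎> ne n≤m = ℕₚ.≤∧≢⇒< n≤m (λ eq → ne (sym eq))

insertSorted-increasing : ∀ g w → All (g ≢_) w → Increasing w → Increasing (insertSorted g w)
insertSorted-increasing g [] _ _ = [] ∷ []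
insertSorted-increasing g (h ∷ w) (g≢h ∷ ne) (h<w ∷ inc) with g <ᵇ h in eq
... | true = (g<h ∷ All.map (ℕₚ.<-trans g<h) h<w) ∷ (h<w ∷ inc)
  where g<h = <ᵇ⇒< g h eq
... | false = Permₚ.All-resp-↭ (↭-sym (insertSorted-↭ g w)) (≢⇒<⊎> g≢h (<ᵇ-false⇒≥ g h eq) ∷ h<w)
  ∷ insertSorted-increasing g w ne inc

sortℕ-increasing : ∀ w → Unique w → Increasing (sortℕ w)
sortℕ-increasing [] _ = []
sortℕ-increasing (g ∷ w) (ne ∷ u) = insertSorted-increasing g (sortℕ w) (Permₚ.All-resp-↭ (↭-sym (sortℕ-↭ w)) ne) (sortℕ-increasing w u)

-- Insertion carries g past exactly the smaller letters of w, each at the price of a sign; these are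
-- the inversions that g contributes.
cw-insertSorted : ∀ {N} g w (x : V N) → All (g ≢_) w → Increasing w →
  sgn (countB (_<ᵇ g) w) ·ᵥ cw (insertSorted g w) x ≈ c g (cw w x)
cw-insertSorted g [] x _ _ β = ·-identityˡ _
cw-insertSorted g (h ∷ w) x (g≢h ∷ ne) (h<w ∷ inc) β with g <ᵇ h in eq
... | true = cong (λ k → sgn k · c g (c h (cw w x)) β) (countB-none (_<ᵇ g) (≥⇒<ᵇ-false (ℕₚ.<⇒≤ g<h) ∷ All.map (λ h<y → ≥⇒<ᵇ-false (ℕₚ.<⇒≤ (ℕₚ.<-trans g<h h<y))) h<w)) ∙ ·-identityˡ _
  where g<h = <ᵇ⇒< g h eq
... | false = cong (λ k → sgn k · c h (cw (insertSorted g w) x) β) (countB-∷ (_<ᵇ g) h w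
      ∙ cong (λ b → (if b then 1 else 0) + countB (_<ᵇ g) w) (<⇒<ᵇ (≢⇒<⊎> g≢h (<ᵇ-false⇒≥ g h eq))))
  ∙ ring38 _ _
  ∙ cong −_ (sym (mul (C-Linear (δ h)) _ _ β) ∙ resp (C-Linear (δ h)) (cw-insertSorted g w x ne inc) β)
  ∙ sym (CC-anti (δ g) (δ h) (cw w x) β)

cw-sort : ∀ {N} w (x : V N) → Unique w → cw w x ≈ sgn (inversions w) ·ᵥ cw (sortℕ w) x
cw-sort [] x _ β = sym (·-identityˡ _)
cw-sort (g ∷ w) x (ne ∷ u) β = resp (C-Linear (δ g)) (cw-sort w x u) β
  ∙ mul (C-Linear (δ g)) _ _ β
  ∙ cong (sgn (inversions w) ·_) (sym (cw-insertSorted g (sortℕ w) x (Permₚ.All-resp-↭ (↭-sym (sortℕ-↭ w)) ne) (sortℕ-increasing w u) β))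
  ∙ ring39 _ _ _
  ∙ cong (_· cw (insertSorted g (sortℕ w)) x β) (cong (λ k → sgn k · sgn (inversions w)) (countB-↭ (_<ᵇ g) (sortℕ-↭ w)) ∙ sym (sgn-+ (countB (_<ᵇ g) w) (inversions w)))

increasing-positive : ∀ {w} → All (0 <_) w → ∃[ v ] w ≡ map suc v
increasing-positive [] = [] , refl
increasing-positive {suc g ∷ w} (_ ∷ p) with increasing-positive p
... | v , refl = g ∷ v , refl

All-map-suc⁻ : ∀ {N} v → All (_< suc N) (map suc v) → All (_< N) v
All-map-suc⁻ [] [] = []
All-map-suc⁻ (g ∷ v) (s≤s g<N ∷ p) = g<N ∷ All-map-suc⁻ v p

Increasing-map-suc⁻ : ∀ v → Increasing (map suc v) → Increasing v
Increasing-map-suc⁻ [] [] = []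
Increasing-map-suc⁻ (g ∷ v) (p ∷ q) = All.map (λ { (s≤s r) → r }) (Allₚ.map⁻ p) ∷ Increasing-map-suc⁻ v q

increasing⇒mono : ∀ N w → Increasing w → All (_< N) w → ∃[ β ] w ≡ mono {N} β
increasing⇒mono zero [] _ _ = [] , refl
increasing⇒mono zero (g ∷ w) _ (() ∷ _)
increasing⇒mono (suc N) [] _ _ with increasing⇒mono N [] [] []
... | β , eq = false ∷ β , cong (map suc) eq
increasing⇒mono (suc N) (zero ∷ w) (p ∷ inc) (_ ∷ bd) with increasing-positive p
... | v , refl with increasing⇒mono N v (Increasing-map-suc⁻ v inc) (All-map-suc⁻ v bd)
... | β , refl = true ∷ β , refl
increasing⇒mono (suc N) (suc g ∷ w) (p ∷ inc) bd with increasing-positive (s≤s z≤n ∷ All.map (λ q → ℕₚ.≤-trans (s≤s z≤n) q) p)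
... | v , eq with increasing⇒mono N v (Increasing-map-suc⁻ v (subst Increasing eq (p ∷ inc))) (All-map-suc⁻ v (subst (All _) eq bd))
... | β , refl = false ∷ β , eq

mono-bounded : ∀ {N} (β : Vec Bool N) → All (_< N) (mono β)
mono-bounded [] = []
mono-bounded (false ∷ β) = Allₚ.map⁺ (All.map s≤s (mono-bounded β))
mono-bounded (true ∷ β) = s≤s z≤n ∷ Allₚ.map⁺ (All.map s≤s (mono-bounded β))

-- `normWord` answers a repeated letter with coefficient 0 and a default word, so a term is
-- admissible either because it vanishes or because its word is a basis monomial.
Proper : ℕ → ℚ × Mono → Set
Proper N (k , m) = (k ≡ 0ℚ) ⊎ (∃[ β ] m ≡ mono {N} β)

opaque
  unfolding ℚ-ring

  evenB-sgn : ∀ k → (if evenB k then 1ℚ else ℚ.-_ 1ℚ) ≡ sgn k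
  evenB-sgn zero = refl
  evenB-sgn (suc k) with evenB k | evenB-sgn k
  ... | true | eq = cong −_ eq
  ... | false | eq = cong −_ eq

normWord-cw : ∀ {N} w (x : V N) → cw w x ≈ proj₁ (normWord w) ·ᵥ cw (proj₂ (normWord w)) x
normWord-cw w x β with hasDup w in eq
... | true = cw-dup w x eq β ∙ sym (·-zeroˡ _)
... | false = cw-sort w x (hasDup-false w eq) β ∙ cong (_· cw (sortℕ w) x β) (sym (evenB-sgn (inversions w)))

normWord-proper : ∀ {N} w → All (_< N) w → Proper N (normWord w)
normWord-proper {N} w bd with hasDup w in eq
... | true = inj₁ refl
... | false = inj₂ (increasing⇒mono N (sortℕ w) (sortℕ-increasing w (hasDup-false w eq)) (Permₚ.All-resp-↭ (↭-sym (sortℕ-↭ w)) bd))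

-- Words act on the vacuum, so unsorted words and repeated letters are read correctly as well. On
-- proper terms the result agrees with `coordOf`, see `coordOf-ι`.
ι : ∀ {N} → Elem → V N
ι x β = sumL (λ t → proj₁ t · cw (proj₂ t) vac β) x

eqListB-map-suc : ∀ v w → eqListB (map suc v) (map suc w) ≡ eqListB v w
eqListB-map-suc [] [] = refl
eqListB-map-suc [] (h ∷ w) = refl
eqListB-map-suc (g ∷ v) [] = refl
eqListB-map-suc (g ∷ v) (h ∷ w) = cong ((g ≡ᵇ h) ∧_) (eqListB-map-suc v w)

eqListB-0-map-suc : ∀ v w → eqListB (0 ∷ v) (map suc w) ≡ false
eqListB-0-map-suc v [] = refl
eqListB-0-map-suc v (h ∷ w) = refl

eqListB-map-suc-0 : ∀ v w → eqListB (map suc v) (0 ∷ w) ≡ false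
eqListB-map-suc-0 [] w = refl
eqListB-map-suc-0 (g ∷ v) w = refl

eqListB-mono : ∀ {N} (γ β : Vec Bool N) → e γ β ≡ (if eqListB (mono γ) (mono β) then 1ℚ else 0ℚ)
eqListB-mono [] [] = refl
eqListB-mono (false ∷ γ) (false ∷ β) = eqListB-mono γ β ∙ cong (if_then 1ℚ else 0ℚ) (sym (eqListB-map-suc (mono γ) (mono β)))
eqListB-mono (true ∷ γ) (true ∷ β) = eqListB-mono γ β ∙ cong (if_then 1ℚ else 0ℚ) (sym (eqListB-map-suc (mono γ) (mono β)))
eqListB-mono (false ∷ γ) (true ∷ β) = cong (if_then 1ℚ else 0ℚ) (sym (eqListB-map-suc-0 (mono γ) (map suc (mono β))))
eqListB-mono (true ∷ γ) (false ∷ β) = cong (if_then 1ℚ else 0ℚ) (sym (eqListB-0-map-suc (map suc (mono γ)) (mono β)))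

sumL-filterB : ∀ {A : Set} (f : A → ℚ) p xs → sumL f (filterB p xs) ≡ sumL (λ x → (if p x then 1ℚ else 0ℚ) · f x) xs
sumL-filterB f p [] = refl
sumL-filterB f p (x ∷ xs) with p x
... | true = cong₂ _⊹_ (sym (·-identityˡ _)) (sumL-filterB f p xs)
... | false = sumL-filterB f p xs ∙ sym (cong (_⊹ _) (·-zeroˡ _) ∙ ⊹-identityˡ _)

coordOf-ι : ∀ {N} x → All (Proper N) x → (β : Vec Bool N) → coordOf x (mono β) ≡ ι x β
coordOf-ι {N} x px β = sumℚ≡sumL proj₁ (filterB (λ t → eqListB (proj₂ t) (mono β)) x) ∙ trans (sumL-filterB proj₁ (λ t → eqListB (proj₂ t) (mono β)) x) (go x px)
  where
  term : ∀ t → Proper N t → (if eqListB (proj₂ t) (mono β) then 1ℚ else 0ℚ) · proj₁ t ≡ proj₁ t · cw (proj₂ t) vac β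
  term (k , m) (inj₁ refl) = ·-zeroʳ _ ∙ sym (·-zeroˡ _)
  term (k , m) (inj₂ (γ , refl)) = cong (_· k) (sym (eqListB-mono γ β)) ∙ ·-comm _ k ∙ cong (k ·_) (e≈cw-mono γ β)
  go : ∀ x → All (Proper N) x → sumL (λ t → (if eqListB (proj₂ t) (mono β) then 1ℚ else 0ℚ) · proj₁ t) x ≡ ι x β
  go [] [] = refl
  go (t ∷ x) (pt ∷ px) = cong₂ _⊹_ (term t pt) (go x px)

-- The action and the product of `Elem` as operators on vectors.

opaque
  unfolding ℚ-ring

  actElem-∷ : ∀ n σ k m x → actElem n σ ((k , m) ∷ x) ≡
    (k · proj₁ (normWord (map (actGen n σ) m)) , proj₂ (normWord (map (actGen n σ) m))) ∷ actElem n σ x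
  actElem-∷ n σ k m x with normWord (map (actGen n σ) m)
  ... | s , w = refl

  mulTerm≡ : ∀ k m l m′ → mulTerm (k , m) (l , m′) ≡
    (k · l · proj₁ (normWord (m ++ m′)) , proj₂ (normWord (m ++ m′)))
  mulTerm≡ k m l m′ with normWord (m ++ m′)
  ... | s , w = refl

Proper-scale : ∀ {N} k w → Proper N w → Proper N (k · proj₁ w , proj₂ w)
Proper-scale k (_ , m) (inj₁ refl) = inj₁ (·-zeroʳ k)
Proper-scale k (_ , m) (inj₂ p) = inj₂ p

map-bounded : ∀ {M N} {h : ℕ → ℕ} → (∀ g → g < M → h g < N) → ∀ {m} → All (_< M) m → All (_< N) (map h m)
map-bounded bd p = Allₚ.map⁺ (All.map (λ {g} → bd g) p)

act : ∀ N → (ℕ → ℕ) → V N → V N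
act N h = hat N h (λ _ → 1ℚ)

act-Linear : ∀ N h → Linear (act N h)
act-Linear N h = hat-Linear N h (λ _ → 1ℚ)

act-c : ∀ N h g → g < N → (x : V N) → act N h (c g x) ≈ c (h g) (act N h x)
act-c N h g g<N x β = hat-c N h (λ _ → 1ℚ) g g<N x β ∙ ·-identityˡ _

act-a : ∀ N h g → g < N → InjectiveBelow N h → (∀ i → i < N → h i < N) → (x : V N) → act N h (a g x) ≈ a (h g) (act N h x)
act-a N h g g<N inj bd x β = sym (·-identityˡ _) ∙ hat-a N h (λ _ → 1ℚ) g g<N inj bd x β

act-cw : ∀ N h m → All (_< N) m → (x : V N) → act N h (cw m x) ≈ cw (map h m) (act N h x)
act-cw N h [] _ x β = refl
act-cw N h (g ∷ m) (g<N ∷ p) x = ≈-trans (act-c N h g g<N (cw m x)) (resp (C-Linear (δ (h g))) (act-cw N h m p x))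

InRange : ℕ → Elem → Set
InRange N = All (λ t → All (_< N) (proj₂ t))

actElem-Proper : ∀ N n σ x → (∀ g → g < N → actGen n σ g < N) → InRange N x → All (Proper N) (actElem n σ x)
actElem-Proper N n σ [] bd [] = []
actElem-Proper N n σ ((k , m) ∷ x) bd (p ∷ px) = subst (All (Proper N)) (sym (actElem-∷ n σ k m x))
  (Proper-scale k (normWord (map (actGen n σ) m)) (normWord-proper _ (map-bounded bd p)) ∷ actElem-Proper N n σ x bd px)

actElem-ι : ∀ N n σ x → InRange N x → ι {N} (actElem n σ x) ≈ act N (actGen n σ) (ι x)
actElem-ι N n σ [] [] β = sym (zer (act-Linear N (actGen n σ)) β)
actElem-ι N n σ ((k , m) ∷ x) (p ∷ px) β = cong (λ y → ι y β) (actElem-∷ n σ k m x)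
  ∙ cong₂ _⊹_ (·-assoc k s _ ∙ cong (k ·_) (sym (normWord-cw (map h m) vac β))) (actElem-ι N n σ x px β)
  ∙ cong (λ t → k · t ⊹ act N h (ι x) β) (resp (cw-Linear (map h m)) (≈-sym (hat-vac N h (λ _ → 1ℚ))) β ∙ sym (act-cw N h m p vac β))
  ∙ cong (_⊹ act N h (ι x) β) (sym (mul (act-Linear N h) k (cw m vac) β))
  ∙ sym (add (act-Linear N h) (k ·ᵥ cw m vac) (ι x) β)
  where
  h = actGen n σ
  s = proj₁ (normWord (map h m))
  w = proj₂ (normWord (map h m))

-- Permutations and their cycles

unique-↭ : ∀ {A : Set} {xs ys : List A} → Unique xs → Unique ys → (∀ {z} → z ∈ xs → z ∈ ys) → (∀ {z} → z ∈ ys → z ∈ xs) → xs ↭ ys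
unique-↭ u v f g = ∼bag⇒↭ (unique∧set⇒bag u v (mk⇔ f g))

∈-concatMap⁺ : ∀ {A B : Set} (f : A → List B) {x y xs} → x ∈ xs → y ∈ f x → y ∈ concatMap f xs
∈-concatMap⁺ f {xs = x ∷ xs} (here refl) y∈ = ∈ₚ.∈-++⁺ˡ y∈
∈-concatMap⁺ f {xs = x ∷ xs} (there x∈) y∈ = ∈ₚ.∈-++⁺ʳ (f x) (∈-concatMap⁺ f x∈ y∈)

∈-concatMap⁻ : ∀ {A B : Set} (f : A → List B) {y} xs → y ∈ concatMap f xs → ∃[ x ] x ∈ xs × y ∈ f x
∈-concatMap⁻ f (x ∷ xs) y∈ with ∈ₚ.∈-++⁻ (f x) y∈
... | inj₁ p = x , here refl , p
... | inj₂ q with ∈-concatMap⁻ f xs q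
... | z , z∈ , r = z , there z∈ , r

All⇒∀∈ : ∀ {A : Set} {P : A → Set} {xs} → All P xs → ∀ {x} → x ∈ xs → P x
All⇒∀∈ = All.lookup

-- The label p separates the blocks: a common element of two blocks forces equal labels, while the
-- labels are pairwise distinct.
concatMap-Unique : ∀ {A B C : Set} (p : A → C) (f : A → List B) xs → Unique (map p xs) → (∀ x → x ∈ xs → Unique (f x)) →
  (∀ x y z → x ∈ xs → y ∈ xs → z ∈ f x → z ∈ f y → p x ≡ p y) → Unique (concatMap f xs)
concatMap-Unique p f [] _ _ _ = []
concatMap-Unique p f (x ∷ xs) (x∉ ∷ u) uf dis =
  Uniqueₚ.++⁺ (uf x (here refl)) (concatMap-Unique p f xs u (λ y y∈ → uf y (there y∈)) (λ y z t y∈ z∈ → dis y z t (there y∈) (there z∈)))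
    (λ { {t} (t∈ , t∈′) → let (y , y∈ , t∈y) = ∈-concatMap⁻ f xs t∈′ in
         All⇒∀∈ x∉ (∈ₚ.∈-map⁺ p y∈) (dis x y t (here refl) (there y∈) t∈ t∈y) })

∈-insertions⁻ : ∀ k ρ {σ} → σ ∈ insertions k ρ → ∃[ as ] ∃[ bs ] ρ ≡ as ++ bs × σ ≡ as ++ k ∷ bs
∈-insertions⁻ k [] (here refl) = [] , [] , refl , refl
∈-insertions⁻ k (y ∷ ρ) (here refl) = [] , y ∷ ρ , refl , refl
∈-insertions⁻ k (y ∷ ρ) (there p) with ∈ₚ.∈-map⁻ (y ∷_) p
... | τ , τ∈ , refl with ∈-insertions⁻ k ρ τ∈
... | as , bs , refl , refl = y ∷ as , bs , refl , refl

∈-insertions⁺ : ∀ k as bs → as ++ k ∷ bs ∈ insertions k (as ++ bs)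
∈-insertions⁺ k [] [] = here refl
∈-insertions⁺ k [] (b ∷ bs) = here refl
∈-insertions⁺ k (x ∷ as) bs = there (∈ₚ.∈-map⁺ (x ∷_) (∈-insertions⁺ k as bs))

IsPerm : ℕ → List ℕ → Set
IsPerm n σ = σ ↭ upTo n

upTo-suc-↭ : ∀ n → n ∷ upTo n ↭ upTo (suc n)
upTo-suc-↭ n = subst (n ∷ upTo n ↭_) (Listₚ.upTo-∷ʳ n) (Permₚ.∷↭∷ʳ n (upTo n))

∈-perms⇒IsPerm : ∀ n {σ} → σ ∈ perms n → IsPerm n σ
∈-perms⇒IsPerm zero (here refl) = ↭-refl
∈-perms⇒IsPerm (suc n) σ∈ with ∈-concatMap⁻ (insertions n) (perms n) σ∈
... | ρ , ρ∈ , p with ∈-insertions⁻ n ρ p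
... | as , bs , refl , refl = ↭-trans (Permₚ.shift n as bs) (↭-trans (Perm.prep n (∈-perms⇒IsPerm n ρ∈)) (upTo-suc-↭ n))

IsPerm⇒∈-perms : ∀ n {σ} → IsPerm n σ → σ ∈ perms n
IsPerm⇒∈-perms zero p with Permₚ.↭-empty-inv p
... | refl = here refl
IsPerm⇒∈-perms (suc n) {σ} p with ∈ₚ.∈-∃++ (Permₚ.∈-resp-↭ (↭-sym p) (∈ₚ.∈-upTo⁺ (ℕₚ.n<1+n n)))
... | as , bs , refl = ∈-concatMap⁺ (insertions n)
  (IsPerm⇒∈-perms n (Permₚ.drop-∷ (↭-trans (↭-sym (Permₚ.shift n as bs)) (↭-trans p (↭-sym (upTo-suc-↭ n))))))
  (∈-insertions⁺ n as bs)

IsPerm-bounded : ∀ {n σ} → IsPerm n σ → All (_< n) σ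
IsPerm-bounded {n} p = Permₚ.All-resp-↭ (↭-sym p) (Allₚ.all-upTo n)

IsPerm-length : ∀ {n σ} → IsPerm n σ → length σ ≡ n
IsPerm-length {n} p = Permₚ.↭-length p ∙ Listₚ.length-upTo n

IsPerm-Unique : ∀ {n σ} → IsPerm n σ → Unique σ
IsPerm-Unique {n} p = Unique-↭ (↭-sym p) (Uniqueₚ.upTo⁺ n)

replaceℕ-absent : ∀ k y xs → All (k ≢_) xs → replaceℕ k y xs ≡ xs
replaceℕ-absent k y [] [] = refl
replaceℕ-absent k y (x ∷ xs) (ne ∷ p) = cong₂ _∷_ (cong (if_then y else x) (≢⇒≡ᵇ-false (λ eq → ne (sym eq)))) (replaceℕ-absent k y xs p)

replaceℕ-mid : ∀ k y as bs → All (k ≢_) as → All (k ≢_) bs → replaceℕ k y (as ++ k ∷ bs) ≡ as ++ y ∷ bs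
replaceℕ-mid k y [] bs _ q = cong₂ _∷_ (cong (if_then y else k) (≡ᵇ-refl k)) (replaceℕ-absent k y bs q)
replaceℕ-mid k y (x ∷ as) bs (ne ∷ p) q = cong₂ _∷_ (cong (if_then y else x) (≢⇒≡ᵇ-false (λ eq → ne (sym eq)))) (replaceℕ-mid k y as bs p q)

remove-mid : ∀ k {as bs as′ bs′ : List ℕ} → All (k ≢_) (as ++ bs) → All (k ≢_) (as′ ++ bs′) →
  as ++ k ∷ bs ≡ as′ ++ k ∷ bs′ → as ++ bs ≡ as′ ++ bs′
remove-mid k {[]} {bs} {[]} p q refl = refl
remove-mid k {[]} {bs} {a′ ∷ as′} p (ne ∷ q) eq = ⊥-elim (ne (Listₚ.∷-injectiveˡ eq))
remove-mid k {x ∷ as} {bs} {[]} (ne ∷ p) q eq = ⊥-elim (ne (sym (Listₚ.∷-injectiveˡ eq)))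
remove-mid k {x ∷ as} {bs} {a′ ∷ as′} (_ ∷ p) (_ ∷ q) eq = cong₂ _∷_ (Listₚ.∷-injectiveˡ eq) (remove-mid k {as} p q (Listₚ.∷-injectiveʳ eq))

insertions-Unique : ∀ k ρ → All (k ≢_) ρ → Unique (insertions k ρ)
insertions-Unique k [] _ = [] ∷ []
insertions-Unique k (y ∷ ρ) (ne ∷ p) =
  All.tabulate (λ {z} z∈ eq → let (τ , _ , eq′) = ∈ₚ.∈-map⁻ (y ∷_) z∈ in ne (Listₚ.∷-injectiveˡ (eq ∙ eq′)))
  ∷ Uniqueₚ.map⁺ Listₚ.∷-injectiveʳ (insertions-Unique k ρ p)

bounded⇒≢ : ∀ {n xs} → All (_< n) xs → All (n ≢_) xs
bounded⇒≢ = All.map (λ x<n eq → ℕₚ.<-irrefl (sym eq) x<n)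

perms-Unique : ∀ n → Unique (perms n)
perms-Unique zero = [] ∷ []
perms-Unique (suc n) = concatMap-Unique id (insertions n) (perms n) (subst Unique (sym (Listₚ.map-id (perms n))) (perms-Unique n))
  (λ ρ ρ∈ → insertions-Unique n ρ (fresh ρ∈))
  (λ ρ ρ′ σ ρ∈ ρ′∈ p q → sep ρ ρ′ (fresh ρ∈) (fresh ρ′∈) p q)
  where
  fresh : ∀ {ρ} → ρ ∈ perms n → All (n ≢_) ρ
  fresh ρ∈ = bounded⇒≢ (IsPerm-bounded (∈-perms⇒IsPerm n ρ∈))
  sep : ∀ ρ ρ′ {σ} → All (n ≢_) ρ → All (n ≢_) ρ′ → σ ∈ insertions n ρ → σ ∈ insertions n ρ′ → ρ ≡ ρ′
  sep ρ ρ′ f f′ p q with ∈-insertions⁻ n ρ p | ∈-insertions⁻ n ρ′ q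
  ... | as , bs , refl , eq | as′ , bs′ , refl , eq′ = remove-mid n {as} f f′ (sym eq ∙ eq′)

setAt : List ℕ → ℕ → ℕ → List ℕ
setAt [] i v = []
setAt (x ∷ xs) zero v = v ∷ xs
setAt (x ∷ xs) (suc i) v = x ∷ setAt xs i v

setAt-split : ∀ xs i v → i < length xs → ∃[ as ] ∃[ bs ] (xs ≡ as ++ lookupD xs i ∷ bs × length as ≡ i × setAt xs i v ≡ as ++ v ∷ bs)
setAt-split (x ∷ xs) zero v _ = [] , xs , refl , refl , refl
setAt-split (x ∷ xs) (suc i) v (s≤s i<) with setAt-split xs i v i<
... | as , bs , eq , len , eq′ = x ∷ as , bs , cong (x ∷_) eq , cong suc len , cong (x ∷_) eq′

length-setAt : ∀ xs i v → length (setAt xs i v) ≡ length xs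
length-setAt [] i v = refl
length-setAt (x ∷ xs) zero v = refl
length-setAt (x ∷ xs) (suc i) v = cong suc (length-setAt xs i v)

lookupD-setAt : ∀ xs i v → i < length xs → lookupD (setAt xs i v) i ≡ v
lookupD-setAt (x ∷ xs) zero v _ = refl
lookupD-setAt (x ∷ xs) (suc i) v (s≤s i<) = lookupD-setAt xs i v i<

lookupD-setAt-≢ : ∀ xs i j v → i ≢ j → lookupD (setAt xs i v) j ≡ lookupD xs j
lookupD-setAt-≢ [] i j v ne = refl
lookupD-setAt-≢ (x ∷ xs) zero zero v ne = ⊥-elim (ne refl)
lookupD-setAt-≢ (x ∷ xs) zero (suc j) v ne = refl
lookupD-setAt-≢ (x ∷ xs) (suc i) zero v ne = refl
lookupD-setAt-≢ (x ∷ xs) (suc i) (suc j) v ne = lookupD-setAt-≢ xs i j v (λ eq → ne (cong suc eq))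

lookupD-++ˡ : ∀ xs ys i → i < length xs → lookupD (xs ++ ys) i ≡ lookupD xs i
lookupD-++ˡ (x ∷ xs) ys zero _ = refl
lookupD-++ˡ (x ∷ xs) ys (suc i) (s≤s i<) = lookupD-++ˡ xs ys i i<

lookupD-mid : ∀ xs y ys → lookupD (xs ++ y ∷ ys) (length xs) ≡ y
lookupD-mid [] y ys = refl
lookupD-mid (x ∷ xs) y ys = lookupD-mid xs y ys

lookupD-∈ : ∀ xs i → i < length xs → lookupD xs i ∈ xs
lookupD-∈ (x ∷ xs) zero _ = here refl
lookupD-∈ (x ∷ xs) (suc i) (s≤s i<) = there (lookupD-∈ xs i i<)

map-lookupD : ∀ xs → xs ≡ applyUpTo (lookupD xs) (length xs)
map-lookupD [] = refl
map-lookupD (x ∷ xs) = cong (x ∷_) (map-lookupD xs)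

IsPerm-lookupD< : ∀ {n σ} → IsPerm n σ → ∀ i → i < n → lookupD σ i < n
IsPerm-lookupD< {n} {σ} p i i<n = All⇒∀∈ (IsPerm-bounded p) (lookupD-∈ σ i (subst (i <_) (sym (IsPerm-length p)) i<n))

Unique-lookupD-injective : ∀ xs → Unique xs → ∀ i j → i < length xs → j < length xs → lookupD xs i ≡ lookupD xs j → i ≡ j
Unique-lookupD-injective (x ∷ xs) (p ∷ u) zero zero _ _ eq = refl
Unique-lookupD-injective (x ∷ xs) (p ∷ u) zero (suc j) _ (s≤s j<) eq = ⊥-elim (All⇒∀∈ p (lookupD-∈ xs j j<) eq)
Unique-lookupD-injective (x ∷ xs) (p ∷ u) (suc i) zero (s≤s i<) _ eq = ⊥-elim (All⇒∀∈ p (lookupD-∈ xs i i<) (sym eq))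
Unique-lookupD-injective (x ∷ xs) (p ∷ u) (suc i) (suc j) (s≤s i<) (s≤s j<) eq = cong suc (Unique-lookupD-injective xs u i j i< j< eq)

IsPerm-injective : ∀ {n σ} → IsPerm n σ → InjectiveBelow n (lookupD σ)
IsPerm-injective {n} {σ} p i j i<n j<n = Unique-lookupD-injective σ (IsPerm-Unique p) i j
  (subst (i <_) (sym (IsPerm-length p)) i<n) (subst (j <_) (sym (IsPerm-length p)) j<n)

Σ<-perm : ∀ {n σ} → IsPerm n σ → (f : ℕ → ℚ) → Σ< n (λ i → f (lookupD σ i)) ≡ Σ< n f
Σ<-perm {n} {σ} p f = begin
  Σ< n (λ i → f (lookupD σ i)) ≡⟨ sym (sumL-applyUpTo f (lookupD σ) n) ⟩
  sumL f (applyUpTo (lookupD σ) n) ≡⟨ cong (λ m → sumL f (applyUpTo (lookupD σ) m)) (sym (IsPerm-length p)) ⟩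
  sumL f (applyUpTo (lookupD σ) (length σ)) ≡⟨ cong (sumL f) (sym (map-lookupD σ)) ⟩
  sumL f σ ≡⟨ sumL-↭ f p ⟩
  sumL f (upTo n) ≡⟨ sumL-applyUpTo f id n ⟩
  _ ∎

-- Permutations of {0..n} obtained from a permutation ρ of {0..n-1}: n becomes
-- a fixed point, or is inserted behind x in the cycle of x.
insertAfter : ℕ → List ℕ → ℕ → List ℕ
insertAfter n ρ x = setAt ρ x n ∷ʳ lookupD ρ x

IsPerm-∷ʳ : ∀ {n ρ} → IsPerm n ρ → IsPerm (suc n) (ρ ∷ʳ n)
IsPerm-∷ʳ {n} {ρ} p = ↭-trans (↭-sym (Permₚ.∷↭∷ʳ n ρ)) (↭-trans (Perm.prep n p) (upTo-suc-↭ n))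

IsPerm-insertAfter : ∀ {n ρ} x → x < n → IsPerm n ρ → IsPerm (suc n) (insertAfter n ρ x)
IsPerm-insertAfter {n} {ρ} x x<n p with setAt-split ρ x n (subst (x <_) (sym (IsPerm-length p)) x<n)
... | as , bs , eq , _ , eq′ = ↭-trans (↭-sym (Permₚ.∷↭∷ʳ y (setAt ρ x n)))
      (↭-trans (Perm.prep y (subst (_↭ n ∷ as ++ bs) (sym eq′) (Permₚ.shift n as bs)))
      (↭-trans (Perm.swap y n ↭-refl)
      (↭-trans (Perm.prep n (↭-trans (↭-sym (Permₚ.shift y as bs)) (subst (_↭ upTo n) eq p))) (upTo-suc-↭ n))))
  where y = lookupD ρ x

-- A cycle of h through x₀, cut open at x₀: the path x, xs leads back to x₀.
data Path (h : ℕ → ℕ) (x₀ : ℕ) : ℕ → List ℕ → Set where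
  end : ∀ {x} → h x ≡ x₀ → Path h x₀ x []
  step : ∀ {x y ys} → h x ≡ y → Path h x₀ y ys → Path h x₀ x (y ∷ ys)

-- A cycle is written from its least element, the starting point that `isCycMin` selects.
IsCycle : (ℕ → ℕ) → List ℕ → Set
IsCycle h [] = ⊥
IsCycle h (x ∷ xs) = Path h x x xs × All (x <_) xs

headD : List ℕ → ℕ
headD [] = 0
headD (x ∷ _) = x

-- `sorted` reflects that `cycleType` lists the lengths in the order of the least elements; it makes
-- `cycleType≡lengths` an equality of lists and not merely of multisets.
record CycleDecomposition (n : ℕ) (cs : List (List ℕ)) (σ : List ℕ) : Set where
  field
    covers : concat cs ↭ upTo n
    cycles : All (IsCycle (lookupD σ)) cs
    sorted : Increasing (map headD cs)
    isPerm : IsPerm n σ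

open CycleDecomposition public

insertIntoCycle : ℕ → List ℕ → List (List ℕ × ℕ)
insertIntoCycle n [] = []
insertIntoCycle n (x ∷ xs) = ((x ∷ n ∷ xs) , x) ∷ map (λ r → (x ∷ proj₁ r , proj₂ r)) (insertIntoCycle n xs)

insertIntoCycles : ℕ → List (List ℕ) → List (List (List ℕ) × ℕ)
insertIntoCycles n [] = []
insertIntoCycles n (c ∷ cs) = map (λ r → (proj₁ r ∷ cs , proj₂ r)) (insertIntoCycle n c) ++ map (λ r → (c ∷ proj₁ r , proj₂ r)) (insertIntoCycles n cs)

map-proj₂-insertIntoCycle : ∀ n xs → map proj₂ (insertIntoCycle n xs) ≡ xs
map-proj₂-insertIntoCycle n [] = refl
map-proj₂-insertIntoCycle n (x ∷ xs) = cong (x ∷_) (sym (Listₚ.map-∘ (insertIntoCycle n xs)) ∙ map-proj₂-insertIntoCycle n xs)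

map-proj₂-insertIntoCycles : ∀ n cs → map proj₂ (insertIntoCycles n cs) ≡ concat cs
map-proj₂-insertIntoCycles n [] = refl
map-proj₂-insertIntoCycles n (c ∷ cs) = Listₚ.map-++ proj₂ (map _ (insertIntoCycle n c)) _
  ∙ (cong₂ _++_ (sym (Listₚ.map-∘ (insertIntoCycle n c)) ∙ map-proj₂-insertIntoCycle n c)
              (sym (Listₚ.map-∘ (insertIntoCycles n cs)) ∙ map-proj₂-insertIntoCycles n cs))

extend : ℕ → List (List ℕ) × List ℕ → List (List (List ℕ) × List ℕ)
extend n (cs , ρ) = (cs ∷ʳ (n ∷ []) , ρ ∷ʳ n) ∷ map (λ r → (proj₁ r , insertAfter n ρ (proj₂ r))) (insertIntoCycles n cs)

-- A second enumeration of the symmetric group, which grows cycles instead of one-line words. Each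
-- permutation of n + 1 points arises once, with n as a fixed point or behind some x in its cycle;
-- this recursion controls cycle types, on which `perms` gives no direct hold.
decompositions : ℕ → List (List (List ℕ) × List ℕ)
decompositions zero = ([] , []) ∷ []
decompositions (suc n) = concatMap (extend n) (decompositions n)

Path-cong : ∀ {h h′ x₀ x xs} → (∀ y → y ∈ x ∷ xs → h y ≡ h′ y) → Path h x₀ x xs → Path h′ x₀ x xs
Path-cong eq (end p) = end (sym (eq _ (here refl)) ∙ p)
Path-cong eq (step p q) = step (sym (eq _ (here refl)) ∙ p) (Path-cong (λ y y∈ → eq y (there y∈)) q)

IsCycle-cong : ∀ {h h′} xs → (∀ y → y ∈ xs → h y ≡ h′ y) → IsCycle h xs → IsCycle h′ xs
IsCycle-cong (x ∷ xs) eq (p , q) = Path-cong eq p , q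

module InsertAfter {n ρ x} (p : IsPerm n ρ) (x<n : x < n) where

  private
    len : length ρ ≡ n
    len = IsPerm-length p
    σ : List ℕ
    σ = insertAfter n ρ x

  at-x : lookupD σ x ≡ n
  at-x = lookupD-++ˡ (setAt ρ x n) _ x (subst (x <_) (sym (length-setAt ρ x n ∙ len)) x<n)
               ∙ lookupD-setAt ρ x n (subst (x <_) (sym len) x<n)

  at-n : lookupD σ n ≡ lookupD ρ x
  at-n = cong (lookupD σ) (sym (length-setAt ρ x n ∙ len)) ∙ lookupD-mid (setAt ρ x n) _ []

  elsewhere : ∀ y → y < n → x ≢ y → lookupD ρ y ≡ lookupD σ y
  elsewhere y y<n ne = sym (lookupD-++ˡ (setAt ρ x n) _ y (subst (y <_) (sym (length-setAt ρ x n ∙ len)) y<n)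
                                  ∙ lookupD-setAt-≢ ρ x y n ne)

  insert-Path : ∀ {x₀ z} xs → All (_< n) (z ∷ xs) → Unique (z ∷ xs) → Path (lookupD ρ) x₀ z xs →
    ∀ {c′} → (c′ , x) ∈ insertIntoCycle n (z ∷ xs) → ∃[ xs′ ] c′ ≡ z ∷ xs′ × Path (lookupD σ) x₀ z xs′
  insert-Path xs bd u (end eq) (here refl) = n ∷ [] , refl , step at-x (end (at-n ∙ eq))
  insert-Path {z = z} (y ∷ ys) (_ ∷ bd) (z∉ ∷ u) (step eq q) (here refl) =
    n ∷ y ∷ ys , refl , step at-x (step (at-n ∙ eq)
      (Path-cong (λ t t∈ → elsewhere t (All⇒∀∈ bd t∈) (All⇒∀∈ z∉ t∈)) q))
  insert-Path {z = z} (y ∷ ys) (z<n ∷ bd) (z∉ ∷ u) (step eq q) (there r) with ∈ₚ.∈-map⁻ (λ r → (z ∷ proj₁ r , proj₂ r)) r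
  ... | (c″ , .x) , r′ , refl with insert-Path ys bd u q r′
  ... | xs″ , refl , q′ = y ∷ xs″ , refl ,
          step (sym (elsewhere z z<n (λ eq′ → All⇒∀∈ z∉ x∈ (sym eq′))) ∙ eq) q′
    where
    x∈ : x ∈ y ∷ ys
    x∈ = subst (x ∈_) (map-proj₂-insertIntoCycle n (y ∷ ys)) (∈ₚ.∈-map⁺ proj₂ r′)

insertIntoCycle-↭ : ∀ n xs {c′ x} → (c′ , x) ∈ insertIntoCycle n xs → c′ ↭ n ∷ xs
insertIntoCycle-↭ n (z ∷ xs) (here refl) = Perm.swap z n ↭-refl
insertIntoCycle-↭ n (z ∷ xs) (there r) with ∈ₚ.∈-map⁻ (λ r → (z ∷ proj₁ r , proj₂ r)) r
... | (c″ , x) , r′ , refl = ↭-trans (Perm.prep z (insertIntoCycle-↭ n xs r′)) (Perm.swap z n ↭-refl)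

-- The new point n goes behind an existing point and exceeds all of them, so every cycle keeps its
-- head and the head stays minimal. Cycles other than the one of x do not see the change.
insertIntoCycles-valid : ∀ {n ρ x} (p : IsPerm n ρ) (x<n : x < n) cs → All (_< n) (concat cs) → Unique (concat cs) →
  All (IsCycle (lookupD ρ)) cs → ∀ {cs′} → (cs′ , x) ∈ insertIntoCycles n cs →
  concat cs′ ↭ n ∷ concat cs × All (IsCycle (lookupD (insertAfter n ρ x))) cs′ × map headD cs′ ≡ map headD cs
insertIntoCycles-valid {n} {ρ} {x} p x<n ((z ∷ zs) ∷ cs) bd u ((path , min) ∷ cyc) r with ∈ₚ.∈-++⁻ (map (λ r → (proj₁ r ∷ cs , proj₂ r)) (insertIntoCycle n (z ∷ zs))) r
... | inj₁ r₁ with ∈ₚ.∈-map⁻ (λ r → (proj₁ r ∷ cs , proj₂ r)) r₁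
... | (c′ , .x) , r′ , refl with InsertAfter.insert-Path p x<n zs (Allₚ.++⁻ˡ (z ∷ zs) bd) (Uniq-++ˡ (z ∷ zs) u) path r′
  where
  Uniq-++ˡ : ∀ (as : List ℕ) {bs} → Unique (as ++ bs) → Unique as
  Uniq-++ˡ [] u = []
  Uniq-++ˡ (y ∷ as) (q ∷ u) = Allₚ.++⁻ˡ as q ∷ Uniq-++ˡ as u
... | xs′ , refl , path′ =
          Permₚ.++⁺ʳ (concat cs) (insertIntoCycle-↭ n (z ∷ zs) r′) ,
          (path′ , min′) ∷ transfer cs (λ c∈ → c∈) cyc ,
          refl
  where
  min′ : All (z <_) xs′
  min′ = Permₚ.All-resp-↭ (↭-sym (Permₚ.drop-∷ (↭-trans (insertIntoCycle-↭ n (z ∷ zs) r′) (Perm.swap n z ↭-refl)))) (All.head bd ∷ min)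
  x∈ : x ∈ z ∷ zs
  x∈ = subst (x ∈_) (map-proj₂-insertIntoCycle n (z ∷ zs)) (∈ₚ.∈-map⁺ proj₂ r′)
  cross : ∀ (as : List ℕ) {bs s t} → Unique (as ++ bs) → s ∈ as → t ∈ bs → s ≢ t
  cross (y ∷ as) (q ∷ u) (here refl) t∈ = All⇒∀∈ q (∈ₚ.∈-++⁺ʳ as t∈)
  cross (y ∷ as) (q ∷ u) (there s∈) t∈ = cross as u s∈ t∈
  transfer : ∀ ds → (∀ {d} → d ∈ ds → d ∈ cs) → All (IsCycle (lookupD ρ)) ds → All (IsCycle (lookupD (insertAfter n ρ x))) ds
  transfer [] _ [] = []
  transfer (d ∷ ds) inc (q ∷ qs) = IsCycle-cong d (λ y y∈ → InsertAfter.elsewhere p x<n y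
      (All⇒∀∈ (Allₚ.++⁻ʳ (z ∷ zs) bd) (∈ₚ.∈-concat⁺′ y∈ (inc (here refl))))
      (cross (z ∷ zs) u x∈ (∈ₚ.∈-concat⁺′ y∈ (inc (here refl))))) q
    ∷ transfer ds (λ d∈ → inc (there d∈)) qs
insertIntoCycles-valid {n} {ρ} {x} p x<n ((z ∷ zs) ∷ cs) bd u ((path , min) ∷ cyc) r | inj₂ r₂ with ∈ₚ.∈-map⁻ (λ r → ((z ∷ zs) ∷ proj₁ r , proj₂ r)) r₂
... | (cs′ , .x) , r′ , refl with insertIntoCycles-valid p x<n cs (Allₚ.++⁻ʳ (z ∷ zs) bd) (Uniq-++ʳ (z ∷ zs) u) cyc r′
  where
  Uniq-++ʳ : ∀ (as : List ℕ) {bs} → Unique (as ++ bs) → Unique bs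
  Uniq-++ʳ [] u = u
  Uniq-++ʳ (y ∷ as) (q ∷ u) = Uniq-++ʳ as u
... | perm , cyc′ , heads =
        ↭-trans (Permₚ.++⁺ˡ (z ∷ zs) perm) (Permₚ.shift n (z ∷ zs) (concat cs)) ,
        IsCycle-cong (z ∷ zs) (λ y y∈ → InsertAfter.elsewhere p x<n y (All⇒∀∈ (Allₚ.++⁻ˡ (z ∷ zs) bd) y∈)
          (λ eq → cross (z ∷ zs) u y∈ x∈ (sym eq))) (path , min) ∷ cyc′ ,
        cong (z ∷_) heads
  where
  x∈ : x ∈ concat cs
  x∈ = subst (x ∈_) (map-proj₂-insertIntoCycles n cs) (∈ₚ.∈-map⁺ proj₂ r′)
  cross : ∀ (as : List ℕ) {bs s t} → Unique (as ++ bs) → s ∈ as → t ∈ bs → s ≢ t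
  cross (y ∷ as) (q ∷ u) (here refl) t∈ = All⇒∀∈ q (∈ₚ.∈-++⁺ʳ as t∈)
  cross (y ∷ as) (q ∷ u) (there s∈) t∈ = cross as u s∈ t∈

∷ʳ-increasing : ∀ xs n → Increasing xs → All (_< n) xs → Increasing (xs ∷ʳ n)
∷ʳ-increasing [] n _ _ = [] ∷ []
∷ʳ-increasing (x ∷ xs) n (p ∷ inc) (x<n ∷ bd) = Allₚ.∷ʳ⁺ p x<n ∷ ∷ʳ-increasing xs n inc bd

heads-bounded : ∀ {n h} cs → All (IsCycle h) cs → All (_< n) (concat cs) → All (_< n) (map headD cs)
heads-bounded [] _ _ = []
heads-bounded ((x ∷ xs) ∷ cs) (_ ∷ cyc) (x<n ∷ bd) = x<n ∷ heads-bounded cs cyc (Allₚ.++⁻ʳ xs bd)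

decompositions-valid : ∀ n {cs σ} → (cs , σ) ∈ decompositions n → CycleDecomposition n cs σ
decompositions-valid zero (here refl) = record { covers = ↭-refl ; cycles = [] ; sorted = [] ; isPerm = ↭-refl }
decompositions-valid (suc n) d∈ with ∈-concatMap⁻ (extend n) (decompositions n) d∈
... | (cs , ρ) , d∈′ , here refl = record
  { covers = subst (_↭ upTo (suc n)) (Listₚ.concat-++ cs ((n ∷ []) ∷ []))
      (↭-trans (↭-sym (Permₚ.∷↭∷ʳ n (concat cs))) (↭-trans (Perm.prep n (covers D)) (upTo-suc-↭ n)))
  ; cycles = Allₚ.∷ʳ⁺ (All.tabulate (λ {c} c∈ → IsCycle-cong c (λ y y∈ → sym (lookupD-++ˡ ρ _ y (subst (y <_) (sym (IsPerm-length (isPerm D))) (All⇒∀∈ bd (∈ₚ.∈-concat⁺′ y∈ c∈))))) (All⇒∀∈ (cycles D) c∈)))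
      (end (cong (lookupD (ρ ∷ʳ n)) (sym (IsPerm-length (isPerm D))) ∙ lookupD-mid ρ n []) , [])
  ; sorted = subst Increasing (sym (Listₚ.map-++ headD cs _)) (∷ʳ-increasing (map headD cs) n (sorted D) (heads-bounded cs (cycles D) bd))
  ; isPerm = IsPerm-∷ʳ (isPerm D) }
  where
  D = decompositions-valid n d∈′
  bd : All (_< n) (concat cs)
  bd = Permₚ.All-resp-↭ (↭-sym (covers D)) (Allₚ.all-upTo n)
... | (cs , ρ) , d∈′ , there r with ∈ₚ.∈-map⁻ (λ r → (proj₁ r , insertAfter n ρ (proj₂ r))) r
... | (cs′ , x) , r′ , refl = record
  { covers = ↭-trans (proj₁ V′) (↭-trans (Perm.prep n (covers D)) (upTo-suc-↭ n))
  ; cycles = proj₁ (proj₂ V′)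
  ; sorted = subst Increasing (sym (proj₂ (proj₂ V′))) (sorted D)
  ; isPerm = IsPerm-insertAfter x x<n (isPerm D) }
  where
  D = decompositions-valid n d∈′
  bd : All (_< n) (concat cs)
  bd = Permₚ.All-resp-↭ (↭-sym (covers D)) (Allₚ.all-upTo n)
  x<n : x < n
  x<n = All⇒∀∈ bd (subst (x ∈_) (map-proj₂-insertIntoCycles n cs) (∈ₚ.∈-map⁺ proj₂ r′))
  V′ = insertIntoCycles-valid (isPerm D) x<n cs bd (Unique-↭ (↭-sym (covers D)) (Uniqueₚ.upTo⁺ n)) (cycles D) r′

extend-perms : ∀ n cs ρ → map proj₂ (extend n (cs , ρ)) ≡ (ρ ∷ʳ n) ∷ map (insertAfter n ρ) (concat cs)
extend-perms n cs ρ = cong ((ρ ∷ʳ n) ∷_) (sym (Listₚ.map-∘ (insertIntoCycles n cs))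
  ∙ Listₚ.map-∘ (insertIntoCycles n cs)
  ∙ cong (map (insertAfter n ρ)) (map-proj₂-insertIntoCycles n cs))

insertAfter-retract : ∀ {n ρ x} → IsPerm n ρ → x < n → replaceℕ n (lookupD ρ x) (setAt ρ x n) ≡ ρ
insertAfter-retract {n} {ρ} {x} p x<n with setAt-split ρ x n (subst (x <_) (sym (IsPerm-length p)) x<n)
... | as , bs , eq , _ , eq′ = cong (replaceℕ n (lookupD ρ x)) eq′
  ∙ replaceℕ-mid n (lookupD ρ x) as bs (Allₚ.++⁻ˡ as fresh) (All.tail (Allₚ.++⁻ʳ as fresh)) ∙ sym eq
  where
  fresh : All (n ≢_) (as ++ lookupD ρ x ∷ bs)
  fresh = subst (All (n ≢_)) eq (bounded⇒≢ (IsPerm-bounded p))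

-- The old permutation can be read off the new word: delete the last entry if it is n, otherwise
-- write the last entry in the place of n.
extend-separated : ∀ {n ρ ρ′ xs xs′ σ} → IsPerm n ρ → IsPerm n ρ′ → All (_< n) xs → All (_< n) xs′ →
  σ ∈ (ρ ∷ʳ n) ∷ map (insertAfter n ρ) xs → σ ∈ (ρ′ ∷ʳ n) ∷ map (insertAfter n ρ′) xs′ → ρ ≡ ρ′
extend-separated {n} {ρ} {ρ′} p p′ bd bd′ (here refl) (here eq) = Listₚ.∷ʳ-injectiveˡ ρ ρ′ eq
extend-separated {n} {ρ} {ρ′} p p′ bd bd′ (here refl) (there q) with ∈ₚ.∈-map⁻ (insertAfter n ρ′) q
... | x , x∈ , eq = ⊥-elim (ℕₚ.<-irrefl (sym (Listₚ.∷ʳ-injectiveʳ ρ _ eq)) (IsPerm-lookupD< p′ x (All⇒∀∈ bd′ x∈)))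
extend-separated {n} {ρ} {ρ′} p p′ bd bd′ (there r) (here refl) with ∈ₚ.∈-map⁻ (insertAfter n ρ) r
... | x , x∈ , eq = ⊥-elim (ℕₚ.<-irrefl (sym (Listₚ.∷ʳ-injectiveʳ ρ′ _ eq)) (IsPerm-lookupD< p x (All⇒∀∈ bd x∈)))
extend-separated {n} {ρ} {ρ′} p p′ bd bd′ (there r) (there q) with ∈ₚ.∈-map⁻ (insertAfter n ρ) r | ∈ₚ.∈-map⁻ (insertAfter n ρ′) q
... | x , x∈ , refl | x′ , x′∈ , eq = begin
  ρ ≡⟨ sym (insertAfter-retract p (All⇒∀∈ bd x∈)) ⟩
  replaceℕ n (lookupD ρ x) (setAt ρ x n) ≡⟨ cong₂ (replaceℕ n) (Listₚ.∷ʳ-injectiveʳ (setAt ρ x n) _ eq) (Listₚ.∷ʳ-injectiveˡ (setAt ρ x n) _ eq) ⟩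
  replaceℕ n (lookupD ρ′ x′) (setAt ρ′ x′ n) ≡⟨ insertAfter-retract p′ (All⇒∀∈ bd′ x′∈) ⟩
  _ ∎

insertAfter-injective : ∀ {n ρ x y} → IsPerm n ρ → x < n → y < n → insertAfter n ρ x ≡ insertAfter n ρ y → x ≡ y
insertAfter-injective {n} {ρ} {x} {y} p x<n y<n eq with x ℕₚ.≟ y
... | yes x≡y = x≡y
... | no x≢y = ⊥-elim (ℕₚ.<-irrefl (begin
  lookupD ρ x ≡⟨ InsertAfter.elsewhere p y<n x x<n (λ eq′ → x≢y (sym eq′)) ⟩
  lookupD (insertAfter n ρ y) x ≡⟨ cong (λ τ → lookupD τ x) (sym eq) ⟩
  lookupD (insertAfter n ρ x) x ≡⟨ InsertAfter.at-x p x<n ⟩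
  _ ∎) (IsPerm-lookupD< p x x<n))

Unique-map∈ : ∀ {A B : Set} {f : A → B} {xs} → (∀ {x y} → x ∈ xs → y ∈ xs → f x ≡ f y → x ≡ y) → Unique xs → Unique (map f xs)
Unique-map∈ inj [] = []
Unique-map∈ {f = f} {x ∷ xs} inj (p ∷ u) = All.tabulate (λ {z} z∈ eq → let (y , y∈ , eq′) = ∈ₚ.∈-map⁻ f z∈ in
    All⇒∀∈ p y∈ (inj (here refl) (there y∈) (eq ∙ eq′)))
  ∷ Unique-map∈ (λ x∈ y∈ → inj (there x∈) (there y∈)) u

decompositions-bounded : ∀ n {cs σ} → (cs , σ) ∈ decompositions n → All (_< n) (concat cs)
decompositions-bounded n d∈ = Permₚ.All-resp-↭ (↭-sym (covers (decompositions-valid n d∈))) (Allₚ.all-upTo n)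

decompositions-Unique : ∀ n → Unique (map proj₂ (decompositions n))
decompositions-Unique zero = [] ∷ []
decompositions-Unique (suc n) = subst Unique (sym (Listₚ.map-concatMap proj₂ (extend n) (decompositions n)))
  (concatMap-Unique proj₂ (map proj₂ ∘ extend n) (decompositions n) (decompositions-Unique n)
    (λ { (cs , ρ) d∈ → subst Unique (sym (extend-perms n cs ρ)) (unique d∈) })
    (λ { (cs , ρ) (cs′ , ρ′) σ d∈ d∈′ q q′ → extend-separated (isPerm (decompositions-valid n d∈)) (isPerm (decompositions-valid n d∈′))
           (decompositions-bounded n d∈) (decompositions-bounded n d∈′)
           (subst (σ ∈_) (extend-perms n cs ρ) q) (subst (σ ∈_) (extend-perms n cs′ ρ′) q′) }))
  where
  unique : ∀ {cs ρ} → (cs , ρ) ∈ decompositions n → Unique ((ρ ∷ʳ n) ∷ map (insertAfter n ρ) (concat cs))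
  unique {cs} {ρ} d∈ = All.tabulate (λ {z} z∈ eq → let (x , x∈ , eq′) = ∈ₚ.∈-map⁻ (insertAfter n ρ) z∈ in
      ℕₚ.<-irrefl (sym (Listₚ.∷ʳ-injectiveʳ ρ _ (eq ∙ eq′))) (IsPerm-lookupD< (isPerm D) x (All⇒∀∈ bd x∈)))
    ∷ Unique-map∈ (λ x∈ y∈ → insertAfter-injective (isPerm D) (All⇒∀∈ bd x∈) (All⇒∀∈ bd y∈))
        (Unique-↭ (↭-sym (covers D)) (Uniqueₚ.upTo⁺ n))
    where
    D = decompositions-valid n d∈
    bd = decompositions-bounded n d∈

decompositions-complete : ∀ n {σ} → IsPerm n σ → σ ∈ map proj₂ (decompositions n)
decompositions-complete zero p with Permₚ.↭-empty-inv p
... | refl = here refl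
decompositions-complete (suc n) {σ} p with initLast σ
... | [] = ⊥-elim (case Permₚ.↭-length p of λ ())
... | τ ∷ʳ′ y with y ℕₚ.≟ n
... | yes refl with ∈ₚ.∈-map⁻ proj₂ (decompositions-complete n {τ}
          (Permₚ.drop-∷ (↭-trans (Permₚ.∷↭∷ʳ n τ) (↭-trans p (↭-sym (upTo-suc-↭ n))))))
... | (cs , .τ) , d∈ , refl = ∈ₚ.∈-map⁺ proj₂ (∈-concatMap⁺ (extend n) d∈ (here refl))
-- Here n stands inside τ. Writing the last entry y in its place gives the smaller permutation, and
-- n is inserted behind the position x where it stood.
decompositions-complete (suc n) p | τ ∷ʳ′ y | no y≢n
  with ∈ₚ.∈-++⁻ τ (Permₚ.∈-resp-↭ (↭-sym p) (∈ₚ.∈-upTo⁺ (ℕₚ.n<1+n n)))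
... | inj₂ (here eq) = ⊥-elim (y≢n (sym eq))
... | inj₁ n∈τ with ∈ₚ.∈-∃++ n∈τ
... | as , bs , refl with ∈ₚ.∈-map⁻ proj₂ (decompositions-complete n {as ++ y ∷ bs} ρ-perm)
  where
  ρ-perm : IsPerm n (as ++ y ∷ bs)
  ρ-perm = Permₚ.drop-∷ (↭-trans (Perm.prep n (Permₚ.shift y as bs))
    (↭-trans (Perm.swap n y ↭-refl)
    (↭-trans (Perm.prep y (↭-sym (Permₚ.shift n as bs)))
    (↭-trans (Permₚ.∷↭∷ʳ y (as ++ n ∷ bs)) (↭-trans p (↭-sym (upTo-suc-↭ n)))))))
... | (cs , .(as ++ y ∷ bs)) , d∈ , refl =
  subst (_∈ map proj₂ (decompositions (suc n))) (cong₂ _∷ʳ_ (setAt-mid as) (lookupD-mid as y bs))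
    (subst (insertAfter n ρ x ∈_) (sym (Listₚ.map-concatMap proj₂ (extend n) (decompositions n)))
      (∈-concatMap⁺ (map proj₂ ∘ extend n) d∈ (subst (insertAfter n ρ x ∈_) (sym (extend-perms n cs ρ)) (there (∈ₚ.∈-map⁺ (insertAfter n ρ) x∈)))))
  where
  ρ = as ++ y ∷ bs
  x = length as
  x∈ : x ∈ concat cs
  x∈ = Permₚ.∈-resp-↭ (↭-sym (covers (decompositions-valid n d∈))) (∈ₚ.∈-upTo⁺
    (subst (x <_) (sym (Listₚ.length-++ as) ∙ IsPerm-length (isPerm (decompositions-valid n d∈))) (ℕₚ.m<m+n (length as) (s≤s z≤n))))
  setAt-mid : ∀ as → setAt (as ++ y ∷ bs) (length as) n ≡ as ++ n ∷ bs
  setAt-mid [] = refl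
  setAt-mid (z ∷ as) = cong (z ∷_) (setAt-mid as)

perms↭decompositions : ∀ n → perms n ↭ map proj₂ (decompositions n)
perms↭decompositions n = unique-↭ (perms-Unique n) (decompositions-Unique n)
  (λ p → decompositions-complete n (∈-perms⇒IsPerm n p))
  (λ q → let ((cs , σ) , d∈ , eq) = ∈ₚ.∈-map⁻ proj₂ q in subst (_∈ perms n) (sym eq) (IsPerm⇒∈-perms n (isPerm (decompositions-valid n d∈))))

iterP-shift : ∀ σ k x → iterP σ (suc k) x ≡ iterP σ k (lookupD σ x)
iterP-shift σ zero x = refl
iterP-shift σ (suc k) x = cong (lookupD σ) (iterP-shift σ k x)

Path-closed : ∀ {h x₀ x xs} (L : List ℕ) → Path h x₀ x xs → x₀ ∈ L → (∀ {y} → y ∈ x ∷ xs → y ∈ L) → ∀ {y} → y ∈ x ∷ xs → h y ∈ L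
Path-closed L (end eq) x₀∈ sub (here refl) = subst (_∈ L) (sym eq) x₀∈
Path-closed L (step eq p) x₀∈ sub (here refl) = subst (_∈ L) (sym eq) (sub (there (here refl)))
Path-closed L (step eq p) x₀∈ sub (there y∈) = Path-closed L p x₀∈ (λ z∈ → sub (there z∈)) y∈

Path-inside : ∀ {σ x₀ x} xs k → Path (lookupD σ) x₀ x xs → k < length xs → iterP σ (suc k) x ∈ xs
Path-inside {σ} {x = x} (y ∷ ys) zero (step eq p) _ = here eq
Path-inside {σ} {x = x} (y ∷ ys) (suc k) (step refl p) (s≤s k<) =
  there (subst (_∈ ys) (sym (iterP-shift σ (suc k) x)) (Path-inside {σ} ys k p k<))

Path-returns : ∀ {σ x₀ x} xs → Path (lookupD σ) x₀ x xs → iterP σ (suc (length xs)) x ≡ x₀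
Path-returns [] (end eq) = eq
Path-returns {σ} {x = x} (y ∷ ys) (step refl p) = iterP-shift σ (suc (length ys)) x ∙ Path-returns {σ} ys p

Path-reaches : ∀ {σ x₀ x} xs → Path (lookupD σ) x₀ x xs → ∀ {y} → y ∈ x ∷ xs → ∃[ k ] k ≤ length xs × iterP σ (suc k) y ≡ x₀
Path-reaches {σ} xs p (here refl) = length xs , ℕₚ.≤-refl , Path-returns {σ} xs p
Path-reaches {σ} (z ∷ zs) (step eq p) (there y∈) with Path-reaches {σ} zs p y∈
... | k , k≤ , eq′ = k , ℕₚ.≤-trans k≤ (ℕₚ.n≤1+n _) , eq′

allB-true : ∀ {A : Set} (p : A → Bool) xs → (∀ x → x ∈ xs → p x ≡ true) → allB p xs ≡ true
allB-true p [] _ = refl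
allB-true p (x ∷ xs) h = cong (_∧ allB p xs) (h x (here refl)) ∙ allB-true p xs (λ y y∈ → h y (there y∈))

allB-false : ∀ {A : Set} (p : A → Bool) {xs x} → x ∈ xs → p x ≡ false → allB p xs ≡ false
allB-false p {xs = x ∷ xs} (here refl) eq = cong (_∧ allB p xs) eq
allB-false p {xs = y ∷ xs} (there x∈) eq = cong (p y ∧_) (allB-false p x∈ eq) ∙ Boolₚ.∧-zeroʳ (p y)

≤⇒≤ᵇ : ∀ {m n} → m ≤ n → (m ≤ᵇ n) ≡ true
≤⇒≤ᵇ {m} {n} m≤n = ≤ᵇ≡not<ᵇ m n ∙ cong not (≥⇒<ᵇ-false m≤n)

>⇒≤ᵇ-false : ∀ {m n} → n < m → (m ≤ᵇ n) ≡ false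
>⇒≤ᵇ-false {m} {n} n<m = ≤ᵇ≡not<ᵇ m n ∙ cong not (<⇒<ᵇ n<m)

head-isCycMin : ∀ {n σ} x xs → IsCycle (lookupD σ) (x ∷ xs) → isCycMin n σ x ≡ true
head-isCycMin {n} {σ} x xs (p , min) = allB-true _ (upTo n) (λ k _ → ≤⇒≤ᵇ (above (inside k)))
  where
  inside : ∀ k → iterP σ k x ∈ x ∷ xs
  inside zero = here refl
  inside (suc k) = Path-closed (x ∷ xs) p (here refl) id (inside k)
  above : ∀ {y} → y ∈ x ∷ xs → x ≤ y
  above (here refl) = ℕₚ.≤-refl
  above (there y∈) = ℕₚ.<⇒≤ (All⇒∀∈ min y∈)

-- From y the path runs on to the smaller head x. The power that reaches it is below n because the
-- whole cycle has at most n points, so `isCycMin` does inspect it.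
tail-not-isCycMin : ∀ {n σ} x xs → IsCycle (lookupD σ) (x ∷ xs) → length (x ∷ xs) ≤ n → ∀ {y} → y ∈ xs → isCycMin n σ y ≡ false
tail-not-isCycMin {n} {σ} x (z ∷ zs) (step _ p , min) len {y} y∈ with Path-reaches {σ} zs p y∈
... | k , k≤ , eq = allB-false _ (∈ₚ.∈-upTo⁺ (ℕₚ.≤-trans (s≤s (s≤s k≤)) len))
  (>⇒≤ᵇ-false (subst (_< y) (sym eq) (All⇒∀∈ min y∈)))

-- The search loop of cycLen is local to its definition; unification
-- recovers it as the solution for the body of cycGo.
mutual
  cycGo : ℕ → List ℕ → ℕ → ℕ → ℕ → ℕ
  cycGo n σ x f k = _

  cycLen-unfold : ∀ σ x f → cycLen (suc f) σ x ≡ (if iterP σ 1 x ≡ᵇ x then 1 else cycGo (suc f) σ x f 2)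
  cycLen-unfold σ x f with suc f | 2
  ... | n | k = refl

head-cycLen : ∀ {n σ} x xs → IsCycle (lookupD σ) (x ∷ xs) → length (x ∷ xs) ≤ n → cycLen n σ x ≡ length (x ∷ xs)
head-cycLen {n} {σ} x xs (p , min) len = search n 0 z≤n len
  where
  -- The loop stands at exponent `suc k` with fuel f; the last hypothesis says that the return at
  -- exponent `suc (length xs)` comes before the fuel runs out.
  search : ∀ f k → k ≤ length xs → suc (length xs) ≤ k + f → cycGo n σ x f (suc k) ≡ suc (length xs)
  search zero k k≤ fuel = ⊥-elim (ℕₚ.<-irrefl refl (ℕₚ.≤-trans (s≤s k≤) (subst (suc (length xs) ≤_) (ℕₚ.+-identityʳ k) fuel)))
  search (suc f) k k≤ fuel with ℕₚ.m≤n⇒m<n∨m≡n k≤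
  ... | inj₂ refl = cong (if_then suc k else cycGo n σ x f (suc (suc k))) (cong (_≡ᵇ x) (Path-returns {σ} xs p) ∙ ≡ᵇ-refl x)
  ... | inj₁ k< = cong (if_then suc k else cycGo n σ x f (suc (suc k)))
      (≢⇒≡ᵇ-false {iterP σ (suc k) x} (λ eq → ℕₚ.<-irrefl (sym eq) (All⇒∀∈ min (Path-inside {σ} xs k p k<))))
    ∙ search f (suc k) k< (subst (suc (length xs) ≤_) (ℕₚ.+-suc k f) fuel)

-- What `cycleType` ought to emit at index i if cs lists the cycles: an intermediary between its
-- search and `map length cs`.
entry : List (List ℕ) → ℕ → List ℕ
entry [] i = []
entry (c ∷ cs) i = (if headD c ≡ᵇ i then length c ∷ [] else []) ++ entry cs i

entry-none : ∀ cs i → All (i ≢_) (map headD cs) → entry cs i ≡ []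
entry-none [] i _ = refl
entry-none (c ∷ cs) i (ne ∷ p) = cong₂ _++_ (cong (if_then length c ∷ [] else []) (≢⇒≡ᵇ-false (λ eq → ne (sym eq)))) (entry-none cs i p)

concatMap-cong∈ : ∀ {A B : Set} {f g : A → List B} xs → (∀ x → x ∈ xs → f x ≡ g x) → concatMap f xs ≡ concatMap g xs
concatMap-cong∈ [] eq = refl
concatMap-cong∈ (x ∷ xs) eq = cong₂ _++_ (eq x (here refl)) (concatMap-cong∈ xs (λ y y∈ → eq y (there y∈)))

concatMap-entry : ∀ n o cs → Increasing (map headD cs) → All (o ≤_) (map headD cs) → All (_< o + n) (map headD cs) →
  concatMap (entry cs) (applyUpTo (o +_) n) ≡ map length cs
concatMap-entry zero o [] _ _ _ = refl
concatMap-entry zero o (c ∷ cs) _ (o≤ ∷ _) (<o ∷ _) = ⊥-elim (ℕₚ.<-irrefl refl (ℕₚ.≤-trans (s≤s o≤) (subst (headD c <_) (ℕₚ.+-identityʳ o) <o)))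
concatMap-entry (suc n) o cs inc ge lt = cong (_++ concatMap (entry cs) (applyUpTo (λ i → o + suc i) n)) (cong (entry cs) (ℕₚ.+-identityʳ o)) ∙ split cs inc ge lt
  where
  shift : ∀ (f : ℕ → List ℕ) → concatMap f (applyUpTo (λ i → o + suc i) n) ≡ concatMap f (applyUpTo (suc o +_) n)
  shift f = cong (concatMap f) (cong-applyUpTo n (λ i → ℕₚ.+-suc o i))
    where
    cong-applyUpTo : ∀ {g h : ℕ → ℕ} n → (∀ i → g i ≡ h i) → applyUpTo g n ≡ applyUpTo h n
    cong-applyUpTo zero eq = refl
    cong-applyUpTo (suc n) eq = cong₂ _∷_ (eq 0) (cong-applyUpTo n (λ i → eq (suc i)))
  widen : ∀ {xs} → All (_< o + suc n) xs → All (_< suc o + n) xs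
  widen = All.map (λ {x} → subst (x <_) (ℕₚ.+-suc o n))
  split : ∀ cs → Increasing (map headD cs) → All (o ≤_) (map headD cs) → All (_< o + suc n) (map headD cs) →
    entry cs o ++ concatMap (entry cs) (applyUpTo (λ i → o + suc i) n) ≡ map length cs
  split [] inc ge lt = shift (entry []) ∙ concatMap-entry n (suc o) [] inc [] (widen lt)
  split (c ∷ cs) (p ∷ inc) (o≤ ∷ ge) (<o ∷ lt) with headD c ℕₚ.≟ o
  ... | yes refl = cong₂ (λ b r → ((if b then length c ∷ [] else []) ++ r) ++ concatMap (entry (c ∷ cs)) (applyUpTo (λ i → o + suc i) n)) (≡ᵇ-refl (headD c)) (entry-none cs (headD c) (All.map (λ q eq → ℕₚ.<-irrefl eq q) p))
    ∙ cong (length c ∷_) (shift (entry (c ∷ cs)) ∙ concatMap-cong∈ (applyUpTo (suc o +_) n) (λ i i∈ →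
        cong (λ b → (if b then length c ∷ [] else []) ++ entry cs i) (≢⇒≡ᵇ-false (λ eq → later i i∈ eq))))
    ∙ cong (length c ∷_) (concatMap-entry n (suc o) cs inc p (widen lt))
    where
    later : ∀ i → i ∈ applyUpTo (suc o +_) n → headD c ≢ i
    later i i∈ eq with ∈ₚ.∈-applyUpTo⁻ (suc o +_) i∈
    ... | j , _ , refl = ℕₚ.<-irrefl eq (s≤s (ℕₚ.m≤m+n o j))
  ... | no ne = cong (_++ concatMap (entry (c ∷ cs)) (applyUpTo (λ i → o + suc i) n))
      (entry-none (c ∷ cs) o ((λ eq → ne (sym eq)) ∷ All.map (λ q eq → ℕₚ.<-irrefl eq (ℕₚ.≤-trans (s≤s o≤) q)) p))
    ∙ shift (entry (c ∷ cs)) ∙ concatMap-entry n (suc o) (c ∷ cs) (p ∷ inc)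
      (o< ∷ All.map (λ q → ℕₚ.≤-trans o< (ℕₚ.<⇒≤ q)) p) (widen (<o ∷ lt))
    where
    o< : suc o ≤ headD c
    o< = ℕₚ.≤∧≢⇒< o≤ (λ eq → ne (sym eq))

length-concat-∈ : ∀ {A : Set} {c : List A} {cs} → c ∈ cs → length c ≤ length (concat cs)
length-concat-∈ {c = c} {cs = _ ∷ cs} (here refl) = subst (length c ≤_) (sym (Listₚ.length-++ c)) (ℕₚ.m≤m+n _ _)
length-concat-∈ {c = c} {cs = d ∷ cs} (there c∈) = ℕₚ.≤-trans (length-concat-∈ c∈) (subst (length (concat cs) ≤_) (sym (Listₚ.length-++ d)) (ℕₚ.m≤n+m _ _))

cycleType≡lengths : ∀ {n cs σ} → CycleDecomposition n cs σ → cycleType n σ ≡ map length cs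
cycleType≡lengths {n} {cs} {σ} D = trans
  (concatMap-cong∈ (upTo n) (λ i i∈ → find cs (λ c∈ → c∈) (cycles D) (Unique-↭ (↭-sym (covers D)) (Uniqueₚ.upTo⁺ n)) (Permₚ.∈-resp-↭ (↭-sym (covers D)) i∈)))
  (concatMap-entry n 0 cs (sorted D) (All.universal (λ _ → z≤n) _) (heads-bounded cs (cycles D) (Permₚ.All-resp-↭ (↭-sym (covers D)) (Allₚ.all-upTo n))))
  where
  own : ℕ → List ℕ
  own i = if isCycMin n σ i then cycLen n σ i ∷ [] else []
  not-head : ∀ {i} ds → All (IsCycle (lookupD σ)) ds → All (i ≢_) (concat ds) → All (i ≢_) (map headD ds)
  not-head [] _ _ = []
  not-head ((x ∷ xs) ∷ ds) (_ ∷ cyc) (ne ∷ p) = ne ∷ not-head ds cyc (Allₚ.++⁻ʳ xs p)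
  cross : ∀ {i} (as : List ℕ) {bs} → Unique (as ++ bs) → i ∈ as → All (i ≢_) bs
  cross (y ∷ as) (q ∷ u) (here refl) = Allₚ.++⁻ʳ as q
  cross (y ∷ as) (q ∷ u) (there i∈) = cross as u i∈
  drop-Unique : ∀ (as : List ℕ) {bs} → Unique (as ++ bs) → Unique bs
  drop-Unique [] u = u
  drop-Unique (y ∷ as) (q ∷ u) = drop-Unique as u
  apart : ∀ (as : List ℕ) {bs i} → Unique (as ++ bs) → i ∈ bs → All (_≢ i) as
  apart [] u i∈ = []
  apart (y ∷ as) (q ∷ u) i∈ = All⇒∀∈ q (∈ₚ.∈-++⁺ʳ as i∈) ∷ apart as u i∈
  short : ∀ {c} → c ∈ cs → length c ≤ n
  short c∈ = subst (_ ≤_) (Permₚ.↭-length (covers D) ∙ Listₚ.length-upTo n) (length-concat-∈ c∈)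
  find : ∀ ds → (∀ {d} → d ∈ ds → d ∈ cs) → All (IsCycle (lookupD σ)) ds → Unique (concat ds) → ∀ {i} → i ∈ concat ds → own i ≡ entry ds i
  find ((x ∷ xs) ∷ ds) inc (cyc ∷ cycs) u {i} i∈ with ∈ₚ.∈-++⁻ (x ∷ xs) i∈
  ... | inj₁ (here refl) = cong₂ (λ b k → if b then k ∷ [] else []) (head-isCycMin {n} {σ} x xs cyc) (head-cycLen {n} {σ} x xs cyc (short (inc (here refl))))
    ∙ sym (cong₂ (λ b r → (if b then length (x ∷ xs) ∷ [] else []) ++ r) (≡ᵇ-refl x)
        (entry-none ds x (not-head ds cycs (cross (x ∷ xs) u (here refl)))))
  ... | inj₁ (there i∈xs) = trans
    (cong (if_then cycLen n σ i ∷ [] else []) (tail-not-isCycMin {n} {σ} x xs cyc (short (inc (here refl))) i∈xs))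
    (sym (entry-none ((x ∷ xs) ∷ ds) i ((λ eq → ℕₚ.<-irrefl (sym eq) (All⇒∀∈ (proj₂ cyc) i∈xs)) ∷ not-head ds cycs (cross (x ∷ xs) u (there i∈xs)))))
  ... | inj₂ i∈ds = find ds (λ d∈ → inc (there d∈)) cycs (drop-Unique (x ∷ xs) u) i∈ds
    ∙ sym (cong (λ b → (if b then length (x ∷ xs) ∷ [] else []) ++ entry ds i) (≢⇒≡ᵇ-false (All⇒∀∈ (apart (x ∷ xs) u i∈ds) (here refl))))

-- Averages over the symmetric group of functions of the cycle type.

overTypes : ℕ → (List ℕ → ℚ) → ℚ
overTypes n f = sumL (λ d → f (map length (proj₁ d))) (decompositions n)

-- The effect of `extend` on cycle types: a cycle of length k offers k places for the new point, and
-- a new fixed point is appended at the end.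
grow : (List ℕ → ℚ) → List ℕ → ℚ
grow f [] = f (1 ∷ [])
grow f (k ∷ μ) = ℕtoℚ k · f (suc k ∷ μ) ⊹ grow (λ ν → f (k ∷ ν)) μ

sumL-insertIntoCycle : ∀ n (f : ℕ → ℚ) xs → sumL (λ r → f (length (proj₁ r))) (insertIntoCycle n xs) ≡ ℕtoℚ (length xs) · f (suc (length xs))
sumL-insertIntoCycle n f [] = sym (·-zeroˡ _)
sumL-insertIntoCycle n f (x ∷ xs) = cong (f (suc (suc (length xs))) ⊹_) (sumL-map F G (insertIntoCycle n xs) ∙ sumL-insertIntoCycle n (f ∘ suc) xs)
  ∙ ring1 _ _
  ∙ cong (_· f (suc (suc (length xs)))) (sym (ℕtoℚ-suc (length xs)))
  where
  F : List ℕ × ℕ → ℚ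
  F r = f (length (proj₁ r))
  G : List ℕ × ℕ → List ℕ × ℕ
  G r = (x ∷ proj₁ r , proj₂ r)

sumL-extend : ∀ n f cs → f (map length (cs ∷ʳ (n ∷ []))) ⊹ sumL (λ r → f (map length (proj₁ r))) (insertIntoCycles n cs) ≡ grow f (map length cs)
sumL-extend n f [] = ⊹-identityʳ _
sumL-extend n f (c ∷ cs) = cong (f (length c ∷ map length (cs ∷ʳ (n ∷ []))) ⊹_) (sumL-++ F (map _ (insertIntoCycle n c)) _
      ∙ (cong₂ _⊹_ (sumL-map F _ (insertIntoCycle n c) ∙ sumL-insertIntoCycle n (λ k → f (k ∷ map length cs)) c) (sumL-map F _ (insertIntoCycles n cs))))
  ∙ ring35 _ _ _
  ∙ cong (ℕtoℚ (length c) · f (suc (length c) ∷ map length cs) ⊹_) (sumL-extend n (λ ν → f (length c ∷ ν)) cs)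
  where
  F : List (List ℕ) × ℕ → ℚ
  F r = f (map length (proj₁ r))

overTypes-suc : ∀ n f → overTypes (suc n) f ≡ overTypes n (grow f)
overTypes-suc n f = sumL-concatMap _ (extend n) (decompositions n)
  ∙ sumL-cong (decompositions n) (λ { (cs , ρ) → trans (cong (_ ⊹_) (sumL-map _ _ (insertIntoCycles n cs))) (sumL-extend n f cs) })

overTypes-⊹ : ∀ n f g → overTypes n (λ μ → f μ ⊹ g μ) ≡ overTypes n f ⊹ overTypes n g
overTypes-⊹ n f g = sumL-⊹ _ _ (decompositions n)

overTypes-· : ∀ n k f → overTypes n (λ μ → k · f μ) ≡ k · overTypes n f
overTypes-· n k f = sumL-· k _ (decompositions n)

average : ℕ → (List ℕ → ℚ) → ℚ
average n f = invℚ (ℕtoℚ (n !)) · overTypes n f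

!≢0 : ∀ n → ℕtoℚ (n !) ≢ 0ℚ
!≢0 n eq = ℕₚ.<-irrefl (sym (ℕtoℚ-injective {n !} {0} eq)) (ℕₚ.1≤n! n)

average-suc : ∀ n f → ℕtoℚ (suc n) · average (suc n) f ≡ average n (grow f)
average-suc n f = ·-cancelˡ (ℕtoℚ (n !)) (!≢0 n) (ring40 _ _ _ _
  ∙ cong (λ t → (invℚ (ℕtoℚ (suc n !)) · t) · overTypes (suc n) f) (sym (ℕtoℚ-· (suc n) (n !)))
  ∙ cong₂ _·_ (·-inverseˡ _ (!≢0 (suc n)) ∙ sym (·-inverseˡ _ (!≢0 n))) (overTypes-suc n f)
  ∙ ring41 _ _ _)

average-⊹ : ∀ n f g → average n (λ μ → f μ ⊹ g μ) ≡ average n f ⊹ average n g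
average-⊹ n f g = cong (_ ·_) (overTypes-⊹ n f g) ∙ ·-distribˡ-⊹ _ _ _

average-· : ∀ n k f → average n (λ μ → k · f μ) ≡ k · average n f
average-· n k f = cong (_ ·_) (overTypes-· n k f) ∙ ring2 _ _ _

-- In probabilistic terms: the length of the first cycle is uniform, and the rest is a uniform
-- permutation of the remaining points. In the induction the first cycle length `suc k` arises with
-- weight k by lengthening the first cycle and with weight `suc m ∸ k` by growing the rest; the
-- weights add up to `suc m` for every k.
average-grow : ∀ n f → average n (grow f) ≡ Σ< (suc n) (λ k → average (n ∸ k) (λ μ → f (suc k ∷ μ)))
average-grow zero f = sym (⊹-identityʳ _)
average-grow (suc m) f = ·-cancelˡ (ℕtoℚ (suc m)) (ℕtoℚ-suc≢0 m) (average-suc m (grow f)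
  ∙ average-grow m (grow f)
  ∙ Σ<-cong< (suc m) (λ { k (s≤s k≤m) → trans (average-⊹ (m ∸ k) (λ μ → ℕtoℚ (suc k) · f (suc (suc k) ∷ μ)) (grow (λ ν → f (suc k ∷ ν))))
      (cong₂ _⊹_ (average-· (m ∸ k) (ℕtoℚ (suc k)) (λ μ → f (suc (suc k) ∷ μ)))
      (sym (average-suc (m ∸ k) (λ ν → f (suc k ∷ ν))) ∙ cong (λ j → ℕtoℚ j · average j (λ μ → f (suc k ∷ μ))) (sym (ℕₚ.+-∸-assoc 1 k≤m)))) })
  ∙ Σ<-⊹ (suc m) (λ k → ℕtoℚ (suc k) · a′ (suc k)) (λ k → ℕtoℚ (suc m ∸ k) · a′ k)
  -- Both sums are padded to length `suc (suc m)` by a term with coefficient 0, the one at index 0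
  -- and the other at index `suc m`.
  ∙ cong₂ _⊹_ (ring42 _ (a′ 0)) (ring43 _ (a′ (suc m)))
  ∙ cong (λ j → Σ< (suc (suc m)) (λ k → ℕtoℚ k · a′ k) ⊹ (Σ< (suc m) (λ k → ℕtoℚ (suc m ∸ k) · a′ k) ⊹ ℕtoℚ j · a′ (suc m))) (sym (ℕₚ.n∸n≡0 (suc m)))
  ∙ cong (Σ< (suc (suc m)) (λ k → ℕtoℚ k · a′ k) ⊹_) (sym (Σ<-snoc (suc m) (λ k → ℕtoℚ (suc m ∸ k) · a′ k)))
  ∙ sym (Σ<-⊹ (suc (suc m)) (λ k → ℕtoℚ k · a′ k) (λ k → ℕtoℚ (suc m ∸ k) · a′ k))
  ∙ Σ<-cong< (suc (suc m)) (λ { k (s≤s k≤) → trans (ring44 _ _ _) (cong (_· a′ k) (sym (ℕtoℚ-⊹ k (suc m ∸ k)) ∙ cong ℕtoℚ (ℕₚ.m+[n∸m]≡n k≤))) })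
  ∙ Σ<-· (suc (suc m)) _ a′)
  where
  a′ : ℕ → ℚ
  a′ k = average (suc m ∸ k) (λ μ → f (suc k ∷ μ))

average-first-cycle : ∀ n f → ℕtoℚ (suc n) · average (suc n) f ≡ Σ< (suc n) (λ k → average (n ∸ k) (λ μ → f (suc k ∷ μ)))
average-first-cycle n f = average-suc n f ∙ average-grow n f

-- Traces of algebra maps permuting the generators

bit : ∀ {N} → ℕ → Vec Bool N → Bool
bit g [] = false
bit zero (b ∷ β) = b
bit (suc g) (b ∷ β) = bit g β

mask : Bool → ℚ → ℚ
mask true x = x
mask false x = 0ℚ

-- The projections onto the monomials that contain g, for `true`, and that lack it, for `false`.
-- They equal `c g` after `a g` and `a g` after `c g`, see `q-true` and `q-false`.
q : ∀ {N} → Bool → ℕ → V N → V N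
q true g x β = mask (bit g β) (x β)
q false g x β = mask (not (bit g β)) (x β)

mask-⊹ : ∀ b x y → mask b (x ⊹ y) ≡ mask b x ⊹ mask b y
mask-⊹ true x y = refl
mask-⊹ false x y = sym (⊹-identityˡ 0ℚ)

mask-· : ∀ b k x → mask b (k · x) ≡ k · mask b x
mask-· true k x = refl
mask-· false k x = sym (·-zeroʳ k)

mask-swap : ∀ b d x → mask b (mask d x) ≡ mask d (mask b x)
mask-swap true true x = refl
mask-swap true false x = refl
mask-swap false true x = refl
mask-swap false false x = refl

mask-idem : ∀ b x → mask b (mask b x) ≡ mask b x
mask-idem true x = refl
mask-idem false x = refl

mask-split : ∀ b x → x ≡ mask b x ⊹ mask (not b) x
mask-split true x = sym (⊹-identityʳ x)
mask-split false x = sym (⊹-identityˡ x)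

q-Linear : ∀ {N} b g → Linear (q {N} b g)
q-Linear true g = record
  { resp = λ p β → cong (mask (bit g β)) (p β) ; add = λ x y β → mask-⊹ (bit g β) _ _ ; mul = λ k x β → mask-· (bit g β) k _ }
q-Linear false g = record
  { resp = λ p β → cong (mask (not (bit g β))) (p β) ; add = λ x y β → mask-⊹ (not (bit g β)) _ _ ; mul = λ k x β → mask-· (not (bit g β)) k _ }

q-comm : ∀ {N} b d g h (x : V N) → q b g (q d h x) ≈ q d h (q b g x)
q-comm true true g h x β = mask-swap (bit g β) (bit h β) _
q-comm true false g h x β = mask-swap (bit g β) (not (bit h β)) _
q-comm false true g h x β = mask-swap (not (bit g β)) (bit h β) _
q-comm false false g h x β = mask-swap (not (bit g β)) (not (bit h β)) _

q-idem : ∀ {N} b g (x : V N) → q b g (q b g x) ≈ q b g x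
q-idem true g x β = mask-idem (bit g β) _
q-idem false g x β = mask-idem (not (bit g β)) _

q-split : ∀ {N} g (x : V N) → x ≈ q true g x +ᵥ q false g x
q-split g x β = mask-split (bit g β) (x β)

q-true : ∀ {N} g (x : V N) → c g (a g x) ≈ q true g x
q-true {zero} g x [] = refl
q-true {suc N} zero x (false ∷ β) = C-weight-0 _ β
q-true {suc N} zero x (true ∷ β) = cong₂ (λ s t → 1ℚ · (1ℚ · x (true ∷ β) ⊹ s) − t) (A-weight-0 _ β) (C-weight-0 _ β) ∙ ring45 _
q-true {suc N} (suc g) x (false ∷ β) = trans
  (resp (C-Linear (δ g)) (λ γ → trans (cong (_⊹ a g (x ∘ (false ∷_)) γ) (·-zeroˡ _)) (⊹-identityˡ _)) β)
  (q-true g (x ∘ (false ∷_)) β)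
q-true {suc N} (suc g) x (true ∷ β) = cong (λ t → 0ℚ · a (suc g) x (false ∷ β) − t) (neg (C-Linear (δ g)) (a g (x ∘ (true ∷_))) β)
  ∙ ring23 _ _ ∙ q-true g (x ∘ (true ∷_)) β

q-false : ∀ {N g} → g < N → (x : V N) → a g (c g x) ≈ q false g x
q-false {g = g} g<N x β = begin
  a g (c g x) β ≡⟨ ac-same g<N x β ⟩
  x β − c g (a g x) β ≡⟨ cong₂ _−_ (q-split g x β) (q-true g x β) ⟩
  (q true g x β ⊹ q false g x β) − q true g x β ≡⟨ ring46 _ _ ⟩
  _ ∎

q-true-c : ∀ {N g h} → g ≢ h → (x : V N) → q true g (c h x) ≈ c h (q true g x)
q-true-c {g = g} {h} g≢h x β = begin
  q true g (c h x) β ≡⟨ sym (q-true g (c h x) β) ⟩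
  c g (a g (c h x)) β ≡⟨ resp (C-Linear (δ g)) (ac-diff g≢h x) β ⟩
  c g (λ γ → − c h (a g x) γ) β ≡⟨ neg (C-Linear (δ g)) (c h (a g x)) β ⟩
  − c g (c h (a g x)) β ≡⟨ cong −_ (CC-anti (δ g) (δ h) (a g x) β) ⟩
  − − c h (c g (a g x)) β ≡⟨ ring47 _ ⟩
  c h (c g (a g x)) β ≡⟨ resp (C-Linear (δ h)) (q-true g x) β ⟩
  _ ∎

q-false-by-true : ∀ {N} g (x : V N) → q false g x ≈ x -ᵥ q true g x
q-false-by-true g x β = ring48 _ _ ∙ cong (_− q true g x β) (sym (q-split g x β))

q-c : ∀ {N g h} b → g ≢ h → (x : V N) → q b g (c h x) ≈ c h (q b g x)
q-c true g≢h x = q-true-c g≢h x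
q-c {g = g} {h} false g≢h x β = begin
  q false g (c h x) β ≡⟨ q-false-by-true g (c h x) β ⟩
  c h x β − q true g (c h x) β ≡⟨ cong (λ t → c h x β − t) (q-true-c g≢h x β) ⟩
  c h x β − c h (q true g x) β ≡⟨ sym (sub (C-Linear (δ h)) x (q true g x) β) ⟩
  c h (x -ᵥ q true g x) β ≡⟨ sym (resp (C-Linear (δ h)) (q-false-by-true g x) β) ⟩
  _ ∎

q-true-a : ∀ {N g h} → g ≢ h → (x : V N) → q true g (a h x) ≈ a h (q true g x)
q-true-a {g = g} {h} g≢h x β = begin
  q true g (a h x) β ≡⟨ sym (q-true g (a h x) β) ⟩
  c g (a g (a h x)) β ≡⟨ resp (C-Linear (δ g)) (AA-anti (δ g) (δ h) x) β ⟩
  c g (λ γ → − a h (a g x) γ) β ≡⟨ neg (C-Linear (δ g)) (a h (a g x)) β ⟩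
  − c g (a h (a g x)) β ≡⟨ sym (ac-diff (λ eq → g≢h (sym eq)) (a g x) β) ⟩
  a h (c g (a g x)) β ≡⟨ resp (A-Linear (δ h)) (q-true g x) β ⟩
  _ ∎

qq : ∀ {N} → Bool → List ℕ → V N → V N
qq b [] x = x
qq b (g ∷ gs) x = q b g (qq b gs x)

qq-Linear : ∀ {N} b gs → Linear (qq {N} b gs)
qq-Linear b [] = Linear-id
qq-Linear b (g ∷ gs) = Linear-∘ (q-Linear b g) (qq-Linear b gs)

qq-++ : ∀ {N} b gs hs (x : V N) → qq b (gs ++ hs) x ≈ qq b gs (qq b hs x)
qq-++ b [] hs x β = refl
qq-++ b (g ∷ gs) hs x = resp (q-Linear b g) (qq-++ b gs hs x)

q-qq-comm : ∀ {N} b d g gs (x : V N) → q b g (qq d gs x) ≈ qq d gs (q b g x)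
q-qq-comm b d g [] x β = refl
q-qq-comm b d g (h ∷ gs) x = ≈-trans (q-comm b d g h (qq d gs x)) (resp (q-Linear d h) (q-qq-comm b d g gs x))

qq-c : ∀ {N} b gs g → All (_≢ g) gs → (x : V N) → qq b gs (c g x) ≈ c g (qq b gs x)
qq-c b [] g _ x β = refl
qq-c b (h ∷ gs) g (ne ∷ p) x = ≈-trans (resp (q-Linear b h) (qq-c b gs g p x)) (q-c b ne (qq b gs x))

qq-true-a : ∀ {N} gs g → All (_≢ g) gs → (x : V N) → qq true gs (a g x) ≈ a g (qq true gs x)
qq-true-a [] g _ x β = refl
qq-true-a (h ∷ gs) g (ne ∷ p) x = ≈-trans (resp (q-Linear true h) (qq-true-a gs g p x)) (q-true-a ne (qq true gs x))

-- The adjoint of `cw w`: the letter that `cw` multiplies last is contracted first, so the two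
-- unwind in nested pairs.
ar : ∀ {N} → List ℕ → V N → V N
ar [] x = x
ar (g ∷ w) x = ar w (a g x)

ar-Linear : ∀ {N} w → Linear (ar {N} w)
ar-Linear [] = Linear-id
ar-Linear (g ∷ w) = Linear-∘ (ar-Linear w) (A-Linear (δ g))

≢-flip : ∀ {A : Set} {g : A} {xs} → All (g ≢_) xs → All (_≢ g) xs
≢-flip = All.map (λ ne eq → ne (sym eq))

cw-ar : ∀ {N} w → Unique w → (x : V N) → cw w (ar w x) ≈ qq true w x
cw-ar [] _ x β = refl
cw-ar (g ∷ w) (g∉ ∷ u) x = ≈-trans (resp (C-Linear (δ g)) (≈-trans (cw-ar w u (a g x)) (qq-true-a w g (≢-flip g∉) x))) (q-true g (qq true w x))

q-cw : ∀ {N} b g w → All (g ≢_) w → (x : V N) → q b g (cw w x) ≈ cw w (q b g x)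
q-cw b g [] _ x β = refl
q-cw b g (h ∷ w) (ne ∷ p) x = ≈-trans (q-c b ne (cw w x)) (resp (C-Linear (δ h)) (q-cw b g w p x))

ar-cw : ∀ {N} w → Unique w → All (_< N) w → (x : V N) → ar w (cw w x) ≈ qq false w x
ar-cw [] _ _ x β = refl
ar-cw (g ∷ w) (g∉ ∷ u) (g<N ∷ bd) x = ≈-trans (resp (ar-Linear w) (≈-trans (q-false g<N (cw w x)) (q-cw false g w g∉ x)))
  (≈-trans (ar-cw w u bd (q false g x)) (≈-sym (q-qq-comm false false g w x)))

prodL : (ℕ → ℚ) → List ℕ → ℚ
prodL w [] = 1ℚ
prodL w (g ∷ gs) = w g · prodL w gs

hat-cw : ∀ N h w v → All (_< N) v → (x : V N) → hat {N} N h w (cw v x) ≈ prodL w v ·ᵥ cw (map h v) (hat N h w x)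
hat-cw N h w [] _ x β = sym (·-identityˡ _)
hat-cw N h w (g ∷ v) (g<N ∷ p) x β = begin
  hat N h w (c g (cw v x)) β ≡⟨ hat-c N h w g g<N (cw v x) β ⟩
  w g · c (h g) (hat N h w (cw v x)) β ≡⟨ cong (w g ·_) (resp (C-Linear (δ (h g))) (hat-cw N h w v p x) β ∙ mul (C-Linear (δ (h g))) (prodL w v) _ β) ⟩
  w g · (prodL w v · c (h g) (cw (map h v) (hat N h w x)) β) ≡⟨ sym (·-assoc _ _ _) ⟩
  _ ∎

map-Path : ∀ {h x₀ x} xs → Path h x₀ x xs → map h (x ∷ xs) ≡ xs ++ x₀ ∷ []
map-Path [] (end eq) = cong (_∷ []) eq
map-Path (y ∷ ys) (step eq p) = cong₂ _∷_ eq (map-Path ys p)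

cw-rotate : ∀ {N} g v (x : V N) → cw (v ++ g ∷ []) x ≈ sgn (length v) ·ᵥ cw (g ∷ v) x
cw-rotate g v x β = begin
  cw (v ++ g ∷ []) x β ≡⟨ cw-++ v (g ∷ []) x β ⟩
  cw v (c g x) β ≡⟨ sym (·-identityˡ _) ⟩
  1ℚ · cw v (c g x) β ≡⟨ cong (_· cw v (c g x) β) (sym (sgn-square (length v))) ⟩
  (sgn (length v) · sgn (length v)) · cw v (c g x) β ≡⟨ ·-assoc _ _ _ ⟩
  sgn (length v) · (sgn (length v) · cw v (c g x) β) ≡⟨ cong (sgn (length v) ·_) (sym (c-cw-comm g v x β)) ⟩
  _ ∎

module PermutationTrace {N : ℕ} (h : ℕ → ℕ) (w : ℕ → ℚ) (inj : InjectiveBelow N h) (bd : ∀ i → i < N → h i < N) where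

  private
    X : V N → V N
    X = hat N h w
    lX : Linear X
    lX = hat-Linear N h w

  X-q-true : ∀ g → g < N → (x : V N) → X (q true g x) ≈ q true (h g) (X x)
  X-q-true g g<N x β = begin
    X (q true g x) β ≡⟨ resp lX (≈-sym (q-true g x)) β ⟩
    X (c g (a g x)) β ≡⟨ hat-c N h w g g<N (a g x) β ⟩
    w g · c (h g) (X (a g x)) β ≡⟨ sym (mul (C-Linear (δ (h g))) (w g) _ β) ⟩
    c (h g) (w g ·ᵥ X (a g x)) β ≡⟨ resp (C-Linear (δ (h g))) (hat-a N h w g g<N inj bd x) β ⟩
    c (h g) (a (h g) (X x)) β ≡⟨ q-true (h g) (X x) β ⟩
    _ ∎

  X-q : ∀ b g → g < N → (x : V N) → X (q b g x) ≈ q b (h g) (X x)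
  X-q true g g<N x = X-q-true g g<N x
  X-q false g g<N x β = begin
    X (q false g x) β ≡⟨ resp lX (q-false-by-true g x) β ⟩
    X (x -ᵥ q true g x) β ≡⟨ sub lX x (q true g x) β ⟩
    X x β − X (q true g x) β ≡⟨ cong (λ t → X x β − t) (X-q-true g g<N x β) ⟩
    X x β − q true (h g) (X x) β ≡⟨ sym (q-false-by-true (h g) (X x) β) ⟩
    _ ∎

  -- On the diagonal of X the generators of a cycle are all present or all absent.
  spread : ∀ b {x₀ x} xs → Path h x₀ x xs → All (_< N) (x ∷ xs) → {Z : V N → V N} → Linear Z →
    (∀ g → g ∈ xs → ∀ y → q b g (Z y) ≈ Z (q b g y)) → tr (λ y → X (q b x (Z y))) ≡ tr (λ y → X (qq b (x ∷ xs) (Z y)))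
  spread b [] p _ lZ comm = refl
  spread b {x = x} (y ∷ ys) (step refl p) (x<N ∷ bds) {Z} lZ comm = tr-cong (λ t → ≈-trans (resp lX (≈-sym (q-idem b x (Z t)))) (X-q b x x<N (q b x (Z t))))
    ∙ tr-cyclic (q-Linear b y) (Linear-∘ lX (Linear-∘ (q-Linear b x) lZ))
    ∙ tr-cong (λ t → resp lX (≈-trans (resp (q-Linear b x) (≈-sym (comm y (here refl) t))) (q-comm b b x y (Z t))))
    ∙ spread b ys p bds {λ t → q b x (Z t)} (Linear-∘ (q-Linear b x) lZ)
        (λ g g∈ t → ≈-trans (q-comm b b g x (Z t)) (resp (q-Linear b x) (comm g (there g∈) t)))
    ∙ tr-cong (λ t → resp lX (≈-sym (q-qq-comm b b x (y ∷ ys) (Z t))))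

  -- The summand 1 belongs to the monomials without any generator of the cycle. The other summand
  -- belongs to those with all of them, and its sign is that of rotating a word of this length by
  -- one place.
  factor : List ℕ → ℚ
  factor [] = 1ℚ
  factor (x ∷ xs) = 1ℚ ⊹ sgn (length xs) · prodL w (x ∷ xs)

  -- Split by the presence of x; by `spread` the whole cycle is then present or absent. If it is
  -- present, insert `cw L ∘ ar L`: X turns `cw L` into a rotated word, that is a scalar times
  -- `cw L`, and cycling this factor around the trace produces `ar L ∘ cw L`, the projection to
  -- absence. D collects the generators already forced to be absent.
  tr-cycle : ∀ x xs → Path h x x xs → All (_< N) (x ∷ xs) → Unique (x ∷ xs) → ∀ D → (∀ g → g ∈ x ∷ xs → All (_≢ g) D) →
    tr (λ y → X (qq false D y)) ≡ factor (x ∷ xs) · tr (λ y → X (qq false ((x ∷ xs) ++ D) y))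
  tr-cycle x xs p bds u D dis = tr-cong (λ y → ≈-trans (resp lX (q-split x (Z y))) (add lX _ _))
    ∙ tr-+ (λ y → X (q true x (Z y))) (λ y → X (q false x (Z y)))
    ∙ cong₂ _⊹_ (spread true xs p bds lZ (λ g _ y → q-qq-comm true false g D y)) (spread false xs p bds lZ (λ g _ y → q-qq-comm false false g D y))
    ∙ cong (_⊹ T) occupied
    ∙ ring49 _ _
    ∙ cong ((1ℚ ⊹ s · prodL w L) ·_) (tr-cong (λ y → resp lX (≈-sym (qq-++ false L D y))))
    where
    L = x ∷ xs
    s = sgn (length xs)
    Z : V N → V N
    Z = qq false D
    lZ : Linear Z
    lZ = qq-Linear false D
    T : ℚ
    T = tr (λ y → X (qq false L (Z y)))
    Z-cw : ∀ v → All (λ g → All (_≢ g) D) v → ∀ y → Z (cw v y) ≈ cw v (Z y)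
    Z-cw [] _ y β = refl
    Z-cw (g ∷ v) (d ∷ p) y = ≈-trans (qq-c false D g d (cw v y)) (resp (C-Linear (δ g)) (Z-cw v p y))
    occupied : tr (λ y → X (qq true L (Z y))) ≡ (s · prodL w L) · T
    occupied = tr-cong (λ y → ≈-trans (resp lX (≈-sym (cw-ar L u (Z y)))) (≈-trans (hat-cw N h w L bds (ar L (Z y)))
          (λ β → trans (cong (prodL w L ·_) (cong (λ v → cw v (X (ar L (Z y))) β) (map-Path xs p) ∙ cw-rotate x xs _ β)) (ring39 _ _ _))))
      ∙ tr-· (s · prodL w L) (λ y → cw L (X (ar L (Z y))))
      ∙ cong ((s · prodL w L) ·_) (tr-cyclic (cw-Linear L) (Linear-∘ lX (Linear-∘ (ar-Linear L) lZ))
          ∙ tr-cong (λ y → resp lX (≈-trans (resp (ar-Linear L) (Z-cw L (All.tabulate (λ {g} g∈ → dis g g∈)) y)) (ar-cw L u bds (Z y)))))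

  zeros : ∀ {M} → Vec Bool M
  zeros {zero} = []
  zeros {suc M} = false ∷ zeros

  vac-zeros : ∀ {M} → vac (zeros {M}) ≡ 1ℚ
  vac-zeros {zero} = refl
  vac-zeros {suc M} = vac-zeros {M}

  bit-zeros : ∀ {M} g → bit g (zeros {M}) ≡ false
  bit-zeros {zero} g = refl
  bit-zeros {suc M} zero = refl
  bit-zeros {suc M} (suc g) = bit-zeros {M} g

  zeros? : ∀ {M} (β : Vec Bool M) → (β ≡ zeros) ⊎ (vac β ≡ 0ℚ × ∃[ g ] g < M × bit g β ≡ true)
  zeros? [] = inj₁ refl
  zeros? (true ∷ β) = inj₂ (refl , 0 , s≤s z≤n , refl)
  zeros? (false ∷ β) with zeros? β
  ... | inj₁ eq = inj₁ (cong (false ∷_) eq)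
  ... | inj₂ (v , g , g< , eq) = inj₂ (v , suc g , s≤s g< , eq)

  qq-zeros : ∀ D (y : V N) → qq false D y zeros ≡ y zeros
  qq-zeros [] y = refl
  qq-zeros (g ∷ D) y = cong (λ b → mask (not b) (qq false D y zeros)) (bit-zeros {N} g) ∙ qq-zeros D y

  qq-kills : ∀ D g → g ∈ D → (y : V N) → ∀ β → bit g β ≡ true → qq false D y β ≡ 0ℚ
  qq-kills (g ∷ D) g (here refl) y β eq = cong (λ b → mask (not b) (qq false D y β)) eq
  qq-kills (h ∷ D) g (there g∈) y β eq = cong (mask (not (bit h β))) (qq-kills D g g∈ y β eq) ∙ mask-0 (not (bit h β))
    where
    mask-0 : ∀ b → mask b 0ℚ ≡ 0ℚ
    mask-0 true = refl
    mask-0 false = refl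

  -- Forcing all generators to be absent leaves the line of the vacuum, which X fixes.
  tr-vacuum : ∀ D → (∀ g → g < N → g ∈ D) → tr (λ y → X (qq false D y)) ≡ 1ℚ
  tr-vacuum D all = tr-cong (λ y → ≈-trans (resp lX (vacuum y)) (≈-trans (mul lX (y zeros) vac) (λ β → cong (y zeros ·_) (hat-vac N h w β))))
    ∙ sumV-cong {N} (λ β → ·-comm (e β zeros) (vac β))
    ∙ sym (expand {N} (coordinate Linear-id zeros) vac)
    ∙ vac-zeros {N}
    where
    vacuum : ∀ y → qq false D y ≈ y zeros ·ᵥ vac
    vacuum y β with zeros? β
    ... | inj₁ refl = qq-zeros D y ∙ sym (cong (y zeros ·_) (vac-zeros {N}) ∙ ·-identityʳ _)
    ... | inj₂ (v , g , g<N , eq) = qq-kills D g (all g g<N) y β eq ∙ sym (cong (y zeros ·_) v ∙ ·-zeroʳ _)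

  data Cycles : List (List ℕ) → Set where
    [] : Cycles []
    _∷_ : ∀ {x xs cs} → Path h x x xs → Cycles cs → Cycles ((x ∷ xs) ∷ cs)

  prodFactors : List (List ℕ) → ℚ
  prodFactors [] = 1ℚ
  prodFactors (c ∷ cs) = factor c · prodFactors cs

  tr-cycles : ∀ cs D → Cycles cs → All (_< N) (concat cs) → Unique (concat cs) → (∀ g → g ∈ concat cs → All (_≢ g) D) →
    (∀ g → g < N → (g ∈ concat cs) ⊎ (g ∈ D)) → tr (λ y → X (qq false D y)) ≡ prodFactors cs
  tr-cycles [] D [] _ _ _ cov = tr-vacuum D (λ g g<N → case cov g g<N of λ { (inj₂ g∈) → g∈ })
  tr-cycles ((x ∷ xs) ∷ cs) D (p ∷ ps) bds u dis cov = trans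
    (tr-cycle x xs p (Allₚ.++⁻ˡ L bds) (uniqueˡ L u) D (λ g g∈ → dis g (∈ₚ.∈-++⁺ˡ g∈)))
    (cong (factor L ·_) (tr-cycles cs (L ++ D) ps (Allₚ.++⁻ʳ L bds) (uniqueʳ L u)
      (λ g g∈ → Allₚ.++⁺ (cross L u g∈) (dis g (∈ₚ.∈-++⁺ʳ L g∈))) cov′))
    where
    L = x ∷ xs
    uniqueˡ : ∀ (as : List ℕ) {bs} → Unique (as ++ bs) → Unique as
    uniqueˡ [] u = []
    uniqueˡ (y ∷ as) (r ∷ u) = Allₚ.++⁻ˡ as r ∷ uniqueˡ as u
    uniqueʳ : ∀ (as : List ℕ) {bs} → Unique (as ++ bs) → Unique bs
    uniqueʳ [] u = u
    uniqueʳ (y ∷ as) (r ∷ u) = uniqueʳ as u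
    cross : ∀ (as : List ℕ) {bs g} → Unique (as ++ bs) → g ∈ bs → All (_≢ g) as
    cross [] u g∈ = []
    cross (y ∷ as) (r ∷ u) g∈ = All⇒∀∈ r (∈ₚ.∈-++⁺ʳ as g∈) ∷ cross as u g∈
    cov′ : ∀ g → g < N → (g ∈ concat cs) ⊎ (g ∈ L ++ D)
    cov′ g g<N with cov g g<N
    ... | inj₂ g∈D = inj₂ (∈ₚ.∈-++⁺ʳ L g∈D)
    ... | inj₁ g∈ with ∈ₚ.∈-++⁻ L g∈
    ... | inj₁ g∈L = inj₂ (∈ₚ.∈-++⁺ˡ g∈L)
    ... | inj₂ g∈cs = inj₁ g∈cs

  tr-permutation : ∀ cs → Cycles cs → concat cs ↭ upTo N → tr X ≡ prodFactors cs
  tr-permutation cs ps cov = tr-cycles cs [] ps (Permₚ.All-resp-↭ (↭-sym cov) (Allₚ.all-upTo N))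
    (Unique-↭ (↭-sym cov) (Uniqueₚ.upTo⁺ N)) (λ _ _ → []) (λ g g<N → inj₁ (Permₚ.∈-resp-↭ (↭-sym cov) (∈ₚ.∈-upTo⁺ g<N)))

-- Inverting d + U D along a ladder with [D , U] = h

module Ladder {N : ℕ} (U D : V N → V N) (lU : Linear U) (lD : Linear D) (P : ℕ → V N → Set)
  (P-resp : ∀ {h x y} → x ≈ y → P h x → P h y)
  (P-sub : ∀ {h x y} → P h x → P h y → P h (x -ᵥ y))
  (P-mul : ∀ {h x} k → P h x → P h (k ·ᵥ x))
  (P-D : ∀ {h x} → P h x → P (2 + h) (D x))
  (P-U : ∀ {h x} → P (2 + h) x → P h (U x))
  (rel : ∀ {h x} → P h x → D (U x) ≈ U (D x) +ᵥ ℕtoℚ h ·ᵥ x) where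

  -- From `rel`, D (d + U D) = (d + (2 + h) + U D) D on vectors of weight h. Hence, if S inverts the
  -- operator in parentheses on the right, 1/d (1 - U S D) inverts d + U D. The recursion climbs the
  -- ladder until D has become nilpotent.
  inv : ℕ → ℕ → ℕ → V N → V N
  inv zero h d x = invℚ (ℕtoℚ d) ·ᵥ x
  inv (suc f) h d x = invℚ (ℕtoℚ d) ·ᵥ (x -ᵥ U (inv f (2 + h) (d + (2 + h)) (D x)))

  inv-Linear : ∀ f h d → Linear (inv f h d)
  inv-Linear zero h d = Linear-· _ Linear-id
  inv-Linear (suc f) h d = Linear-· _ (Linear-− Linear-id (Linear-∘ lU (Linear-∘ (inv-Linear f (2 + h) (d + (2 + h))) lD)))

  inv-P : ∀ f h d {x} → P h x → P h (inv f h d x)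
  inv-P zero h d p = P-mul _ p
  inv-P (suc f) h d p = P-mul _ (P-sub p (P-U (inv-P f (2 + h) (d + (2 + h)) (P-D p))))

  inv-comm : ∀ f h d {Y : V N → V N} → Linear Y → (∀ x → Y (U x) ≈ U (Y x)) → (∀ x → Y (D x) ≈ D (Y x)) →
    ∀ x → Y (inv f h d x) ≈ inv f h d (Y x)
  inv-comm zero h d lY YU YD x = mul lY _ x
  inv-comm (suc f) h d {Y} lY YU YD x β = trans (mul lY i _ β) (cong (i ·_) (sub lY x _ β))
    ∙ cong (λ t → i · (Y x β − t)) (YU _ β ∙ resp lU (≈-trans (inv-comm f (2 + h) (d + (2 + h)) lY YU YD (D x))
        (resp (inv-Linear f (2 + h) (d + (2 + h))) (YD x))) β)
    where i = invℚ (ℕtoℚ d)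

  Nil : ℕ → V N → Set
  Nil zero x = D x ≈ 0ᵥ
  Nil (suc f) x = Nil f (D x)

  cancel : ∀ d → d ≢ 0 → ∀ x → invℚ (ℕtoℚ d) · (ℕtoℚ d · x) ≡ x
  cancel d d≢0 x = sym (·-assoc _ _ _) ∙ cong (_· x) (·-inverseˡ _ (λ eq → d≢0 (ℕtoℚ-injective {d} {0} eq))) ∙ ·-identityˡ x

  cancel′ : ∀ d → d ≢ 0 → ∀ x → ℕtoℚ d · (invℚ (ℕtoℚ d) · x) ≡ x
  cancel′ d d≢0 x = ring2 _ _ x ∙ cancel d d≢0 x

  private
    positive : ∀ d h → d + (2 + h) ≢ 0
    positive d h eq with trans (sym (ℕₚ.+-suc d (suc h))) eq
    ... | ()

  inv-left : ∀ f h d {x} → d ≢ 0 → P h x → Nil f x → inv f h d (ℕtoℚ d ·ᵥ x +ᵥ U (D x)) ≈ x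
  inv-left zero h d {x} d≢0 p nil β = trans
    (cong (λ t → invℚ (ℕtoℚ d) · (ℕtoℚ d · x β ⊹ t)) (vanish lU nil β))
    (cong (invℚ (ℕtoℚ d) ·_) (⊹-identityʳ _) ∙ cancel d d≢0 (x β))
  inv-left (suc f) h d {x} d≢0 p nil β = cong (λ t → i · (z β − t)) (resp lU (≈-trans (resp (inv-Linear f h′ d′) Dz) (inv-left f h′ d′ (positive d h) (P-D p) nil)) β)
    ∙ cong (i ·_) (ring50 _ _)
    ∙ cancel d d≢0 (x β)
    where
    i = invℚ (ℕtoℚ d)
    h′ = 2 + h
    d′ = d + (2 + h)
    z = ℕtoℚ d ·ᵥ x +ᵥ U (D x)
    Dz : D z ≈ ℕtoℚ d′ ·ᵥ D x +ᵥ U (D (D x))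
    Dz γ = begin
      D z γ ≡⟨ trans (add lD _ _ γ) (cong₂ _⊹_ (mul lD (ℕtoℚ d) x γ) (rel (P-D p) γ)) ⟩
      ℕtoℚ d · D x γ ⊹ (U (D (D x)) γ ⊹ ℕtoℚ h′ · D x γ) ≡⟨ ring51 _ _ _ _ ⟩
      (ℕtoℚ d ⊹ ℕtoℚ h′) · D x γ ⊹ U (D (D x)) γ ≡⟨ cong (λ t → t · D x γ ⊹ U (D (D x)) γ) (sym (ℕtoℚ-⊹ d h′)) ⟩
      _ ∎

  inv-right : ∀ f h d {x} → d ≢ 0 → P h x → Nil f x → ℕtoℚ d ·ᵥ inv f h d x +ᵥ U (D (inv f h d x)) ≈ x
  inv-right zero h d {x} d≢0 p nil β = (cong₂ _⊹_ (cancel′ d d≢0 (x β))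
      (vanish lU (λ γ → trans (mul lD _ x γ) (cong (invℚ (ℕtoℚ d) ·_) (nil γ) ∙ ·-zeroʳ _)) β)) ∙ ⊹-identityʳ _
  inv-right (suc f) h d {x} d≢0 p nil β = cong₂ _⊹_ (cancel′ d d≢0 _) (resp lU (mul lD i (x -ᵥ U y)) β ∙ mul lU i (D (x -ᵥ U y)) β)
    ∙ cong (λ t → (x β − U y β) ⊹ i · t) (resp lU Dxy β ∙ mul lU (ℕtoℚ d) y β)
    ∙ cong ((x β − U y β) ⊹_) (cancel d d≢0 (U y β))
    ∙ ring53 _ _
    where
    i = invℚ (ℕtoℚ d)
    h′ = 2 + h
    d′ = d + (2 + h)
    y = inv f h′ d′ (D x)
    IH : ℕtoℚ d′ ·ᵥ y +ᵥ U (D y) ≈ D x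
    IH = inv-right f h′ d′ (positive d h) (P-D p) nil
    Dxy : D (x -ᵥ U y) ≈ ℕtoℚ d ·ᵥ y
    Dxy γ = begin
      D (x -ᵥ U y) γ ≡⟨ sub lD x (U y) γ ⟩
      D x γ − D (U y) γ ≡⟨ cong₂ _−_ (sym (IH γ)) (rel (inv-P f h′ d′ (P-D p)) γ) ⟩
      (ℕtoℚ d′ · y γ ⊹ U (D y) γ) − (U (D y) γ ⊹ ℕtoℚ h′ · y γ) ≡⟨ cong (λ t → (t · y γ ⊹ U (D y) γ) − (U (D y) γ ⊹ ℕtoℚ h′ · y γ)) (ℕtoℚ-⊹ d h′) ⟩
      ((ℕtoℚ d ⊹ ℕtoℚ h′) · y γ ⊹ U (D y) γ) − (U (D y) γ ⊹ ℕtoℚ h′ · y γ) ≡⟨ ring52 _ _ _ _ ⟩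
      _ ∎

-- Multiplication of an array of coefficients by u, respectively by v.
shift₁ shift₂ : (ℕ → ℕ → ℚ) → ℕ → ℕ → ℚ
shift₁ F zero b = 0ℚ
shift₁ F (suc a) b = F a b
shift₂ F a zero = 0ℚ
shift₂ F a (suc b) = F a b

hat-diag : ∀ {M} N h w κ κ′ p → (∀ i → i < N → κ′ (h i) ≡ κ i) → (x : V N) → hat {M} N h w (diag κ p x) ≈ diag κ′ p (hat N h w x)
hat-diag zero h w κ κ′ p eq x β = ·-assoc _ _ _ ∙ ring2 _ _ _ ∙ sym (mul (diag-Linear κ′ p) (x []) vac β ∙ cong (x [] ·_) (diag-vac κ′ p β))
hat-diag {M} (suc N) h w κ κ′ p eq x β = cong₂ (λ u v → u ⊹ w 0 · v) (IH p x₀ β) (resp (C-Linear (δ (h 0))) (IH (bump (κ 0) p) x₁) β)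
  ∙ cong (λ u → diag κ′ p (hat N h′ w′ x₀) β ⊹ w 0 · u) (sym (diag-C (κ 0) κ′ p (δ (h 0)) kind (hat N h′ w′ x₁) β))
  ∙ sym (add (diag-Linear κ′ p) _ _ β ∙ cong (diag κ′ p (hat N h′ w′ x₀) β ⊹_) (mul (diag-Linear κ′ p) (w 0) _ β))
  where
  h′ : ℕ → ℕ
  h′ = h ∘ suc
  w′ : ℕ → ℚ
  w′ = w ∘ suc
  x₀ x₁ : V N
  x₀ = x ∘ (false ∷_)
  x₁ = x ∘ (true ∷_)
  IH : ∀ p y → hat {M} N h′ w′ (diag (κ ∘ suc) p y) ≈ diag κ′ p (hat N h′ w′ y)
  IH p = hat-diag N h′ w′ (κ ∘ suc) κ′ p (λ i i<N → eq (suc i) (s≤s i<N))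
  kind : OfKind (κ 0) κ′ (δ (h 0))
  kind i ne = δ-≢ {h 0} {i} (λ { refl → ne (eq 0 (s≤s z≤n)) })

-- Right multiplication by a transposition.

swapAt : ℕ → ℕ → List ℕ → List ℕ
swapAt i j σ = setAt (setAt σ i (lookupD σ j)) j (lookupD σ i)

module SwapAt {n σ i j} (p : IsPerm n σ) (i<n : i < n) (j<n : j < n) where

  private
    i< : i < length σ
    i< = subst (i <_) (sym (IsPerm-length p)) i<n
    j< : j < length (setAt σ i (lookupD σ j))
    j< = subst (j <_) (sym (length-setAt σ i _ ∙ IsPerm-length p)) j<n

  at-j : lookupD (swapAt i j σ) j ≡ lookupD σ i
  at-j = lookupD-setAt (setAt σ i (lookupD σ j)) j _ j<

  at-i : lookupD (swapAt i j σ) i ≡ lookupD σ j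
  at-i with j ℕₚ.≟ i
  ... | yes refl = at-j
  ... | no j≢i = lookupD-setAt-≢ (setAt σ i (lookupD σ j)) j i _ j≢i ∙ lookupD-setAt σ i _ i<

  elsewhere : ∀ k → i ≢ k → j ≢ k → lookupD (swapAt i j σ) k ≡ lookupD σ k
  elsewhere k i≢k j≢k = lookupD-setAt-≢ (setAt σ i (lookupD σ j)) j k _ j≢k ∙ lookupD-setAt-≢ σ i k _ i≢k

  length-swapAt : length (swapAt i j σ) ≡ n
  length-swapAt = length-setAt (setAt σ i (lookupD σ j)) j _ ∙ length-setAt σ i _ ∙ IsPerm-length p

lookupD-ext : ∀ xs ys → length xs ≡ length ys → (∀ k → k < length xs → lookupD xs k ≡ lookupD ys k) → xs ≡ ys
lookupD-ext [] [] _ _ = refl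
lookupD-ext (x ∷ xs) (y ∷ ys) eq h = cong₂ _∷_ (h 0 (s≤s z≤n)) (lookupD-ext xs ys (ℕₚ.suc-injective eq) (λ k k< → h (suc k) (s≤s k<)))

swapAt-IsPerm : ∀ {n σ i j} → IsPerm n σ → i < n → j < n → IsPerm n (swapAt i j σ)
swapAt-IsPerm {n} {σ} {i} {j} p i<n j<n = unique-↭ unique (Uniqueₚ.upTo⁺ n) into onto
  where
  open SwapAt p i<n j<n
  τ = swapAt i j σ
  back : ∀ k → k < n → ∃[ l ] l < n × lookupD τ k ≡ lookupD σ l
  back k k<n with i ℕₚ.≟ k | j ℕₚ.≟ k
  ... | yes refl | _ = j , j<n , at-i
  ... | no _ | yes refl = i , i<n , at-j
  ... | no i≢k | no j≢k = k , k<n , elsewhere k i≢k j≢k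
  forth : ∀ l → l < n → ∃[ k ] k < n × lookupD τ k ≡ lookupD σ l
  forth l l<n with i ℕₚ.≟ l | j ℕₚ.≟ l
  ... | yes refl | _ = j , j<n , at-j
  ... | no _ | yes refl = i , i<n , at-i
  ... | no i≢l | no j≢l = l , l<n , elsewhere l i≢l j≢l
  position : ∀ (xs : List ℕ) {z} → z ∈ xs → ∃[ k ] k < length xs × lookupD xs k ≡ z
  position (x ∷ xs) (here refl) = 0 , s≤s z≤n , refl
  position (x ∷ xs) (there z∈) with position xs z∈
  ... | k , k< , eq = suc k , s≤s k< , eq
  into : ∀ {z} → z ∈ τ → z ∈ upTo n
  into z∈ with position τ z∈
  ... | k , k< , refl with back k (subst (k <_) length-swapAt k<)
  ... | l , l<n , eq = ∈ₚ.∈-upTo⁺ (subst (_< n) (sym eq) (IsPerm-lookupD< p l l<n))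
  onto : ∀ {z} → z ∈ upTo n → z ∈ τ
  onto z∈ with position σ (Permₚ.∈-resp-↭ (↭-sym p) z∈)
  ... | l , l< , refl with forth l (subst (l <_) (IsPerm-length p) l<)
  ... | k , k<n , eq = subst (_∈ τ) eq (lookupD-∈ τ k (subst (k <_) (sym length-swapAt) k<n))
  injective : InjectiveBelow n (lookupD τ)
  injective k l k<n l<n eq with i ℕₚ.≟ k | j ℕₚ.≟ k | i ℕₚ.≟ l | j ℕₚ.≟ l
  ... | yes refl | _ | yes refl | _ = refl
  ... | yes refl | _ | no i≢l | yes refl = sym (IsPerm-injective p j i j<n i<n (sym at-i ∙ eq ∙ at-j))
  ... | yes refl | _ | no i≢l | no j≢l = ⊥-elim (j≢l (IsPerm-injective p j l j<n l<n (sym at-i ∙ eq ∙ elsewhere l i≢l j≢l)))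
  ... | no i≢k | yes refl | yes refl | _ = sym (IsPerm-injective p i j i<n j<n (sym at-j ∙ eq ∙ at-i))
  ... | no i≢k | yes refl | no _ | yes refl = refl
  ... | no i≢k | yes refl | no i≢l | no j≢l = ⊥-elim (i≢l (IsPerm-injective p i l i<n l<n (sym at-j ∙ eq ∙ elsewhere l i≢l j≢l)))
  ... | no i≢k | no j≢k | yes refl | _ = ⊥-elim (j≢k (sym (IsPerm-injective p k j k<n j<n (sym (elsewhere k i≢k j≢k) ∙ eq ∙ at-i))))
  ... | no i≢k | no j≢k | no _ | yes refl = ⊥-elim (i≢k (sym (IsPerm-injective p k i k<n i<n (sym (elsewhere k i≢k j≢k) ∙ eq ∙ at-j))))
  ... | no i≢k | no j≢k | no i≢l | no j≢l = IsPerm-injective p k l k<n l<n (sym (elsewhere k i≢k j≢k) ∙ eq ∙ elsewhere l i≢l j≢l)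
  lookupD-Unique : ∀ (xs : List ℕ) → InjectiveBelow (length xs) (lookupD xs) → Unique xs
  lookupD-Unique [] _ = []
  lookupD-Unique (x ∷ xs) inj = All.tabulate (λ {z} z∈ eq → let (k , k< , eq′) = position xs z∈ in
      case inj 0 (suc k) (s≤s z≤n) (s≤s k<) (eq ∙ sym eq′) of λ ())
    ∷ lookupD-Unique xs (injective-tail inj)
  unique : Unique τ
  unique = lookupD-Unique τ (subst (λ m → InjectiveBelow m (lookupD τ)) (sym length-swapAt) injective)

swapAt-involutive : ∀ {n σ i j} → IsPerm n σ → i < n → j < n → swapAt i j (swapAt i j σ) ≡ σ
swapAt-involutive {n} {σ} {i} {j} p i<n j<n = lookupD-ext _ _ (S′.length-swapAt ∙ sym (IsPerm-length p)) agree
  where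
  module S = SwapAt p i<n j<n
  module S′ = SwapAt (swapAt-IsPerm p i<n j<n) i<n j<n
  agree : ∀ k → k < length (swapAt i j (swapAt i j σ)) → lookupD (swapAt i j (swapAt i j σ)) k ≡ lookupD σ k
  agree k _ with i ℕₚ.≟ k | j ℕₚ.≟ k
  ... | yes refl | _ = S′.at-i ∙ S.at-j
  ... | no _ | yes refl = S′.at-j ∙ S.at-i
  ... | no i≢k | no j≢k = S′.elsewhere k i≢k j≢k ∙ S.elsewhere k i≢k j≢k

-- The swap is an involution of the set of permutations; it reindexes the Reynolds sum in
-- `R-exchange`.
perms-swapAt : ∀ n {i j} → i < n → j < n → map (swapAt i j) (perms n) ↭ perms n
perms-swapAt n {i} {j} i<n j<n = unique-↭
  (Unique-map∈ (λ {σ} {τ} σ∈ τ∈ eq → trans (sym (invol σ∈)) (cong (swapAt i j) eq ∙ invol τ∈)) (perms-Unique n)) (perms-Unique n)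
  (λ z∈ → let (σ , σ∈ , eq) = ∈ₚ.∈-map⁻ (swapAt i j) z∈ in subst (_∈ perms n) (sym eq) (closed σ∈))
  (λ {z} z∈ → subst (_∈ map (swapAt i j) (perms n)) (invol z∈) (∈ₚ.∈-map⁺ (swapAt i j) (closed z∈)))
  where
  closed : ∀ {σ} → σ ∈ perms n → swapAt i j σ ∈ perms n
  closed σ∈ = IsPerm⇒∈-perms n (swapAt-IsPerm (∈-perms⇒IsPerm n σ∈) i<n j<n)
  invol : ∀ {σ} → σ ∈ perms n → swapAt i j (swapAt i j σ) ≡ σ
  invol σ∈ = swapAt-involutive (∈-perms⇒IsPerm n σ∈) i<n j<n

-- The invariants and the ideal they generate

-- `true` precedes `false` to follow the order of `sublists`, so that `sublists-upTo` is an equality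
-- of lists.
vecs : ∀ N → List (Vec Bool N)
vecs zero = [] ∷ []
vecs (suc N) = map (true ∷_) (vecs N) ++ map (false ∷_) (vecs N)

sublists-map : ∀ (f : ℕ → ℕ) xs → sublists (map f xs) ≡ map (map f) (sublists xs)
sublists-map f [] = refl
sublists-map f (x ∷ xs) = cong (λ l → map (f x ∷_) l ++ l) (sublists-map f xs)
  ∙ cong (_++ map (map f) (sublists xs)) (sym (Listₚ.map-∘ (sublists xs)) ∙ Listₚ.map-∘ (sublists xs))
  ∙ sym (Listₚ.map-++ (map f) (map (x ∷_) (sublists xs)) (sublists xs))

sublists-upTo : ∀ N → sublists (upTo N) ≡ map mono (vecs N)
sublists-upTo zero = refl
sublists-upTo (suc N) = cong (λ l → map (0 ∷_) l ++ l) (cong sublists (sym (Listₚ.map-upTo suc N)) ∙ sublists-map suc (upTo N) ∙ cong (map (map suc)) (sublists-upTo N))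
  ∙ cong₂ _++_ (sym (Listₚ.map-∘ (map mono (vecs N))) ∙ sym (Listₚ.map-∘ (vecs N)) ∙ Listₚ.map-∘ (vecs N))
      (sym (Listₚ.map-∘ (vecs N)) ∙ Listₚ.map-∘ (vecs N))
  ∙ sym (Listₚ.map-++ mono (map (true ∷_) (vecs N)) (map (false ∷_) (vecs N)))

∈-vecs : ∀ {N} (β : Vec Bool N) → β ∈ vecs N
∈-vecs [] = here refl
∈-vecs (true ∷ β) = ∈ₚ.∈-++⁺ˡ (∈ₚ.∈-map⁺ (true ∷_) (∈-vecs β))
∈-vecs {suc N} (false ∷ β) = ∈ₚ.∈-++⁺ʳ (map (true ∷_) (vecs N)) (∈ₚ.∈-map⁺ (false ∷_) (∈-vecs β))

sumL-vecs : ∀ {N} (f : Vec Bool N → ℚ) → sumL f (vecs N) ≡ sumV f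
sumL-vecs {zero} f = ⊹-identityʳ _
sumL-vecs {suc N} f = sumL-++ f (map (true ∷_) (vecs N)) _ ∙ ⊹-comm _ _
  ∙ (cong₂ _⊹_ (sumL-map f (false ∷_) (vecs N) ∙ sumL-vecs (f ∘ (false ∷_))) (sumL-map f (true ∷_) (vecs N) ∙ sumL-vecs (f ∘ (true ∷_))))

filterB-map : ∀ {A B : Set} (p : B → Bool) (f : A → B) xs → filterB p (map f xs) ≡ map f (filterB (p ∘ f) xs)
filterB-map p f [] = refl
filterB-map p f (x ∷ xs) with p (f x)
... | true = cong (f x ∷_) (filterB-map p f xs)
... | false = filterB-map p f xs

filterB-cong : ∀ {A : Set} {p q : A → Bool} → (∀ x → p x ≡ q x) → ∀ xs → filterB p xs ≡ filterB q xs
filterB-cong eq [] = refl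
filterB-cong {p = p} {q = r} eq (x ∷ xs) with p x | r x | eq x
... | true | .true | refl = cong (x ∷_) (filterB-cong eq xs)
... | false | .false | refl = filterB-cong eq xs

∈-filterB⁻ : ∀ {A : Set} (p : A → Bool) {x} xs → x ∈ filterB p xs → x ∈ xs × p x ≡ true
∈-filterB⁻ p (y ∷ xs) x∈ with p y in eq
∈-filterB⁻ p (y ∷ xs) (here refl) | true = here refl , eq
∈-filterB⁻ p (y ∷ xs) (there x∈) | true with ∈-filterB⁻ p xs x∈
... | r , e = there r , e
∈-filterB⁻ p (y ∷ xs) x∈ | false with ∈-filterB⁻ p xs x∈
... | r , e = there r , e

∈-filterB⁺ : ∀ {A : Set} (p : A → Bool) {x xs} → x ∈ xs → p x ≡ true → x ∈ filterB p xs
∈-filterB⁺ p {xs = y ∷ xs} (here refl) eq with p y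
∈-filterB⁺ p {xs = y ∷ xs} (here refl) refl | true = here refl
∈-filterB⁺ p {xs = y ∷ xs} (there x∈) eq with p y
... | true = there (∈-filterB⁺ p x∈ eq)
... | false = ∈-filterB⁺ p x∈ eq

countB-map : ∀ {A B : Set} (p : B → Bool) (f : A → B) xs → countB p (map f xs) ≡ countB (p ∘ f) xs
countB-map p f xs = cong length (filterB-map p f xs) ∙ Listₚ.length-map f (filterB (p ∘ f) xs)

countB-mono-true : ∀ {N} κ (β : Vec Bool N) → countB κ (mono β) ≡ #kind true κ β
countB-mono-true κ [] = refl
countB-mono-true κ (false ∷ β) = countB-map κ suc (mono β) ∙ countB-mono-true (κ ∘ suc) β
countB-mono-true κ (true ∷ β) with κ 0
... | true = cong suc (countB-map κ suc (mono β) ∙ countB-mono-true (κ ∘ suc) β)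
... | false = countB-map κ suc (mono β) ∙ countB-mono-true (κ ∘ suc) β

countB-mono-false : ∀ {N} κ (β : Vec Bool N) → countB (not ∘ κ) (mono β) ≡ #kind false κ β
countB-mono-false κ [] = refl
countB-mono-false κ (false ∷ β) = countB-map (not ∘ κ) suc (mono β) ∙ countB-mono-false (κ ∘ suc) β
countB-mono-false κ (true ∷ β) with κ 0
... | true = countB-map (not ∘ κ) suc (mono β) ∙ countB-mono-false (κ ∘ suc) β
... | false = cong suc (countB-map (not ∘ κ) suc (mono β) ∙ countB-mono-false (κ ∘ suc) β)

normWord-bounded : ∀ {N} w → All (_< N) w → All (_< N) (proj₂ (normWord w))
normWord-bounded w bd with hasDup w
... | true = []
... | false = Permₚ.All-resp-↭ (↭-sym (sortℕ-↭ w)) bd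

-- Correctness of the elimination procedure spanBasis

opaque
  unfolding ℚ-ring

  indexℚ-vsub : ∀ v w i → length v ≡ length w → indexℚ (vsub v w) i ≡ indexℚ v i − indexℚ w i
  indexℚ-vsub [] [] i _ = refl
  indexℚ-vsub (x ∷ v) (y ∷ w) zero _ = refl
  indexℚ-vsub (x ∷ v) (y ∷ w) (suc i) eq = indexℚ-vsub v w i (ℕₚ.suc-injective eq)

  indexℚ-vscale : ∀ k v i → indexℚ (vscale k v) i ≡ k · indexℚ v i
  indexℚ-vscale k [] i = sym (·-zeroʳ k)
  indexℚ-vscale k (x ∷ v) zero = refl
  indexℚ-vscale k (x ∷ v) (suc i) = indexℚ-vscale k v i

length-vsub : ∀ v w → length v ≡ length w → length (vsub v w) ≡ length v
length-vsub [] [] _ = refl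
length-vsub (x ∷ v) (y ∷ w) eq = cong suc (length-vsub v w (ℕₚ.suc-injective eq))

firstNZ-nothing : ∀ v → firstNZ v ≡ nothing → ∀ i → indexℚ v i ≡ 0ℚ
firstNZ-nothing [] _ i = refl
firstNZ-nothing (x ∷ v) eq i with x ℚₚ.≟ 0ℚ | firstNZ v in eqv
firstNZ-nothing (x ∷ v) eq zero | yes x≡0 | nothing = x≡0
firstNZ-nothing (x ∷ v) eq (suc i) | yes x≡0 | nothing = firstNZ-nothing v eqv i

firstNZ-just : ∀ v p → firstNZ v ≡ just p → indexℚ v p ≢ 0ℚ
firstNZ-just (x ∷ v) p eq with x ℚₚ.≟ 0ℚ | firstNZ v in eqv
firstNZ-just (x ∷ v) .zero refl | no x≢0 | _ = x≢0
firstNZ-just (x ∷ v) .(suc p) refl | yes _ | just p = firstNZ-just v p eqv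

Row : Set
Row = Vec' × ℕ

row : Row → ℕ → ℚ
row r = indexℚ (proj₁ r)

pivot : Row → ℕ
pivot = proj₂

Independent : Row → Row → Set
Independent r r′ = row r (pivot r′) ≡ 0ℚ × row r′ (pivot r) ≡ 0ℚ

record Echelon (D : ℕ) (B : RBasis) : Set where
  constructor echelon
  field
    lengths : All (λ r → length (proj₁ r) ≡ D) B
    units : All (λ r → row r (pivot r) ≡ 1ℚ) B
    indep : AllPairs Independent B

-- The only candidate for u inside the row space: in a reduced basis the coefficient of a row is the
-- entry at its pivot.
combine : RBasis → (ℕ → ℚ) → ℕ → ℚ
combine B u i = sumL (λ r → u (pivot r) · row r i) B

-- The rows are subtracted one after another, but each row vanishes at the pivots of the others, so
-- every coefficient can be read from the original v.
reduceBy-spec : ∀ {D} B v → Echelon D B → length v ≡ D →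
  length (reduceBy B v) ≡ D × (∀ i → indexℚ (reduceBy B v) i ≡ indexℚ v i − combine B (indexℚ v) i)
reduceBy-spec [] v _ len = len , λ i → ring93 _
reduceBy-spec {D} ((b , p) ∷ B) v (echelon (lb ∷ ls) (_ ∷ us) (ind ∷ inds)) len with reduceBy-spec B w (echelon ls us inds) lw
  where
  w = vsub v (vscale (indexℚ v p) b)
  lw : length w ≡ D
  lw = length-vsub v _ (len ∙ sym (Listₚ.length-map _ b ∙ lb)) ∙ len
... | l , eq = l , λ i → begin
  indexℚ (reduceBy B w) i ≡⟨ eq i ⟩
  indexℚ w i − combine B (indexℚ w) i ≡⟨ cong₂ _−_ (w-index i) (sumL-cong∈ B (λ r r∈ → cong (_· row r i) (w-pivot r r∈))) ⟩
  (indexℚ v i − indexℚ v p · indexℚ b i) − combine B (indexℚ v) i ≡⟨ ring94 _ _ _ ⟩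
  _ ∎
  where
  w = vsub v (vscale (indexℚ v p) b)
  w-index : ∀ i → indexℚ w i ≡ indexℚ v i − indexℚ v p · indexℚ b i
  w-index i = indexℚ-vsub v _ i (len ∙ sym (Listₚ.length-map _ b ∙ lb)) ∙ cong (λ t → indexℚ v i − t) (indexℚ-vscale (indexℚ v p) b i)
  w-pivot : ∀ r → r ∈ B → indexℚ w (pivot r) ≡ indexℚ v (pivot r)
  w-pivot r r∈ = w-index (pivot r) ∙ cong (λ t → indexℚ v (pivot r) − indexℚ v p · t) (proj₁ (All⇒∀∈ ind r∈)) ∙ ring84 _ _

combine-pivot : ∀ {D} B → Echelon D B → ∀ u r → r ∈ B → combine B u (pivot r) ≡ u (pivot r)
combine-pivot (r ∷ B) (echelon _ (un ∷ _) (ind ∷ _)) u r (here refl) = trans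
  (cong₂ (λ a b → u (pivot r) · a ⊹ b) un (sumL-zero∈ B (λ r′ r′∈ → trans (cong (u (pivot r′) ·_) (proj₂ (All⇒∀∈ ind r′∈))) (·-zeroʳ _)))) (ring95 _)
combine-pivot (r₀ ∷ B) (echelon (_ ∷ ls) (_ ∷ us) (ind ∷ inds)) u r (there r∈) = trans
  (cong₂ (λ a b → u (pivot r₀) · a ⊹ b) (proj₁ (All⇒∀∈ ind r∈)) (combine-pivot B (echelon ls us inds) u r r∈)) (ring96 _ _)

data Span (G : List Vec') : (ℕ → ℚ) → Set where
  null : ∀ {u} → (∀ i → u i ≡ 0ℚ) → Span G u
  more : ∀ {u u′ v} k → v ∈ G → Span G u′ → (∀ i → u i ≡ k · indexℚ v i ⊹ u′ i) → Span G u

Span-resp : ∀ {G u u′} → (∀ i → u i ≡ u′ i) → Span G u → Span G u′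
Span-resp eq (null z) = null (λ i → trans (sym (eq i)) (z i))
Span-resp eq (more k v∈ s d) = more k v∈ s (λ i → trans (sym (eq i)) (d i))

Span-add : ∀ {G u u′} → Span G u → Span G u′ → Span G (λ i → u i ⊹ u′ i)
Span-add (null z) s = Span-resp (λ i → sym (cong (_⊹ _) (z i) ∙ ⊹-identityˡ _)) s
Span-add (more k v∈ s d) s′ = more k v∈ (Span-add s s′) (λ i → trans (cong (_⊹ _) (d i)) (⊹-assoc _ _ _))

Span-mul : ∀ {G u} j → Span G u → Span G (λ i → j · u i)
Span-mul j (null z) = null (λ i → trans (cong (j ·_) (z i)) (·-zeroʳ j))
Span-mul j (more k v∈ s d) = more (j · k) v∈ (Span-mul j s) (λ i → trans (cong (j ·_) (d i)) (ring97 _ _ _ _))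

Span-sub : ∀ {G u u′} → Span G u → Span G u′ → Span G (λ i → u i − u′ i)
Span-sub s s′ = Span-resp (λ i → cong (_ ⊹_) (sym (−≡-1· _))) (Span-add s (Span-mul (− 1ℚ) s′))

Span-gen : ∀ {G v} → v ∈ G → Span G (indexℚ v)
Span-gen v∈ = more {u′ = λ _ → 0ℚ} 1ℚ v∈ (null (λ _ → refl)) (λ i → sym (⊹-identityʳ _ ∙ ·-identityˡ _))

Span-combine : ∀ {G} B u → All (λ r → Span G (row r)) B → Span G (combine B u)
Span-combine [] u [] = null (λ _ → refl)
Span-combine (r ∷ B) u (s ∷ ss) = Span-add (Span-mul (u (pivot r)) s) (Span-combine B u ss)

-- Membership in the row space, expressed as being rebuilt from one's own pivot entries. The
-- condition is linear, so it passes from generators to their span.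
Fixed : RBasis → (ℕ → ℚ) → Set
Fixed B u = ∀ i → u i ≡ combine B u i

Fixed-Span : ∀ {G B} → (∀ {v} → v ∈ G → Fixed B (indexℚ v)) → ∀ {u} → Span G u → Fixed B u
Fixed-Span {B = B} fix (null z) i = z i ∙ sym (sumL-zero∈ B (λ r _ → trans (cong (_· row r i) (z (pivot r))) (·-zeroˡ _)))
Fixed-Span {B = B} fix {u} (more {u′ = u′} {v} k v∈ s d) i = d i
  ∙ cong₂ (λ a b → k · a ⊹ b) (fix v∈ i) (Fixed-Span {B = B} fix s i)
  ∙ cong (_⊹ combine B u′ i) (sym (sumL-· k (λ r → indexℚ v (pivot r) · row r i) B))
  ∙ sym (sumL-⊹ (λ r → k · (indexℚ v (pivot r) · row r i)) (λ r → u′ (pivot r) · row r i) B)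
  ∙ sumL-cong B (λ r → trans (ring98 _ _ _ _) (cong (_· row r i) (sym (d (pivot r)))))

insertVec-nothing : ∀ B v → firstNZ (reduceBy B v) ≡ nothing → insertVec B v ≡ B
insertVec-nothing B v eq rewrite eq = refl

module Insert {D} (B : RBasis) (v : Vec') (E : Echelon D B) (len : length v ≡ D) (p : ℕ) (eqp : firstNZ (reduceBy B v) ≡ just p) where

  v′ v″ : Vec'
  v′ = reduceBy B v
  v″ = vscale (invℚ (indexℚ v′ p)) v′

  clear : Row → Row
  clear r = (vsub (proj₁ r) (vscale (indexℚ (proj₁ r) p) v″) , proj₂ r)

  B′ : RBasis
  B′ = (v″ , p) ∷ map clear B

  insertVec-just : insertVec B v ≡ B′
  insertVec-just rewrite eqp = refl

  private
    κ : ℚ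
    κ = invℚ (indexℚ v′ p)
    spec : ∀ i → indexℚ v′ i ≡ indexℚ v i − combine B (indexℚ v) i
    spec = proj₂ (reduceBy-spec B v E len)
    l″ : length v″ ≡ D
    l″ = Listₚ.length-map _ v′ ∙ proj₁ (reduceBy-spec B v E len)

  v″-index : ∀ i → indexℚ v″ i ≡ κ · indexℚ v′ i
  v″-index = indexℚ-vscale κ v′

  v″-p : indexℚ v″ p ≡ 1ℚ
  v″-p = v″-index p ∙ ·-inverseˡ _ (firstNZ-just v′ p eqp)

  v″-pivot : ∀ r → r ∈ B → indexℚ v″ (pivot r) ≡ 0ℚ
  v″-pivot r r∈ = v″-index (pivot r) ∙ cong (κ ·_) (spec (pivot r) ∙ cong (λ t → indexℚ v (pivot r) − t) (combine-pivot B E (indexℚ v) r r∈) ∙ −-inverse _) ∙ ·-zeroʳ κ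

  clear-index : ∀ r → r ∈ B → ∀ i → row (clear r) i ≡ row r i − row r p · indexℚ v″ i
  clear-index r r∈ i = indexℚ-vsub (proj₁ r) _ i (All⇒∀∈ (Echelon.lengths E) r∈ ∙ sym (Listₚ.length-map _ v″ ∙ l″))
    ∙ cong (λ t → row r i − t) (indexℚ-vscale (row r p) v″ i)

  clear-pivot : ∀ r r′ → r ∈ B → r′ ∈ B → row (clear r) (pivot r′) ≡ row r (pivot r′)
  clear-pivot r r′ r∈ r′∈ = clear-index r r∈ (pivot r′) ∙ cong (λ t → row r (pivot r′) − row r p · t) (v″-pivot r′ r′∈) ∙ ring84 _ _

  clear-p : ∀ r → r ∈ B → row (clear r) p ≡ 0ℚ
  clear-p r r∈ = clear-index r r∈ p ∙ cong (λ t → row r p − row r p · t) v″-p ∙ ring99 _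

  B′-Echelon : Echelon D B′
  B′-Echelon = echelon
    (l″ ∷ Allₚ.map⁺ (All.tabulate (λ {r} r∈ → trans (length-vsub (proj₁ r) _ (All⇒∀∈ (Echelon.lengths E) r∈ ∙ sym (Listₚ.length-map _ v″ ∙ l″))) (All⇒∀∈ (Echelon.lengths E) r∈))))
    (v″-p ∷ Allₚ.map⁺ (All.tabulate (λ {r} r∈ → trans (clear-pivot r r r∈ r∈) (All⇒∀∈ (Echelon.units E) r∈))))
    (Allₚ.map⁺ (All.tabulate (λ {r} r∈ → v″-pivot r r∈ , clear-p r r∈)) ∷ go B (λ r∈ → r∈) (Echelon.indep E))
    where
    go : ∀ C → (∀ {r} → r ∈ C → r ∈ B) → AllPairs Independent C → AllPairs Independent (map clear C)
    go [] inc [] = []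
    go (r ∷ C) inc (p ∷ ps) = Allₚ.map⁺ (All.tabulate (λ {r′} r′∈ → trans (clear-pivot r r′ (inc (here refl)) (inc (there r′∈))) (proj₁ (All⇒∀∈ p r′∈)) ,
        trans (clear-pivot r′ r (inc (there r′∈)) (inc (here refl))) (proj₂ (All⇒∀∈ p r′∈))))
      ∷ go C (λ r∈ → inc (there r∈)) ps

  -- Clearing column p in the old rows removes `combine B u p` copies of `v″` in total, and the new
  -- row adds `u p` copies.
  combine-B′ : ∀ u i → combine B′ u i ≡ combine B u i ⊹ (u p − combine B u p) · indexℚ v″ i
  combine-B′ u i = cong (u p · indexℚ v″ i ⊹_) (sumL-map (λ r → u (pivot r) · row r i) clear B ∙ sumL-cong∈ B (λ r r∈ → trans (cong (u (pivot r) ·_) (clear-index r r∈ i)) (ring100 _ _ _ _))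
        ∙ sumL-⊹ (λ r → u (pivot r) · row r i) (λ r → (− indexℚ v″ i) · (u (pivot r) · row r p)) B ∙ cong (combine B u i ⊹_) (sumL-· (− indexℚ v″ i) (λ r → u (pivot r) · row r p) B))
    ∙ ring101 _ _ _ _

  Fixed-old : ∀ {u} → Fixed B u → Fixed B′ u
  Fixed-old {u} fix i = sym (combine-B′ u i ∙ cong₂ (λ a b → a ⊹ (u p − b) · indexℚ v″ i) (sym (fix i)) (sym (fix p)) ∙ ring102 _ _ _)

  Fixed-new : Fixed B′ (indexℚ v)
  Fixed-new i = sym (combine-B′ (indexℚ v) i
    ∙ cong₂ (λ a b → combine B (indexℚ v) i ⊹ a · b) (sym (spec p)) (v″-index i)
    ∙ cong (combine B (indexℚ v) i ⊹_) (ring39 _ _ _ ∙ cong (_· indexℚ v′ i) (·-inverseˡ _ (firstNZ-just v′ p eqp)) ∙ ·-identityˡ _ ∙ spec i)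
    ∙ ring103 _ _)

  B′-Span : ∀ {G} → v ∈ G → All (λ r → Span G (row r)) B → All (λ r → Span G (row r)) B′
  B′-Span {G} v∈ rows = s″ ∷ Allₚ.map⁺ (All.tabulate (λ {r} r∈ → Span-resp (λ i → sym (clear-index r r∈ i)) (Span-sub (All⇒∀∈ rows r∈) (Span-mul (row r p) s″))))
    where
    s″ : Span G (indexℚ v″)
    s″ = Span-resp (λ i → sym (v″-index i ∙ cong (κ ·_) (spec i))) (Span-mul κ (Span-sub (Span-gen v∈) (Span-combine B (indexℚ v) rows)))

record Spans (D : ℕ) (G : List Vec') (B : RBasis) : Set where
  field
    isEchelon : Echelon D B
    fixes : ∀ {u} → Span G u → Fixed B u
    inside : All (λ r → Span G (row r)) B

record Inserted (D : ℕ) (G : List Vec') (B : RBasis) (v : Vec') (B′ : RBasis) : Set where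
  constructor inserted
  field
    isEchelon : Echelon D B′
    inside : All (λ r → Span G (row r)) B′
    fixes-new : Fixed B′ (indexℚ v)
    fixes-old : ∀ {u} → Fixed B u → Fixed B′ u

insertVec-Inserted : ∀ {D G} B v → Echelon D B → length v ≡ D → v ∈ G → All (λ r → Span G (row r)) B → Inserted D G B v (insertVec B v)
insertVec-Inserted {D} {G} B v E len v∈ rows = go (firstNZ (reduceBy B v)) refl
  where
  go : ∀ mb → firstNZ (reduceBy B v) ≡ mb → Inserted D G B v (insertVec B v)
  go nothing eq = subst (Inserted D G B v) (sym (insertVec-nothing B v eq)) (inserted E rows
    (λ i → trans (ring104 _ _) (cong (_⊹ combine B (indexℚ v) i) (sym (proj₂ (reduceBy-spec B v E len) i) ∙ firstNZ-nothing (reduceBy B v) eq i) ∙ ⊹-identityˡ _)) id)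
  go (just p) eq = subst (Inserted D G B v) (sym insertVec-just) (inserted B′-Echelon (B′-Span v∈ rows) Fixed-new Fixed-old)
    where open Insert B v E len p eq

spanBasis-Spans : ∀ {D} G → All (λ v → length v ≡ D) G → Spans D G (spanBasis G)
spanBasis-Spans {D} G lens = let (E , rows , new , old) = go G [] lens (λ v∈ → v∈) (echelon [] [] []) [] in
  record { isEchelon = E ; fixes = Fixed-Span {B = spanBasis G} new ; inside = rows }
  where
  go : ∀ vs B → All (λ v → length v ≡ D) vs → (∀ {v} → v ∈ vs → v ∈ G) → Echelon D B → All (λ r → Span G (row r)) B →
    Echelon D (foldl insertVec B vs) × All (λ r → Span G (row r)) (foldl insertVec B vs)
    × (∀ {v} → v ∈ vs → Fixed (foldl insertVec B vs) (indexℚ v)) × (∀ {u} → Fixed B u → Fixed (foldl insertVec B vs) u)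
  go [] B _ _ E rows = E , rows , (λ ()) , id
  go (v ∷ vs) B (l ∷ ls) inc E rows =
    let ins = insertVec-Inserted B v E l (inc (here refl)) rows
        (E′ , rows′ , new , old) = go vs (insertVec B v) ls (λ v∈ → inc (there v∈)) (Inserted.isEchelon ins) (Inserted.inside ins)
    in E′ , rows′ , (λ { (here refl) → old (Inserted.fixes-new ins) ; (there v∈) → new v∈ }) , (λ fix → old (Inserted.fixes-old ins fix))

-- The character of the quotient

indexℚ-map-⊹ : ∀ {A : Set} (x y : A → ℚ) bs i → indexℚ (map (λ β → x β ⊹ y β) bs) i ≡ indexℚ (map x bs) i ⊹ indexℚ (map y bs) i
indexℚ-map-⊹ x y [] i = sym (⊹-identityˡ 0ℚ)
indexℚ-map-⊹ x y (β ∷ bs) zero = refl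
indexℚ-map-⊹ x y (β ∷ bs) (suc i) = indexℚ-map-⊹ x y bs i

indexℚ-map-· : ∀ {A : Set} k (x : A → ℚ) bs i → indexℚ (map (λ β → k · x β) bs) i ≡ k · indexℚ (map x bs) i
indexℚ-map-· k x [] i = sym (·-zeroʳ k)
indexℚ-map-· k x (β ∷ bs) zero = refl
indexℚ-map-· k x (β ∷ bs) (suc i) = indexℚ-map-· k x bs i

fromCoords : ∀ {N} → List (Vec Bool N) → (ℕ → ℚ) → V N
fromCoords [] u γ = 0ℚ
fromCoords (β ∷ bs) u γ = u 0 · e β γ ⊹ fromCoords bs (u ∘ suc) γ

fromCoords-cong : ∀ {N} (bs : List (Vec Bool N)) {u w} → (∀ i → u i ≡ w i) → fromCoords bs u ≈ fromCoords bs w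
fromCoords-cong [] eq γ = refl
fromCoords-cong (β ∷ bs) eq γ = cong₂ (λ k y → k · e β γ ⊹ y) (eq 0) (fromCoords-cong bs (eq ∘ suc) γ)

fromCoords-⊹ : ∀ {N} (bs : List (Vec Bool N)) u w → fromCoords bs (λ i → u i ⊹ w i) ≈ fromCoords bs u +ᵥ fromCoords bs w
fromCoords-⊹ [] u w γ = sym (⊹-identityˡ 0ℚ)
fromCoords-⊹ (β ∷ bs) u w γ = cong ((u 0 ⊹ w 0) · e β γ ⊹_) (fromCoords-⊹ bs (u ∘ suc) (w ∘ suc) γ) ∙ ring20 _ _ _ _ _

fromCoords-· : ∀ {N} (bs : List (Vec Bool N)) k u → fromCoords bs (λ i → k · u i) ≈ k ·ᵥ fromCoords bs u
fromCoords-· [] k u γ = sym (·-zeroʳ k)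
fromCoords-· (β ∷ bs) k u γ = cong ((k · u 0) · e β γ ⊹_) (fromCoords-· bs k (u ∘ suc) γ) ∙ ring105 _ _ _ _

fromCoords-0 : ∀ {N} (bs : List (Vec Bool N)) {u} → (∀ i → u i ≡ 0ℚ) → fromCoords bs u ≈ 0ᵥ
fromCoords-0 [] z γ = refl
fromCoords-0 (β ∷ bs) z γ = cong₂ (λ k y → k · e β γ ⊹ y) (z 0) (fromCoords-0 bs (z ∘ suc) γ) ∙ ring21 _

fromCoords-map : ∀ {N} (bs : List (Vec Bool N)) (x : V N) γ → fromCoords bs (indexℚ (map x bs)) γ ≡ sumL (λ β → x β · e β γ) bs
fromCoords-map [] x γ = refl
fromCoords-map (β ∷ bs) x γ = cong (x β · e β γ ⊹_) (fromCoords-map bs x γ)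

fromCoords-zip : ∀ {N} v (bs : List (Vec Bool N)) → length v ≡ length bs → ι (zip v (map mono bs)) ≈ fromCoords bs (indexℚ v)
fromCoords-zip [] [] _ γ = refl
fromCoords-zip (k ∷ v) (β ∷ bs) eq γ = cong₂ (λ x y → k · x ⊹ y) (sym (e≈cw-mono β γ)) (fromCoords-zip v bs (ℕₚ.suc-injective eq) γ)

fromCoords-combine : ∀ {N} (bs : List (Vec Bool N)) B u → fromCoords bs (combine B u) ≈ (λ γ → sumL (λ r → u (pivot r) · fromCoords bs (row r) γ) B)
fromCoords-combine bs [] u γ = fromCoords-0 bs (λ _ → refl) γ
fromCoords-combine bs (r ∷ B) u γ = fromCoords-⊹ bs (λ i → u (pivot r) · row r i) (combine B u) γ
  ∙ (cong₂ _⊹_ (fromCoords-· bs (u (pivot r)) (row r) γ) (fromCoords-combine bs B u γ))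

e-diagonal : ∀ {N} (φ : Vec Bool N → ℚ) β γ → φ γ · e β γ ≡ φ β · e β γ
e-diagonal φ [] [] = refl
e-diagonal φ (false ∷ β) (false ∷ γ) = e-diagonal (φ ∘ (false ∷_)) β γ
e-diagonal φ (true ∷ β) (true ∷ γ) = e-diagonal (φ ∘ (true ∷_)) β γ
e-diagonal φ (false ∷ β) (true ∷ γ) = ·-zeroʳ _ ∙ sym (·-zeroʳ _)
e-diagonal φ (true ∷ β) (false ∷ γ) = ·-zeroʳ _ ∙ sym (·-zeroʳ _)

zip-InRange : ∀ {N} v (bs : List (Vec Bool N)) → InRange N (zip v (map mono bs))
zip-InRange [] bs = []
zip-InRange (k ∷ v) [] = []
zip-InRange (k ∷ v) (β ∷ bs) = mono-bounded β ∷ zip-InRange v bs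

opaque
  unfolding ℚ-ring

  charR≡ : ∀ n a b σ → charR n a b σ ≡ traceE n a b σ − traceSub n a b σ (spanBasis (idealGens n a b))
  charR≡ n a b σ = refl

-- Super-symmetric functions of the alphabet 1 , uv ∣ u , v

pw : ℚ → ℕ → ℚ
pw x zero = 1ℚ
pw x (suc k) = x · pw x k

-- conv p m f = Σ_{k=1..m} p_k f_{m-k}, where p_k is stored as p (k - 1).
conv : (ℕ → ℚ) → ℕ → (ℕ → ℚ) → ℚ
conv p m f = Σ< m (λ k → p k · f (m ∸ suc k))

-- Newton's identities: f are the complete symmetric functions of an alphabet with power sums p.
Newton : (ℕ → ℚ) → (ℕ → ℚ) → Set
Newton p f = ∀ m → ℕtoℚ m · f m ≡ conv p m f

conv-add : ∀ p q m f → conv (λ k → p k ⊹ q k) m f ≡ conv p m f ⊹ conv q m f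
conv-add p q m f = Σ<-cong m (λ k → ring24 _ _ _) ∙ Σ<-⊹ m _ _

conv-geometric : ∀ a m f → conv (λ k → pw a (suc k)) (suc m) f ≡ a · f m ⊹ a · conv (λ k → pw a (suc k)) m f
conv-geometric a m f = cong₂ _⊹_ (cong (_· f m) (·-identityʳ a))
  (Σ<-cong m (λ k → ·-assoc a (pw a (suc k)) (f (m ∸ suc k))) ∙ Σ<-· m a (λ k → pw a (suc k) · f (m ∸ suc k)))

suc-∸-suc : ∀ {m k} → k < m → m ∸ k ≡ suc (m ∸ suc k)
suc-∸-suc {suc m} {zero} _ = refl
suc-∸-suc {suc m} {suc k} (s≤s k<) = suc-∸-suc k<

-- Multiplication of the generating function by 1/(1 - a z) and by 1 + c z.
geo fac : ℚ → (ℕ → ℚ) → ℕ → ℚ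
geo a f zero = f 0
geo a f (suc m) = f (suc m) ⊹ a · geo a f m
fac c f zero = f 0
fac c f (suc m) = f (suc m) ⊹ c · f m

-- For generating functions this is g = f + a z y multiplied by that of p; `geo` takes y = g and
-- `fac` takes y = f.
conv-shift : ∀ p a (f g y : ℕ → ℚ) → g 0 ≡ f 0 → (∀ m → g (suc m) ≡ f (suc m) ⊹ a · y m) → ∀ m → conv p (suc m) g ≡ conv p (suc m) f ⊹ a · conv p m y
conv-shift p a f g y e₀ es m = Σ<-snoc m (λ k → p k · g (m ∸ k))
  ∙ cong₂ _⊹_ (Σ<-cong< m (λ k k<m → trans (cong (λ j → p k · g j) (suc-∸-suc k<m)) (cong (p k ·_) (es (m ∸ suc k) ∙ cong (λ j → f j ⊹ a · y (m ∸ suc k)) (sym (suc-∸-suc k<m))) ∙ ring108 _ _ _ _)))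
      (cong (λ j → p m · g j) (ℕₚ.n∸n≡0 m) ∙ cong (p m ·_) e₀ ∙ cong (λ j → p m · f j) (sym (ℕₚ.n∸n≡0 m)))
  ∙ cong (_⊹ p m · f (m ∸ m)) (Σ<-⊹ m (λ k → p k · f (m ∸ k)) (λ k → a · (p k · y (m ∸ suc k))) ∙ cong (Σ< m (λ k → p k · f (m ∸ k)) ⊹_) (Σ<-· m a (λ k → p k · y (m ∸ suc k))))
  ∙ ring109 _ _ _
  ∙ cong (_⊹ a · conv p m y) (sym (Σ<-snoc m (λ k → p k · f (m ∸ k))))

-- Adjoining an ordinary letter a adds its powers to the power sums. An odd letter c, treated in
-- `Newton-fac`, subtracts the powers of - c.
Newton-geo : ∀ {p f} a → Newton p f → Newton (λ k → p k ⊹ pw a (suc k)) (geo a f)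
Newton-geo a new zero = ·-zeroˡ _
Newton-geo {p} {f} a new (suc m) = trans (·-distribˡ-⊹ _ _ _) (cong₂ _⊹_ (new (suc m)) (cong (_· (a · geo a f m)) (ℕtoℚ-suc m)))
  ∙ ring110 _ _ _ _
  ∙ cong (λ t → conv p (suc m) f ⊹ (a · geo a f m ⊹ a · t)) (Newton-geo a new m ∙ conv-add p (λ k → pw a (suc k)) m (geo a f))
  ∙ ring111 _ _ _ _ _
  ∙ cong₂ _⊹_ (sym (conv-shift p a f (geo a f) (geo a f) refl (λ _ → refl) m)) (sym (conv-geometric a m (geo a f)))
  ∙ sym (conv-add p (λ k → pw a (suc k)) (suc m) (geo a f))

fac-geometric : ∀ c f m → conv (λ k → pw (− c) (suc k)) (suc m) (fac c f) ≡ − (c · f m)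
fac-geometric c f zero = conv-geometric (− c) 0 (fac c f) ∙ ring112 _ _
fac-geometric c f (suc m) = conv-geometric (− c) (suc m) (fac c f) ∙ cong (λ t → (− c) · (f (suc m) ⊹ c · f m) ⊹ (− c) · t) (fac-geometric c f m) ∙ ring113 _ _ _

conv-neg : ∀ q m f → conv (λ k → − q k) m f ≡ − conv q m f
conv-neg q m f = Σ<-cong m (λ k → ring38 _ _) ∙ Σ<-neg m (λ k → q k · f (m ∸ suc k))

Newton-fac : ∀ {p f} c → Newton p f → Newton (λ k → p k − pw (− c) (suc k)) (fac c f)
Newton-fac c new zero = ·-zeroˡ _
Newton-fac {p} {f} c new (suc m) = trans (·-distribˡ-⊹ _ _ _) (cong₂ _⊹_ (new (suc m)) (cong (_· (c · f m)) (ℕtoℚ-suc m)))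
  ∙ ring114 _ _ _ _
  ∙ cong₂ (λ x y → (conv p (suc m) f ⊹ c · x) ⊹ − y) (new m) (sym (fac-geometric c f m))
  ∙ cong₂ _⊹_ (sym (conv-shift p c f (fac c f) f refl (λ _ → refl) m)) (sym (conv-neg (λ k → pw (− c) (suc k)) (suc m) (fac c f)))
  ∙ sym (conv-add p (λ k → − pw (− c) (suc k)) (suc m) (fac c f))

unit : ℕ → ℚ
unit zero = 1ℚ
unit (suc m) = 0ℚ

Newton-unit : Newton (λ _ → 0ℚ) unit
Newton-unit m = lem m ∙ sym (Σ<-zero m (λ k _ → ·-zeroˡ _))
  where
  lem : ∀ m → ℕtoℚ m · unit m ≡ 0ℚ
  lem zero = ·-zeroˡ _
  lem (suc m) = ·-zeroʳ _

pw-· : ∀ x y k → pw (x · y) k ≡ pw x k · pw y k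
pw-· x y zero = sym (·-identityˡ 1ℚ)
pw-· x y (suc k) = cong ((x · y) ·_) (pw-· x y k) ∙ ring115 _ _ _ _

pw-neg : ∀ x k → pw (− x) k ≡ sgn k · pw x k
pw-neg x zero = sym (·-identityˡ 1ℚ)
pw-neg x (suc k) = cong ((− x) ·_) (pw-neg x k) ∙ ring116 _ _ _

pw-+ : ∀ x i j → pw x (i + j) ≡ pw x i · pw x j
pw-+ x zero j = sym (·-identityˡ _)
pw-+ x (suc i) j = cong (x ·_) (pw-+ x i j) ∙ sym (·-assoc x (pw x i) (pw x j))

pw-1 : ∀ k → pw 1ℚ k ≡ 1ℚ
pw-1 zero = refl
pw-1 (suc k) = ·-identityˡ _ ∙ pw-1 k

-- Bead configurations as vectors of an exterior algebra

-- It measures the distance from decreasing order, in which β-sets are written; its sign compares a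
-- bead list met during the recursion with the sorted one.
noninversions : List ℕ → ℕ
noninversions [] = 0
noninversions (x ∷ xs) = countB (x <ᵇ_) xs + noninversions xs

replaceℕ-∈ : ∀ k y as bs → Unique (as ++ k ∷ bs) → replaceℕ k y (as ++ k ∷ bs) ≡ as ++ y ∷ bs
replaceℕ-∈ k y as bs u = replaceℕ-mid k y as bs (All.tabulate (λ z∈ eq → before as u z∈ (sym eq))) (after as u)
  where
  before : ∀ as {z} → Unique (as ++ k ∷ bs) → z ∈ as → z ≢ k
  before (x ∷ as) (p ∷ u) (here refl) = All⇒∀∈ p (∈ₚ.∈-insert as)
  before (x ∷ as) (p ∷ u) (there z∈) = before as u z∈
  after : ∀ as → Unique (as ++ k ∷ bs) → All (k ≢_) bs
  after [] (p ∷ u) = p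
  after (x ∷ as) (p ∷ u) = after as u

between : ℕ → ℕ → ℕ → Bool
between c b z = (c <ᵇ z) ∧ (z <ᵇ b)

private
  tally : Bool → ℕ
  tally b = if b then 1 else 0

between-above : ∀ {c b z} → c < b → b ≢ z → c ≢ z → tally (c <ᵇ z) ≡ tally (between c b z) + tally (b <ᵇ z)
between-above {c} {b} {z} c<b b≢z c≢z with ℕₚ.<-cmp b z
... | tri≈ _ eq _ = ⊥-elim (b≢z eq)
... | tri< b<z _ _ rewrite <⇒<ᵇ (ℕₚ.<-trans c<b b<z) | ≥⇒<ᵇ-false (ℕₚ.<⇒≤ b<z) | <⇒<ᵇ b<z = refl
... | tri> _ _ z<b rewrite <⇒<ᵇ z<b | ≥⇒<ᵇ-false (ℕₚ.<⇒≤ z<b) | Boolₚ.∧-identityʳ (c <ᵇ z) = sym (ℕₚ.+-identityʳ _)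

between-below : ∀ {c b z} → c < b → b ≢ z → c ≢ z → tally (z <ᵇ b) ≡ tally (between c b z) + tally (z <ᵇ c)
between-below {c} {b} {z} c<b b≢z c≢z with ℕₚ.<-cmp z c
... | tri≈ _ eq _ = ⊥-elim (c≢z (sym eq))
... | tri< z<c _ _ rewrite <⇒<ᵇ z<c | <⇒<ᵇ (ℕₚ.<-trans z<c c<b) | ≥⇒<ᵇ-false (ℕₚ.<⇒≤ z<c) = refl
... | tri> _ _ c<z rewrite <⇒<ᵇ c<z | ≥⇒<ᵇ-false (ℕₚ.<⇒≤ c<z) = sym (ℕₚ.+-identityʳ _)

countB-between-above : ∀ {c b} xs → c < b → All (b ≢_) xs → All (c ≢_) xs → countB (c <ᵇ_) xs ≡ countB (between c b) xs + countB (b <ᵇ_) xs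
countB-between-above [] _ _ _ = refl
countB-between-above {c} {b} (x ∷ xs) c<b (p ∷ ps) (q ∷ qs) = trans (countB-∷ (c <ᵇ_) x xs) (cong₂ _+_ (between-above c<b p q) (countB-between-above xs c<b ps qs))
  ∙ ℕ-interchange (tally (between c b x)) _ _ _
  ∙ sym (cong₂ _+_ (countB-∷ (between c b) x xs) (countB-∷ (b <ᵇ_) x xs))
  where
  ℕ-interchange : ∀ a b c d → (a + b) + (c + d) ≡ (a + c) + (b + d)
  ℕ-interchange a b c d = ℕₚ.+-assoc a b (c + d) ∙ cong (a +_) (sym (ℕₚ.+-assoc b c d) ∙ cong (_+ d) (ℕₚ.+-comm b c) ∙ ℕₚ.+-assoc c b d) ∙ sym (ℕₚ.+-assoc a c (b + d))

countB-++ : ∀ {A : Set} (p : A → Bool) xs ys → countB p (xs ++ ys) ≡ countB p xs + countB p ys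
countB-++ p [] ys = refl
countB-++ p (x ∷ xs) ys = countB-∷ p x (xs ++ ys) ∙ cong ((if p x then 1 else 0) +_) (countB-++ p xs ys)
  ∙ sym (ℕₚ.+-assoc (if p x then 1 else 0) _ _) ∙ cong (_+ countB p ys) (sym (countB-∷ p x xs))

-- A bead that slides from b to c passes exactly the beads strictly between them, so the sorting
-- sign changes by the Murnaghan-Nakayama sign of the removed ribbon.
sgn-noninversions : ∀ as bs c b → c < b → All (b ≢_) (as ++ bs) → All (c ≢_) (as ++ bs) →
  sgn (noninversions (as ++ c ∷ bs)) ≡ sgn (countB (between c b) (as ++ b ∷ bs)) · sgn (noninversions (as ++ b ∷ bs))
sgn-noninversions [] bs c b c<b p q = cong (λ m → sgn (m + noninversions bs)) (countB-between-above bs c<b p q)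
  ∙ cong sgn (ℕₚ.+-assoc (countB (between c b) bs) _ _)
  ∙ sgn-+ (countB (between c b) bs) _
  ∙ cong (λ m → sgn m · sgn (countB (b <ᵇ_) bs + noninversions bs)) (sym itself)
  where
  itself : countB (between c b) (b ∷ bs) ≡ countB (between c b) bs
  itself = countB-∷ (between c b) b bs ∙ cong (λ d → tally d + countB (between c b) bs) (cong ((c <ᵇ b) ∧_) (≥⇒<ᵇ-false {b} ℕₚ.≤-refl) ∙ Boolₚ.∧-zeroʳ (c <ᵇ b))
sgn-noninversions (x ∷ as) bs c b c<b (p ∷ ps) (q ∷ qs) = trans (sgn-+ (countB (x <ᵇ_) (as ++ c ∷ bs)) _) (cong₂ _·_ (cong sgn (split c)) (sgn-noninversions as bs c b c<b ps qs))
  ∙ cong (_· (sgn B · sgn N)) (sgn-+ (tally (x <ᵇ c)) M)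
  ∙ cong (λ s → (s · sgn M) · (sgn B · sgn N)) flip
  ∙ ring145 _ _ _ _ _
  ∙ cong₂ _·_ (sym (cong sgn (countB-∷ (between c b) x (as ++ b ∷ bs)) ∙ sgn-+ (tally (between c b x)) B))
      (sym (sgn-+ (countB (x <ᵇ_) (as ++ b ∷ bs)) N ∙ cong (_· sgn N) (cong sgn (split b) ∙ sgn-+ (tally (x <ᵇ b)) M)))
  where
  B = countB (between c b) (as ++ b ∷ bs)
  N = noninversions (as ++ b ∷ bs)
  M = countB (x <ᵇ_) as + countB (x <ᵇ_) bs
  split : ∀ y → countB (x <ᵇ_) (as ++ y ∷ bs) ≡ tally (x <ᵇ y) + M
  split y = countB-↭ (x <ᵇ_) (Permₚ.shift y as bs) ∙ countB-∷ (x <ᵇ_) y (as ++ bs) ∙ cong (tally (x <ᵇ y) +_) (countB-++ (x <ᵇ_) as bs)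
  flip : sgn (tally (x <ᵇ c)) ≡ sgn (tally (between c b x)) · sgn (tally (x <ᵇ b))
  flip = sym (cong (sgn (tally (between c b x)) ·_) (cong sgn (between-below c<b p q) ∙ sgn-+ (tally (between c b x)) (tally (x <ᵇ c)))
    ∙ ring146 _ _ ∙ cong (_· sgn (tally (x <ᵇ c))) (sgn-square (tally (between c b x))) ∙ ·-identityˡ _)

Σ<-reverse : ∀ m f → Σ< m (λ i → f (m ∸ suc i)) ≡ Σ< m f
Σ<-reverse zero f = refl
Σ<-reverse (suc m) f = ⊹-comm _ _ ∙ cong (_⊹ f m) (Σ<-reverse m f) ∙ sym (Σ<-snoc m f)

Σ<-ℕtoℚ : ∀ m (f : ℕ → ℕ) → Σ< m (λ i → ℕtoℚ (f i)) ≡ ℕtoℚ (sum (applyUpTo f m))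
Σ<-ℕtoℚ zero f = refl
Σ<-ℕtoℚ (suc m) f = cong (ℕtoℚ (f 0) ⊹_) (Σ<-ℕtoℚ m (f ∘ suc)) ∙ sym (ℕtoℚ-⊹ (f 0) _)

increasing-sum : ∀ o ys → Increasing ys → All (o ≤_) ys → sum (applyUpTo (o +_) (length ys)) ≤ sum ys
increasing-sum o [] _ _ = z≤n
increasing-sum o (y ∷ ys) (p ∷ inc) (o≤y ∷ _) = ℕₚ.+-mono-≤ (subst (_≤ y) (sym (ℕₚ.+-identityʳ o)) o≤y)
  (subst (λ l → sum l ≤ sum ys) (shifted o (length ys)) (increasing-sum (suc o) ys inc (All.map (λ y<z → ℕₚ.≤-trans (s≤s o≤y) y<z) p)))
  where
  shifted : ∀ o m → applyUpTo (suc o +_) m ≡ applyUpTo (λ i → o + suc i) m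
  shifted o m = ext m (λ i → sym (ℕₚ.+-suc o i))
    where
    ext : ∀ {f g : ℕ → ℕ} m → (∀ i → f i ≡ g i) → applyUpTo f m ≡ applyUpTo g m
    ext zero eq = refl
    ext (suc m) eq = cong₂ _∷_ (eq 0) (ext m (eq ∘ suc))

-- Distinct numbers from o on reach the minimal sum only as an interval. It characterises the bead
-- configuration of the empty partition.
increasing-sum-max : ∀ o ys → Increasing ys → All (o ≤_) ys → sum ys ≤ sum (applyUpTo (o +_) (length ys)) → All (_< o + length ys) ys
increasing-sum-max o [] _ _ _ = []
increasing-sum-max o (y ∷ ys) (p ∷ inc) (o≤y ∷ _) le = subst (_< o + suc (length ys)) (sym y≡o) (subst (o <_) (sym (ℕₚ.+-suc o _)) (s≤s (ℕₚ.m≤m+n o _)))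
  ∷ subst (λ m → All (_< m) ys) (sym (ℕₚ.+-suc o (length ys))) (increasing-sum-max (suc o) ys inc ge tail≤)
  where
  ext : ∀ {f g : ℕ → ℕ} m → (∀ i → f i ≡ g i) → applyUpTo f m ≡ applyUpTo g m
  ext zero eq = refl
  ext (suc m) eq = cong₂ _∷_ (eq 0) (ext m (eq ∘ suc))
  S : ℕ
  S = sum (applyUpTo (suc o +_) (length ys))
  le′ : y + sum ys ≤ o + S
  le′ = subst (y + sum ys ≤_) (cong₂ _+_ (ℕₚ.+-identityʳ o) (cong sum (ext (length ys) (λ i → ℕₚ.+-suc o i)))) le
  ge : All (suc o ≤_) ys
  ge = All.map (λ y<z → ℕₚ.≤-trans (s≤s o≤y) y<z) p
  S≤ : S ≤ sum ys
  S≤ = increasing-sum (suc o) ys inc ge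
  y≡o : y ≡ o
  y≡o = ℕₚ.≤-antisym (ℕₚ.+-cancelʳ-≤ S y o (ℕₚ.≤-trans (ℕₚ.+-monoʳ-≤ y S≤) le′)) o≤y
  tail≤ : sum ys ≤ S
  tail≤ = ℕₚ.+-cancelˡ-≤ o (sum ys) S (ℕₚ.≤-trans (ℕₚ.+-monoˡ-≤ (sum ys) o≤y) le′)

increasing-bounded-length : ∀ m o ys → Increasing ys → All (o ≤_) ys → All (_< o + m) ys → length ys ≤ m
increasing-bounded-length m o [] _ _ _ = z≤n
increasing-bounded-length zero o (y ∷ ys) _ (o≤y ∷ _) (y< ∷ _) = ⊥-elim (ℕₚ.<-irrefl refl (ℕₚ.≤-trans (s≤s o≤y) (subst (y <_) (ℕₚ.+-identityʳ o) y<)))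
increasing-bounded-length (suc m) o (y ∷ ys) (p ∷ inc) (o≤y ∷ _) (_ ∷ bd) =
  s≤s (increasing-bounded-length m (suc o) ys inc (All.map (λ y<z → ℕₚ.≤-trans (s≤s o≤y) y<z) p) (subst (λ k → All (_< k) ys) (ℕₚ.+-suc o m) bd))

increasing-full : ∀ m o ys → Increasing ys → All (o ≤_) ys → All (_< o + m) ys → length ys ≡ m → ys ≡ applyUpTo (o +_) m
increasing-full zero o [] _ _ _ _ = refl
increasing-full (suc m) o (y ∷ ys) (p ∷ inc) (o≤y ∷ ge) (y< ∷ bd) len with o ℕₚ.≟ y
... | yes refl = cong₂ _∷_ (sym (ℕₚ.+-identityʳ o)) (increasing-full m (suc o) ys inc p (subst (λ k → All (_< k) ys) (ℕₚ.+-suc o m) bd) (ℕₚ.suc-injective len) ∙ ext m (λ i → sym (ℕₚ.+-suc o i)))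
  where
  ext : ∀ {f g : ℕ → ℕ} m → (∀ i → f i ≡ g i) → applyUpTo f m ≡ applyUpTo g m
  ext zero eq = refl
  ext (suc m) eq = cong₂ _∷_ (eq 0) (ext m (eq ∘ suc))
... | no o≢y = ⊥-elim (ℕₚ.<-irrefl refl (subst (_≤ m) len (increasing-bounded-length m (suc o) (y ∷ ys) (p ∷ inc)
    (o<y ∷ All.map (λ y<z → ℕₚ.≤-trans o<y (ℕₚ.<⇒≤ y<z)) p) (subst (λ k → All (_< k) (y ∷ ys)) (ℕₚ.+-suc o m) (y< ∷ bd)))))
  where
  o<y : o < y
  o<y = ℕₚ.≤∧≢⇒< o≤y o≢y

δ-scale : ∀ (φ : ℕ → ℚ) i j → φ j · δ i j ≡ φ i · δ i j
δ-scale φ i j with i ℕₚ.≟ j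
... | yes refl = refl
... | no ne = cong (φ j ·_) (δ-≢ {i} {j} ne) ∙ ·-zeroʳ _ ∙ sym (cong (φ i ·_) (δ-≢ {i} {j} ne) ∙ ·-zeroʳ _)

ones : ∀ {M} → Vec Bool M
ones {zero} = []
ones {suc M} = true ∷ ones

-- The average of the irreducible character against the graded traces

average-cong : ∀ n {f g : List ℕ → ℚ} → (∀ μ → f μ ≡ g μ) → average n f ≡ average n g
average-cong n eq = cong (invℚ (ℕtoℚ (n !)) ·_) (sumL-cong (decompositions n) (λ d → eq (map length (proj₁ d))))

average-zero : ∀ n → average n (λ _ → 0ℚ) ≡ 0ℚ
average-zero n = cong (invℚ (ℕtoℚ (n !)) ·_) (sumL-zero∈ (decompositions n) (λ _ _ → refl)) ∙ ·-zeroʳ _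

average-sumL : ∀ {A : Set} n (F : A → List ℕ → ℚ) bs → average n (λ μ → sumL (λ b → F b μ) bs) ≡ sumL (λ b → average n (F b)) bs
average-sumL n F [] = average-zero n
average-sumL n F (b ∷ bs) = average-⊹ n (F b) (λ μ → sumL (λ b → F b μ) bs) ∙ cong (average n (F b) ⊹_) (average-sumL n F bs)

ℤtoℚ-sumℤ : ∀ {A : Set} (f : A → ℤ.ℤ) xs → ℤtoℚ (sumℤ (map f xs)) ≡ sumL (λ x → ℤtoℚ (f x)) xs
ℤtoℚ-sumℤ f [] = refl
ℤtoℚ-sumℤ f (x ∷ xs) = ℤtoℚ-⊹ (f x) _ ∙ cong (ℤtoℚ (f x) ⊹_) (ℤtoℚ-sumℤ f xs)

opaque
  unfolding ℚ-ring

  ℤtoℚ-sign : ∀ k → ℤtoℚ (if evenB k then ℤ.+ 1 else ℤ.-_ (ℤ.+ 1)) ≡ sgn k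
  ℤtoℚ-sign k = push (evenB k) ∙ evenB-sgn k
    where
    push : ∀ b → ℤtoℚ (if b then ℤ.+ 1 else ℤ.-_ (ℤ.+ 1)) ≡ (if b then 1ℚ else ℚ.-_ 1ℚ)
    push true = refl
    push false = refl

-- The sign of the removal of a ribbon of length j + 1 ending at the bead b, or 0.
ribbon : List ℕ → ℕ → ℕ → ℚ
ribbon β j b = if (j <ᵇ b) ∧ not (elemB (b ∸ suc j) β) then sgn (countB (between (b ∸ suc j) b) β) else 0ℚ

mn-expand : ∀ β j μ → ℤtoℚ (mn β (suc j ∷ μ)) ≡ sumL (λ b → ribbon β j b · ℤtoℚ (mn (replaceℕ b (b ∸ suc j) β) μ)) β
mn-expand β j μ = ℤtoℚ-sumℤ _ β ∙ sumL-cong β (λ b → push ((j <ᵇ b) ∧ not (elemB (b ∸ suc j) β)) (countB (between (b ∸ suc j) b) β) (mn (replaceℕ b (b ∸ suc j) β) μ))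
  where
  push : ∀ d k z → ℤtoℚ (if d then ((if evenB k then ℤ.+ 1 else ℤ.-_ (ℤ.+ 1)) ℤ.* z) else ℤ.+ 0) ≡ (if d then sgn k else 0ℚ) · ℤtoℚ z
  push true k z = ℤtoℚ-· (if evenB k then ℤ.+ 1 else ℤ.-_ (ℤ.+ 1)) z ∙ cong (_· ℤtoℚ z) (ℤtoℚ-sign k)
  push false k z = sym (·-zeroˡ _)

Σ<-truncate : ∀ m b (f : ℕ → ℚ) → (∀ k → m ≤ k → k < b → f k ≡ 0ℚ) → Σ< m (λ k → (if k <ᵇ b then 1ℚ else 0ℚ) · f k) ≡ Σ< b f
Σ<-truncate zero b f z = sym (Σ<-zero b (λ k k<b → z k z≤n k<b))
Σ<-truncate (suc m) zero f z = Σ<-zero (suc m) {λ k → 0ℚ · f k} (λ k _ → ·-zeroˡ _)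
Σ<-truncate (suc m) (suc b) f z = cong₂ _⊹_ (·-identityˡ _) (Σ<-truncate m b (f ∘ suc) (λ k m≤k k<b → z (suc k) (s≤s m≤k) (s≤s k<b)))

-- The β-set of (λ₁ , λ₂ , 2^ℓ , 1^d)

-- The recursion of betaSet is local to its definition; unification
-- recovers it as the solution for the body of betaGo.
mutual
  betaGo : List ℕ → List ℕ → ℕ → List ℕ
  betaGo p xs r = _

  betaSet-∷ : ∀ x xs → betaSet (x ∷ xs) ≡ (x + length xs) ∷ betaGo (x ∷ xs) xs (length xs)
  betaSet-∷ x xs with x ∷ xs | length xs
  ... | p | r = refl

lowBeads : ℕ → ℕ → List ℕ
lowBeads zero zero = []
lowBeads zero (suc d) = suc d ∷ lowBeads zero d
lowBeads (suc ℓ) d = suc (suc (ℓ + d)) ∷ lowBeads ℓ d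

betaGo-low : ∀ p ℓ d → betaGo p (replicate ℓ 2 ++ replicate d 1) (ℓ + d) ≡ lowBeads ℓ d
betaGo-low p zero zero = refl
betaGo-low p zero (suc d) = cong (suc d ∷_) (betaGo-low p zero d)
betaGo-low p (suc ℓ) d = cong (suc (suc (ℓ + d)) ∷_) (betaGo-low p ℓ d)

length-columns : ∀ ℓ d → length (replicate ℓ 2 ++ replicate d 1) ≡ ℓ + d
length-columns ℓ d = Listₚ.length-++ (replicate ℓ 2) ∙ (cong₂ _+_ (Listₚ.length-replicate ℓ) (Listₚ.length-replicate d))

hookBeads : ℕ → ℕ → ℕ → ℕ → List ℕ
hookBeads λ₁ λ₂ ℓ d = (λ₁ + suc (ℓ + d)) ∷ (λ₂ + (ℓ + d)) ∷ lowBeads ℓ d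

betaSet-hook : ∀ λ₁ λ₂ ℓ d → betaSet (λ₁ ∷ λ₂ ∷ (replicate ℓ 2 ++ replicate d 1)) ≡ hookBeads λ₁ λ₂ ℓ d
betaSet-hook λ₁ λ₂ ℓ d = betaSet-∷ λ₁ (λ₂ ∷ (replicate ℓ 2 ++ replicate d 1))
  ∙ cong (λ m → (λ₁ + suc m) ∷ (λ₂ + m) ∷ betaGo (λ₁ ∷ λ₂ ∷ (replicate ℓ 2 ++ replicate d 1)) (replicate ℓ 2 ++ replicate d 1) m) (length-columns ℓ d)
    ∙ cong (λ l → (λ₁ + suc (ℓ + d)) ∷ (λ₂ + (ℓ + d)) ∷ l) (betaGo-low (λ₁ ∷ λ₂ ∷ (replicate ℓ 2 ++ replicate d 1)) ℓ d)

lowBeads-bounded : ∀ ℓ d → All (_< suc (suc (ℓ + d))) (lowBeads ℓ d)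
lowBeads-bounded zero zero = []
lowBeads-bounded zero (suc d) = s≤s (s≤s (ℕₚ.n≤1+n d)) ∷ All.map (λ p → ℕₚ.≤-trans p (ℕₚ.n≤1+n _)) (lowBeads-bounded zero d)
lowBeads-bounded (suc ℓ) d = ℕₚ.≤-refl ∷ All.map (λ p → ℕₚ.≤-trans p (ℕₚ.n≤1+n _)) (lowBeads-bounded ℓ d)

columnBeads-bounded : ∀ d → All (_< suc d) (lowBeads zero d)
columnBeads-bounded zero = []
columnBeads-bounded (suc d) = ℕₚ.≤-refl ∷ All.map (λ p → ℕₚ.≤-trans p (ℕₚ.n≤1+n _)) (columnBeads-bounded d)

Decreasing : List ℕ → Set
Decreasing = AllPairs (λ x y → y < x)

lowBeads-decreasing : ∀ ℓ d → Decreasing (lowBeads ℓ d)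
lowBeads-decreasing zero zero = []
lowBeads-decreasing zero (suc d) = columnBeads-bounded d ∷ lowBeads-decreasing zero d
lowBeads-decreasing (suc ℓ) d = lowBeads-bounded ℓ d ∷ lowBeads-decreasing ℓ d

hookBeads-decreasing : ∀ {λ₁ λ₂} ℓ d → 2 ≤ λ₂ → λ₂ ≤ λ₁ → Decreasing (hookBeads λ₁ λ₂ ℓ d)
hookBeads-decreasing {λ₁} {λ₂} ℓ d 2≤λ₂ λ₂≤λ₁ =
  (second<first ∷ All.map (λ p → ℕₚ.<-trans p (ℕₚ.≤-trans (s≤s above) second<first)) (lowBeads-bounded ℓ d))
    ∷ All.map (λ p → ℕₚ.≤-trans p above) (lowBeads-bounded ℓ d) ∷ lowBeads-decreasing ℓ d
  where
  above : suc (suc (ℓ + d)) ≤ λ₂ + (ℓ + d)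
  above = ℕₚ.+-monoˡ-≤ (ℓ + d) 2≤λ₂
  second<first : λ₂ + (ℓ + d) < λ₁ + suc (ℓ + d)
  second<first = subst (λ₂ + (ℓ + d) <_) (sym (ℕₚ.+-suc λ₁ (ℓ + d))) (s≤s (ℕₚ.+-monoˡ-≤ (ℓ + d) λ₂≤λ₁))

Decreasing⇒Unique : ∀ {xs} → Decreasing xs → Unique xs
Decreasing⇒Unique [] = []
Decreasing⇒Unique (p ∷ d) = All.map (λ y<x eq → ℕₚ.<-irrefl (sym eq) y<x) p ∷ Decreasing⇒Unique d

noninversions-decreasing : ∀ {xs} → Decreasing xs → noninversions xs ≡ 0
noninversions-decreasing [] = refl
noninversions-decreasing {x ∷ xs} (p ∷ d) = cong₂ _+_ (none xs p) (noninversions-decreasing d)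
  where
  none : ∀ ys → All (_< x) ys → countB (x <ᵇ_) ys ≡ 0
  none [] _ = refl
  none (y ∷ ys) (y<x ∷ q) = countB-∷ (x <ᵇ_) y ys ∙ (cong₂ _+_ (cong (if_then 1 else 0) (≥⇒<ᵇ-false (ℕₚ.<⇒≤ y<x))) (none ys q))

length-lowBeads : ∀ ℓ d → length (lowBeads ℓ d) ≡ ℓ + d
length-lowBeads zero zero = refl
length-lowBeads zero (suc d) = cong suc (length-lowBeads zero d)
length-lowBeads (suc ℓ) d = cong suc (length-lowBeads ℓ d)

sum-upTo-suc : ∀ m → sum (upTo (suc m)) ≡ m + sum (upTo m)
sum-upTo-suc m = cong sum (sym (Listₚ.upTo-∷ʳ m)) ∙ sum-↭ (↭-sym (Permₚ.∷↭∷ʳ m (upTo m)))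

sum-lowBeads : ∀ ℓ d → sum (lowBeads ℓ d) ≡ (2 * ℓ + d) + sum (upTo (ℓ + d))
sum-lowBeads zero zero = refl
sum-lowBeads zero (suc d) = cong (suc d +_) (sum-lowBeads zero d) ∙ trans (cong suc (ℕ-swap d d _ ∙ refl)) (cong (suc d +_) (sym (sum-upTo-suc d)))
  where
  ℕ-swap : ∀ a b c → a + (b + c) ≡ b + (a + c)
  ℕ-swap = ℕSolver.solve-∀
sum-lowBeads (suc ℓ) d = cong (suc (suc (ℓ + d)) +_) (sum-lowBeads ℓ d) ∙ trans (rearrange ℓ d (sum (upTo (ℓ + d)))) (cong ((2 * suc ℓ + d) +_) (sym (sum-upTo-suc (ℓ + d))))
  where
  rearrange : ∀ ℓ d s → suc (suc (ℓ + d)) + ((2 * ℓ + d) + s) ≡ (2 * suc ℓ + d) + ((ℓ + d) + s)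
  rearrange = ℕSolver.solve-∀

sum-hookBeads : ∀ λ₁ λ₂ ℓ d → sum (hookBeads λ₁ λ₂ ℓ d) ≡ (d + (2 * ℓ + λ₁ + λ₂)) + sum (upTo (suc (suc (ℓ + d))))
sum-hookBeads λ₁ λ₂ ℓ d = cong (λ s → (λ₁ + suc (ℓ + d)) + ((λ₂ + (ℓ + d)) + s)) (sum-lowBeads ℓ d)
  ∙ rearrange λ₁ λ₂ ℓ d (sum (upTo (ℓ + d)))
    ∙ cong ((d + (2 * ℓ + λ₁ + λ₂)) +_) (sym (sum-upTo-suc (suc (ℓ + d)) ∙ cong (suc (ℓ + d) +_) (sum-upTo-suc (ℓ + d))))
  where
  rearrange : ∀ λ₁ λ₂ ℓ d s → (λ₁ + suc (ℓ + d)) + ((λ₂ + (ℓ + d)) + ((2 * ℓ + d) + s)) ≡ (d + (2 * ℓ + λ₁ + λ₂)) + (suc (ℓ + d) + ((ℓ + d) + s))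
  rearrange = ℕSolver.solve-∀

-- Complements of the β-set: the free coordinates are ℓ and ℓ + d + 1.

columnHole : ∀ d → Vec Bool (suc d)
columnHole zero = false ∷ []
columnHole (suc d) = true ∷ columnHole d

holes : ∀ ℓ d → Vec Bool (suc (suc (ℓ + d)))
holes zero d = false ∷ columnHole d
holes (suc ℓ) d = true ∷ holes ℓ d

reversed : ℕ → List ℕ → List ℕ
reversed m = map (λ b → m ∸ suc b)

reversed-suc : ∀ m xs → All (_< m) xs → reversed (suc m) xs ≡ map suc (reversed m xs)
reversed-suc m [] _ = refl
reversed-suc m (x ∷ xs) (x<m ∷ p) = cong₂ _∷_ (suc-∸-suc x<m) (reversed-suc m xs p)

reversed-column : ∀ d → reversed (suc d) (lowBeads zero d) ≡ mono (columnHole d)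
reversed-column zero = refl
reversed-column (suc d) = cong₂ _∷_ (ℕₚ.n∸n≡0 d) (reversed-suc (suc d) (lowBeads zero d) (columnBeads-bounded d) ∙ cong (map suc) (reversed-column d))

reversed-low : ∀ ℓ d → reversed (suc (suc (ℓ + d))) (lowBeads ℓ d) ≡ mono (holes ℓ d)
reversed-low zero d = reversed-suc (suc d) (lowBeads zero d) (columnBeads-bounded d) ∙ cong (map suc) (reversed-column d)
reversed-low (suc ℓ) d = cong₂ _∷_ (ℕₚ.n∸n≡0 (ℓ + d)) (reversed-suc (suc (suc (ℓ + d))) (lowBeads ℓ d) (lowBeads-bounded ℓ d) ∙ cong (map suc) (reversed-low ℓ d))

C-columnHole : ∀ d w → C w (e (columnHole d)) ones ≡ sgn d · w d
C-columnHole zero w = ring162 _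
C-columnHole (suc d) w = cong (λ t → w 0 · 0ℚ − t) (C-columnHole d (w ∘ suc)) ∙ ring163 _ _ _

-- Only the components of w and z at the two free coordinates reach the top monomial, which leaves a
-- minor. Both factors pass the first ℓ generators, without a net sign; just one of them passes the
-- d generators between the holes.
CC-holes : ∀ ℓ d w z → C w (C z (e (holes ℓ d))) ones ≡ sgn d · (w ℓ · z (ℓ + suc d) − z ℓ · w (ℓ + suc d))
CC-holes zero d w z = cong (λ t → w 0 · C (z ∘ suc) (e (columnHole d)) ones − t)
      (resp (C-Linear (w ∘ suc)) (λ β → trans (cong (λ t → z 0 · e (columnHole d) β − t) (zer (C-Linear (z ∘ suc)) β)) (ring61 _)) ones
      ∙ mul (C-Linear (w ∘ suc)) (z 0) (e (columnHole d)) ones)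
  ∙ cong₂ (λ a b → w 0 · a − z 0 · b) (C-columnHole d (z ∘ suc)) (C-columnHole d (w ∘ suc))
  ∙ ring164 _ _ _ _ _
CC-holes (suc ℓ) d w z = cong₂ (λ a b → w 0 · a − b) (zer (C-Linear {suc (suc (ℓ + d))} (z ∘ suc)) ones)
      (resp (C-Linear (w ∘ suc)) {y = (− 1ℚ) ·ᵥ C (z ∘ suc) (e (holes ℓ d))} (λ β → ring165 (z 0) (C (z ∘ suc) (e (holes ℓ d)) β)) ones ∙ mul (C-Linear (w ∘ suc)) (− 1ℚ) (C (z ∘ suc) (e (holes ℓ d))) ones)
  ∙ ring166 _ _
  ∙ CC-holes ℓ d (w ∘ suc) (z ∘ suc)

-- Hook Schur functions of the superalphabet in closed form.

module Hooks (u v : ℚ) (uv≢1 : u · v ≢ 1ℚ) (u≢v : u ≢ v) where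

  i₁ i₂ : ℚ
  i₁ = invℚ (1ℚ − u · v)
  i₂ = invℚ (u − v)

  −≢0 : ∀ {x y} → x ≢ y → x − y ≢ 0ℚ
  −≢0 {x} {y} ne eq = ne (ring104 x y ∙ cong (_⊹ y) eq ∙ ⊹-identityˡ y)

  i₁-inverse : i₁ · (1ℚ − u · v) ≡ 1ℚ
  i₁-inverse = ·-inverseˡ _ (−≢0 (λ eq → uv≢1 (sym eq)))

  i₂-inverse : i₂ · (u − v) ≡ 1ℚ
  i₂-inverse = ·-inverseˡ _ (−≢0 u≢v)

  -- The power sum p_{k+1}: the trace of a (k+1)-cycle, graded by u and v.
  P : ℕ → ℚ
  P k = (1ℚ ⊹ sgn k · pw u (suc k)) · (1ℚ ⊹ sgn k · pw v (suc k))

  -- The generating functions are (1 + u z) (1 + v z) / ((1 - z) (1 - u v z)) for the complete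
  -- functions and, with the two kinds of letters exchanged, (1 + z) (1 + u v z) / ((1 - u z) (1 - v
  -- z)) for the elementary ones.
  hs es : ℕ → ℚ
  hs = fac u (fac v (geo 1ℚ (geo (u · v) unit)))
  es = fac 1ℚ (fac (u · v) (geo u (geo v unit)))

  Newton-hs : Newton P hs
  Newton-hs m = Newton-fac u (Newton-fac v (Newton-geo 1ℚ (Newton-geo (u · v) Newton-unit))) m
    ∙ Σ<-cong m (λ k → cong (_· hs (m ∸ suc k)) (power k))
    where
    power : ∀ k → (((0ℚ ⊹ pw (u · v) (suc k)) ⊹ pw 1ℚ (suc k)) − pw (− v) (suc k)) − pw (− u) (suc k) ≡ P k
    power k = cong₂ (λ x y → (((0ℚ ⊹ x) ⊹ y) − pw (− v) (suc k)) − pw (− u) (suc k)) (pw-· u v (suc k)) (pw-1 (suc k))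
      ∙ cong₂ (λ x y → (((0ℚ ⊹ pw u (suc k) · pw v (suc k)) ⊹ 1ℚ) − x) − y) (pw-neg v (suc k)) (pw-neg u (suc k))
      ∙ ring117 (sgn k) (pw u (suc k)) (pw v (suc k)) ∙ sym (ring118 _ _ _ ∙ cong (λ t → 1ℚ ⊹ sgn k · pw u (suc k) ⊹ sgn k · pw v (suc k) ⊹ t) (cong (_· (pw u (suc k) · pw v (suc k))) (sgn-square k) ∙ ·-identityˡ _))

  Pᵉ : ℕ → ℚ
  Pᵉ k = sgn k · P k

  Newton-es : Newton Pᵉ es
  Newton-es m = Newton-fac 1ℚ (Newton-fac (u · v) (Newton-geo u (Newton-geo v Newton-unit))) m
    ∙ Σ<-cong m (λ k → cong (_· es (m ∸ suc k)) (power k))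
    where
    power : ∀ k → (((0ℚ ⊹ pw v (suc k)) ⊹ pw u (suc k)) − pw (− (u · v)) (suc k)) − pw (− 1ℚ) (suc k) ≡ Pᵉ k
    power k = cong₂ (λ x y → (((0ℚ ⊹ pw v (suc k)) ⊹ pw u (suc k)) − x) − y)
        (pw-neg (u · v) (suc k) ∙ cong (sgn (suc k) ·_) (pw-· u v (suc k))) (pw-neg 1ℚ (suc k) ∙ cong (sgn (suc k) ·_) (pw-1 (suc k)))
      ∙ ring119 (sgn k) (pw u (suc k)) (pw v (suc k)) ∙ sym (ring120 _ _ _
        ∙ cong (λ t → sgn k ⊹ t · pw u (suc k) ⊹ t · pw v (suc k) ⊹ t · (sgn k · (pw u (suc k) · pw v (suc k)))) (sgn-square k) ∙ ring121 _ _ _)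

  private
    S₁ : ℕ → ℚ
    S₁ = geo 1ℚ (geo (u · v) unit)
    T₁ : ℕ → ℚ
    T₁ = geo u (geo v unit)

    geo-unit : ∀ a m → geo a unit m ≡ pw a m
    geo-unit a zero = refl
    geo-unit a (suc m) = ⊹-identityˡ _ ∙ cong (a ·_) (geo-unit a m)

  S-closed : ∀ m → (1ℚ − u · v) · S₁ m ≡ 1ℚ − (u · v) · pw (u · v) m
  S-closed zero = ring122 _
  S-closed (suc m) = cong (λ t → (1ℚ − u · v) · (t ⊹ 1ℚ · S₁ m)) (geo-unit (u · v) (suc m)) ∙ ring123 _ _ _ ∙ cong ((1ℚ − u · v) · (u · v · pw (u · v) m) ⊹_) (S-closed m) ∙ ring124 _ _

  T-closed : ∀ m → (u − v) · T₁ m ≡ u · pw u m − v · pw v m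
  T-closed zero = ring125 _ _
  T-closed (suc m) = cong (λ t → (u − v) · (t ⊹ u · T₁ m)) (geo-unit v (suc m)) ∙ ring126 _ _ _ _ ∙ cong (λ t → (u − v) · (v · pw v m) ⊹ u · t) (T-closed m) ∙ ring127 _ _ _ _

  -- Extended to index 0 the closed form would give 0, whereas `hs` is 1 there; hence the shifted
  -- index.
  hs-closed : ∀ m → hs (suc m) ≡ i₁ · ((1ℚ ⊹ u) · (1ℚ ⊹ v) · (1ℚ − (u · v) · pw (u · v) m))
  hs-closed m = ·-cancelˡ (1ℚ − u · v) (−≢0 (λ eq → uv≢1 (sym eq))) (direct m ∙ sym (ring39 _ _ _ ∙ cong (_· ((1ℚ ⊹ u) · (1ℚ ⊹ v) · (1ℚ − (u · v) · pw (u · v) m))) i₁-inverse ∙ ·-identityˡ _))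
    where
    direct : ∀ m → (1ℚ − u · v) · hs (suc m) ≡ (1ℚ ⊹ u) · (1ℚ ⊹ v) · (1ℚ − (u · v) · pw (u · v) m)
    direct zero = ring128 u v (1ℚ − u · v) (S₁ 1) ∙ cong (_⊹ (1ℚ − u · v) · (u ⊹ v)) (S-closed 1) ∙ ring129 u v
    direct (suc m) = ring130 u v (1ℚ − u · v) (S₁ (suc (suc m))) (S₁ (suc m)) (S₁ m)
      ∙ cong₂ (λ x y → x ⊹ (u ⊹ v) · y ⊹ (u · v) · ((1ℚ − u · v) · S₁ m)) (S-closed (suc (suc m))) (S-closed (suc m))
      ∙ cong (λ z → (1ℚ − (u · v) · pw (u · v) (suc (suc m))) ⊹ (u ⊹ v) · (1ℚ − (u · v) · pw (u · v) (suc m)) ⊹ (u · v) · z) (S-closed m) ∙ ring131 u v (pw (u · v) m)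

  es-closed : ∀ m → es (suc m) ≡ i₂ · ((1ℚ ⊹ u) · (1ℚ ⊹ v) · (u · pw u m − v · pw v m))
  es-closed m = ·-cancelˡ (u − v) (−≢0 u≢v) (direct m ∙ sym (ring39 _ _ _ ∙ cong (_· ((1ℚ ⊹ u) · (1ℚ ⊹ v) · (u · pw u m − v · pw v m))) i₂-inverse ∙ ·-identityˡ _))
    where
    direct : ∀ m → (u − v) · es (suc m) ≡ (1ℚ ⊹ u) · (1ℚ ⊹ v) · (u · pw u m − v · pw v m)
    direct zero = ring132 u v (u − v) (T₁ 1) ∙ cong (_⊹ (u − v) · (1ℚ ⊹ u · v)) (T-closed 1) ∙ ring133 u v
    direct (suc m) = ring134 u v (u − v) (T₁ (suc (suc m))) (T₁ (suc m)) (T₁ m)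
      ∙ cong₂ (λ x y → x ⊹ (1ℚ ⊹ u · v) · y ⊹ (u · v) · ((u − v) · T₁ m)) (T-closed (suc (suc m))) (T-closed (suc m))
      ∙ cong (λ z → (u · pw u (suc (suc m)) − v · pw v (suc (suc m))) ⊹ (1ℚ ⊹ u · v) · (u · pw u (suc m) − v · pw v (suc m)) ⊹ (u · v) · z) (T-closed m) ∙ ring135 u v (pw u m) (pw v m)

  -- The hook Schur function s_(x|y) = Σᵢ (-1)ⁱ h_{x+1+i} e_{y-i} in closed form.
  core : ℚ → ℚ → ℚ → ℚ
  core X U V′ = (u · (1ℚ ⊹ v)) · U − (v · (1ℚ ⊹ u)) · V′ ⊹ (u · v) · X · ((1ℚ ⊹ v) · V′ − (1ℚ ⊹ u) · U)

  Gh : ℕ → ℕ → ℚ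
  Gh x y = (i₁ · i₂ · ((1ℚ ⊹ u) · (1ℚ ⊹ v))) · core (pw (u · v) x) (pw u y) (pw v y)

  Gh-row : ∀ x → Gh x 0 ≡ hs (suc x)
  Gh-row x = ring136 _ _ _ _ _ ∙ cong (_· (i₁ · ((1ℚ ⊹ u) · (1ℚ ⊹ v) · (1ℚ − (u · v) · pw (u · v) x)))) i₂-inverse ∙ ·-identityˡ _ ∙ sym (hs-closed x)

  Gh-column : ∀ y → Gh 0 y ≡ es (suc y)
  Gh-column y = ring137 _ _ _ _ _ _ ∙ cong (_· (i₂ · ((1ℚ ⊹ u) · (1ℚ ⊹ v) · (u · pw u y − v · pw v y)))) i₁-inverse ∙ ·-identityˡ _ ∙ sym (es-closed y)

  Gh-step : ∀ x y → Gh x (suc y) ≡ hs (suc x) · es (suc y) − Gh (suc x) y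
  Gh-step x y = ring138 _ _ _ _ _ _ _ ∙ cong (_− Gh (suc x) y) (sym (cong₂ _·_ (hs-closed x) (es-closed y)))

  -- Murnaghan–Nakayama for hooks: remove a ribbon from the arm, from the leg,
  -- or the whole hook.
  hook-rule : ∀ y x → ℕtoℚ (suc (x + y)) · Gh x y ≡ conv P x (λ j → Gh j y) ⊹ conv Pᵉ y (Gh x) ⊹ sgn y · P (x + y)
  hook-rule zero x = cong₂ (λ m z → ℕtoℚ (suc m) · z) (ℕₚ.+-identityʳ x) (Gh-row x)
    ∙ Newton-hs (suc x)
    ∙ Σ<-snoc x (λ k → P k · hs (x ∸ k))
    ∙ cong₂ _⊹_ (Σ<-cong< x (λ k k<x → cong (P k ·_) (cong hs (suc-∸-suc k<x) ∙ sym (Gh-row (x ∸ suc k))))) (cong (λ m → P x · hs m) (ℕₚ.n∸n≡0 x))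
    ∙ ring139 _ _
    ∙ cong (λ m → conv P x (λ j → Gh j 0) ⊹ 0ℚ ⊹ 1ℚ · P m) (sym (ℕₚ.+-identityʳ x))
  -- By `Gh-step` the hook is a product h e minus a hook with shorter leg and longer arm. The size
  -- splits as `suc x + suc y`, one part for the Newton identity of h and one for that of e; the
  -- whole-hook term reappears with opposite sign.
  hook-rule (suc y) x = cong₂ (λ m z → ℕtoℚ m · z) (cong suc (ℕₚ.+-suc x y)) (Gh-step x y)
    ∙ ring140 _ _ _ ∙ (cong₂ _−_ (cong (_· (hs (suc x) · es (suc y))) (cong ℕtoℚ (sym (ℕₚ.+-suc (suc x) y)) ∙ ℕtoℚ-⊹ (suc x) (suc y))) (hook-rule y (suc x)))
    ∙ ring141 _ _ _ _ _ _ _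
    ∙ cong₂ _⊹_ (cong₂ _⊹_ arm leg) (ring36 _ _ ∙ cong (λ m → (− sgn y) · P m) (sym (ℕₚ.+-suc x y)))
    where
    Σ-sub : ∀ m (f g : ℕ → ℚ) → Σ< m f − Σ< m g ≡ Σ< m (λ k → f k − g k)
    Σ-sub m f g = sym (Σ<-⊹ m f (λ k → − g k) ∙ cong (Σ< m f ⊹_) (Σ<-neg m g))
    arm : (ℕtoℚ (suc x) · hs (suc x)) · es (suc y) − conv P (suc x) (λ j → Gh j y) ≡ conv P x (λ j → Gh j (suc y))
    arm = cong (_− conv P (suc x) (λ j → Gh j y)) (cong (_· es (suc y)) (Newton-hs (suc x)) ∙ ·-comm _ _ ∙ sym (Σ<-· (suc x) (es (suc y)) (λ k → P k · hs (x ∸ k))))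
      ∙ Σ-sub (suc x) (λ k → es (suc y) · (P k · hs (x ∸ k))) (λ k → P k · Gh (x ∸ k) y)
          ∙ Σ<-cong (suc x) (λ k → trans (cong (_− P k · Gh (x ∸ k) y) (·-comm (es (suc y)) (P k · hs (x ∸ k)))) (ring19 (P k) (hs (x ∸ k)) (es (suc y)) (Gh (x ∸ k) y)))
      ∙ Σ<-snoc x (λ k → P k · (hs (x ∸ k) · es (suc y) − Gh (x ∸ k) y))
      ∙ cong₂ _⊹_ (Σ<-cong< x (λ k k<x → cong (P k ·_) (cong (λ m → hs m · es (suc y) − Gh m y) (suc-∸-suc k<x) ∙ sym (Gh-step (x ∸ suc k) y))))
          (cong (P x ·_) (cong (λ m → hs m · es (suc y) − Gh m y) (ℕₚ.n∸n≡0 x) ∙ cong (λ t → 1ℚ · es (suc y) − t) (Gh-column y)))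
      ∙ ring142 _ _ _
    leg : hs (suc x) · (ℕtoℚ (suc y) · es (suc y)) − conv Pᵉ y (Gh (suc x)) ≡ conv Pᵉ (suc y) (Gh x)
    leg = cong (λ t → hs (suc x) · t − conv Pᵉ y (Gh (suc x))) (Newton-es (suc y) ∙ Σ<-snoc y (λ k → Pᵉ k · es (y ∸ k)) ∙ cong (λ m → Σ< y (λ k → Pᵉ k · es (y ∸ k)) ⊹ Pᵉ y · es m) (ℕₚ.n∸n≡0 y))
      ∙ cong (_− conv Pᵉ y (Gh (suc x))) (ring143 _ _ _) ∙ ring144 _ _ _
      ∙ cong₂ _⊹_ (cong (_− conv Pᵉ y (Gh (suc x))) (sym (Σ<-· y (hs (suc x)) (λ k → Pᵉ k · es (y ∸ k)))) ∙ Σ-sub y (λ k → hs (suc x) · (Pᵉ k · es (y ∸ k))) (λ k → Pᵉ k · Gh (suc x) (y ∸ suc k))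
          ∙ Σ<-cong< y (λ k k<y → trans (ring6 (hs (suc x)) (Pᵉ k) (es (y ∸ k)) (Gh (suc x) (y ∸ suc k))) (cong (Pᵉ k ·_) (cong (λ m → hs (suc x) · es m − Gh (suc x) (y ∸ suc k)) (suc-∸-suc k<y)
          ∙ sym (Gh-step x (y ∸ suc k)) ∙ cong (Gh x) (sym (suc-∸-suc k<y)))))) (cong (Pᵉ y ·_) (sym (Gh-row x) ∙ cong (Gh x) (sym (ℕₚ.n∸n≡0 y))))
      ∙ sym (Σ<-snoc y (λ k → Pᵉ k · Gh x (y ∸ k)))

  -- Beads as vectors and the Murnaghan-Nakayama recursion.

  module Beads (r : ℕ) where

    Γ : ℕ → ℕ → ℚ
    Γ x y = sgn y · Gh x y

    -- The hook rule with the sign of the leg absorbed: the leg sum becomes a convolution with `P`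
    -- itself, on the other side, and the whole-hook term loses its sign. In this form arms and legs
    -- can be read as bead positions and coordinates.
    Γ-rule : ∀ x y → conv P x (λ j → Γ j y) ⊹ P (x + y) ≡ ℕtoℚ (suc (x + y)) · Γ x y ⊹ conv P y (Γ x)
    Γ-rule x y = sym (cong (_⊹ conv P y (Γ x)) (ring2 _ _ _ ∙ cong (sgn y ·_) (hook-rule y x))
      ∙ ring147 _ _ _ _ _
      ∙ cong₂ (λ a b → a ⊹ b · P (x + y) ⊹ (sgn y · conv Pᵉ y (Gh x) ⊹ conv P y (Γ x))) arm (sgn-square y)
      ∙ cong (λ t → conv P x (λ j → Γ j y) ⊹ 1ℚ · P (x + y) ⊹ (t ⊹ conv P y (Γ x))) leg
      ∙ ring148 _ _ _)
      where
      arm : sgn y · conv P x (λ j → Gh j y) ≡ conv P x (λ j → Γ j y)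
      arm = sym (Σ<-· x (sgn y) (λ k → P k · Gh (x ∸ suc k) y)) ∙ Σ<-cong x (λ k → ring2 (sgn y) (P k) (Gh (x ∸ suc k) y))
      leg : sgn y · conv Pᵉ y (Gh x) ≡ − conv P y (Γ x)
      leg = sym (Σ<-· y (sgn y) (λ k → Pᵉ k · Gh x (y ∸ suc k))) ∙ trans (Σ<-cong< y term) (Σ<-neg y (λ k → P k · Γ x (y ∸ suc k)))
        where
        term : ∀ k → k < y → sgn y · (Pᵉ k · Gh x (y ∸ suc k)) ≡ − (P k · Γ x (y ∸ suc k))
        term k k<y = cong (_· (Pᵉ k · Gh x (y ∸ suc k))) (cong sgn (sym (cong (k +_) (sym (suc-∸-suc k<y)) ∙ ℕₚ.m+[n∸m]≡n (ℕₚ.<⇒≤ k<y))) ∙ sgn-+ k (suc (y ∸ suc k)))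
          ∙ ring149 (sgn k) (sgn (y ∸ suc k)) (P k) (Gh x (y ∸ suc k)) ∙ cong (_· (− (P k · Γ x (y ∸ suc k)))) (sgn-square k) ∙ ·-identityˡ _

    -- A bead below r is a basis vector (read from above); a bead at r + x
    -- is expanded in the beads below r.
    wt : ℕ → ℕ → ℚ
    wt b = if b <ᵇ r then δ (r ∸ suc b) else Γ (b ∸ r)

    wt-low : ∀ {b} → b < r → wt b ≡ δ (r ∸ suc b)
    wt-low {b} b<r = cong (if_then δ (r ∸ suc b) else Γ (b ∸ r)) (<⇒<ᵇ b<r)

    wt-high : ∀ x → wt (r + x) ≡ Γ x
    wt-high x = cong (if_then δ (r ∸ suc (r + x)) else Γ (r + x ∸ r)) (≥⇒<ᵇ-false (ℕₚ.m≤m+n r x)) ∙ cong Γ (ℕₚ.m+n∸m≡n r x)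

    -- Made so that sliding bead b down in all ways, weighted by power sums, gives b times the bead
    -- minus `Ĝ` of it, see `wt-rule`. It is triangular, and its diagonal entry `r ∸ suc y` is the
    -- position of the bead that coordinate y stands for.
    Ĝ : (ℕ → ℚ) → ℕ → ℚ
    Ĝ w y = ℕtoℚ (r ∸ suc y) · w y − conv P y w

    δ-∸ : ∀ m j k → k ≤ m + j → δ m (m + j ∸ k) ≡ δ j k
    δ-∸ m j k k≤ with j ℕₚ.≟ k
    ... | yes refl = cong (δ m) (ℕₚ.m+n∸n≡m m j) ∙ δ-refl m ∙ sym (δ-refl j)
    ... | no j≢k = δ-≢ {m} {m + j ∸ k} (λ eq → j≢k (ℕₚ.+-cancelˡ-≡ m j k (sym (ℕₚ.m∸n+n≡m k≤) ∙ cong (_+ k) (sym eq)))) ∙ sym (δ-≢ {j} {k} j≢k)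

    δ-conv : ∀ b m y → y < suc b + m → Σ< b (λ k → P k · δ (m + suc k) y) ≡ conv P y (δ m)
    δ-conv b m y y< with ℕₚ.<-≤-connex m y
    ... | inj₂ y≤m = Σ<-zero b (λ k _ → trans (cong (P k ·_) (δ-≢ {m + suc k} {y} (λ eq → ℕₚ.<-irrefl (sym eq) (ℕₚ.≤-trans (s≤s y≤m) (subst (suc m ≤_) (sym (ℕₚ.+-suc m k)) (s≤s (ℕₚ.m≤m+n m k))))))) (·-zeroʳ _))
      ∙ sym (Σ<-zero y (λ k k<y → trans (cong (P k ·_) (δ-≢ {m} {y ∸ suc k} (λ eq → ℕₚ.<-irrefl (sym eq) (ℕₚ.≤-trans (ℕₚ.≤-reflexive (sym (suc-∸-suc k<y))) (ℕₚ.≤-trans (ℕₚ.m∸n≤m y k) y≤m))))) (·-zeroʳ _)))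
    ... | inj₁ m<y with ℕₚ.m≤n⇒∃[o]m+o≡n m<y
    ... | j , refl = Σ<-cong b (λ k → trans (cong (P k ·_) (cong (λ z → δ z (suc m + j)) (ℕₚ.+-suc m k) ∙ shift m k j ∙ δ-sym k j)) (·-comm _ _))
      ∙ Σ<-δ b P (ℕₚ.+-cancelʳ-< m j b (subst (_< b + m) (ℕₚ.+-comm m j) (ℕₚ.+-cancelˡ-< 1 (m + j) (b + m) y<)))
      ∙ sym (Σ<-δ (suc m + j) P (s≤s (ℕₚ.m≤n+m j m)))
      ∙ Σ<-cong< (suc m + j) (λ { k (s≤s k≤) → trans (·-comm _ _) (cong (P k ·_) (sym (δ-∸ m j k k≤))) })
      where
      shift : ∀ m k j → δ (m + k) (m + j) ≡ δ k j
      shift zero k j = refl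
      shift (suc m) k j = shift m k j

    wt-rule-low : ∀ b y → y < r → b < r → Σ< b (λ k → P k · wt (b ∸ suc k) y) ≡ ℕtoℚ b · wt b y − Ĝ (wt b) y
    wt-rule-low b y y<r b<r = Σ<-cong< b (λ k k<b → cong (P k ·_) (cong (λ f → f y) (wt-low (ℕₚ.≤-trans (s≤s (ℕₚ.m∸n≤m b (suc k))) b<r)) ∙ cong (λ z → δ z y) (coordinate′ k k<b)))
      ∙ δ-conv b m y (subst (y <_) r≡ y<r)
      ∙ ring150 _ _ ∙ cong (λ t → t − (ℕtoℚ (r ∸ suc y) · δ m y − conv P y (δ m))) diagonal
      ∙ cong (λ f → ℕtoℚ b · f y − Ĝ f y) (sym (wt-low b<r))
      where
      m : ℕ
      m = r ∸ suc b
      r≡ : r ≡ suc b + m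
      r≡ = sym (ℕₚ.m+[n∸m]≡n b<r)
      diagonal : ℕtoℚ (r ∸ suc y) · δ m y ≡ ℕtoℚ b · δ m y
      diagonal = δ-scale (λ z → ℕtoℚ (r ∸ suc z)) m y ∙ cong (λ z → ℕtoℚ z · δ m y) (cong (_∸ suc m) (r≡ ∙ sym (ℕₚ.+-suc b m)) ∙ ℕₚ.m+n∸n≡m b (suc m))
      coordinate′ : ∀ k → k < b → r ∸ suc (b ∸ suc k) ≡ m + suc k
      coordinate′ k k<b = begin
        r ∸ suc (b ∸ suc k) ≡⟨ cong (_∸ suc (b ∸ suc k)) r≡′ ⟩
        (m + suc k + suc (b ∸ suc k)) ∸ suc (b ∸ suc k) ≡⟨ ℕₚ.m+n∸n≡m (m + suc k) (suc (b ∸ suc k)) ⟩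
        _ ∎
        where
        r≡′ : r ≡ m + suc k + suc (b ∸ suc k)
        r≡′ = r≡ ∙ ℕₚ.+-comm (suc b) m ∙ cong (m +_) (cong suc (sym (ℕₚ.m+[n∸m]≡n (ℕₚ.<⇒≤ k<b))))
          ∙ cong (λ z → m + suc (k + z)) (suc-∸-suc k<b) ∙ sym (ℕₚ.+-assoc m (suc k) (suc (b ∸ suc k)))

    -- The first x slides stay at or above r and form the arm sum. The slide with k = x + j lands on
    -- the basis vector j, so at coordinate y only `P (x + y)` survives, the whole-hook term of
    -- `Γ-rule`.
    wt-rule-high : ∀ x y → y < r → Σ< (r + x) (λ k → P k · wt (r + x ∸ suc k) y) ≡ ℕtoℚ (r + x) · wt (r + x) y − Ĝ (wt (r + x)) y
    wt-rule-high x y y<r = cong (λ m → Σ< m (λ k → P k · wt (r + x ∸ suc k) y)) (ℕₚ.+-comm r x)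
      ∙ Σ<-+ x r (λ k → P k · wt (r + x ∸ suc k) y)
      ∙ cong₂ _⊹_ (Σ<-cong< x (λ k k<x → cong (P k ·_) (cong (λ z → wt z y) (ℕₚ.+-∸-assoc r k<x) ∙ cong (λ f → f y) (wt-high (x ∸ suc k)))))
          (Σ<-cong< r (λ j j<r → trans (cong (P (x + j) ·_) (cong (λ z → wt z y) (below j) ∙ cong (λ f → f y) (wt-low (ℕₚ.∸-monoʳ-< {r} (s≤s z≤n) j<r) ∙ cong δ (reflect j j<r))))
          (·-comm _ _ ∙ cong (_· P (x + j)) (δ-sym j y))) ∙ Σ<-δ r (λ j → P (x + j)) y<r)
      ∙ Γ-rule x y
      ∙ ring151 _ _ _ _
      ∙ cong (λ t → t · Γ x y − (ℕtoℚ (r ∸ suc y) · Γ x y − conv P y (Γ x))) (sym (ℕtoℚ-⊹ (suc (x + y)) (r ∸ suc y)) ∙ cong ℕtoℚ total)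
      ∙ cong (λ f → ℕtoℚ (r + x) · f y − Ĝ f y) (sym (wt-high x))
      where
      below : ∀ j → r + x ∸ suc (x + j) ≡ r ∸ suc j
      below j = (cong₂ _∸_ (ℕₚ.+-comm r x) (sym (ℕₚ.+-suc x j))) ∙ ℕₚ.[m+n]∸[m+o]≡n∸o x r (suc j)
      reflect : ∀ j → j < r → r ∸ suc (r ∸ suc j) ≡ j
      reflect j j<r = cong (r ∸_) (sym (suc-∸-suc j<r)) ∙ ℕₚ.m∸[m∸n]≡n (ℕₚ.<⇒≤ j<r)
      total : suc (x + y) + (r ∸ suc y) ≡ r + x
      total = cong (_+ (r ∸ suc y)) (sym (ℕₚ.+-suc x y)) ∙ ℕₚ.+-assoc x (suc y) _ ∙ cong (x +_) (ℕₚ.m+[n∸m]≡n y<r) ∙ ℕₚ.+-comm x r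

    wt-rule : ∀ b y → y < r → Σ< b (λ k → P k · wt (b ∸ suc k) y) ≡ ℕtoℚ b · wt b y − Ĝ (wt b) y
    wt-rule b y y<r = split (ℕₚ.<-≤-connex b r)
      where
      split : b < r ⊎ r ≤ b → Σ< b (λ k → P k · wt (b ∸ suc k) y) ≡ ℕtoℚ b · wt b y − Ĝ (wt b) y
      split (inj₁ b<r) = wt-rule-low b y y<r b<r
      split (inj₂ r≤b) = subst (λ b → Σ< b (λ k → P k · wt (b ∸ suc k) y) ≡ ℕtoℚ b · wt b y − Ĝ (wt b) y) (proj₂ (ℕₚ.m≤n⇒∃[o]m+o≡n r≤b)) (wt-rule-high (proj₁ (ℕₚ.m≤n⇒∃[o]m+o≡n r≤b)) y y<r)

    -- The derivation of the exterior algebra extending Ĝ.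
    𝔾 : V r → V r
    𝔾 x β = Σ< r (λ g → C (Ĝ (δ g)) (a g x) β)

    Ĝ-expand : ∀ w y → y < r → Σ< r (λ g → w g · Ĝ (δ g) y) ≡ Ĝ w y
    Ĝ-expand w y y<r = trans (Σ<-cong r (λ g → ring152 _ _ _ _)) (Σ<-⊹ r (λ g → ℕtoℚ (r ∸ suc y) · (w g · δ g y)) (λ g → − (w g · conv P y (δ g))) ∙ (cong₂ _⊹_ (Σ<-· r (ℕtoℚ (r ∸ suc y)) (λ g → w g · δ g y)) (Σ<-neg r (λ g → w g · conv P y (δ g)))))
      ∙ cong₂ (λ s t → ℕtoℚ (r ∸ suc y) · s − t) (pick y y<r) inner
      where
      pick : ∀ z → z < r → Σ< r (λ g → w g · δ g z) ≡ w z
      pick z z<r = Σ<-cong r (λ g → trans (·-comm _ _) (cong (_· w g) (δ-sym g z))) ∙ Σ<-δ r w z<r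
      inner : Σ< r (λ g → w g · conv P y (δ g)) ≡ conv P y w
      inner = Σ<-cong r (λ g → trans (sym (Σ<-· y (w g) (λ k → P k · δ g (y ∸ suc k)))) (Σ<-cong y (λ k → ring2 _ _ _)))
        ∙ Σ<-swap r y (λ g k → P k · (w g · δ g (y ∸ suc k)))
        ∙ Σ<-cong< y (λ k k<y → trans (Σ<-· r (P k) (λ g → w g · δ g (y ∸ suc k))) (cong (P k ·_) (pick (y ∸ suc k) (ℕₚ.≤-trans (s≤s (ℕₚ.m∸n≤m y (suc k))) y<r))))

    aC′ : ∀ w {g} → g < r → (x : V r) → a g (C w x) ≈ w g ·ᵥ x -ᵥ C w (a g x)
    aC′ w {g} g<r x β = AC-anti (δ g) w x β ∙ cong (λ k → k · x β − C w (a g x) β) (dot-δ r w g<r)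

    -- The Leibniz rule. Moving `a g` past `C w` splits off `w g`, and these scalars reassemble
    -- `Ĝ w` by `Ĝ-expand`.
    𝔾-C : ∀ w x → 𝔾 (C w x) ≈ C (Ĝ w) x +ᵥ C w (𝔾 x)
    𝔾-C w x β = Σ<-cong< r term
      ∙ Σ<-⊹ r (λ g → C (λ y → w g · Ĝ (δ g) y) x β) (λ g → C w (C (Ĝ (δ g)) (a g x)) β)
      ∙ cong₂ _⊹_ (sym (C-weight-Σ< r (λ g y → w g · Ĝ (δ g) y) x β) ∙ C-weight-cong (Ĝ-expand w) x β)
          (sym (sumΣ< (C-Linear w) r (λ g → C (Ĝ (δ g)) (a g x)) β))
      where
      term : ∀ g → g < r → C (Ĝ (δ g)) (a g (C w x)) β ≡ C (λ y → w g · Ĝ (δ g) y) x β ⊹ C w (C (Ĝ (δ g)) (a g x)) β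
      term g g<r = resp (C-Linear (Ĝ (δ g))) (aC′ w g<r x) β ∙ sub (C-Linear (Ĝ (δ g))) (w g ·ᵥ x) _ β
        ∙ (cong₂ _−_ (mul (C-Linear (Ĝ (δ g))) (w g) x β ∙ sym (C-weight-· (w g) (Ĝ (δ g)) x β)) (CC-anti (Ĝ (δ g)) w (a g x) β)) ∙ ring153 _ _

    top : V r → ℚ
    top x = x ones

    A-top : ∀ {M} w (x : V M) → A w x ones ≡ 0ℚ
    A-top {zero} w x = refl
    A-top {suc M} w x = (cong −_ (A-top (w ∘ suc) (x ∘ (true ∷_)))) ∙ −0≡0

    T : ℕ
    T = sum (upTo r)

    -- On the top exterior power a derivation acts by its trace. `Ĝ` is triangular, so the trace is
    -- the sum of the positions 0, ..., r - 1.
    top-𝔾 : ∀ x → top (𝔾 x) ≡ ℕtoℚ T · top x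
    top-𝔾 x = Σ<-cong< r (λ g g<r → trans (ring150 _ _) (cong (λ t → Ĝ (δ g) g · x ones − t) (sym (aC′ (Ĝ (δ g)) g<r x ones) ∙ A-top (δ g) (C (Ĝ (δ g)) x)) ∙ ring61 _ ∙ cong (_· x ones) (diagonal g)))
      ∙ Σ<-cong r (λ g → ·-comm _ _) ∙ Σ<-· r (x ones) _ ∙ ·-comm _ _
      ∙ cong (_· x ones) (Σ<-reverse r ℕtoℚ ∙ Σ<-ℕtoℚ r id)
      where
      diagonal : ∀ g → Ĝ (δ g) g ≡ ℕtoℚ (r ∸ suc g)
      diagonal g = cong₂ (λ d s → ℕtoℚ (r ∸ suc g) · d − s) (δ-refl g) (Σ<-zero g (λ k k<g → trans (cong (P k ·_) (δ-≢ {g} {g ∸ suc k} (λ eq → ℕₚ.<-irrefl (sym eq) (ℕₚ.∸-monoʳ-< {g} (s≤s z≤n) k<g)))) (·-zeroʳ _))) ∙ ring154 _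

    wedge : List ℕ → V r → V r
    wedge [] x = x
    wedge (b ∷ β) x = C (wt b) (wedge β x)

    wedge-Linear : ∀ β → Linear (wedge β)
    wedge-Linear [] = Linear-id
    wedge-Linear (b ∷ β) = Linear-∘ (C-Linear (wt b)) (wedge-Linear β)

    wedge-++ : ∀ as bs x → wedge (as ++ bs) x ≈ wedge as (wedge bs x)
    wedge-++ [] bs x β = refl
    wedge-++ (b ∷ as) bs x = resp (C-Linear (wt b)) (wedge-++ as bs x)

    Φ : List ℕ → ℚ
    Φ β = top (wedge β vac)

    slides : List ℕ → V r
    slides [] = 0ᵥ
    slides (b ∷ β) = (λ γ → Σ< b (λ k → P k · C (wt (b ∸ suc k)) (wedge β vac) γ)) +ᵥ C (wt b) (slides β)

    𝔾-wedge : ∀ β → 𝔾 (wedge β vac) ≈ ℕtoℚ (sum β) ·ᵥ wedge β vac -ᵥ slides β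
    𝔾-wedge [] γ = Σ<-zero r (λ g _ → vanish (C-Linear (Ĝ (δ g))) (A-vac (δ g)) γ) ∙ sym (ring13 _)
    𝔾-wedge (b ∷ β) γ = 𝔾-C (wt b) W γ
      ∙ cong₂ _⊹_ first (resp (C-Linear (wt b)) (𝔾-wedge β) γ ∙ sub (C-Linear (wt b)) (ℕtoℚ (sum β) ·ᵥ W) _ γ ∙ cong (_− C (wt b) (slides β) γ) (mul (C-Linear (wt b)) _ W γ))
      ∙ ring155 _ _ _ _ _
      ∙ cong (λ t → t · C (wt b) W γ − (Σ< b (λ k → P k · C (wt (b ∸ suc k)) W γ) ⊹ C (wt b) (slides β) γ)) (sym (ℕtoℚ-⊹ b (sum β)))
      where
      W = wedge β vac
      first : C (Ĝ (wt b)) W γ ≡ ℕtoℚ b · C (wt b) W γ − Σ< b (λ k → P k · C (wt (b ∸ suc k)) W γ)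
      first = C-weight-cong (λ y y<r → trans (ring150 _ (ℕtoℚ b · wt b y)) (cong (λ t → ℕtoℚ b · wt b y − t) (sym (wt-rule b y y<r)) ∙ ring156 _ _)) W γ
        ∙ C-weight-⊹ (λ y → ℕtoℚ b · wt b y) (λ y → (− 1ℚ) · Σ< b (λ k → P k · wt (b ∸ suc k) y)) W γ
            ∙ (cong₂ _⊹_ (C-weight-· (ℕtoℚ b) (wt b) W γ) (C-weight-· (− 1ℚ) (λ y → Σ< b (λ k → P k · wt (b ∸ suc k) y)) W γ
            ∙ cong ((− 1ℚ) ·_) (C-weight-Σ< b (λ k y → P k · wt (b ∸ suc k) y) W γ ∙ Σ<-cong b (λ k → C-weight-· (P k) (wt (b ∸ suc k)) W γ))))
        ∙ sym (ring156 _ _)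

    -- The top coefficient of `𝔾 (wedge β vac)` is found twice: as the sum of the positions times Φ
    -- minus the slides, and as the trace `T` times Φ. The excess of the positions over `T` is the
    -- size n of the partition.
    top-slides : ∀ n β → sum β ≡ n + T → top (slides β) ≡ ℕtoℚ n · Φ β
    top-slides n β eq = ring150 _ _
      ∙ cong (λ t → ℕtoℚ (sum β) · Φ β − t) (sym (𝔾-wedge β ones) ∙ top-𝔾 (wedge β vac))
      ∙ cong (λ t → t · Φ β − ℕtoℚ T · Φ β) (cong ℕtoℚ eq ∙ ℕtoℚ-⊹ n T)
      ∙ ring157 _ _ _

    positions : List ℕ → List ℕ → ℚ
    positions as [] = 0ℚ
    positions as (b ∷ bs) = Σ< b (λ k → P k · Φ (as ++ (b ∸ suc k) ∷ bs)) ⊹ positions (as ∷ʳ b) bs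

    wedge-slides : ∀ as bs → top (wedge as (slides bs)) ≡ positions as bs
    wedge-slides as [] = zer (wedge-Linear as) ones
    wedge-slides as (b ∷ bs) = add (wedge-Linear as) _ (C (wt b) (slides bs)) ones ∙ (cong₂ _⊹_
      (sumΣ< (wedge-Linear as) b (λ k → P k ·ᵥ C (wt (b ∸ suc k)) (wedge bs vac)) ones
        ∙ Σ<-cong b (λ k → trans (mul (wedge-Linear as) (P k) _ ones) (cong (P k ·_) (sym (wedge-++ as ((b ∸ suc k) ∷ bs) vac ones)))))
      (sym (wedge-++ as (b ∷ []) (slides bs) ones) ∙ wedge-slides (as ∷ʳ b) bs))

    positions-sum : ∀ as bs → Unique (as ++ bs) → positions as bs ≡ sumL (λ b → Σ< b (λ k → P k · Φ (replaceℕ b (b ∸ suc k) (as ++ bs)))) bs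
    positions-sum as [] u = refl
    positions-sum as (b ∷ bs) u = cong₂ _⊹_
      (Σ<-cong b (λ k → cong (λ l → P k · Φ l) (sym (replaceℕ-∈ b (b ∸ suc k) as bs u))))
      (positions-sum (as ∷ʳ b) bs (subst Unique (sym (Listₚ.∷ʳ-++ as b bs)) u)
        ∙ sumL-cong bs (λ z → Σ<-cong z (λ k → cong (λ l → P k · Φ (replaceℕ z (z ∸ suc k) l)) (Listₚ.∷ʳ-++ as b bs))))

    top-slides-sum : ∀ β → Unique β → top (slides β) ≡ sumL (λ b → Σ< b (λ k → P k · Φ (replaceℕ b (b ∸ suc k) β))) β
    top-slides-sum β u = wedge-slides [] β ∙ positions-sum [] β u

    -- The wedge counterpart of the rule that a ribbon cannot be removed onto an occupied position.
    wedge-elem : ∀ b β x → elemB b β ≡ true → C (wt b) (wedge β x) ≈ 0ᵥ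
    wedge-elem b (z ∷ β) x eq γ with b ≡ᵇ z in b≡z
    ... | true with refl ← ≡ᵇ⇒≡ b z b≡z = CC-zero (wt b) (wedge β x) γ
    ... | false = CC-anti (wt b) (wt z) (wedge β x) γ ∙ (cong −_ (vanish (C-Linear (wt z)) (wedge-elem b β x eq) γ)) ∙ −0≡0

    wedge-dup : ∀ β x → hasDup β ≡ true → wedge β x ≈ 0ᵥ
    wedge-dup (b ∷ β) x eq γ with elemB b β in eqb
    ... | true = wedge-elem b β x eqb γ
    ... | false = vanish (C-Linear (wt b)) (wedge-dup β x eq) γ

    sum-bound : ∀ β → Unique β → length β ≡ r → T ≤ sum β
    sum-bound β u len = subst₂ _≤_ (cong (λ m → sum (upTo m)) (Permₚ.↭-length (sortℕ-↭ β) ∙ len)) (sum-↭ (sortℕ-↭ β))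
      (increasing-sum 0 (sortℕ β) (sortℕ-increasing β u) (All.universal (λ _ → z≤n) _))

    sum-tight : ∀ β → Unique β → length β ≡ r → sum β ≡ T → All (_< r) β
    sum-tight β u len eq = Permₚ.All-resp-↭ (sortℕ-↭ β) (subst (λ m → All (_< m) (sortℕ β)) len′
      (increasing-sum-max 0 (sortℕ β) (sortℕ-increasing β u) (All.universal (λ _ → z≤n) _)
        (ℕₚ.≤-reflexive (sum-↭ (sortℕ-↭ β) ∙ eq ∙ cong (λ m → sum (upTo m)) (sym len′)))))
      where
      len′ : length (sortℕ β) ≡ r
      len′ = Permₚ.↭-length (sortℕ-↭ β) ∙ len

    rev : ℕ → ℕ
    rev b = r ∸ suc b

    wedge-low : ∀ β → All (_< r) β → ∀ x → wedge β x ≈ cw (map rev β) x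
    wedge-low [] _ x γ = refl
    wedge-low (b ∷ β) (b<r ∷ p) x γ = cong (λ w → C w (wedge β x) γ) (wt-low b<r) ∙ resp (C-Linear (δ (rev b))) (wedge-low β p x) γ

    rev-<ᵇ : ∀ {x y} → x < r → y < r → (rev y <ᵇ rev x) ≡ (x <ᵇ y)
    rev-<ᵇ {x} {y} x<r y<r with ℕₚ.<-≤-connex x y
    ... | inj₁ x<y = <⇒<ᵇ (ℕₚ.∸-monoʳ-< (s≤s x<y) y<r) ∙ sym (<⇒<ᵇ x<y)
    ... | inj₂ y≤x = ≥⇒<ᵇ-false (ℕₚ.∸-monoʳ-≤ r (s≤s y≤x)) ∙ sym (≥⇒<ᵇ-false y≤x)

    inversions-rev : ∀ β → All (_< r) β → inversions (map rev β) ≡ noninversions β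
    inversions-rev [] _ = refl
    inversions-rev (x ∷ xs) (x<r ∷ p) = cong₂ _+_ (countB-map (_<ᵇ rev x) rev xs ∙ same xs p) (inversions-rev xs p)
      where
      same : ∀ xs → All (_< r) xs → countB (λ y → rev y <ᵇ rev x) xs ≡ countB (x <ᵇ_) xs
      same [] _ = refl
      same (y ∷ ys) (y<r ∷ q) = countB-∷ (λ y → rev y <ᵇ rev x) y ys ∙ cong₂ (λ b m → (if b then 1 else 0) + m) (rev-<ᵇ x<r y<r) (same ys q) ∙ sym (countB-∷ (x <ᵇ_) y ys)

    rev-injective : ∀ {x y} → x < r → y < r → rev x ≡ rev y → x ≡ y
    rev-injective x<r y<r eq = ℕₚ.suc-injective (ℕₚ.∸-cancelˡ-≡ x<r y<r eq)

    upTo≡mono-ones : ∀ m → upTo m ≡ mono (ones {m})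
    upTo≡mono-ones zero = refl
    upTo≡mono-ones (suc m) = cong (0 ∷_) (sym (Listₚ.map-upTo suc m) ∙ cong (map suc) (upTo≡mono-ones m))

    e-ones : ∀ m → e (ones {m}) ones ≡ 1ℚ
    e-ones zero = refl
    e-ones (suc m) = e-ones m

    Φ-low : ∀ β → Unique β → length β ≡ r → All (_< r) β → Φ β ≡ sgn (noninversions β)
    Φ-low β u len bd = wedge-low β bd vac ones
      ∙ cw-sort w vac uw ones
      ∙ cong₂ (λ m l → sgn m · cw l vac ones) (inversions-rev β bd) (w-sorted ∙ upTo≡mono-ones r)
      ∙ cong (sgn (noninversions β) ·_) (sym (e≈cw-mono (ones {r}) ones) ∙ e-ones r)
      ∙ ·-identityʳ _
      where
      w : List ℕ
      w = map rev β
      uw : Unique w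
      uw = Unique-map∈ (λ x∈ y∈ → rev-injective (All⇒∀∈ bd x∈) (All⇒∀∈ bd y∈)) u
      w-sorted : sortℕ w ≡ upTo r
      w-sorted = increasing-full r 0 (sortℕ w) (sortℕ-increasing w uw) (All.universal (λ _ → z≤n) _)
        (Permₚ.All-resp-↭ (↭-sym (sortℕ-↭ w)) (Allₚ.map⁺ (All.map (λ {x} x<r → ℕₚ.∸-monoʳ-< {r} (s≤s z≤n) x<r) bd)))
        (Permₚ.↭-length (sortℕ-↭ w) ∙ Listₚ.length-map rev β ∙ len)

    -- The power sum p_μ of the superalphabet; `P` is indexed from 0, hence `k ∸ 1`.
    weight : List ℕ → ℚ
    weight [] = 1ℚ
    weight (k ∷ μ) = P (k ∸ 1) · weight μ

    -- Frobenius' expansion of a Schur function into power sums, with the partition given by its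
    -- beads.
    Av : ℕ → List ℕ → ℚ
    Av n β = average n (λ μ → weight μ · ℤtoℚ (mn β μ))

    -- The first cycle has uniform length; the character is expanded by removing a ribbon of that
    -- length.
    Av-suc : ∀ n β → ℕtoℚ (suc n) · Av (suc n) β ≡ Σ< (suc n) (λ k → P k · sumL (λ b → ribbon β k b · Av (n ∸ k) (replaceℕ b (b ∸ suc k) β)) β)
    Av-suc n β = average-first-cycle n (λ μ → weight μ · ℤtoℚ (mn β μ)) ∙ Σ<-cong (suc n) (λ k → average-cong (n ∸ k) (λ μ → trans (cong ((P k · weight μ) ·_) (mn-expand β k μ)) (·-assoc _ _ _ ∙ cong (P k ·_)
          (sym (sumL-· (weight μ) (λ b → ribbon β k b · ℤtoℚ (mn (replaceℕ b (b ∸ suc k) β) μ)) β) ∙ sumL-cong β (λ b → ring2 _ _ _))))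
      ∙ average-· (n ∸ k) (P k) (λ μ → sumL (λ b → ribbon β k b · (weight μ · ℤtoℚ (mn (replaceℕ b (b ∸ suc k) β) μ))) β)
      ∙ cong (P k ·_) (average-sumL (n ∸ k) (λ b μ → ribbon β k b · (weight μ · ℤtoℚ (mn (replaceℕ b (b ∸ suc k) β) μ))) β
          ∙ sumL-cong β (λ b → average-· (n ∸ k) (ribbon β k b) (λ μ → weight μ · ℤtoℚ (mn (replaceℕ b (b ∸ suc k) β) μ)))))

    private
      below : ℕ → ℕ → ℚ
      below k b = if k <ᵇ b then 1ℚ else 0ℚ

    record Moved (β : List ℕ) (b c : ℕ) : Set where
      constructor moved
      field
        {before after} : List ℕ
        β≡ : β ≡ before ++ b ∷ after
        β′≡ : replaceℕ b c β ≡ before ++ c ∷ after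

    move : ∀ {β b} c → Unique β → b ∈ β → Moved β b c
    move c u b∈ with ∈ₚ.∈-∃++ b∈
    ... | as , bs , refl = moved {before = as} {bs} refl (replaceℕ-∈ _ c as bs u)

    sum-moved : ∀ {β b c} → Moved β b c → b + sum (replaceℕ b c β) ≡ c + sum β
    sum-moved {β} {b} {c} (moved {as} {bs} eq eq′) = begin
      b + sum (replaceℕ b c β) ≡⟨ cong (λ l → b + sum l) eq′ ⟩
      b + sum (as ++ c ∷ bs) ≡⟨ cong (b +_) (sum-↭ (Permₚ.shift c as bs)) ⟩
      b + (c + sum (as ++ bs)) ≡⟨ trans (sym (ℕₚ.+-assoc b c _)) (cong (_+ sum (as ++ bs)) (ℕₚ.+-comm b c) ∙ ℕₚ.+-assoc c b _) ⟩
      c + (b + sum (as ++ bs)) ≡⟨ cong (c +_) (sym (sum-↭ (Permₚ.shift b as bs))) ⟩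
      c + sum (as ++ b ∷ bs) ≡⟨ cong (λ l → c + sum l) (sym eq) ⟩
      _ ∎

    length-moved : ∀ {β b c} → Moved β b c → length (replaceℕ b c β) ≡ length β
    length-moved {β} {b} {c} _ = Listₚ.length-map _ β

    Unique-mid⁻ : ∀ {b : ℕ} as bs → Unique (as ++ b ∷ bs) → Unique (as ++ bs) × All (b ≢_) (as ++ bs)
    Unique-mid⁻ {b} as bs u with Unique-↭ (Permₚ.shift b as bs) u
    ... | p ∷ q = q , p

    Unique-mid⁺ : ∀ {b : ℕ} as bs → Unique (as ++ bs) → All (b ≢_) (as ++ bs) → Unique (as ++ b ∷ bs)
    Unique-mid⁺ {b} as bs u p = Unique-↭ (↭-sym (Permₚ.shift b as bs)) (p ∷ u)

    slid-sum : ∀ {β b} k → b ∈ β → k < b → Unique β → suc k + sum (replaceℕ b (b ∸ suc k) β) ≡ sum β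
    slid-sum {β} {b} k b∈ k<b u = ℕₚ.+-cancelˡ-≡ (b ∸ suc k) _ _ (sym (ℕₚ.+-assoc (b ∸ suc k) (suc k) _)
      ∙ cong (_+ sum (replaceℕ b (b ∸ suc k) β)) (ℕₚ.m∸n+n≡m k<b) ∙ sum-moved (move (b ∸ suc k) u b∈))

    -- A slide longer than the excess `suc n` pushes the sum of the positions below `T`, the minimum
    -- for r distinct positions. So two beads coincide, and the sum over k ≤ n may be exchanged for
    -- the sum over k < b.
    Φ-overslid : ∀ n β → Unique β → length β ≡ r → sum β ≡ suc n + T → ∀ b → b ∈ β → ∀ k → suc n ≤ k → k < b → Φ (replaceℕ b (b ∸ suc k) β) ≡ 0ℚ
    Φ-overslid n β u len eq b b∈ k n<k k<b with hasDup (replaceℕ b (b ∸ suc k) β) in dup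
    ... | true = wedge-dup (replaceℕ b (b ∸ suc k) β) vac dup ones
    ... | false = ⊥-elim (ℕₚ.<-irrefl refl (ℕₚ.+-cancelʳ-≤ T (suc k) k (ℕₚ.≤-trans
        (ℕₚ.+-monoʳ-≤ (suc k) (sum-bound (replaceℕ b (b ∸ suc k) β) (hasDup-false _ dup) (length-moved (move (b ∸ suc k) u b∈) ∙ len)))
        (subst (_≤ k + T) (sym eq ∙ sym (slid-sum k b∈ k<b u)) (ℕₚ.+-monoˡ-≤ T n<k)))))

    -- If the target is occupied, the ribbon coefficient is 0 and F′ vanishes on the repetition. If
    -- it is free, the induction hypothesis applies, and `sgn-noninversions` cancels the ribbon
    -- sign, which occurs squared.
    slide-term : ∀ (A′ : ℕ → List ℕ → ℚ) (F′ : List ℕ → ℚ) n β → Unique β → length β ≡ r → sum β ≡ suc n + T →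
      (∀ k → k ≤ n → ∀ γ → Unique γ → length γ ≡ r → sum γ ≡ (n ∸ k) + T → A′ (n ∸ k) γ ≡ sgn (noninversions γ) · F′ γ) →
      (∀ γ → hasDup γ ≡ true → F′ γ ≡ 0ℚ) → ∀ k → k ≤ n → ∀ b → b ∈ β →
      ribbon β k b · A′ (n ∸ k) (replaceℕ b (b ∸ suc k) β) ≡ below k b · (sgn (noninversions β) · F′ (replaceℕ b (b ∸ suc k) β))
    slide-term A′ F′ n β u len eq IH dup-zero k k≤n b b∈ with k <ᵇ b in k<ᵇb
    ... | false = ·-zeroˡ _ ∙ sym (·-zeroˡ _)
    ... | true with elemB (b ∸ suc k) β in el | move (b ∸ suc k) u b∈
    ... | true | moved {as} {bs} refl β′≡ = ·-zeroˡ _ ∙ sym (cong (λ t → 1ℚ · ((sgn (noninversions (as ++ b ∷ bs))) · t)) zero′ ∙ ring161 _)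
      where
      c₀ : ℕ
      c₀ = b ∸ suc k
      c₀≢b : c₀ ≢ b
      c₀≢b eq′ = ℕₚ.<-irrefl eq′ (ℕₚ.∸-monoʳ-< {b} (s≤s z≤n) (<ᵇ⇒< k b k<ᵇb))
      c₀∈ : c₀ ∈ as ++ bs
      c₀∈ with Permₚ.∈-resp-↭ (Permₚ.shift b as bs) (find c₀ (as ++ b ∷ bs) el)
        where
        find : ∀ g w → elemB g w ≡ true → g ∈ w
        find g (z ∷ w) e′ with g ≡ᵇ z in g≡z
        ... | true = here (≡ᵇ⇒≡ g z g≡z)
        ... | false = there (find g w e′)
      ... | here eq′ = ⊥-elim (c₀≢b eq′)
      ... | there p = p
      zero′ : F′ (replaceℕ b c₀ (as ++ b ∷ bs)) ≡ 0ℚ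
      zero′ with hasDup (replaceℕ b c₀ (as ++ b ∷ bs)) in dup
      ... | true = dup-zero (replaceℕ b c₀ (as ++ b ∷ bs)) dup
      ... | false = ⊥-elim (All⇒∀∈ (proj₂ (Unique-mid⁻ as bs (subst Unique β′≡ (hasDup-false _ dup)))) c₀∈ refl)
    ... | false | moved {as} {bs} refl β′≡ = cong (sgn B ·_) (IH k k≤n _ u′ len′ sum′)
      ∙ cong (λ s → sgn B · (s · F′ (replaceℕ b c₀ (as ++ b ∷ bs)))) (cong (λ l → sgn (noninversions l)) β′≡
          ∙ sgn-noninversions as bs c₀ b c₀<b (proj₂ (Unique-mid⁻ as bs u)) (proj₂ c-fresh))
      ∙ ring160 _ _ _ ∙ cong (_· (1ℚ · ((sgn (noninversions (as ++ b ∷ bs))) · F′ (replaceℕ b c₀ (as ++ b ∷ bs))))) (sgn-square B) ∙ ·-identityˡ _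
      where
      c₀ : ℕ
      c₀ = b ∸ suc k
      B : ℕ
      B = countB (between c₀ b) (as ++ b ∷ bs)
      k<b : k < b
      k<b = <ᵇ⇒< k b k<ᵇb
      c₀<b : c₀ < b
      c₀<b = ℕₚ.∸-monoʳ-< {b} (s≤s z≤n) k<b
      c-fresh : c₀ ≢ b × All (c₀ ≢_) (as ++ bs)
      c-fresh with Permₚ.All-resp-↭ (Permₚ.shift b as bs) (elemB-false c₀ (as ++ b ∷ bs) el)
      ... | p ∷ q = p , q
      u′ : Unique (replaceℕ b c₀ (as ++ b ∷ bs))
      u′ = subst Unique (sym β′≡) (Unique-mid⁺ as bs (proj₁ (Unique-mid⁻ as bs u)) (proj₂ c-fresh))
      len′ : length (replaceℕ b c₀ (as ++ b ∷ bs)) ≡ r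
      len′ = length-moved (move c₀ u b∈) ∙ len
      sum′ : sum (replaceℕ b c₀ (as ++ b ∷ bs)) ≡ (n ∸ k) + T
      sum′ = ℕₚ.+-cancelˡ-≡ (suc k) _ _ (slid-sum k b∈ k<b u ∙ eq ∙ cong (λ j → suc j + T) (sym (ℕₚ.m+[n∸m]≡n k≤n)) ∙ ℕₚ.+-assoc (suc k) (n ∸ k) T)

    -- Both sides obey the same recursion by one weighted slide, `Av-suc` and `top-slides`. The
    -- bound m turns strong induction on n into structural recursion.
    Murnaghan–Nakayama : ∀ m n → n ≤ m → ∀ β → Unique β → length β ≡ r → sum β ≡ n + T → Av n β ≡ sgn (noninversions β) · Φ β
    -- Size 0 forces all beads below r by `sum-tight`, so `mn` returns 1 and the wedge is the top
    -- monomial up to sign.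
    Murnaghan–Nakayama m zero _ β u len eq = cong (λ z → invℚ (ℕtoℚ 1) · (1ℚ · ℤtoℚ z ⊹ 0ℚ)) (cong (if_then ℤ.+ 1 else ℤ.+ 0) (allB-true _ β (λ x x∈ → <⇒<ᵇ (subst (x <_) (sym len) (All⇒∀∈ bd x∈)))))
      ∙ ring158 _
      ∙ ·-inverseˡ (ℕtoℚ 1) (ℕtoℚ-suc≢0 0)
      ∙ sym (sgn-square (noninversions β))
      ∙ cong (sgn (noninversions β) ·_) (sym (Φ-low β u len bd))
      where
      bd : All (_< r) β
      bd = sum-tight β u len eq
    Murnaghan–Nakayama (suc m) (suc n) (s≤s n≤m) β u len eq = ·-cancelˡ (ℕtoℚ (suc n)) (ℕtoℚ-suc≢0 n) (Av-suc n β
      ∙ Σ<-cong< (suc n) (λ { k (s≤s k≤n) → trans (sym (sumL-· (P k) (λ b → ribbon β k b · Av (n ∸ k) (replaceℕ b (b ∸ suc k) β)) β))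
          (sumL-cong∈ β (λ b b∈ → trans (cong (P k ·_) (term k k≤n b b∈)) (ring159 _ _ _ _))) })
      ∙ sym (sumL-Σ< (suc n) (λ k b → ε · (below k b · (P k · Φ (replaceℕ b (b ∸ suc k) β)))) β)
      ∙ sumL-cong∈ β (λ b b∈ → trans (Σ<-· (suc n) ε (λ k → below k b · (P k · Φ (replaceℕ b (b ∸ suc k) β))))
          (cong (ε ·_) (Σ<-truncate (suc n) b (λ k → P k · Φ (replaceℕ b (b ∸ suc k) β))
          (λ k n<k k<b → trans (cong (P k ·_) (Φ-overslid n β u len eq b b∈ k n<k k<b)) (·-zeroʳ _)))))
      ∙ sumL-· ε (λ b → Σ< b (λ k → P k · Φ (replaceℕ b (b ∸ suc k) β))) β ∙ cong (ε ·_) (sym (top-slides-sum β u) ∙ top-slides (suc n) β eq)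
      ∙ ring2 _ _ _)
      where
      ε : ℚ
      ε = sgn (noninversions β)
      term : ∀ k → k ≤ n → ∀ b → b ∈ β → ribbon β k b · Av (n ∸ k) (replaceℕ b (b ∸ suc k) β) ≡ below k b · (ε · Φ (replaceℕ b (b ∸ suc k) β))
      term = slide-term Av Φ n β u len eq (λ k k≤n → Murnaghan–Nakayama m (n ∸ k) (ℕₚ.≤-trans (ℕₚ.m∸n≤m n k) n≤m)) (λ γ dup → wedge-dup γ vac dup ones)

  -- Two hooks: the determinant and its factorisation.

  module HookAverage (ℓ d : ℕ) where

    private
      r : ℕ
      r = suc (suc (ℓ + d))

    open Beads r

    -- Only two beads lie at or above r, the number of rows. In Frobenius coordinates the shape has
    -- arms x, y and legs ℓ + d + 1, ℓ, and this is Giambelli's determinant.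
    Φ-hook : ∀ x y → Φ ((r + x) ∷ (r + y) ∷ lowBeads ℓ d) ≡ Gh x (ℓ + suc d) · Gh y ℓ − Gh x ℓ · Gh y (ℓ + suc d)
    Φ-hook x y = cong₂ (λ w z → C w (C z (wedge (lowBeads ℓ d) vac)) ones) (wt-high x) (wt-high y)
      ∙ resp (Linear-∘ (C-Linear (Γ x)) (C-Linear (Γ y))) (≈-trans (wedge-low (lowBeads ℓ d) (lowBeads-bounded ℓ d) vac)
          (λ β → trans (cong (λ l → cw l vac β) (reversed-low ℓ d)) (sym (e≈cw-mono (holes ℓ d) β)))) ones
      ∙ CC-holes ℓ d (Γ x) (Γ y)
      ∙ cong (λ s → sgn d · ((sgn ℓ · Gh x ℓ) · (s · Gh y (ℓ + suc d)) − (sgn ℓ · Gh y ℓ) · (s · Gh x (ℓ + suc d)))) (sgn-+ ℓ (suc d))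
      ∙ ring167 _ _ _ _ _ _
      ∙ cong₂ (λ s t → (s · t) · (Gh x (ℓ + suc d) · Gh y ℓ − Gh x ℓ · Gh y (ℓ + suc d))) (sgn-square d) (sgn-square ℓ)
      ∙ ring168 _

    -- `core` is a bilinear form in (1 , X) and (U , V′). The minor is therefore a product of three
    -- 2 × 2 determinants: Y - X, U T - V′ S, and u v (u - v) (1 - u v) for the matrix of the form.
    core-minor : ∀ X Y U V′ S T →
      core X U V′ · core Y S T − core X S T · core Y U V′ ≡ ((u · v) · (Y − X)) · ((U · T − V′ · S) · ((u − v) · (1ℚ − u · v)))
    core-minor = ring169 u v

    Gh-minor : ∀ y k → ((u − v) · (1ℚ − u · v)) · (Gh (suc (y + k)) (ℓ + suc d) · Gh y ℓ − Gh (suc (y + k)) ℓ · Gh y (ℓ + suc d))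
      ≡ ((1ℚ ⊹ u) · (1ℚ ⊹ v)) · ((1ℚ ⊹ u) · (1ℚ ⊹ v)) · (pw (u · v) (suc (ℓ + y)) · (1ℚ − pw (u · v) (suc k)) · (pw u (suc d) − pw v (suc d)))
    Gh-minor y k = ring170 _ _ _ _ _ _
      ∙ cong (λ t → ((u − v) · (1ℚ − u · v)) · ((κ · κ) · t)) (core-minor X Y U V′ S T′)
      ∙ ring171 _ _ _ _ _ _ _ _
      ∙ cong₂ (λ p q → (p · q · (p · q)) · (E · E · (((u · v) · (Y − X)) · (U · T′ − V′ · S)))) i₁-inverse i₂-inverse
      ∙ cong₂ (λ p q → (1ℚ · 1ℚ · (1ℚ · 1ℚ)) · (E · E · (((u · v) · p) · q)))
          (cong (λ t → Y − t) (cong (pw (u · v)) (sym (ℕₚ.+-suc y k)) ∙ pw-+ (u · v) y (suc k)))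
          (cong₂ (λ p q → p · T′ − q · S) (pw-+ u ℓ (suc d)) (pw-+ v ℓ (suc d)))
      ∙ ring172 _ _ _ _ _ _ _ _
      ∙ cong (λ t → E · E · ((u · v) · t · (1ℚ − pw (u · v) (suc k)) · (pw u (suc d) − pw v (suc d)))) (cong (_· Y) (sym (pw-· u v ℓ)) ∙ sym (pw-+ (u · v) ℓ y))
      where
      E κ X Y U V′ S T′ : ℚ
      E = (1ℚ ⊹ u) · (1ℚ ⊹ v)
      κ = i₁ · i₂ · E
      X = pw (u · v) (suc (y + k))
      Y = pw (u · v) y
      U = pw u (ℓ + suc d)
      V′ = pw v (ℓ + suc d)
      S = pw u ℓ
      T′ = pw v ℓ

    Av-hook : ∀ y k → ((u − v) · (1ℚ − u · v)) · Av (d + (2 * ℓ + suc (suc (y + k)) + suc (suc y))) (hookBeads (suc (suc (y + k))) (suc (suc y)) ℓ d)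
      ≡ ((1ℚ ⊹ u) · (1ℚ ⊹ v)) · ((1ℚ ⊹ u) · (1ℚ ⊹ v)) · (pw (u · v) (suc (ℓ + y)) · (1ℚ − pw (u · v) (suc k)) · (pw u (suc d) − pw v (suc d)))
    Av-hook y k = cong (((u − v) · (1ℚ − u · v)) ·_) (trans
        (Murnaghan–Nakayama n n ℕₚ.≤-refl β (Decreasing⇒Unique dec) (cong (suc ∘ suc) (length-lowBeads ℓ d)) (sum-hookBeads (suc (suc (y + k))) (suc (suc y)) ℓ d))
        (cong (λ m → sgn m · Φ β) (noninversions-decreasing dec) ∙ ·-identityˡ _ ∙ cong Φ β≡ ∙ Φ-hook (suc (y + k)) y))
      ∙ Gh-minor y k
      where
      n : ℕ
      n = d + (2 * ℓ + suc (suc (y + k)) + suc (suc y))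
      β : List ℕ
      β = hookBeads (suc (suc (y + k))) (suc (suc y)) ℓ d
      dec : Decreasing β
      dec = hookBeads-decreasing ℓ d (s≤s (s≤s z≤n)) (s≤s (s≤s (ℕₚ.m≤m+n y k)))
      shift₁′ : ∀ x y ℓd → suc (suc (x + y)) + suc ℓd ≡ suc (suc ℓd) + suc (x + y)
      shift₁′ = ℕSolver.solve-∀
      shift₂′ : ∀ y ℓd → suc (suc y) + ℓd ≡ suc (suc ℓd) + y
      shift₂′ = ℕSolver.solve-∀
      β≡ : β ≡ (r + suc (y + k)) ∷ (r + y) ∷ lowBeads ℓ d
      β≡ = cong₂ (λ p q → p ∷ q ∷ lowBeads ℓ d) (shift₁′ y k (ℓ + d)) (shift₂′ y (ℓ + d))

-- Polynomials in two variables, as arrays of coefficients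

-- Opaque, since Σ< unfolds on the sizes suc (…) that occur below.
opaque
  poly : ℕ → (ℕ → ℚ) → ℚ → ℚ
  poly M f x = Σ< M (λ i → f i · pw x i)

  poly-suc : ∀ M f x → poly (suc M) f x ≡ f 0 ⊹ x · poly M (f ∘ suc) x
  poly-suc M f x = cong₂ _⊹_ (·-identityʳ _) (Σ<-cong M (λ i → ring2 _ _ _) ∙ Σ<-· M x (λ i → f (suc i) · pw x i))

  poly-zero : ∀ M x → poly M (λ _ → 0ℚ) x ≡ 0ℚ
  poly-zero M x = Σ<-zero M (λ i _ → ·-zeroˡ _)

  poly-cong< : ∀ M {f g} x → (∀ i → i < M → f i ≡ g i) → poly M f x ≡ poly M g x
  poly-cong< M x eq = Σ<-cong< M (λ i i<M → cong (_· pw x i) (eq i i<M))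

  poly-⊹ : ∀ M f g x → poly M (λ i → f i ⊹ g i) x ≡ poly M f x ⊹ poly M g x
  poly-⊹ M f g x = Σ<-cong M (λ i → ring24 _ _ _) ∙ Σ<-⊹ M (λ i → f i · pw x i) (λ i → g i · pw x i)

  poly-· : ∀ M k f x → poly M (λ i → k · f i) x ≡ k · poly M f x
  poly-· M k f x = Σ<-cong M (λ i → ·-assoc k (f i) (pw x i)) ∙ Σ<-· M k (λ i → f i · pw x i)

  poly-snoc : ∀ M f x → f M ≡ 0ℚ → poly (suc M) f x ≡ poly M f x
  poly-snoc M f x z = Σ<-snoc M (λ i → f i · pw x i) ∙ cong (poly M f x ⊹_) (cong (_· pw x M) z ∙ ·-zeroˡ _) ∙ ⊹-identityʳ _

  poly-Σ< : ∀ M f x → poly M f x ≡ Σ< M (λ i → f i · pw x i)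
  poly-Σ< M f x = refl

  poly-empty : ∀ f x → poly 0 f x ≡ 0ℚ
  poly-empty f x = refl

  poly-constant : ∀ f g ρ x → poly 1 f x ≡ poly 1 f ρ ⊹ (x − ρ) · poly 0 g x
  poly-constant f g ρ x = ring174 (f 0) x ρ

poly-drop : ∀ k M f x → (∀ i → i < k → f i ≡ 0ℚ) → poly (k + M) f x ≡ pw x k · poly M (λ i → f (k + i)) x
poly-drop zero M f x z = sym (·-identityˡ _)
poly-drop (suc k) M f x z = poly-suc (k + M) f x ∙ cong₂ (λ a b → a ⊹ x · b) (z 0 (s≤s z≤n)) (poly-drop k M (f ∘ suc) x (λ i i<k → z (suc i) (s≤s i<k))) ∙ ring173 _ _ _

-- Division by X - ρ: the coefficients of the quotient are the values at ρ
-- of the tails.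
quotient : ℕ → (ℕ → ℚ) → ℚ → ℕ → ℚ
quotient zero f ρ i = 0ℚ
quotient (suc M) f ρ zero = poly (suc M) f ρ
quotient (suc M) f ρ (suc i) = quotient M (f ∘ suc) ρ i

quotient-rule : ∀ M f ρ x → poly (suc M) f x ≡ poly (suc M) f ρ ⊹ (x − ρ) · poly M (quotient M (f ∘ suc) ρ) x
quotient-rule zero f ρ x = poly-constant f (quotient 0 (f ∘ suc) ρ) ρ x
quotient-rule (suc M) f ρ x = trans (poly-suc (suc M) f x) (cong (λ t → f 0 ⊹ x · t) (quotient-rule M (f ∘ suc) ρ x))
  ∙ ring175 _ _ _ _ _
  ∙ sym (cong₂ (λ a b → a ⊹ (x − ρ) · b) (poly-suc (suc M) f ρ) (poly-suc M (quotient (suc M) (f ∘ suc) ρ) x))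

quotient-zero : ∀ M f ρ → (∀ i → i < M → quotient M f ρ i ≡ 0ℚ) → ∀ i → i < M → f i ≡ 0ℚ
quotient-zero (suc M) f ρ z (suc i) (s≤s i<M) = quotient-zero M (f ∘ suc) ρ (λ j j<M → z (suc j) (s≤s j<M)) i i<M
quotient-zero (suc M) f ρ z zero _ = trans (ring176 _ _) (cong (λ t → (f 0 ⊹ ρ · poly M (f ∘ suc) ρ) − ρ · t) (tail M f (λ i i<M → z (suc i) (s≤s i<M))))
  ∙ cong (_− ρ · 0ℚ) (sym (poly-suc M f ρ) ∙ z 0 (s≤s z≤n)) ∙ ring177 _
  where
  tail : ∀ M f → (∀ i → i < M → quotient M (f ∘ suc) ρ i ≡ 0ℚ) → poly M (f ∘ suc) ρ ≡ 0ℚ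
  tail zero f z = poly-empty (f ∘ suc) ρ
  tail (suc M) f z = z 0 (s≤s z≤n)

-- The root ρ is divided out, and the quotient has one coefficient less. It vanishes at the integers
-- beyond ρ, where the divisor is nonzero; hence the starting point moves up with every division.
interpolation : ∀ M f ρ → (∀ m → ρ ≤ m → poly M f (ℕtoℚ m) ≡ 0ℚ) → ∀ i → i < M → f i ≡ 0ℚ
interpolation (suc M) f ρ z = coefficients
  where
  quotient≡0 : ∀ i → i < M → quotient M (f ∘ suc) (ℕtoℚ ρ) i ≡ 0ℚ
  quotient≡0 = interpolation M (quotient M (f ∘ suc) (ℕtoℚ ρ)) (suc ρ) (λ m ρ<m → ·-cancelˡ (ℕtoℚ m − ℕtoℚ ρ)
      (λ eq → ℕₚ.<-irrefl (sym (ℕtoℚ-injective {m} {ρ} (ring104 (ℕtoℚ m) (ℕtoℚ ρ) ∙ cong (_⊹ ℕtoℚ ρ) eq ∙ ⊹-identityˡ _))) ρ<m)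
      (ring48 _ _ ∙ (cong₂ _−_ (sym (quotient-rule M f (ℕtoℚ ρ) (ℕtoℚ m)) ∙ z m (ℕₚ.<⇒≤ ρ<m)) (z ρ ℕₚ.≤-refl)) ∙ ring178 (ℕtoℚ m − ℕtoℚ ρ)))
  coefficients : ∀ i → i < suc M → f i ≡ 0ℚ
  coefficients = quotient-zero (suc M) f (ℕtoℚ ρ) λ { zero _ → z ρ ℕₚ.≤-refl ; (suc i) (s≤s i<M) → quotient≡0 i i<M }

ev : ℕ → (ℕ → ℕ → ℚ) → ℚ → ℚ → ℚ
ev M F x y = poly M (λ a → poly M (F a) y) x

ev-Σ< : ∀ M F x y → ev M F x y ≡ Σ< M (λ a → Σ< M (λ b → F a b · pw y b) · pw x a)
ev-Σ< M F x y = poly-Σ< M (λ a → poly M (F a) y) x ∙ Σ<-cong M (λ a → cong (_· pw x a) (poly-Σ< M (F a) y))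

-- For each fixed j the admissible i are still unbounded, so the first variable can be eliminated at
-- fixed j before j varies.
interpolation² : ∀ M F → (∀ i j → 2 ≤ j → j < i → ev M F (ℕtoℚ i) (ℕtoℚ j) ≡ 0ℚ) → ∀ a b → a < M → b < M → F a b ≡ 0ℚ
interpolation² M F z a b a<M b<M = interpolation M (F a) 2
  (λ j 2≤j → interpolation M (λ a → poly M (F a) (ℕtoℚ j)) (suc j) (λ i j<i → z i j 2≤j j<i) a a<M) b b<M

ev-cong< : ∀ M {F G} x y → (∀ a b → a < M → b < M → F a b ≡ G a b) → ev M F x y ≡ ev M G x y
ev-cong< M x y eq = poly-cong< M x (λ a a<M → poly-cong< M y (λ b b<M → eq a b a<M b<M))

ev-⊹ : ∀ M F G x y → ev M (λ a b → F a b ⊹ G a b) x y ≡ ev M F x y ⊹ ev M G x y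
ev-⊹ M F G x y = poly-cong< M x (λ a _ → poly-⊹ M (F a) (G a) y) ∙ poly-⊹ M (λ a → poly M (F a) y) (λ a → poly M (G a) y) x

ev-· : ∀ M k F x y → ev M (λ a b → k · F a b) x y ≡ k · ev M F x y
ev-· M k F x y = poly-cong< M x (λ a _ → poly-· M k (F a) y) ∙ poly-· M k (λ a → poly M (F a) y) x

ev-zero : ∀ M x y → ev M (λ _ _ → 0ℚ) x y ≡ 0ℚ
ev-zero M x y = poly-cong< M x (λ _ _ → poly-zero M y) ∙ poly-zero M x

ev-shift₁ : ∀ M F x y → (∀ b → F M b ≡ 0ℚ) → ev (suc M) (shift₁ F) x y ≡ x · ev (suc M) F x y
ev-shift₁ M F x y z = poly-suc M (λ a → poly (suc M) (shift₁ F a) y) x ∙ cong (_⊹ x · poly M (λ a → poly (suc M) (F a) y) x) (poly-zero (suc M) y)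
  ∙ ⊹-identityˡ _ ∙ cong (x ·_) (sym (poly-snoc M (λ a → poly (suc M) (F a) y) x (poly-cong< (suc M) y (λ b _ → z b) ∙ poly-zero (suc M) y)))

ev-shift₂ : ∀ M F x y → (∀ a → F a M ≡ 0ℚ) → ev (suc M) (shift₂ F) x y ≡ y · ev (suc M) F x y
ev-shift₂ M F x y z = poly-cong< (suc M) x shifted ∙ poly-· (suc M) y (λ a → poly (suc M) (F a) y) x
  where
  shifted : ∀ a → a < suc M → poly (suc M) (shift₂ F a) y ≡ y · poly (suc M) (F a) y
  shifted a _ = poly-suc M (shift₂ F a) y ∙ ⊹-identityˡ _ ∙ cong (y ·_) (sym (poly-snoc M (F a) y (z a)))

-- Graded traces of a permutation

applyUpTo-+ : ∀ m n (f : ℕ → ℕ) → applyUpTo f (m + n) ≡ applyUpTo f m ++ applyUpTo (λ i → f (m + i)) n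
applyUpTo-+ zero n f = refl
applyUpTo-+ (suc m) n f = cong (f 0 ∷_) (applyUpTo-+ m n (f ∘ suc))

Path-map : ∀ {h h′ : ℕ → ℕ} k → (∀ y → h′ (k + y) ≡ k + h y) → ∀ {x₀ x xs} → Path h x₀ x xs → Path h′ (k + x₀) (k + x) (map (k +_) xs)
Path-map k eq (end p) = end (eq _ ∙ cong (k +_) p)
Path-map k eq (step p q) = step (eq _ ∙ cong (k +_) p) (Path-map k eq q)

prodL-const : ∀ (w : ℕ → ℚ) z gs → (∀ g → g ∈ gs → w g ≡ z) → prodL w gs ≡ pw z (length gs)
prodL-const w z [] eq = refl
prodL-const w z (g ∷ gs) eq = cong₂ _·_ (eq g (here refl)) (prodL-const w z gs (λ g g∈ → eq g (there g∈)))

-- The polynomials of the statement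

coeff : Poly → ℕ → ℕ → ℚ
coeff F a b = ℕtoℚ (F a b)

data Shifted (k : ℕ) : ℕ → ℕ → Set where
  inside : ∀ i j → Shifted k (k + i) (k + j)
  outside : ∀ {a b} → (∀ F → uvPow* k F a b ≡ 0) → Shifted k a b

shifted? : ∀ k a b → Shifted k a b
shifted? k a b with ℕₚ.<-≤-connex a k | ℕₚ.<-≤-connex b k
... | inj₁ a<k | _ = outside (λ F → cong (λ t → if t ∧ (k ≤ᵇ b) then F (a ∸ k) (b ∸ k) else 0) (>⇒≤ᵇ-false a<k))
... | inj₂ _ | inj₁ b<k = outside (λ F → cong (if_then F (a ∸ k) (b ∸ k) else 0) (cong ((k ≤ᵇ a) ∧_) (>⇒≤ᵇ-false b<k) ∙ Boolₚ.∧-zeroʳ _))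
... | inj₂ k≤a | inj₂ k≤b with ℕₚ.m≤n⇒∃[o]m+o≡n k≤a | ℕₚ.m≤n⇒∃[o]m+o≡n k≤b
... | i , refl | j , refl = inside i j

uvPow*-inside : ∀ k F i j → uvPow* k F (k + i) (k + j) ≡ F i j
uvPow*-inside k F i j = cong₂ (λ s t → if s ∧ t then F (k + i ∸ k) (k + j ∸ k) else 0) (≤⇒≤ᵇ (ℕₚ.m≤m+n k i)) (≤⇒≤ᵇ (ℕₚ.m≤m+n k j))
  ∙ cong₂ F (ℕₚ.m+n∸m≡n k i) (ℕₚ.m+n∸m≡n k j)

uvPow*-below : ∀ k F {a} b → a < k → uvPow* k F a b ≡ 0
uvPow*-below k F {a} b a<k = cong (λ t → if t ∧ (k ≤ᵇ b) then F (a ∸ k) (b ∸ k) else 0) (>⇒≤ᵇ-false a<k)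

uvPow*-left : ∀ k F a {b} → b < k → uvPow* k F a b ≡ 0
uvPow*-left k F a {b} b<k = cong (if_then F (a ∸ k) (b ∸ k) else 0) (cong ((k ≤ᵇ a) ∧_) (>⇒≤ᵇ-false b<k) ∙ Boolₚ.∧-zeroʳ _)

-- Bounds on the total degree are all that the comparison with the cut at n asks for.
record InDegrees (lo hi : ℕ) (F : Poly) : Set where
  field
    vanish-below : ∀ a b → a + b < lo → F a b ≡ 0
    vanish-above : ∀ a b → hi < a + b → F a b ≡ 0

open InDegrees public

qint-InDegrees : ∀ j → InDegrees j j (qint (suc j))
qint-InDegrees j = record
  { vanish-below = λ a b lt → cong (if_then 1 else 0) (≢⇒≡ᵇ-false (λ eq → ℕₚ.<-irrefl eq lt))
  ; vanish-above = λ a b lt → cong (if_then 1 else 0) (≢⇒≡ᵇ-false (λ eq → ℕₚ.<-irrefl (sym eq) lt)) }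

InDegrees-weaken : ∀ {lo hi lo′ hi′ F} → lo′ ≤ lo → hi ≤ hi′ → InDegrees lo hi F → InDegrees lo′ hi′ F
InDegrees-weaken l≤ ≤h D = record
  { vanish-below = λ a b lt → vanish-below D a b (ℕₚ.≤-trans lt l≤)
  ; vanish-above = λ a b lt → vanish-above D a b (ℕₚ.≤-trans (s≤s ≤h) lt) }

⊕-InDegrees : ∀ {lo hi F G} → InDegrees lo hi F → InDegrees lo hi G → InDegrees lo hi (F ⊕ G)
⊕-InDegrees D E = record
  { vanish-below = λ a b lt → cong₂ _+_ (vanish-below D a b lt) (vanish-below E a b lt)
  ; vanish-above = λ a b lt → cong₂ _+_ (vanish-above D a b lt) (vanish-above E a b lt) }

degree-inside : ∀ k i j → (k + i) + (k + j) ≡ (k + k) + (i + j)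
degree-inside = ℕSolver.solve-∀

uvPow*-InDegrees : ∀ k {lo hi F} → InDegrees lo hi F → InDegrees (k + k + lo) (k + k + hi) (uvPow* k F)
uvPow*-InDegrees k {lo} {hi} {F} D = record { vanish-below = under ; vanish-above = over }
  where
  under : ∀ a b → a + b < k + k + lo → uvPow* k F a b ≡ 0
  under a b lt with shifted? k a b
  ... | outside z = z F
  ... | inside i j = uvPow*-inside k F i j ∙ vanish-below D i j (ℕₚ.+-cancelˡ-< (k + k) (i + j) lo (subst (_< k + k + lo) (degree-inside k i j) lt))
  over : ∀ a b → k + k + hi < a + b → uvPow* k F a b ≡ 0
  over a b lt with shifted? k a b
  ... | outside z = z F
  ... | inside i j = uvPow*-inside k F i j ∙ vanish-above D i j (ℕₚ.+-cancelˡ-< (k + k) hi (i + j) (subst (k + k + hi <_) (degree-inside k i j) lt))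

uvPow*-cong-below : ∀ k {lo F G} → (∀ a b → a + b < lo → F a b ≡ G a b) → ∀ a b → a + b < k + k + lo → uvPow* k F a b ≡ uvPow* k G a b
uvPow*-cong-below k {lo} {F} {G} eq a b lt with shifted? k a b
... | outside z = z F ∙ sym (z G)
... | inside i j = uvPow*-inside k F i j ∙ eq i j (ℕₚ.+-cancelˡ-< (k + k) (i + j) lo (subst (_< k + k + lo) (degree-inside k i j) lt)) ∙ sym (uvPow*-inside k G i j)

module Evaluation (u v : ℚ) where

  ev-uvPow* : ∀ k M F → ev (k + M) (coeff (uvPow* k F)) u v ≡ pw (u · v) k · ev M (coeff F) u v
  ev-uvPow* k M F = poly-drop k M (λ a → poly (k + M) (coeff (uvPow* k F) a) v) u
        (λ a a<k → trans (poly-cong< (k + M) v (λ b _ → cong ℕtoℚ (uvPow*-below k F b a<k))) (poly-zero (k + M) v))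
    ∙ cong (pw u k ·_) (poly-cong< M u (λ a _ → trans (poly-drop k M (coeff (uvPow* k F) (k + a)) v (λ b b<k → cong ℕtoℚ (uvPow*-left k F (k + a) b<k)))
        (cong (pw v k ·_) (poly-cong< M v (λ b _ → cong ℕtoℚ (uvPow*-inside k F a b))))))
    ∙ cong (pw u k ·_) (poly-· M (pw v k) (λ a → poly M (coeff F a) v) u) ∙ sym (·-assoc _ _ _) ∙ cong (_· ev M (coeff F) u v) (sym (pw-· u v k))

  ev-⊕ : ∀ M F G → ev M (coeff (F ⊕ G)) u v ≡ ev M (coeff F) u v ⊹ ev M (coeff G) u v
  ev-⊕ M F G = ev-cong< M u v (λ a b _ _ → ℕtoℚ-⊹ (F a b) (G a b)) ∙ ev-⊹ M (coeff F) (coeff G) u v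

  qint-suc : ∀ j a b → qint (suc j) (suc a) b ≡ qint j a b
  qint-suc zero a b = refl
  qint-suc (suc j) a b = refl

  qint-column : ∀ j B → j < B → poly B (coeff (qint (suc j)) 0) v ≡ pw v j
  qint-column zero (suc B) _ = poly-suc B (coeff (qint 1) 0) v ∙ cong (λ t → 1ℚ ⊹ v · t) (poly-zero B v) ∙ ring185 _
  qint-column (suc j) (suc B) (s≤s j<B) = poly-suc B (coeff (qint (suc (suc j))) 0) v ∙ ⊹-identityˡ _ ∙ cong (v ·_) (qint-column j B j<B)

  -- The two truncation bounds are kept apart because the recursion shortens only the first of them.
  qint-rectangle : ∀ j A B → j ≤ A → j ≤ B → (u − v) · poly A (λ a → poly B (coeff (qint j) a) v) u ≡ pw u j − pw v j
  qint-rectangle zero A B _ _ = cong ((u − v) ·_) (poly-cong< A u (λ a _ → poly-zero B v) ∙ poly-zero A u) ∙ ring186 _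
  qint-rectangle (suc j) (suc A) B (s≤s j≤A) j<B = cong ((u − v) ·_) (poly-suc A (λ a → poly B (coeff (qint (suc j)) a) v) u ∙ cong₂ (λ s t → s ⊹ u · t) (qint-column j B j<B)
        (poly-cong< A u (λ a _ → poly-cong< B v (λ b _ → cong ℕtoℚ (qint-suc j a b)))))
    ∙ ring187 _ _ _ _
    ∙ cong (λ t → (u − v) · pw v j ⊹ u · t) (qint-rectangle j A B j≤A (ℕₚ.<⇒≤ j<B))
    ∙ ring188 _ _ _ _

  ev-qint : ∀ j M → j ≤ M → (u − v) · ev M (coeff (qint j)) u v ≡ pw u j − pw v j
  ev-qint j M j≤M = qint-rectangle j M M j≤M j≤M

-- (1 + u) (1 + v) [d + 1], expanded by (u + v) [d + 1] = [d + 2] + u v [d].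
hookPoly : ℕ → Poly
hookPoly d = uvPow* 1 (qint (suc d)) ⊕ uvPow* 1 (qint d) ⊕ qint (suc (suc d)) ⊕ qint (suc d)

hookPoly-InDegrees : ∀ d → InDegrees d (suc (suc d)) (hookPoly d)
hookPoly-InDegrees d = ⊕-InDegrees (⊕-InDegrees (⊕-InDegrees
  (InDegrees-weaken (ℕₚ.m≤n+m d 2) ℕₚ.≤-refl (uvPow*-InDegrees 1 (qint-InDegrees d))) (previous d))
  (InDegrees-weaken (ℕₚ.n≤1+n d) (ℕₚ.n≤1+n _) (qint-InDegrees (suc d))))
  (InDegrees-weaken ℕₚ.≤-refl (ℕₚ.m≤n+m d 2) (qint-InDegrees d))
  where
  previous : ∀ d → InDegrees d (suc (suc d)) (uvPow* 1 (qint d))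
  previous zero = record { vanish-below = λ _ _ () ; vanish-above = λ a b _ → Boolₚ.if-eta ((1 ≤ᵇ a) ∧ (1 ≤ᵇ b)) }
  previous (suc d) = InDegrees-weaken (ℕₚ.n≤1+n _) (ℕₚ.n≤1+n _) (uvPow*-InDegrees 1 (qint-InDegrees d))

module _ (u v : ℚ) where
  open Evaluation u v

  ev-hookPoly : ∀ d M → suc d ≤ M → (u − v) · ev (suc M) (coeff (hookPoly d)) u v ≡ ((1ℚ ⊹ u) · (1ℚ ⊹ v)) · (pw u (suc d) − pw v (suc d))
  ev-hookPoly d M d<M = cong ((u − v) ·_) (ev-⊕ (suc M) (F₁ ⊕ F₂ ⊕ F₃) F₄ ∙ cong (_⊹ ev (suc M) (coeff F₄) u v) (ev-⊕ (suc M) (F₁ ⊕ F₂) F₃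
        ∙ cong (_⊹ ev (suc M) (coeff F₃) u v) (ev-⊕ (suc M) F₁ F₂ ∙ (cong₂ _⊹_ (ev-uvPow* 1 M (qint (suc d))) (ev-uvPow* 1 M (qint d))))))
    ∙ ring189 _ _ _ _ _ _
    ∙ cong₂ _⊹_ (cong₂ _⊹_ (cong₂ (λ s t → (u · v) · s ⊹ (u · v) · t) (ev-qint (suc d) M d<M) (ev-qint d M (ℕₚ.<⇒≤ d<M))) (ev-qint (suc (suc d)) (suc M) (s≤s d<M)))
        (ev-qint (suc d) (suc M) (ℕₚ.≤-trans d<M (ℕₚ.n≤1+n M)))
    ∙ ring190 _ _ _ _
    where
    F₁ F₂ F₃ F₄ : Poly
    F₁ = uvPow* 1 (qint (suc d))
    F₂ = uvPow* 1 (qint d)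
    F₃ = qint (suc (suc d))
    F₄ = qint (suc d)

-- The multiplicity of a hook-shaped partition

opaque
  unfolding ℚ-ring

  frobSchurCoeff≡ : ∀ n p a b → frobSchurCoeff n p a b ≡ invℚ (ℕtoℚ (n !)) · sumℚ (map (λ σ → charR n a b σ · ℤtoℚ (irrChar p (cycleType n σ))) (perms n))
  frobSchurCoeff≡ n p a b = refl

ev-sumL : ∀ {A : Set} M (F : A → ℕ → ℕ → ℚ) xs x y → ev M (λ a b → sumL (λ t → F t a b) xs) x y ≡ sumL (λ t → ev M (F t) x y) xs
ev-sumL M F [] x y = ev-zero M x y
ev-sumL M F (t ∷ ts) x y = ev-⊹ M (F t) (λ a b → sumL (λ t → F t a b) ts) x y ∙ cong (ev M (F t) x y ⊹_) (ev-sumL M F ts x y)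

-- `hookPoly d` without its top-degree part u v [d + 1]. When the first two rows are equal, that
-- part would land in total degree n.
hookPoly-equal : ℕ → Poly
hookPoly-equal d = uvPow* 1 (qint d) ⊕ qint (suc (suc d)) ⊕ qint (suc d)

hookPoly-equal-InDegrees : ∀ d → InDegrees d (suc d) (hookPoly-equal d)
hookPoly-equal-InDegrees d = ⊕-InDegrees (⊕-InDegrees (previous d)
  (InDegrees-weaken (ℕₚ.n≤1+n d) ℕₚ.≤-refl (qint-InDegrees (suc d))))
  (InDegrees-weaken ℕₚ.≤-refl (ℕₚ.n≤1+n d) (qint-InDegrees d))
  where
  previous : ∀ d → InDegrees d (suc d) (uvPow* 1 (qint d))
  previous zero = record { vanish-below = λ _ _ () ; vanish-above = λ a b _ → Boolₚ.if-eta ((1 ≤ᵇ a) ∧ (1 ≤ᵇ b)) }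
  previous (suc d) = InDegrees-weaken (ℕₚ.n≤1+n _) ℕₚ.≤-refl (uvPow*-InDegrees 1 (qint-InDegrees d))

hookPoly-agree : ∀ d a b → a + b < suc (suc d) → hookPoly d a b ≡ hookPoly-equal d a b
hookPoly-agree d a b lt = cong (λ x → x + uvPow* 1 (qint d) a b + qint (suc (suc d)) a b + qint (suc d) a b) (vanish-below (uvPow*-InDegrees 1 (qint-InDegrees d)) a b lt)

-- Operators on the exterior algebra and their commutation relations.

module Coinvariants (n : ℕ) (n≢0 : n ≢ 0) where

  N : ℕ
  N = n + n

  κ : ℕ → Bool
  κ g = g <ᵇ n

  𝟙θ 𝟙ξ : ℕ → ℚ
  𝟙θ g = if κ g then 1ℚ else 0ℚ
  𝟙ξ g = if κ g then 0ℚ else 1ℚ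

  t s ∂t ∂s L Λ : V N → V N
  t = C 𝟙θ
  s = C 𝟙ξ
  ∂t = A 𝟙θ
  ∂s = A 𝟙ξ
  L x β = Σ< n (λ i → c i (c (n + i) x) β)
  Λ x β = Σ< n (λ i → a (n + i) (a i x) β)

  lt : Linear t
  lt = C-Linear 𝟙θ
  ls : Linear s
  ls = C-Linear 𝟙ξ
  l∂t : Linear ∂t
  l∂t = A-Linear 𝟙θ
  l∂s : Linear ∂s
  l∂s = A-Linear 𝟙ξ
  lL : Linear L
  lL = Linear-Σ< n (λ i → Linear-∘ (C-Linear (δ i)) (C-Linear (δ (n + i))))
  lΛ : Linear Λ
  lΛ = Linear-Σ< n (λ i → Linear-∘ (A-Linear (δ (n + i))) (A-Linear (δ i)))

  κ-θ : ∀ {i} → i < n → κ i ≡ true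
  κ-θ = <⇒<ᵇ

  κ-ξ : ∀ i → κ (n + i) ≡ false
  κ-ξ i = ≥⇒<ᵇ-false (ℕₚ.m≤m+n n i)

  θ< : ∀ {i} → i < n → i < N
  θ< i<n = ℕₚ.≤-trans i<n (ℕₚ.m≤m+n n n)

  ξ< : ∀ {i} → i < n → n + i < N
  ξ< i<n = ℕₚ.+-monoʳ-< n i<n

  𝟙θ-θ : ∀ {i} → i < n → 𝟙θ i ≡ 1ℚ
  𝟙θ-θ i<n = cong (if_then 1ℚ else 0ℚ) (κ-θ i<n)

  𝟙ξ-θ : ∀ {i} → i < n → 𝟙ξ i ≡ 0ℚ
  𝟙ξ-θ i<n = cong (if_then 0ℚ else 1ℚ) (κ-θ i<n)

  𝟙θ-ξ : ∀ i → 𝟙θ (n + i) ≡ 0ℚ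
  𝟙θ-ξ i = cong (if_then 1ℚ else 0ℚ) (κ-ξ i)

  𝟙ξ-ξ : ∀ i → 𝟙ξ (n + i) ≡ 1ℚ
  𝟙ξ-ξ i = cong (if_then 0ℚ else 1ℚ) (κ-ξ i)

  OfKind-𝟙θ : OfKind true κ 𝟙θ
  OfKind-𝟙θ g ne with κ g
  ... | true = ⊥-elim (ne refl)
  ... | false = refl

  OfKind-𝟙ξ : OfKind false κ 𝟙ξ
  OfKind-𝟙ξ g ne with κ g
  ... | true = refl
  ... | false = ⊥-elim (ne refl)

  OfKind-δ : ∀ k g → κ g ≡ k → OfKind k κ (δ g)
  OfKind-δ k g eq i ne = δ-≢ {g} {i} (λ { refl → ne eq })

  dot-𝟙 : ∀ (w z : ℕ → ℚ) → dot N w z ≡ Σ< n (λ i → w i · z i) ⊹ Σ< n (λ i → w (n + i) · z (n + i))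
  dot-𝟙 w z = Σ<-+ n n _

  private
    νn : ℚ
    νn = ℕtoℚ n

  dot-θθ : dot N 𝟙θ 𝟙θ ≡ ℕtoℚ n
  dot-θθ = begin
    dot N 𝟙θ 𝟙θ ≡⟨ dot-𝟙 𝟙θ 𝟙θ ⟩
    _
      ≡⟨ cong₂ _⊹_ (Σ<-cong< n (λ i i<n → trans (cong₂ _·_ (𝟙θ-θ i<n) (𝟙θ-θ i<n)) (·-identityˡ 1ℚ)))
                   (Σ<-zero n (λ i _ → trans (cong (_· 𝟙θ (n + i)) (𝟙θ-ξ i)) (·-zeroˡ _))) ⟩
    Σ< n (λ _ → 1ℚ) ⊹ 0ℚ ≡⟨ trans (⊹-identityʳ _) (Σ<-const n 1ℚ ∙ ·-identityʳ _) ⟩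
    _ ∎

  dot-ξξ : dot N 𝟙ξ 𝟙ξ ≡ ℕtoℚ n
  dot-ξξ = begin
    dot N 𝟙ξ 𝟙ξ ≡⟨ dot-𝟙 𝟙ξ 𝟙ξ ⟩
    _
      ≡⟨ cong₂ _⊹_ (Σ<-zero n (λ i i<n → trans (cong (_· 𝟙ξ i) (𝟙ξ-θ i<n)) (·-zeroˡ _)))
                   (Σ<-cong n (λ i → trans (cong₂ _·_ (𝟙ξ-ξ i) (𝟙ξ-ξ i)) (·-identityˡ 1ℚ))) ⟩
    0ℚ ⊹ Σ< n (λ _ → 1ℚ) ≡⟨ trans (⊹-identityˡ _) (Σ<-const n 1ℚ ∙ ·-identityʳ _) ⟩
    _ ∎

  dot-θξ : dot N 𝟙θ 𝟙ξ ≡ 0ℚ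
  dot-θξ = Σ<-zero N (λ i _ → aux (κ i))
    where
    aux : ∀ b → (if b then 1ℚ else 0ℚ) · (if b then 0ℚ else 1ℚ) ≡ 0ℚ
    aux true = ·-zeroʳ _
    aux false = ·-zeroˡ _

  dot-ξθ : dot N 𝟙ξ 𝟙θ ≡ 0ℚ
  dot-ξθ = Σ<-cong N (λ i → ·-comm _ _) ∙ dot-θξ

  ∂t-t : ∀ x → ∂t (t x) ≈ νn ·ᵥ x -ᵥ t (∂t x)
  ∂t-t x β = AC-anti 𝟙θ 𝟙θ x β ∙ cong (λ k → k · x β − t (∂t x) β) dot-θθ

  ∂s-s : ∀ x → ∂s (s x) ≈ νn ·ᵥ x -ᵥ s (∂s x)
  ∂s-s x β = AC-anti 𝟙ξ 𝟙ξ x β ∙ cong (λ k → k · x β − s (∂s x) β) dot-ξξ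

  ∂t-s : ∀ x → ∂t (s x) ≈ (λ β → − s (∂t x) β)
  ∂t-s x β = AC-anti 𝟙θ 𝟙ξ x β ∙ cong (λ k → k · x β − s (∂t x) β) dot-θξ ∙ ring54 _ _

  ∂s-t : ∀ x → ∂s (t x) ≈ (λ β → − t (∂s x) β)
  ∂s-t x β = AC-anti 𝟙ξ 𝟙θ x β ∙ cong (λ k → k · x β − t (∂s x) β) dot-ξθ ∙ ring54 _ _

  δ-shift : ∀ m i j → δ (m + i) (m + j) ≡ δ i j
  δ-shift zero i j = refl
  δ-shift (suc m) i j = δ-shift m i j

  sumδξ : ∀ g → g < N → Σ< n (λ i → δ (n + i) g) ≡ 𝟙ξ g
  sumδξ g g<N with κ g in eq
  ... | true = Σ<-zero n (λ i _ → δ-≢ {n + i} {g} (λ e → ℕₚ.<-irrefl refl (ℕₚ.≤-trans (<ᵇ⇒< g n eq) (subst (n ≤_) e (ℕₚ.m≤m+n n i)))))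
  ... | false with ℕₚ.m≤n⇒∃[o]m+o≡n (<ᵇ-false⇒≥ g n eq)
  ... | j , refl = Σ<-cong n (λ i → trans (δ-shift n i j) (δ-sym i j ∙ sym (·-identityʳ _))) ∙ Σ<-δ n (λ _ → 1ℚ) (ℕₚ.+-cancelˡ-< n j n g<N)

  s≈Σ : ∀ x β → Σ< n (λ i → c (n + i) x β) ≡ s x β
  s≈Σ x β = sym (C-weight-Σ< n (λ i → δ (n + i)) x β) ∙ C-weight-cong sumδξ x β

  ∂s≈Σ : ∀ x β → Σ< n (λ i → a (n + i) x β) ≡ ∂s x β
  ∂s≈Σ x β = sym (A-weight-Σ< n (λ i → δ (n + i)) x β) ∙ A-weight-cong sumδξ x β

  sumδθ : ∀ g → Σ< n (λ i → δ i g) ≡ 𝟙θ g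
  sumδθ g with κ g in eq
  ... | true = Σ<-cong n (λ i → trans (δ-sym i g) (sym (·-identityʳ _))) ∙ Σ<-δ n (λ _ → 1ℚ) (<ᵇ⇒< g n eq)
  ... | false = Σ<-zero n (λ i i<n → δ-≢ {i} {g} (λ { refl → ℕₚ.<-irrefl refl (ℕₚ.≤-trans i<n (<ᵇ-false⇒≥ g n eq)) }))

  t≈Σ : ∀ x β → Σ< n (λ i → c i x β) ≡ t x β
  t≈Σ x β = sym (C-weight-Σ< n δ x β) ∙ C-weight-cong (λ g _ → sumδθ g) x β

  ∂t≈Σ : ∀ x β → Σ< n (λ i → a i x β) ≡ ∂t x β
  ∂t≈Σ x β = sym (A-weight-Σ< n δ x β) ∙ A-weight-cong (λ g _ → sumδθ g) x β

  L-C : ∀ w x → L (C w x) ≈ C w (L x)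
  L-C w x β = sym (sumΣ< (C-Linear w) n (λ i → c i (c (n + i) x)) β ∙ Σ<-cong n term)
    where
    term : ∀ i → C w (c i (c (n + i) x)) β ≡ c i (c (n + i) (C w x)) β
    term i = begin
      C w (c i (c (n + i) x)) β ≡⟨ CC-anti w (δ i) _ β ⟩
      − c i (C w (c (n + i) x)) β ≡⟨ cong −_ (resp (C-Linear (δ i)) (CC-anti w (δ (n + i)) x) β) ⟩
      − c i (λ γ → − c (n + i) (C w x) γ) β ≡⟨ cong −_ (neg (C-Linear (δ i)) _ β) ⟩
      − − c i (c (n + i) (C w x)) β ≡⟨ ring47 _ ⟩
      _ ∎

  Λ-A : ∀ w x → Λ (A w x) ≈ A w (Λ x)
  Λ-A w x β = sym (sumΣ< (A-Linear w) n (λ i → a (n + i) (a i x)) β ∙ Σ<-cong n term)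
    where
    term : ∀ i → A w (a (n + i) (a i x)) β ≡ a (n + i) (a i (A w x)) β
    term i = begin
      A w (a (n + i) (a i x)) β ≡⟨ AA-anti w (δ (n + i)) _ β ⟩
      − a (n + i) (A w (a i x)) β ≡⟨ cong −_ (resp (A-Linear (δ (n + i))) (AA-anti w (δ i) x) β) ⟩
      − a (n + i) (λ γ → − a i (A w x) γ) β ≡⟨ cong −_ (neg (A-Linear (δ (n + i))) _ β) ⟩
      − − a (n + i) (a i (A w x)) β ≡⟨ ring47 _ ⟩
      _ ∎

  dot-δʳ : ∀ w {g} → g < N → dot N w (δ g) ≡ w g
  dot-δʳ w {g} g<N = Σ<-cong N (λ i → ·-comm (w i) (δ g i)) ∙ Σ<-δ N w g<N

  Ac : ∀ w {g} → g < N → (x : V N) → A w (c g x) ≈ w g ·ᵥ x -ᵥ c g (A w x)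
  Ac w {g} g<N x β = AC-anti w (δ g) x β ∙ cong (λ k → k · x β − c g (A w x) β) (dot-δʳ w g<N)

  aC : ∀ w {g} → g < N → (x : V N) → a g (C w x) ≈ w g ·ᵥ x -ᵥ C w (a g x)
  aC w {g} g<N x β = AC-anti (δ g) w x β ∙ cong (λ k → k · x β − C w (a g x) β) (dot-δ N w g<N)

  -- Contraction is an antiderivation and L multiplies by an even element, so the commutator
  -- contracts the factors θᵢ ξᵢ. It is specialised below to `𝟙θ`, `𝟙ξ` and single generators.
  A-L : ∀ w x β → A w (L x) β ≡ L (A w x) β ⊹ Σ< n (λ i → w i · c (n + i) x β − w (n + i) · c i x β)
  A-L w x β = sumΣ< (A-Linear w) n (λ i → c i (c (n + i) x)) β
    ∙ Σ<-cong< n term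
    ∙ Σ<-⊹ n (λ i → c i (c (n + i) (A w x)) β) (λ i → w i · c (n + i) x β − w (n + i) · c i x β)
    where
    term : ∀ i → i < n → A w (c i (c (n + i) x)) β ≡ c i (c (n + i) (A w x)) β ⊹ (w i · c (n + i) x β − w (n + i) · c i x β)
    term i i<n = Ac w (θ< i<n) _ β
      ∙ cong (λ k → w i · c (n + i) x β − k) (resp (C-Linear (δ i)) (Ac w (ξ< i<n) x) β
          ∙ sub (C-Linear (δ i)) (w (n + i) ·ᵥ x) _ β ∙ cong (_− c i (c (n + i) (A w x)) β) (mul (C-Linear (δ i)) (w (n + i)) x β))
      ∙ ring55 _ _ _

  Λ-C : ∀ w x β → Λ (C w x) β ≡ C w (Λ x) β ⊹ Σ< n (λ i → w i · a (n + i) x β − w (n + i) · a i x β)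
  Λ-C w x β = Σ<-cong< n term
    ∙ Σ<-⊹ n (λ i → C w (a (n + i) (a i x)) β) (λ i → w i · a (n + i) x β − w (n + i) · a i x β)
    ∙ cong (_⊹ Σ< n (λ i → w i · a (n + i) x β − w (n + i) · a i x β)) (sym (sumΣ< (C-Linear w) n (λ i → a (n + i) (a i x)) β))
    where
    term : ∀ i → i < n → a (n + i) (a i (C w x)) β ≡ C w (a (n + i) (a i x)) β ⊹ (w i · a (n + i) x β − w (n + i) · a i x β)
    term i i<n = resp (A-Linear (δ (n + i))) (aC w (θ< i<n) x) β
      ∙ sub (A-Linear (δ (n + i))) (w i ·ᵥ x) _ β ∙ (cong₂ _−_ (mul (A-Linear (δ (n + i))) (w i) x β) (aC w (ξ< i<n) (a i x) β))
      ∙ ring55 _ _ _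

  pick-θ : ∀ (w : ℕ → ℚ) (f g : ℕ → ℚ) → (∀ i → i < n → w i ≡ 1ℚ) → (∀ i → w (n + i) ≡ 0ℚ) →
    Σ< n (λ i → w i · f i − w (n + i) · g i) ≡ Σ< n f
  pick-θ w f g p r = Σ<-cong< n (λ i i<n → trans (cong₂ (λ k l → k · f i − l · g i) (p i i<n) (r i)) (ring56 _ _))

  pick-ξ : ∀ (w : ℕ → ℚ) (f g : ℕ → ℚ) → (∀ i → i < n → w i ≡ 0ℚ) → (∀ i → w (n + i) ≡ 1ℚ) →
    Σ< n (λ i → w i · f i − w (n + i) · g i) ≡ − Σ< n g
  pick-ξ w f g p r = Σ<-cong< n (λ i i<n → trans (cong₂ (λ k l → k · f i − l · g i) (p i i<n) (r i)) (ring57 _ _)) ∙ Σ<-neg n g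

  ∂t-L : ∀ x β → ∂t (L x) β ≡ L (∂t x) β ⊹ s x β
  ∂t-L x β = A-L 𝟙θ x β ∙ cong (L (∂t x) β ⊹_) (pick-θ 𝟙θ _ (λ i → c i x β) (λ i → 𝟙θ-θ) 𝟙θ-ξ ∙ s≈Σ x β)

  ∂s-L : ∀ x β → ∂s (L x) β ≡ L (∂s x) β − t x β
  ∂s-L x β = A-L 𝟙ξ x β ∙ cong (L (∂s x) β ⊹_) (pick-ξ 𝟙ξ (λ i → c (n + i) x β) _ (λ i → 𝟙ξ-θ) 𝟙ξ-ξ ∙ (cong −_ (t≈Σ x β)))

  Λ-t : ∀ x β → Λ (t x) β ≡ t (Λ x) β ⊹ ∂s x β
  Λ-t x β = Λ-C 𝟙θ x β ∙ cong (t (Λ x) β ⊹_) (pick-θ 𝟙θ _ (λ i → a i x β) (λ i → 𝟙θ-θ) 𝟙θ-ξ ∙ ∂s≈Σ x β)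

  Λ-s : ∀ x β → Λ (s x) β ≡ s (Λ x) β − ∂t x β
  Λ-s x β = Λ-C 𝟙ξ x β ∙ cong (s (Λ x) β ⊹_) (pick-ξ 𝟙ξ (λ i → a (n + i) x β) _ (λ i → 𝟙ξ-θ) 𝟙ξ-ξ ∙ (cong −_ (∂t≈Σ x β)))

  private
    δ-offset : ∀ {j} → j < n → ∀ i → δ j (n + i) ≡ 0ℚ
    δ-offset {j} j<n i = δ-≢ {j} {n + i} (λ { refl → ℕₚ.<-irrefl refl (ℕₚ.≤-trans j<n (ℕₚ.m≤m+n n i)) })

    δ-offset′ : ∀ j {i} → i < n → δ (n + j) i ≡ 0ℚ
    δ-offset′ j {i} i<n = δ-≢ {n + j} {i} (λ { refl → ℕₚ.<-irrefl refl (ℕₚ.≤-trans i<n (ℕₚ.m≤m+n n j)) })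

  aθ-L : ∀ {j} → j < n → ∀ x β → a j (L x) β ≡ L (a j x) β ⊹ c (n + j) x β
  aθ-L {j} j<n x β = A-L (δ j) x β ∙ cong (L (a j x) β ⊹_) (trans
    (Σ<-cong n (λ i → trans (cong (λ k → δ j i · c (n + i) x β − k · c i x β) (δ-offset j<n i)) (ring58 _ _)))
    (Σ<-δ n (λ i → c (n + i) x β) j<n))

  aξ-L : ∀ {j} → j < n → ∀ x β → a (n + j) (L x) β ≡ L (a (n + j) x) β − c j x β
  aξ-L {j} j<n x β = A-L (δ (n + j)) x β ∙ cong (L (a (n + j) x) β ⊹_) (trans
    (Σ<-cong< n (λ i i<n → trans (cong₂ (λ k l → k · c (n + i) x β − l · c i x β) (δ-offset′ j i<n) (δ-shift n j i)) (ring54 _ _))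
           ∙ Σ<-neg n (λ i → δ j i · c i x β))
    (cong −_ (Σ<-δ n (λ i → c i x β) j<n)))

  number : V N → V N
  number = diag κ (λ i j → ℕtoℚ (i + j))

  -- Each of the n pairs θᵢ, ξᵢ contributes 1 minus the number of its members that are present.
  Λ-L : ∀ x β → Λ (L x) β ≡ L (Λ x) β ⊹ (νn · x β − number x β)
  Λ-L x β = Σ<-cong< n term
    ∙ Σ<-⊹ n (λ j → L (a (n + j) (a j x)) β) (λ j → x β − (c j (a j x) β ⊹ c (n + j) (a (n + j) x) β))
    ∙ cong₂ _⊹_ (sym (sumΣ< lL n (λ j → a (n + j) (a j x)) β)) count
    where
    term : ∀ j → j < n → a (n + j) (a j (L x)) β ≡ L (a (n + j) (a j x)) β ⊹ (x β − (c j (a j x) β ⊹ c (n + j) (a (n + j) x) β))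
    term j j<n = trans (resp (A-Linear (δ (n + j))) (aθ-L j<n x) β) (add (A-Linear (δ (n + j))) (L (a j x)) (c (n + j) x) β)
      ∙ cong₂ _⊹_ (aξ-L j<n (a j x) β) (ac-same (ξ< j<n) x β)
      ∙ ring59 _ _ _ _
    count : Σ< n (λ j → x β − (c j (a j x) β ⊹ c (n + j) (a (n + j) x) β)) ≡ νn · x β − number x β
    count = trans (Σ<-⊹ n (λ _ → x β) (λ j → − (c j (a j x) β ⊹ c (n + j) (a (n + j) x) β))) (cong₂ _⊹_ (Σ<-const n (x β)) (Σ<-neg n (λ j → c j (a j x) β ⊹ c (n + j) (a (n + j) x) β)))
      ∙ cong (λ k → νn · x β − k) (Σ<-⊹ n (λ j → c j (a j x) β) (λ j → c (n + j) (a (n + j) x) β) ∙ sym (Σ<-+ n n (λ g → c g (a g x) β)))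
      ∙ cong (λ k → νn · x β − k) (sym (ring60 _ (x β)) ∙ number-operator κ x 0 β)

  ν : ℚ
  ν = invℚ (ℕtoℚ n)

  νn≡1 : ν · ℕtoℚ n ≡ 1ℚ
  νn≡1 = ·-inverseˡ _ (λ eq → n≢0 (ℕtoℚ-injective {n} {0} eq))

  -- The exterior algebra on the reflection representation, as a subspace.
  Reduced : V N → Set
  Reduced x = (∂t x ≈ 0ᵥ) × (∂s x ≈ 0ᵥ)

  -- L leaves the reduced subspace, since `∂t` of L x is s x there. Subtracting t s / n repairs this
  -- and changes L only by an element of the ideal of t and s; the commutator with Λ drops from n -
  -- deg to n - 1 - deg, see `Λ-L′`.
  L′ : V N → V N
  L′ x = L x -ᵥ ν ·ᵥ t (s x)

  lL′ : Linear L′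
  lL′ = Linear-− lL (Linear-· ν (Linear-∘ lt ls))

  ∂t-ts : ∀ {x} → Reduced x → ∂t (t (s x)) ≈ ℕtoℚ n ·ᵥ s x
  ∂t-ts {x} (rt , rs) β = begin
    ∂t (t (s x)) β ≡⟨ ∂t-t (s x) β ⟩
    ℕtoℚ n · s x β − t (∂t (s x)) β ≡⟨ cong (λ k → ℕtoℚ n · s x β − k) (vanish lt (λ γ → trans (∂t-s x γ) ((cong −_ (vanish ls rt γ)) ∙ −0≡0)) β) ⟩
    ℕtoℚ n · s x β − 0ℚ ≡⟨ ring61 _ ⟩
    _ ∎

  ∂s-s-reduced : ∀ {x} → Reduced x → ∂s (s x) ≈ ℕtoℚ n ·ᵥ x
  ∂s-s-reduced {x} (rt , rs) β = ∂s-s x β ∙ cong (λ k → ℕtoℚ n · x β − k) (vanish ls rs β) ∙ ring61 _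

  Reduced-L′ : ∀ {x} → Reduced x → Reduced (L′ x)
  Reduced-L′ {x} r@(rt , rs) = zero-t , zero-s
    where
    kill : ∀ y → (1ℚ − ν · ℕtoℚ n) · y ≡ 0ℚ
    kill y = cong (λ k → (1ℚ − k) · y) νn≡1 ∙ ring64 y
    zero-t : ∂t (L′ x) ≈ 0ᵥ
    zero-t β = begin
      ∂t (L′ x) β ≡⟨ trans (sub l∂t (L x) _ β) (cong (λ k → ∂t (L x) β − k) (mul l∂t ν (t (s x)) β)) ⟩
      ∂t (L x) β − ν · ∂t (t (s x)) β ≡⟨ cong₂ (λ k l → k − ν · l) (∂t-L x β ∙ cong (_⊹ s x β) (vanish lL rt β)) (∂t-ts r β) ⟩
      (0ℚ ⊹ s x β) − ν · (ℕtoℚ n · s x β) ≡⟨ ring62 _ _ _ ⟩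
      (1ℚ − ν · ℕtoℚ n) · s x β ≡⟨ kill _ ⟩
      _ ∎
    zero-s : ∂s (L′ x) ≈ 0ᵥ
    zero-s β = begin
      ∂s (L′ x) β ≡⟨ trans (sub l∂s (L x) _ β) (cong (λ k → ∂s (L x) β − k) (mul l∂s ν (t (s x)) β)) ⟩
      ∂s (L x) β − ν · ∂s (t (s x)) β ≡⟨ cong₂ (λ k l → k − ν · l) (∂s-L x β ∙ cong (_− t x β) (vanish lL rs β))
                                                    (∂s-t (s x) β ∙ (cong −_ (resp lt (∂s-s-reduced r) β ∙ mul lt (ℕtoℚ n) x β))) ⟩
      (0ℚ − t x β) − ν · (− (ℕtoℚ n · t x β)) ≡⟨ ring63 _ _ _ ⟩
      − ((1ℚ − ν · ℕtoℚ n) · t x β) ≡⟨ trans (cong −_ (kill _)) −0≡0 ⟩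
      _ ∎

  Reduced-Λ : ∀ {x} → Reduced x → Reduced (Λ x)
  Reduced-Λ {x} (rt , rs) = (λ β → trans (sym (Λ-A 𝟙θ x β)) (vanish lΛ rt β)) , (λ β → trans (sym (Λ-A 𝟙ξ x β)) (vanish lΛ rs β))

  Λ-L′ : ∀ {x} → Reduced x → ∀ β → Λ (L′ x) β ≡ L′ (Λ x) β ⊹ (ℕtoℚ n · x β − x β − number x β)
  Λ-L′ {x} r@(rt , rs) β = trans (sub lΛ (L x) _ β) (cong (λ k → Λ (L x) β − k) (mul lΛ ν (t (s x)) β))
    ∙ cong₂ (λ k l → k − ν · l) (Λ-L x β) Λts
    ∙ ring65 _ _ _ _ _ _
    ∙ cong (λ k → (L (Λ x) β − ν · t (s (Λ x)) β) ⊹ (ℕtoℚ n · x β − k − number x β)) (cong (_· x β) νn≡1 ∙ ·-identityˡ _)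
    where
    Λts : Λ (t (s x)) β ≡ t (s (Λ x)) β ⊹ ℕtoℚ n · x β
    Λts = Λ-t (s x) β ∙ (cong₂ _⊹_ (resp lt (λ γ → trans (Λ-s x γ) (cong (λ k → s (Λ x) γ − k) (rt γ) ∙ ring61 _)) β) (∂s-s-reduced r β))

  diag-t : ∀ p x → diag κ p (t x) ≈ t (diag κ (bump true p) x)
  diag-t p x = diag-C true κ p 𝟙θ OfKind-𝟙θ x

  diag-s : ∀ p x → diag κ p (s x) ≈ s (diag κ (bump false p) x)
  diag-s p x = diag-C false κ p 𝟙ξ OfKind-𝟙ξ x

  up : (ℕ → ℕ → ℚ) → (ℕ → ℕ → ℚ)
  up p i j = p (suc i) (suc j)

  diag-L : ∀ p x → diag κ p (L x) ≈ L (diag κ (up p) x)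
  diag-L p x β = sumΣ< (diag-Linear κ p) n (λ i → c i (c (n + i) x)) β ∙ Σ<-cong< n (λ i i<n → trans
    (diag-C true κ p (δ i) (OfKind-δ true i (κ-θ i<n)) _ β)
    (resp (C-Linear (δ i)) (diag-C false κ (bump true p) (δ (n + i)) (OfKind-δ false (n + i) (κ-ξ i)) x) β))

  diag-Λ : ∀ p x → diag κ (up p) (Λ x) ≈ Λ (diag κ p x)
  diag-Λ p x β = sumΣ< (diag-Linear κ (up p)) n (λ i → a (n + i) (a i x)) β ∙ Σ<-cong< n (λ i i<n → trans
    (diag-A false κ (bump true p) (δ (n + i)) (OfKind-δ false (n + i) (κ-ξ i)) _ β)
    (resp (A-Linear (δ (n + i))) (diag-A true κ p (δ i) (OfKind-δ true i (κ-θ i<n)) x) β))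

  diag-L′ : ∀ p x → diag κ p (L′ x) ≈ L′ (diag κ (up p) x)
  diag-L′ p x β = sub (diag-Linear κ p) (L x) _ β ∙ (cong₂ _−_ (diag-L p x β)
    (mul (diag-Linear κ p) ν (t (s x)) β ∙ cong (ν ·_) (diag-t p (s x) β ∙ resp lt (diag-s (bump true p) x) β)))

  number-up : ∀ x β → diag κ (up (λ i j → ℕtoℚ (i + j))) x β ≡ number x β ⊹ ℕtoℚ 2 · x β
  number-up x β = diag-cong κ (λ i j → trans (cong ℕtoℚ (cong suc (ℕₚ.+-suc i j) ∙ ℕₚ.+-comm 2 (i + j))) (ℕtoℚ-⊹ (i + j) 2)) x β
    ∙ diag-scales κ _ x β ∙ ring24 _ _ _ ∙ cong (_⊹ ℕtoℚ 2 · x β) (sym (diag-scales κ _ x β))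

  number-Λ : ∀ x β → Λ (number x) β ≡ number (Λ x) β ⊹ ℕtoℚ 2 · Λ x β
  number-Λ x β = sym (diag-Λ _ x β) ∙ number-up (Λ x) β

  number-L′ : ∀ x β → number (L′ x) β ≡ L′ (number x) β ⊹ ℕtoℚ 2 · L′ x β
  number-L′ x β = diag-L′ _ x β ∙ resp lL′ (number-up x) β ∙ add lL′ (number x) _ β ∙ cong (L′ (number x) β ⊹_) (mul lL′ (ℕtoℚ 2) x β)

  Reduced-resp : ∀ {x y} → x ≈ y → Reduced x → Reduced y
  Reduced-resp p (rt , rs) = ≈-trans (resp l∂t (≈-sym p)) rt , ≈-trans (resp l∂s (≈-sym p)) rs

  Reduced-sub : ∀ {x y} → Reduced x → Reduced y → Reduced (x -ᵥ y)
  Reduced-sub {x} {y} (rt , rs) (rt′ , rs′) =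
    (λ β → trans (sub l∂t x y β) ((cong₂ _−_ (rt β) (rt′ β)) ∙ −-inverse 0ℚ)) ,
    (λ β → trans (sub l∂s x y β) ((cong₂ _−_ (rs β) (rs′ β)) ∙ −-inverse 0ℚ))

  Reduced-mul : ∀ {x} k → Reduced x → Reduced (k ·ᵥ x)
  Reduced-mul {x} k (rt , rs) =
    (λ β → trans (mul l∂t k x β) (cong (k ·_) (rt β) ∙ ·-zeroʳ k)) ,
    (λ β → trans (mul l∂s k x β) (cong (k ·_) (rs β) ∙ ·-zeroʳ k))

  -- Reduced vectors of weight n − 1 − deg = k, respectively deg − (n − 1) = k.
  record Low (k : ℕ) (x : V N) : Set where
    constructor mkLow
    field
      reduced : Reduced x
      weight : ∀ β → number x β ⊹ x β ⊹ ℕtoℚ k · x β ≡ ℕtoℚ n · x β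

  record High (k : ℕ) (x : V N) : Set where
    constructor mkHigh
    field
      reduced : Reduced x
      weight : ∀ β → number x β ⊹ x β ≡ ℕtoℚ n · x β ⊹ ℕtoℚ k · x β

  lnumber : Linear number
  lnumber = diag-Linear κ (λ i j → ℕtoℚ (i + j))

  Low-resp : ∀ {k x y} → x ≈ y → Low k x → Low k y
  Low-resp p (mkLow r w) = mkLow (Reduced-resp p r) (λ β → trans (cong₂ (λ u v → u ⊹ v ⊹ _ · v) (sym (resp lnumber p β)) (sym (p β))) (w β ∙ cong (_ ·_) (p β)))

  High-resp : ∀ {k x y} → x ≈ y → High k x → High k y
  High-resp p (mkHigh r w) = mkHigh (Reduced-resp p r) (λ β → trans (cong₂ _⊹_ (sym (resp lnumber p β)) (sym (p β))) (w β ∙ cong (λ v → _ · v ⊹ _ · v) (p β)))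

  Low-sub : ∀ {k x y} → Low k x → Low k y → Low k (x -ᵥ y)
  Low-sub {k} {x} {y} (mkLow r w) (mkLow r′ w′) = mkLow (Reduced-sub r r′) (λ β → trans (cong (λ u → u ⊹ (x β − y β) ⊹ ℕtoℚ k · (x β − y β)) (sub lnumber x y β))
      (ring66 _ _ _ _ _ ∙ (cong₂ _−_ (w β) (w′ β)) ∙ ring4 _ _ _))

  High-sub : ∀ {k x y} → High k x → High k y → High k (x -ᵥ y)
  High-sub {k} {x} {y} (mkHigh r w) (mkHigh r′ w′) = mkHigh (Reduced-sub r r′) (λ β → trans (cong (_⊹ (x β − y β)) (sub lnumber x y β))
      (ring67 _ _ _ _ ∙ (cong₂ _−_ (w β) (w′ β)) ∙ ring68 _ _ _ _))

  Low-mul : ∀ {k x} j → Low k x → Low k (j ·ᵥ x)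
  Low-mul {k} {x} j (mkLow r w) = mkLow (Reduced-mul j r) (λ β → trans (cong (λ u → u ⊹ j · x β ⊹ ℕtoℚ k · (j · x β)) (mul lnumber j x β))
      (ring69 _ _ _ _ ∙ cong (j ·_) (w β) ∙ ring2 _ _ _))

  High-mul : ∀ {k x} j → High k x → High k (j ·ᵥ x)
  High-mul {k} {x} j (mkHigh r w) = mkHigh (Reduced-mul j r) (λ β → trans (cong (_⊹ j · x β) (mul lnumber j x β))
      (ring70 _ _ _ ∙ cong (j ·_) (w β) ∙ ring71 _ _ _ _))

  module _ {X : V N → V N} (lX : Linear X) where
    Low-image : ∀ {k x} → (∀ β → number x β ⊹ x β ⊹ ℕtoℚ k · x β ≡ ℕtoℚ n · x β) →
      ∀ β → X (number x) β ⊹ X x β ⊹ ℕtoℚ k · X x β ≡ ℕtoℚ n · X x β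
    Low-image {k} {x} w β = sym (add lX (number x +ᵥ x) _ β ∙ (cong₂ _⊹_ (add lX (number x) x β) (mul lX (ℕtoℚ k) x β)))
      ∙ resp lX w β ∙ mul lX (ℕtoℚ n) x β

    High-image : ∀ {k x} → (∀ β → number x β ⊹ x β ≡ ℕtoℚ n · x β ⊹ ℕtoℚ k · x β) →
      ∀ β → X (number x) β ⊹ X x β ≡ ℕtoℚ n · X x β ⊹ ℕtoℚ k · X x β
    High-image {k} {x} w β = sym (add lX (number x) x β) ∙ resp lX w β
      ∙ add lX (ℕtoℚ n ·ᵥ x) _ β ∙ (cong₂ _⊹_ (mul lX (ℕtoℚ n) x β) (mul lX (ℕtoℚ k) x β))

  Low-Λ : ∀ {k x} → Low k x → Low (2 + k) (Λ x)
  Low-Λ {k} {x} (mkLow r w) = mkLow (Reduced-Λ r) (λ β → trans (cong (λ u → number (Λ x) β ⊹ Λ x β ⊹ u · Λ x β) (ℕtoℚ-⊹ 2 k) ∙ ring72 _ _ _ _)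
      (cong (λ u → u ⊹ Λ x β ⊹ ℕtoℚ k · Λ x β) (sym (number-Λ x β)) ∙ Low-image lΛ {k} {x} w β))

  Low-L′ : ∀ {k x} → Low (2 + k) x → Low k (L′ x)
  Low-L′ {k} {x} (mkLow r w) = mkLow (Reduced-L′ r) (λ β → trans (cong (λ u → u ⊹ L′ x β ⊹ ℕtoℚ k · L′ x β) (number-L′ x β))
      (ring73 _ _ _ _ ∙ cong (λ u → L′ (number x) β ⊹ L′ x β ⊹ u · L′ x β) (sym (ℕtoℚ-⊹ 2 k)) ∙ Low-image lL′ {2 + k} {x} w β))

  Low-rel : ∀ {k x} → Low k x → Λ (L′ x) ≈ L′ (Λ x) +ᵥ ℕtoℚ k ·ᵥ x
  Low-rel {k} {x} (mkLow r w) β = Λ-L′ r β ∙ cong (L′ (Λ x) β ⊹_) (cong (λ u → u − x β − number x β) (sym (w β)) ∙ ring74 _ _ _)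

  High-L′ : ∀ {k x} → High k x → High (2 + k) (L′ x)
  High-L′ {k} {x} (mkHigh r w) = mkHigh (Reduced-L′ r) (λ β → trans (cong (_⊹ L′ x β) (number-L′ x β)) (ring75 _ _ _
      ∙ cong (_⊹ ℕtoℚ 2 · L′ x β) (High-image lL′ {k} {x} w β) ∙ ring76 _ _ _ _ ∙ cong (λ u → ℕtoℚ n · L′ x β ⊹ u · L′ x β) (sym (ℕtoℚ-⊹ 2 k))))

  High-Λ : ∀ {k x} → High (2 + k) x → High k (Λ x)
  High-Λ {k} {x} (mkHigh r w) = mkHigh (Reduced-Λ r) (λ β → trans (ring77 _ _ (ℕtoℚ 2)) (cong (_− ℕtoℚ 2 · Λ x β) (cong (_⊹ Λ x β) (sym (number-Λ x β)) ∙ High-image lΛ {2 + k} {x} w β)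
      ∙ cong (λ u → (ℕtoℚ n · Λ x β ⊹ u · Λ x β) − ℕtoℚ 2 · Λ x β) (ℕtoℚ-⊹ 2 k) ∙ ring78 _ _ _ _))

  High-rel : ∀ {k x} → High k x → L′ (Λ x) ≈ Λ (L′ x) +ᵥ ℕtoℚ k ·ᵥ x
  High-rel {k} {x} (mkHigh r w) β = sym (cong (_⊹ ℕtoℚ k · x β) (Λ-L′ r β) ∙ ring79 _ _ _ _ _ ∙ cong (λ u → L′ (Λ x) β ⊹ (u − (number x β ⊹ x β))) (sym (w β)) ∙ ring80 _ _)

  -- One ladder used from both ends: on low degrees it inverts Λ L′ = h + L′ Λ, and on high degrees,
  -- with the roles of Λ and L′ exchanged, L′ Λ = h + Λ L′.
  module Down = Ladder L′ Λ lL′ lΛ Low Low-resp Low-sub Low-mul Low-Λ Low-L′ Low-rel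
  module Up = Ladder Λ L′ lΛ lL′ High High-resp High-sub High-mul High-L′ High-Λ High-rel

  -- Since `∂t t + t ∂t` is multiplication by n, `Qθ` is the projection onto the kernel of `∂t`
  -- along the image of t; likewise `Qξ`. Together they project onto `Reduced` along the ideal of t
  -- and s.
  Qθ Qξ Q : V N → V N
  Qθ x = ν ·ᵥ ∂t (t x)
  Qξ x = ν ·ᵥ ∂s (s x)
  Q x = Qθ (Qξ x)

  lQθ : Linear Qθ
  lQθ = Linear-· ν (Linear-∘ l∂t lt)
  lQξ : Linear Qξ
  lQξ = Linear-· ν (Linear-∘ l∂s ls)
  lQ : Linear Q
  lQ = Linear-∘ lQθ lQξ

  Qθ-split : ∀ x → x ≈ Qθ x +ᵥ t (ν ·ᵥ ∂t x)
  Qθ-split x β = begin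
    x β ≡⟨ sym (·-identityˡ _) ⟩
    1ℚ · x β ≡⟨ cong (_· x β) (sym νn≡1) ⟩
    (ν · ℕtoℚ n) · x β ≡⟨ ring81 _ _ _ _ ⟩
    ν · (ℕtoℚ n · x β − t (∂t x) β) ⊹ ν · t (∂t x) β ≡⟨ cong₂ (λ u v → ν · u ⊹ v) (sym (∂t-t x β)) (sym (mul lt ν (∂t x) β)) ⟩
    _ ∎

  Qξ-split : ∀ x → x ≈ Qξ x +ᵥ s (ν ·ᵥ ∂s x)
  Qξ-split x β = begin
    x β ≡⟨ sym (·-identityˡ _) ⟩
    1ℚ · x β ≡⟨ cong (_· x β) (sym νn≡1) ⟩
    (ν · ℕtoℚ n) · x β ≡⟨ ring81 _ _ _ _ ⟩
    ν · (ℕtoℚ n · x β − s (∂s x) β) ⊹ ν · s (∂s x) β ≡⟨ cong₂ (λ u v → ν · u ⊹ v) (sym (∂s-s x β)) (sym (mul ls ν (∂s x) β)) ⟩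
    _ ∎

  Q-split : ∀ x → x ≈ Q x +ᵥ (t (ν ·ᵥ ∂t (Qξ x)) +ᵥ s (ν ·ᵥ ∂s x))
  Q-split x β = Qξ-split x β ∙ cong (_⊹ s (ν ·ᵥ ∂s x) β) (Qθ-split (Qξ x) β) ∙ ⊹-assoc _ _ _

  Qξ-t : ∀ x → Qξ (t x) ≈ t (Qξ x)
  Qξ-t x β = begin
    ν · ∂s (s (t x)) β ≡⟨ cong (ν ·_) (resp l∂s (CC-anti 𝟙ξ 𝟙θ x) β ∙ neg l∂s (t (s x)) β) ⟩
    ν · − ∂s (t (s x)) β ≡⟨ cong (λ u → ν · − u) (∂s-t (s x) β) ⟩
    ν · − − t (∂s (s x)) β ≡⟨ ring82 _ _ ⟩
    ν · t (∂s (s x)) β ≡⟨ sym (mul lt ν (∂s (s x)) β) ⟩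
    _ ∎

  Qθ-t : ∀ x → Qθ (t x) ≈ 0ᵥ
  Qθ-t x β = cong (ν ·_) (vanish l∂t (CC-zero 𝟙θ x) β) ∙ ·-zeroʳ ν

  Q-t : ∀ x → Q (t x) ≈ 0ᵥ
  Q-t x = ≈-trans (resp lQθ (Qξ-t x)) (Qθ-t (Qξ x))

  Q-s : ∀ x → Q (s x) ≈ 0ᵥ
  Q-s x = vanish lQθ (λ β → trans (cong (ν ·_) (vanish l∂s (CC-zero 𝟙ξ x) β)) (·-zeroʳ ν))

  ∂s-Qθ : ∀ x → ∂s (Qθ x) ≈ Qθ (∂s x)
  ∂s-Qθ x β = begin
    ∂s (ν ·ᵥ ∂t (t x)) β ≡⟨ mul l∂s ν _ β ⟩
    ν · ∂s (∂t (t x)) β ≡⟨ cong (ν ·_) (AA-anti 𝟙ξ 𝟙θ (t x) β) ⟩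
    ν · − ∂t (∂s (t x)) β ≡⟨ cong (λ u → ν · − u) (resp l∂t (∂s-t x) β ∙ neg l∂t (t (∂s x)) β) ⟩
    ν · − − ∂t (t (∂s x)) β ≡⟨ ring82 _ _ ⟩
    _ ∎

  Reduced-Q : ∀ x → Reduced (Q x)
  Reduced-Q x = (λ β → trans (mul l∂t ν _ β) (cong (ν ·_) (AA-zero 𝟙θ _ β) ∙ ·-zeroʳ ν)) ,
    ≈-trans (∂s-Qθ (Qξ x)) (vanish lQθ (λ β → trans (mul l∂s ν _ β) (cong (ν ·_) (AA-zero 𝟙ξ _ β) ∙ ·-zeroʳ ν)))

  Q-fixes : ∀ {x} → Reduced x → Q x ≈ x
  Q-fixes {x} (rt , rs) β = resp lQθ Qξx β ∙ sym (Qθ-split x β ∙ cong (Qθ x β ⊹_) (vanish lt (λ γ → trans (cong (ν ·_) (rt γ)) (·-zeroʳ ν)) β) ∙ ⊹-identityʳ _)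
    where
    Qξx : Qξ x ≈ x
    Qξx γ = sym (Qξ-split x γ ∙ cong (Qξ x γ ⊹_) (vanish ls (λ ζ → trans (cong (ν ·_) (rs ζ)) (·-zeroʳ ν)) γ) ∙ ⊹-identityʳ _)

  -- x differs from Q x by images of t and s; these are stable under L and killed by Q. On the
  -- reduced part Q also absorbs the difference between L and L′.
  Q-L : ∀ x → Q (L x) ≈ L′ (Q x)
  Q-L x β = resp lQ (resp lL (Q-split x)) β
    ∙ resp lQ (λ γ → trans (add lL (Q x) _ γ) (cong (L (Q x) γ ⊹_) (add lL (t y) (s z) γ ∙ (cong₂ _⊹_ (L-C 𝟙θ y γ) (L-C 𝟙ξ z γ))))) β
    ∙ add lQ (L (Q x)) _ β ∙ cong (Q (L (Q x)) β ⊹_) (add lQ (t (L y)) _ β ∙ (cong₂ _⊹_ (Q-t (L y) β) (Q-s (L z) β)))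
    ∙ lem₁ _
    ∙ cong (λ u → Q (L (Q x)) β − ν · u) (sym (Q-t (s (Q x)) β))
    ∙ sym (sub lQ (L (Q x)) _ β ∙ cong (λ u → Q (L (Q x)) β − u) (mul lQ ν (t (s (Q x))) β))
    ∙ Q-fixes (Reduced-L′ (Reduced-Q x)) β
    where
    y = ν ·ᵥ ∂t (Qξ x)
    z = ν ·ᵥ ∂s x
    lem₁ : ∀ a → a ⊹ (0ℚ ⊹ 0ℚ) ≡ a − ν · 0ℚ
    lem₁ a = ring83 a ν ∙ refl

  Q-L′ : ∀ x → Q (L′ x) ≈ L′ (Q x)
  Q-L′ x β = sub lQ (L x) _ β ∙ (cong₂ _−_ (Q-L x β) (mul lQ ν (t (s x)) β ∙ cong (ν ·_) (Q-t (s x) β))) ∙ ring84 _ ν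

  diag-Q : ∀ p x → diag κ p (Q x) ≈ Q (diag κ p x)
  diag-Q p x = ≈-trans (onθ p (Qξ x)) (resp lQθ (onξ p x))
    where
    onθ : ∀ p x → diag κ p (Qθ x) ≈ Qθ (diag κ p x)
    -- The predecessor makes a preimage of p under `bump true`, as `diag-A` requires; `diag-t` bumps
    -- it back to p.
    onθ p x β = mul (diag-Linear κ p) ν _ β ∙ cong (ν ·_) (diag-A true κ (λ i j → p (ℕ.pred i) j) 𝟙θ OfKind-𝟙θ (t x) β
      ∙ resp l∂t (diag-t (λ i j → p (ℕ.pred i) j) x) β)
    onξ : ∀ p x → diag κ p (Qξ x) ≈ Qξ (diag κ p x)
    onξ p x β = mul (diag-Linear κ p) ν _ β ∙ cong (ν ·_) (diag-A false κ (λ i j → p i (ℕ.pred j)) 𝟙ξ OfKind-𝟙ξ (s x) β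
      ∙ resp l∂s (diag-s (λ i j → p i (ℕ.pred j)) x) β)

  δ² : ℕ → ℕ → ℕ → ℕ → ℚ
  δ² a b i j = δ a i · δ b j

  π : ℕ → ℕ → V N → V N
  π a b = diag κ (δ² a b)

  lπ : ∀ a b → Linear (π a b)
  lπ a b = diag-Linear κ (δ² a b)

  -- What the trace computations use of a permutation. The instance is `act-Equivariant`.
  record Equivariant (Y : V N → V N) : Set where
    field
      linear : Linear Y
      Y-t : ∀ x → Y (t x) ≈ t (Y x)
      Y-s : ∀ x → Y (s x) ≈ s (Y x)
      Y-∂t : ∀ x → Y (∂t x) ≈ ∂t (Y x)
      Y-∂s : ∀ x → Y (∂s x) ≈ ∂s (Y x)
      Y-L : ∀ x → Y (L x) ≈ L (Y x)
      Y-Λ : ∀ x → Y (Λ x) ≈ Λ (Y x)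
      Y-diag : ∀ p x → Y (diag κ p x) ≈ diag κ p (Y x)

    Y-L′ : ∀ x → Y (L′ x) ≈ L′ (Y x)
    Y-L′ x β = sub linear (L x) _ β ∙ (cong₂ _−_ (Y-L x β) (mul linear ν (t (s x)) β ∙ cong (ν ·_) (Y-t (s x) β ∙ resp lt (Y-s x) β)))

    Y-Q : ∀ x → Y (Q x) ≈ Q (Y x)
    Y-Q x β = mul linear ν _ β ∙ cong (ν ·_) (Y-∂t _ β ∙ resp l∂t (≈-trans (Y-t (Qξ x)) (resp lt
      (λ γ → trans (mul linear ν _ γ) (cong (ν ·_) (Y-∂s _ γ ∙ resp l∂s (Y-s x) γ))))) β)

  -- A subspace that contains the ideal generated by t, s and L. It is applied to the span of the
  -- given generators and to the kernel of the constructed projection, which yields the two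
  -- inclusions between the ideals.
  record IsIdeal (J : V N → Set) : Set where
    field
      J-resp : ∀ {x y} → x ≈ y → J x → J y
      J-add : ∀ {x y} → J x → J y → J (x +ᵥ y)
      J-mul : ∀ {x} k → J x → J (k ·ᵥ x)
      J-t : ∀ y → J (t y)
      J-s : ∀ y → J (s y)
      J-L : ∀ y → J (L y)

    J-sub : ∀ {x y} → J x → J y → J (x -ᵥ y)
    J-sub {x} {y} p r = J-resp (λ β → cong (x β ⊹_) (sym (−≡-1· (y β)))) (J-add p (J-mul (− 1ℚ) r))

    J-L′ : ∀ y → J (L′ y)
    J-L′ y = J-sub (J-L y) (J-mul ν (J-t (s y)))

    J-1-Q : ∀ x → J (x -ᵥ Q x)
    J-1-Q x = J-resp (λ β → sym (cong (_− Q x β) (Q-split x β) ∙ ring46 _ _)) (J-add (J-t (ν ·ᵥ ∂t (Qξ x))) (J-s (ν ·ᵥ ∂s x)))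

  π-t : ∀ a b x → π (suc a) b (t x) ≈ t (π a b x)
  π-t a b x = diag-t (δ² (suc a) b) x

  π-t-0 : ∀ b x → π 0 b (t x) ≈ 0ᵥ
  π-t-0 b x = ≈-trans (diag-t (δ² 0 b) x) (vanish lt (≈-trans (diag-cong κ (λ i j → ·-zeroˡ _) x) (diag-0 κ x)))

  π-s : ∀ a b x → π a (suc b) (s x) ≈ s (π a b x)
  π-s a b x = diag-s (δ² a (suc b)) x

  π-s-0 : ∀ a x → π a 0 (s x) ≈ 0ᵥ
  π-s-0 a x = ≈-trans (diag-s (δ² a 0) x) (vanish ls (≈-trans (diag-cong κ (λ i j → ·-zeroʳ _) x) (diag-0 κ x)))

  π-L : ∀ a b x → π (suc a) (suc b) (L x) ≈ L (π a b x)
  π-L a b x = diag-L (δ² (suc a) (suc b)) x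

  π-L-0ˡ : ∀ b x → π 0 b (L x) ≈ 0ᵥ
  π-L-0ˡ b x = ≈-trans (diag-L (δ² 0 b) x) (vanish lL (≈-trans (diag-cong κ (λ i j → ·-zeroˡ _) x) (diag-0 κ x)))

  π-L-0ʳ : ∀ a x → π a 0 (L x) ≈ 0ᵥ
  π-L-0ʳ a x = ≈-trans (diag-L (δ² a 0) x) (vanish lL (≈-trans (diag-cong κ (λ i j → ·-zeroʳ _) x) (diag-0 κ x)))

  δ²-scale : ∀ (φ : ℕ → ℕ → ℚ) a b i j → φ i j · δ² a b i j ≡ φ a b · δ² a b i j
  δ²-scale φ a b i j with a ℕₚ.≟ i | b ℕₚ.≟ j
  ... | yes refl | yes refl = refl
  ... | no ne | _ = cong (φ i j ·_) z ∙ trans (·-zeroʳ _) (sym (cong (φ a b ·_) z ∙ ·-zeroʳ _))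
    where z = cong (_· δ b j) (δ-≢ {a} {i} ne) ∙ ·-zeroˡ _
  ... | _ | no ne = cong (φ i j ·_) z ∙ trans (·-zeroʳ _) (sym (cong (φ a b ·_) z ∙ ·-zeroʳ _))
    where z = cong (δ a i ·_) (δ-≢ {b} {j} ne) ∙ ·-zeroʳ _

  δ²-eigen : ∀ a b i j → ℕtoℚ (i + j) · δ² a b i j ≡ ℕtoℚ (a + b) · δ² a b i j
  δ²-eigen = δ²-scale (λ i j → ℕtoℚ (i + j))

  number-π : ∀ a b x → number (π a b x) ≈ ℕtoℚ (a + b) ·ᵥ π a b x
  number-π a b x β = diag-∘ κ _ (δ² a b) x β ∙ diag-cong κ (δ²-eigen a b) x β ∙ diag-scales κ _ x β
    ∙ ·-assoc _ _ _ ∙ cong (ℕtoℚ (a + b) ·_) (sym (diag-scales κ (δ² a b) x β))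

  number-Qπ : ∀ a b x → number (Q (π a b x)) ≈ ℕtoℚ (a + b) ·ᵥ Q (π a b x)
  number-Qπ a b x = ≈-trans (diag-Q _ (π a b x)) (≈-trans (resp lQ (number-π a b x)) (mul lQ (ℕtoℚ (a + b)) (π a b x)))

  Low-Qπ : ∀ a b k x → suc (a + b + k) ≡ n → Low k (Q (π a b x))
  Low-Qπ a b k x eq = mkLow (Reduced-Q (π a b x)) (λ β → trans (cong (λ u → u ⊹ Q (π a b x) β ⊹ ℕtoℚ k · Q (π a b x) β) (number-Qπ a b x β))
      (ring85 _ _ _ ∙ cong (_· Q (π a b x) β) (cong (1ℚ ⊹_) (sym (ℕtoℚ-⊹ (a + b) k)) ∙ sym (ℕtoℚ-suc (a + b + k)) ∙ cong ℕtoℚ eq)))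

  High-Qπ : ∀ a b k x → suc (a + b) ≡ n + k → High k (Q (π a b x))
  High-Qπ a b k x eq = mkHigh (Reduced-Q (π a b x)) (λ β → trans (cong (_⊹ Q (π a b x) β) (number-Qπ a b x β))
      (ring49 _ _ ∙ cong (_· Q (π a b x) β) (sym (ℕtoℚ-suc (a + b)) ∙ cong ℕtoℚ eq ∙ ℕtoℚ-⊹ n k) ∙ ring24 _ _ _))

  Down-Nil-resp : ∀ f {x y} → x ≈ y → Down.Nil f x → Down.Nil f y
  Down-Nil-resp zero p nil = ≈-trans (resp lΛ (≈-sym p)) nil
  Down-Nil-resp (suc f) p nil = Down-Nil-resp f (resp lΛ p) nil

  Up-Nil-resp : ∀ f {x y} → x ≈ y → Up.Nil f x → Up.Nil f y
  Up-Nil-resp zero p nil = ≈-trans (resp lL′ (≈-sym p)) nil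
  Up-Nil-resp (suc f) p nil = Up-Nil-resp f (resp lL′ p) nil

  -- Each Λ lowers the θ-degree by one, so f + 1 of them kill θ-degree at most f. `Up-Nil` is the
  -- counterpart: L′ raises the θ-degree, which cannot exceed N.
  Down-Nil : ∀ f p → (∀ i j → f < i → p i j ≡ 0ℚ) → ∀ x → Down.Nil f (diag κ p x)
  Down-Nil zero p h x = ≈-trans (≈-sym (diag-Λ p x)) (≈-trans (diag-cong κ (λ i j → h (suc i) (suc j) (s≤s z≤n)) (Λ x)) (diag-0 κ (Λ x)))
  Down-Nil (suc f) p h x = Down-Nil-resp f (diag-Λ p x) (Down-Nil f (up p) (λ i j f<i → h (suc i) (suc j) (s≤s f<i)) (Λ x))

  #kind≤ : ∀ {M} k (κ : ℕ → Bool) (β : Vec Bool M) → #kind k κ β ≤ M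
  #kind≤ k κ [] = z≤n
  #kind≤ k κ (false ∷ β) = ℕₚ.≤-trans (#kind≤ k (κ ∘ suc) β) (ℕₚ.n≤1+n _)
  #kind≤ true κ (true ∷ β) with κ 0
  ... | true = s≤s (#kind≤ true (κ ∘ suc) β)
  ... | false = ℕₚ.≤-trans (#kind≤ true (κ ∘ suc) β) (ℕₚ.n≤1+n _)
  #kind≤ false κ (true ∷ β) with κ 0
  ... | true = ℕₚ.≤-trans (#kind≤ false (κ ∘ suc) β) (ℕₚ.n≤1+n _)
  ... | false = s≤s (#kind≤ false (κ ∘ suc) β)

  private
    down : (ℕ → ℕ → ℚ) → (ℕ → ℕ → ℚ)
    down p zero j = 0ℚ
    down p (suc i) j = p i (ℕ.pred j)

  L′-diag : ∀ p x → L′ (diag κ p x) ≈ diag κ (down p) (L′ x)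
  L′-diag p x = ≈-sym (diag-L′ (down p) x)

  down-vanishes : ∀ f p → (∀ i j → i < f → p i j ≡ 0ℚ) → ∀ i j → i < suc f → down p i j ≡ 0ℚ
  down-vanishes f p h zero j _ = refl
  down-vanishes f p h (suc i) j (s≤s i<f) = h i (ℕ.pred j) i<f

  Up-Nil : ∀ f a p → N ≤ a + f → (∀ i j → i < a → p i j ≡ 0ℚ) → ∀ x → Up.Nil f (diag κ p x)
  Up-Nil zero a p N≤ h x = ≈-trans (L′-diag p x) (λ β → trans (diag-scales κ (down p) (L′ x) β)
    (cong (_· L′ x β) (down-vanishes a p h _ _ (s≤s (ℕₚ.≤-trans (#kind≤ true κ β) (subst (N ≤_) (ℕₚ.+-identityʳ a) N≤)))) ∙ ·-zeroˡ _))
  Up-Nil (suc f) a p N≤ h x = Up-Nil-resp f (≈-sym (L′-diag p x))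
    (Up-Nil f (suc a) (down p) (subst (N ≤_) (ℕₚ.+-suc a f) N≤) (down-vanishes a p h) (L′ x))

  δ²-above : ∀ a b i j → a < i → δ² a b i j ≡ 0ℚ
  δ²-above a b i j a<i = cong (_· δ b j) (δ-≢ {a} {i} (λ eq → ℕₚ.<-irrefl eq a<i)) ∙ ·-zeroˡ _

  δ²-below : ∀ a b i j → i < a → δ² a b i j ≡ 0ℚ
  δ²-below a b i j i<a = cong (_· δ b j) (δ-≢ {a} {i} (λ eq → ℕₚ.<-irrefl (sym eq) i<a)) ∙ ·-zeroˡ _

  -- For Y that respect the bidegree and the projection Q, this is the trace of Y on the reduced
  -- vectors of bidegree (a , b).
  g : (V N → V N) → ℕ → ℕ → ℚ
  g Y a b = tr (λ x → Y (Q (π a b x)))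

  -- Complement a b projects bidegree (a , b) along the ideal (t , s , L).
  record Complement (a b : ℕ) : Set₁ where
    field
      proj : V N → V N
      linear : Linear proj
      kills-t : ∀ y → proj (π a b (t y)) ≈ 0ᵥ
      kills-s : ∀ y → proj (π a b (s y)) ≈ 0ᵥ
      kills-L : ∀ y → proj (π a b (L y)) ≈ 0ᵥ
      ideal : ∀ {J} → IsIdeal J → ∀ x → J (π a b x -ᵥ proj (π a b x))
      equiv : ∀ {Y} → Equivariant Y → ∀ x → Y (proj x) ≈ proj (Y x)
      trace : ∀ {Y} → Equivariant Y → tr (λ x → Y (proj (π a b x))) ≡ (if (a + b) <ᵇ n then g Y a b − shift₁ (shift₂ (g Y)) a b else 0ℚ)

  Q-π-t : ∀ a b y → Q (π a b (t y)) ≈ 0ᵥ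
  Q-π-t zero b y = vanish lQ (π-t-0 b y)
  Q-π-t (suc a) b y = ≈-trans (resp lQ (π-t a b y)) (Q-t (π a b y))

  Q-π-s : ∀ a b y → Q (π a b (s y)) ≈ 0ᵥ
  Q-π-s a zero y = vanish lQ (π-s-0 a y)
  Q-π-s a (suc b) y = ≈-trans (resp lQ (π-s a b y)) (Q-s (π a b y))

  -- In this bidegree L contributes nothing to the ideal, so Q alone is the projection.
  complement-edge : ∀ a b → a + b < n → (∀ y → π a b (L y) ≈ 0ᵥ) → (∀ F → shift₁ (shift₂ F) a b ≡ 0ℚ) → Complement a b
  complement-edge a b a+b<n noL no-shift = record
    { proj = Q ; linear = lQ ; kills-t = Q-π-t a b ; kills-s = Q-π-s a b ; kills-L = λ y → vanish lQ (noL y)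
    ; ideal = λ I x → IsIdeal.J-1-Q I (π a b x) ; equiv = λ E → Equivariant.Y-Q E
    ; trace = λ {Y} E → sym (cong (if_then g Y a b − shift₁ (shift₂ (g Y)) a b else 0ℚ) (<⇒<ᵇ a+b<n)
        ∙ cong (λ u → g Y a b − u) (no-shift (g Y)) ∙ ring61 _) }

  -- After Q has removed t and s, the image of L′ is split off by L′ K Λ, where K inverts Λ L′ on
  -- reduced vectors of bidegree (a , b); their weight is k + 2. Cycling L′ around the trace
  -- identifies the part removed with `g Y a b`.
  complement-low : ∀ a b k → suc (a + b + suc (suc k)) ≡ n → Complement (suc a) (suc b)
  complement-low a b k eq = record
    { proj = P ; linear = lP
    ; kills-t = λ y → P-kills (Q-π-t (suc a) (suc b) y)
    ; kills-s = λ y → P-kills (Q-π-s (suc a) (suc b) y)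
    ; kills-L = λ y β → trans (cong₂ _−_ (QL y β) (resp lL′ (≈-trans (resp lK (resp lΛ (QL y))) (K-inverts y)) β)) (−-inverse _)
    ; ideal = λ I x → IsIdeal.J-resp I (λ β → ring86 _ _ _) (IsIdeal.J-add I (IsIdeal.J-1-Q I (π (suc a) (suc b) x)) (IsIdeal.J-L′ I (K (Λ (Q (π (suc a) (suc b) x))))))
    ; equiv = λ {Y} E x β → let open Equivariant E in trans (sub (Equivariant.linear E) (Q x) _ β) (cong₂ _−_ (Y-Q x β)
        (Y-L′ _ β ∙ resp lL′ (≈-trans (Down.inv-comm a (suc (suc k)) (suc (suc k)) (Equivariant.linear E) Y-L′ Y-Λ (Λ (Q x)))
          (resp lK (≈-trans (Y-Λ (Q x)) (resp lΛ (Y-Q x))))) β))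
    ; trace = λ {Y} E → trans (trace-P E) (sym (cong (if_then g Y (suc a) (suc b) − g Y a b else 0ℚ) (<⇒<ᵇ bound))) }
    where
    K : V N → V N
    K = Down.inv a (suc (suc k)) (suc (suc k))
    lK : Linear K
    lK = Down.inv-Linear a (suc (suc k)) (suc (suc k))
    P : V N → V N
    P x = Q x -ᵥ L′ (K (Λ (Q x)))
    lP : Linear P
    lP = Linear-− lQ (Linear-∘ lL′ (Linear-∘ lK (Linear-∘ lΛ lQ)))
    bound : suc a + suc b < n
    bound = subst₂ _<_ (sym (cong suc (ℕₚ.+-suc a b))) (cong suc (sym (ℕₚ.+-suc (a + b) (suc k) ∙ cong suc (ℕₚ.+-suc (a + b) k))) ∙ eq)
      (s≤s (s≤s (s≤s (ℕₚ.m≤m+n (a + b) k))))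
    P-kills : ∀ {x} → Q x ≈ 0ᵥ → P x ≈ 0ᵥ
    P-kills {x} z β = (cong₂ _−_ (z β) (vanish lL′ (vanish lK (vanish lΛ z)) β)) ∙ −-inverse 0ℚ
    QL : ∀ y → Q (π (suc a) (suc b) (L y)) ≈ L′ (Q (π a b y))
    QL y = ≈-trans (resp lQ (π-L a b y)) (Q-L (π a b y))
    K-inverts : ∀ y → K (Λ (L′ (Q (π a b y)))) ≈ Q (π a b y)
    K-inverts y = ≈-trans (resp lK (≈-trans (Low-rel lo) (λ β → ⊹-comm _ _)))
      (Down.inv-left a (suc (suc k)) (suc (suc k)) (λ ()) lo (Down-Nil-resp a (diag-Q (δ² a b) y) (Down-Nil a (δ² a b) (λ i j → δ²-above a b i j) (Q y))))
      where
      lo : Low (suc (suc k)) (Q (π a b y))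
      lo = Low-Qπ a b (suc (suc k)) y eq
    trace-P : ∀ {Y} → Equivariant Y → tr (λ x → Y (P (π (suc a) (suc b) x))) ≡ g Y (suc a) (suc b) − g Y a b
    trace-P {Y} E = tr-cong (λ x β → trans (sub lY (Q (π (suc a) (suc b) x)) _ β) (cong (Y (Q (π (suc a) (suc b) x)) β ⊹_) ((cong −_ (Y-L′ (K (Λ (Q (π (suc a) (suc b) x)))) β)) ∙ −≡-1· _)))
      ∙ tr-+ (λ x → Y (Q (π (suc a) (suc b) x))) (λ x → (− 1ℚ) ·ᵥ L′ (Y (K (Λ (Q (π (suc a) (suc b) x)))))) ∙ cong (g Y (suc a) (suc b) ⊹_) (tr-· (− 1ℚ) (λ x → L′ (Y (K (Λ (Q (π (suc a) (suc b) x)))))))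
      ∙ cong (λ u → g Y (suc a) (suc b) ⊹ (− 1ℚ) · u) (tr-cyclic lL′ (Linear-∘ lY (Linear-∘ lK (Linear-∘ lΛ (Linear-∘ lQ (lπ (suc a) (suc b)))))))
      ∙ cong (λ u → g Y (suc a) (suc b) ⊹ (− 1ℚ) · u) (tr-cong (λ x → resp lY (≈-trans (resp lK (resp lΛ
          (≈-trans (resp lQ (diag-L′ (δ² (suc a) (suc b)) x)) (Q-L′ (π a b x))))) (K-inverts x))))
      ∙ cong (g Y (suc a) (suc b) ⊹_) (sym (−≡-1· _))
      where
      open Equivariant E renaming (linear to lY)

  -- The reduced vectors have weight `suc k`, and M inverts L′ Λ on them, so Q x = L′ (Λ (M (Q x))).
  -- The whole bidegree lies in the ideal, and the projection is 0.
  complement-high : ∀ a b k → suc (a + b) ≡ n + suc k → Complement a b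
  complement-high a b k eq = record
    { proj = λ _ → 0ᵥ
    ; linear = record { resp = λ _ _ → refl ; add = λ _ _ _ → sym (⊹-identityˡ 0ℚ) ; mul = λ c _ _ → sym (·-zeroʳ c) }
    ; kills-t = λ _ _ → refl ; kills-s = λ _ _ → refl ; kills-L = λ _ _ → refl
    ; ideal = λ I x → IsIdeal.J-resp I (λ β → everything x β) (IsIdeal.J-add I (IsIdeal.J-1-Q I (π a b x)) (IsIdeal.J-L′ I (Λ (M (Q (π a b x))))))
    ; equiv = λ E _ → zer (Equivariant.linear E)
    ; trace = λ {Y} E → trans (sumV-zero (λ β → zer (Equivariant.linear E) β)) (sym (cong (if_then g Y a b − shift₁ (shift₂ (g Y)) a b else 0ℚ)
        (≥⇒<ᵇ-false (ℕₚ.+-cancelˡ-≤ 1 n (a + b) (subst (suc n ≤_) (sym (eq ∙ ℕₚ.+-suc n k)) (s≤s (ℕₚ.m≤m+n n k))))))) }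
    where
    M : V N → V N
    M = Up.inv N (suc k) (suc k)
    everything : ∀ x β → ((π a b x -ᵥ Q (π a b x)) +ᵥ L′ (Λ (M (Q (π a b x))))) β ≡ (π a b x -ᵥ 0ᵥ) β
    everything x β = cong ((π a b x β − Q (π a b x) β) ⊹_) (High-rel (Up.inv-P N (suc k) (suc k) hi) β ∙ ⊹-comm _ _
        ∙ Up.inv-right N (suc k) (suc k) (λ ()) hi (Up-Nil-resp N (diag-Q (δ² a b) x) (Up-Nil N a (δ² a b) (ℕₚ.m≤n+m N a) (λ i j → δ²-below a b i j) (Q x))) β) ∙ ring87 _ _
      where
      hi : High (suc k) (Q (π a b x))
      hi = High-Qπ a b (suc k) x eq

  complement : ∀ a b → Complement a b
  complement a b with ℕₚ.<-≤-connex (a + b) n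
  ... | inj₂ n≤ with ℕₚ.m≤n⇒∃[o]m+o≡n n≤
  ... | k , eq = complement-high a b k (cong suc (sym eq) ∙ sym (ℕₚ.+-suc n k))
  complement zero b | inj₁ lt = complement-edge 0 b lt (π-L-0ˡ b) (λ F → refl)
  complement (suc a) zero | inj₁ lt = complement-edge (suc a) 0 lt (π-L-0ʳ (suc a)) (λ F → refl)
  complement (suc a) (suc b) | inj₁ lt with ℕₚ.m≤n⇒∃[o]m+o≡n lt
  ... | k , eq = complement-low a b k (cong suc (ℕₚ.+-suc (a + b) (suc k) ∙ cong suc (ℕₚ.+-suc (a + b) k))
    ∙ cong (λ m → suc (suc (m + k))) (sym (ℕₚ.+-suc a b)) ∙ eq)

  -- From the reduced part to the whole exterior algebra.

  f : (V N → V N) → ℕ → ℕ → ℚ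
  f Y a b = tr (λ x → Y (π a b x))

  module _ {Y : V N → V N} (E : Equivariant Y) where
    open Equivariant E renaming (linear to lY)

    private
      g₁ : ℕ → ℕ → ℚ
      g₁ a b = tr (λ x → Y (Qξ (π a b x)))

      f≡g₁ : ∀ a b → f Y a b ≡ g₁ a b ⊹ shift₂ g₁ a b
      f≡g₁ a b = tr-cong (λ x → ≈-trans (resp lY (Qξ-split (π a b x))) (≈-trans (add lY _ _) (λ β → cong (Y (Qξ (π a b x)) β ⊹_) (Y-s _ β))))
        ∙ tr-+ (λ x → Y (Qξ (π a b x))) (λ x → s (Y (ν ·ᵥ ∂s (π a b x))))
        ∙ cong (g₁ a b ⊹_) (tr-cyclic ls (Linear-∘ lY (Linear-· ν (Linear-∘ l∂s (lπ a b)))) ∙ moved b)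
        where
        moved : ∀ b → tr (λ x → Y (ν ·ᵥ ∂s (π a b (s x)))) ≡ shift₂ g₁ a b
        moved zero = tr-cong (λ x → vanish lY (vanish (Linear-· ν l∂s) (π-s-0 a x))) ∙ sumV-zero {N} (λ _ → refl)
        moved (suc b) = tr-cong (λ x → resp lY (resp (Linear-· ν l∂s) (π-s a b x)))

      g₁≡g : ∀ a b → g₁ a b ≡ g Y a b ⊹ shift₁ (g Y) a b
      g₁≡g a b = tr-cong (λ x → ≈-trans (resp lY (Qθ-split (Qξ (π a b x)))) (≈-trans (add lY _ _) (λ β → cong (Y (Q (π a b x)) β ⊹_) (Y-t _ β))))
        ∙ tr-+ (λ x → Y (Q (π a b x))) (λ x → t (Y (ν ·ᵥ ∂t (Qξ (π a b x)))))
        ∙ cong (g Y a b ⊹_) (tr-cyclic lt (Linear-∘ lY (Linear-· ν (Linear-∘ l∂t (Linear-∘ lQξ (lπ a b))))) ∙ moved a)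
        where
        moved : ∀ a → tr (λ x → Y (ν ·ᵥ ∂t (Qξ (π a b (t x))))) ≡ shift₁ (g Y) a b
        moved zero = tr-cong (λ x → vanish lY (vanish (Linear-· ν (Linear-∘ l∂t lQξ)) (π-t-0 b x))) ∙ sumV-zero {N} (λ _ → refl)
        moved (suc a) = tr-cong (λ x → resp lY (resp (Linear-· ν l∂t) (≈-trans (resp lQξ (π-t a b x)) (Qξ-t (π a b x)))))

    -- The coefficient form of F = (1 + u) (1 + v) G. A vector splits into its projection plus an
    -- image of s or t; on that image, cycling s or t around the trace lowers the bidegree by one
    -- and leaves the projection.
    f≡g : ∀ a b → f Y a b ≡ (g Y a b ⊹ shift₁ (g Y) a b) ⊹ shift₂ (λ i j → g Y i j ⊹ shift₁ (g Y) i j) a b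
    f≡g a b = f≡g₁ a b ∙ (cong₂ _⊹_ (g₁≡g a b) (shifted b))
      where
      shifted : ∀ b → shift₂ g₁ a b ≡ shift₂ (λ i j → g Y i j ⊹ shift₁ (g Y) i j) a b
      shifted zero = refl
      shifted (suc b) = g₁≡g a b

  -- Permutations commute with all the structure.

  h : List ℕ → ℕ → ℕ
  h = actGen n

  h-θ : ∀ σ {i} → i < n → h σ i ≡ lookupD σ i
  h-θ σ {i} i<n = cong (if_then lookupD σ i else n + lookupD σ (i ∸ n)) (κ-θ i<n)

  h-ξ : ∀ σ i → h σ (n + i) ≡ n + lookupD σ i
  h-ξ σ i = cong (if_then lookupD σ (n + i) else n + lookupD σ (n + i ∸ n)) (κ-ξ i) ∙ cong (λ k → n + lookupD σ k) (ℕₚ.m+n∸m≡n n i)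

  data Letter : ℕ → Set where
    θ : ∀ i → i < n → Letter i
    ξ : ∀ i → i < n → Letter (n + i)

  letter : ∀ g → g < N → Letter g
  letter g g<N with ℕₚ.<-≤-connex g n
  ... | inj₁ g<n = θ g g<n
  ... | inj₂ n≤g with ℕₚ.m≤n⇒∃[o]m+o≡n n≤g
  ... | i , refl = ξ i (ℕₚ.+-cancelˡ-< n i n g<N)

  module _ {σ} (p : IsPerm n σ) where

    h-bounded : ∀ g → g < N → h σ g < N
    h-bounded g g<N with letter g g<N
    ... | θ i i<n = subst (_< N) (sym (h-θ σ i<n)) (θ< (IsPerm-lookupD< p i i<n))
    ... | ξ i i<n = subst (_< N) (sym (h-ξ σ i)) (ξ< (IsPerm-lookupD< p i i<n))

    h-kind : ∀ g → g < N → κ (h σ g) ≡ κ g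
    h-kind g g<N with letter g g<N
    ... | θ i i<n = cong κ (h-θ σ i<n) ∙ κ-θ (IsPerm-lookupD< p i i<n) ∙ sym (κ-θ i<n)
    ... | ξ i i<n = cong κ (h-ξ σ i) ∙ κ-ξ _ ∙ sym (κ-ξ i)

    h-injective : InjectiveBelow N (h σ)
    h-injective g g′ g<N g′<N eq with letter g g<N | letter g′ g′<N
    ... | θ i i<n | θ j j<n = IsPerm-injective p i j i<n j<n (sym (h-θ σ i<n) ∙ eq ∙ h-θ σ j<n)
    ... | ξ i i<n | ξ j j<n = cong (n +_) (IsPerm-injective p i j i<n j<n (ℕₚ.+-cancelˡ-≡ n _ _ (sym (h-ξ σ i) ∙ eq ∙ h-ξ σ j)))
    ... | θ i i<n | ξ j j<n = case trans (sym (h-kind i g<N ∙ κ-θ i<n)) (cong κ eq ∙ h-kind (n + j) g′<N ∙ κ-ξ j) of λ ()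
    ... | ξ i i<n | θ j j<n = case trans (sym (h-kind j g′<N ∙ κ-θ j<n)) (cong κ (sym eq) ∙ h-kind (n + i) g<N ∙ κ-ξ i) of λ ()

    act-Equivariant : Equivariant (act N (h σ))
    act-Equivariant = record
      { linear = lY
      ; Y-t = λ x β → trans (resp lY (λ γ → sym (t≈Σ x γ)) β) (sumΣ< lY n (λ i → c i x) β
          ∙ Σ<-cong< n (λ i i<n → trans (act-c N (h σ) i (θ< i<n) x β) (cong (λ k → c k (Y x) β) (h-θ σ i<n)))
          ∙ Σ<-perm p (λ k → c k (Y x) β) ∙ t≈Σ (Y x) β)
      ; Y-s = λ x β → trans (resp lY (λ γ → sym (s≈Σ x γ)) β) (sumΣ< lY n (λ i → c (n + i) x) β
          ∙ Σ<-cong< n (λ i i<n → trans (act-c N (h σ) (n + i) (ξ< i<n) x β) (cong (λ k → c k (Y x) β) (h-ξ σ i)))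
          ∙ Σ<-perm p (λ k → c (n + k) (Y x) β) ∙ s≈Σ (Y x) β)
      ; Y-∂t = λ x β → trans (resp lY (λ γ → sym (∂t≈Σ x γ)) β) (sumΣ< lY n (λ i → a i x) β
          ∙ Σ<-cong< n (λ i i<n → trans (ya (θ< i<n) x β) (cong (λ k → a k (Y x) β) (h-θ σ i<n)))
          ∙ Σ<-perm p (λ k → a k (Y x) β) ∙ ∂t≈Σ (Y x) β)
      ; Y-∂s = λ x β → trans (resp lY (λ γ → sym (∂s≈Σ x γ)) β) (sumΣ< lY n (λ i → a (n + i) x) β
          ∙ Σ<-cong< n (λ i i<n → trans (ya (ξ< i<n) x β) (cong (λ k → a k (Y x) β) (h-ξ σ i)))
          ∙ Σ<-perm p (λ k → a (n + k) (Y x) β) ∙ ∂s≈Σ (Y x) β)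
      ; Y-L = λ x β → trans (sumΣ< lY n (λ i → c i (c (n + i) x)) β)
          (Σ<-cong< n (λ i i<n → trans (act-c N (h σ) i (θ< i<n) _ β) (resp (C-Linear (δ (h σ i))) (act-c N (h σ) (n + i) (ξ< i<n) x) β
            ∙ cong₂ (λ k l → c k (c l (Y x)) β) (h-θ σ i<n) (h-ξ σ i)))
          ∙ Σ<-perm p (λ k → c k (c (n + k) (Y x)) β))
      ; Y-Λ = λ x β → trans (sumΣ< lY n (λ i → a (n + i) (a i x)) β)
          (Σ<-cong< n (λ i i<n → trans (ya (ξ< i<n) _ β) (resp (A-Linear (δ (h σ (n + i)))) (ya (θ< i<n) x) β
            ∙ cong₂ (λ k l → a k (a l (Y x)) β) (h-ξ σ i) (h-θ σ i<n)))
          ∙ Σ<-perm p (λ k → a (n + k) (a k (Y x)) β))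
      ; Y-diag = λ p′ x → hat-diag N (h σ) (λ _ → 1ℚ) κ κ p′ h-kind x }
      where
      Y : V N → V N
      Y = act N (h σ)
      lY : Linear Y
      lY = act-Linear N (h σ)
      ya : ∀ {g} → g < N → ∀ x → Y (a g x) ≈ a (h σ g) (Y x)
      ya g<N = act-a N (h σ) _ g<N h-injective h-bounded

  -- Left multiplication by the (unnormalised) Reynolds symmetrisation of a word.
  R : List ℕ → V N → V N
  R w x β = sumL (λ σ → cw (map (h σ) w) x β) (perms n)

  R-Linear : ∀ w → Linear (R w)
  R-Linear w = Linear-sumL (perms n) (λ σ → cw-Linear (map (h σ) w))

  R-cong : ∀ k v w x → (∀ σ β → IsPerm n σ → cw (map (h σ) v) x β ≡ k · cw (map (h σ) w) x β) → R v x ≈ k ·ᵥ R w x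
  R-cong k v w x eq β = sumL-cong∈ (perms n) (λ σ σ∈ → eq σ β (∈-perms⇒IsPerm n σ∈)) ∙ sumL-· k _ (perms n)

  R-zero : ∀ w x → (∀ σ β → cw (map (h σ) w) x β ≡ 0ℚ) → R w x ≈ 0ᵥ
  R-zero w x eq β = sumL-zero∈ (perms n) (λ σ _ → eq σ β)

  cw-move : ∀ u g v (x : V N) → cw (u ++ g ∷ v) x ≈ sgn (length u) ·ᵥ c g (cw (u ++ v) x)
  cw-move [] g v x β = sym (·-identityˡ _)
  cw-move (k ∷ u) g v x β = begin
    c k (cw (u ++ g ∷ v) x) β ≡⟨ trans (resp (C-Linear (δ k)) (cw-move u g v x) β) (mul (C-Linear (δ k)) _ _ β) ⟩
    sgn (length u) · c k (c g (cw (u ++ v) x)) β ≡⟨ cong (sgn (length u) ·_) (CC-anti (δ k) (δ g) _ β) ⟩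
    sgn (length u) · − c g (c k (cw (u ++ v) x)) β ≡⟨ ring88 _ _ ⟩
    _ ∎

  R-move : ∀ u g v x → R (u ++ g ∷ v) x ≈ sgn (length u) ·ᵥ R (g ∷ u ++ v) x
  R-move u g v x = R-cong (sgn (length u)) (u ++ g ∷ v) (g ∷ u ++ v) x (λ σ β _ → begin
    cw (map (h σ) (u ++ g ∷ v)) x β ≡⟨ cong (λ z → cw z x β) (Listₚ.map-++ (h σ) u (g ∷ v)) ⟩
    cw (map (h σ) u ++ h σ g ∷ map (h σ) v) x β ≡⟨ cw-move (map (h σ) u) (h σ g) (map (h σ) v) x β ⟩
    _
      ≡⟨ cong₂ (λ l z → sgn l · c (h σ g) (cw z x) β) (Listₚ.length-map (h σ) u) (sym (Listₚ.map-++ (h σ) u v)) ⟩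
    _ ∎)

  elemB-true : ∀ g w → elemB g w ≡ true → g ∈ w
  elemB-true g (k ∷ w) eq with g ≡ᵇ k in g≡k
  ... | true = here (≡ᵇ⇒≡ g k g≡k)
  ... | false = there (elemB-true g w eq)

  elemB-true⁻ : ∀ {g w} → g ∈ w → elemB g w ≡ true
  elemB-true⁻ {g} {w = _ ∷ w} (here refl) = cong (_∨ elemB g w) (≡ᵇ-refl g)
  elemB-true⁻ {g} {w = k ∷ w} (there g∈) = cong ((g ≡ᵇ k) ∨_) (elemB-true⁻ g∈) ∙ Boolₚ.∨-zeroʳ (g ≡ᵇ k)

  c-cw-∈ : ∀ {g w} (x : V N) → g ∈ w → c g (cw w x) ≈ 0ᵥ
  c-cw-∈ {g} {w} x g∈ = c-cw-elem g w x (elemB-true⁻ g∈)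

  usesIndex : ℕ → List ℕ → Bool
  usesIndex j w = elemB j w ∨ elemB (n + j) w

  -- A uniform treatment of the factors θⱼ, ξⱼ and θⱼ ξⱼ, for which `op` is t, s and L. `F-fresh`
  -- says that the image of a block depends only on where its index goes.
  record Block : Set where
    field
      F : ℕ → List ℕ
      F-act : ∀ σ j → j < n → map (h σ) (F j) ≡ F (lookupD σ j)
      F-fresh : ∀ {σ τ} j k → j < n → k < n → lookupD τ j ≡ lookupD σ k → map (h τ) (F j) ≡ map (h σ) (F k)

    op : V N → V N
    op x β = Σ< n (λ j → cw (F j) x β)

    op-R : ∀ w x → op (R w x) ≈ (λ β → Σ< n (λ j → R (F j ++ w) x β))
    op-R w x β = Σ<-cong n (λ j → sumL-Linear (cw-Linear (F j)) (perms n) β)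
      ∙ sym (sumL-Σ< n (λ j σ → cw (F j) (cw (map (h σ) w) x) β) (perms n))
      ∙ sumL-cong∈ (perms n) (λ σ σ∈ → sym (Σ<-perm (∈-perms⇒IsPerm n σ∈) (λ j → cw (F j) (cw (map (h σ) w) x) β)))
      ∙ sumL-cong (perms n) (λ σ → Σ<-cong< n (λ j j<n → trans (cong (λ z → cw z (cw (map (h σ) w) x) β) (sym (F-act σ j j<n)))
          (sym (cw-++ (map (h σ) (F j)) (map (h σ) w) x β) ∙ cong (λ z → cw z x β) (sym (Listₚ.map-++ (h σ) (F j) w)))))
      ∙ sumL-Σ< n (λ j σ → cw (map (h σ) (F j ++ w)) x β) (perms n)
      where
      sumL-Linear : ∀ {X : V N → V N} → Linear X → ∀ σs β → X (λ γ → sumL (λ σ → cw (map (h σ) w) x γ) σs) β ≡ sumL (λ σ → X (cw (map (h σ) w) x) β) σs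
      sumL-Linear lX [] β = zer lX β
      sumL-Linear lX (σ ∷ σs) β = add lX (cw (map (h σ) w) x) _ β ∙ cong (_ ⊹_) (sumL-Linear lX σs β)

    -- Reindex the group sum by the transposition of i and j: it exchanges the two blocks and leaves
    -- the letters of w alone, because w uses neither index.
    R-exchange : ∀ i j w x → i < n → j < n → All (_< N) w → usesIndex i w ≡ false → usesIndex j w ≡ false → R (F j ++ w) x ≈ R (F i ++ w) x
    R-exchange i j w x i<n j<n bd ui uj β = sym (sumL-↭ (λ σ → cw (map (h σ) (F j ++ w)) x β) (perms-swapAt n i<n j<n))
      ∙ sumL-map (λ σ → cw (map (h σ) (F j ++ w)) x β) (swapAt i j) (perms n)
      ∙ sumL-cong∈ (perms n) (λ σ σ∈ → cong (λ z → cw z x β) (words σ (∈-perms⇒IsPerm n σ∈)))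
      where
      words : ∀ σ → IsPerm n σ → map (h (swapAt i j σ)) (F j ++ w) ≡ map (h σ) (F i ++ w)
      words σ p = Listₚ.map-++ _ (F j) w ∙ trans (cong₂ _++_ (F-fresh {σ} {swapAt i j σ} j i j<n i<n at-j)
          (rest w bd (elemB-false i w (∨-falseˡ ui)) (elemB-false j w (∨-falseˡ uj)) (elemB-false (n + i) w (∨-falseʳ (elemB i w) ui)) (elemB-false (n + j) w (∨-falseʳ (elemB j w) uj))))
        (sym (Listₚ.map-++ _ (F i) w))
        where
        open SwapAt p i<n j<n
        ∨-falseˡ : ∀ {b d} → b ∨ d ≡ false → b ≡ false
        ∨-falseˡ {false} _ = refl
        ∨-falseʳ : ∀ b {d} → b ∨ d ≡ false → d ≡ false
        ∨-falseʳ false eq = eq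
        rest : ∀ w → All (_< N) w → All (i ≢_) w → All (j ≢_) w → All (n + i ≢_) w → All (n + j ≢_) w → map (h (swapAt i j σ)) w ≡ map (h σ) w
        rest [] _ _ _ _ _ = refl
        rest (g ∷ w) (g<N ∷ bd) (i≢ ∷ p₁) (j≢ ∷ p₂) (i≢′ ∷ p₃) (j≢′ ∷ p₄) = cong₂ _∷_ (same g g<N i≢ j≢ i≢′ j≢′) (rest w bd p₁ p₂ p₃ p₄)
          where
          same : ∀ g → g < N → i ≢ g → j ≢ g → n + i ≢ g → n + j ≢ g → h (swapAt i j σ) g ≡ h σ g
          same g g<N i≢ j≢ i≢′ j≢′ with letter g g<N
          ... | θ k k<n = h-θ (swapAt i j σ) k<n ∙ elsewhere k i≢ j≢ ∙ sym (h-θ σ k<n)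
          ... | ξ k k<n = h-ξ (swapAt i j σ) k ∙ cong (n +_) (elsewhere k (λ eq → i≢′ (cong (n +_) eq)) (λ eq → j≢′ (cong (n +_) eq))) ∙ sym (h-ξ σ k)

  open Block

  θ-block ξ-block θξ-block : Block
  θ-block = record
    { F = λ j → j ∷ [] ; F-act = λ σ j j<n → cong (_∷ []) (h-θ σ j<n)
    ; F-fresh = λ {σ} {τ} j k j<n k<n eq → cong (_∷ []) (h-θ τ j<n ∙ eq ∙ sym (h-θ σ k<n)) }
  ξ-block = record
    { F = λ j → n + j ∷ [] ; F-act = λ σ j j<n → cong (_∷ []) (h-ξ σ j)
    ; F-fresh = λ {σ} {τ} j k j<n k<n eq → cong (_∷ []) (h-ξ τ j ∙ cong (n +_) eq ∙ sym (h-ξ σ k)) }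
  θξ-block = record
    { F = λ j → j ∷ n + j ∷ [] ; F-act = λ σ j j<n → cong₂ (λ u v → u ∷ v ∷ []) (h-θ σ j<n) (h-ξ σ j)
    ; F-fresh = λ {σ} {τ} j k j<n k<n eq → cong₂ (λ u v → u ∷ v ∷ []) (h-θ τ j<n ∙ eq ∙ sym (h-θ σ k<n))
        (h-ξ τ j ∙ cong (n +_) eq ∙ sym (h-ξ σ k)) }

  -- The given generators of the ideal as Reynolds operators, and their reduction to t, s and L.

  mulElem-ι : ∀ x (γ : Vec Bool N) β → ι {N} (mulElem x ((1ℚ , mono γ) ∷ [])) β ≡ sumL (λ u → proj₁ u · cw (proj₂ u) (e γ) β) x
  mulElem-ι x γ β = sumL-concatMap _ (λ u → map (mulTerm u) ((1ℚ , mono γ) ∷ [])) x ∙ sumL-cong x term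
    where
    term : ∀ u → sumL (λ v → proj₁ v · cw (proj₂ v) vac β) (mulTerm u (1ℚ , mono γ) ∷ []) ≡ proj₁ u · cw (proj₂ u) (e γ) β
    term (k , m) = cong (λ v → sumL (λ v → proj₁ v · cw (proj₂ v) vac β) (v ∷ [])) (mulTerm≡ k m 1ℚ (mono γ))
      ∙ ring89 _ _ _
      ∙ cong (k ·_) (sym (normWord-cw (m ++ mono γ) vac β) ∙ cw-++ m (mono γ) vac β ∙ resp (cw-Linear m) (≈-sym (e≈cw-mono γ)) β)

  mulElem-Proper : ∀ x (γ : Vec Bool N) → InRange N x → All (Proper N) (mulElem x ((1ℚ , mono γ) ∷ []))
  mulElem-Proper [] γ [] = []
  mulElem-Proper ((k , m) ∷ x) γ (p ∷ px) = subst (Proper N) (sym (mulTerm≡ k m 1ℚ (mono γ)))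
    (Proper-scale (k · 1ℚ) (normWord (m ++ mono γ)) (normWord-proper (m ++ mono γ) (Allₚ.++⁺ p (mono-bounded γ)))) ∷ mulElem-Proper x γ px

  reynolds-InRange : ∀ m → All (_< N) m → InRange N (reynolds n m)
  reynolds-InRange m bd = go (perms n) (λ σ∈ → ∈-perms⇒IsPerm n σ∈)
    where
    go : ∀ σs → (∀ {σ} → σ ∈ σs → IsPerm n σ) → InRange N (concatMap (λ σ → actElem n σ ((1ℚ , m) ∷ [])) σs)
    go [] _ = []
    go (σ ∷ σs) ps = subst (λ l → InRange N (l ++ concatMap (λ σ → actElem n σ ((1ℚ , m) ∷ [])) σs)) (sym (actElem-∷ n σ 1ℚ m []))
      (normWord-bounded (map (h σ) m) (map-bounded (h-bounded (ps (here refl))) bd) ∷ go σs (λ σ∈ → ps (there σ∈)))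

  reynolds-R : ∀ m (γ : Vec Bool N) β → ι {N} (mulElem (reynolds n m) ((1ℚ , mono γ) ∷ [])) β ≡ R m (e γ) β
  reynolds-R m γ β = mulElem-ι (reynolds n m) γ β ∙ trans (sumL-concatMap _ (λ σ → actElem n σ ((1ℚ , m) ∷ [])) (perms n)) (sumL-cong (perms n) term)
    where
    term : ∀ σ → sumL (λ u → proj₁ u · cw (proj₂ u) (e γ) β) (actElem n σ ((1ℚ , m) ∷ [])) ≡ cw (map (h σ) m) (e γ) β
    term σ = cong (sumL (λ u → proj₁ u · cw (proj₂ u) (e γ) β)) (actElem-∷ n σ 1ℚ m []) ∙ ring90 _ _ ∙ sym (normWord-cw (map (h σ) m) (e γ) β)

  count-step : ∀ d {s} → ∃[ k ] s ≡ ℕtoℚ k → ∃[ k ] (if d then 0ℚ else 1ℚ) ⊹ s ≡ ℕtoℚ k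
  count-step true (k , eq) = k , trans (⊹-identityˡ _) eq
  count-step false (k , eq) = suc k , trans (cong (1ℚ ⊹_) eq) (sym (ℕtoℚ-suc k))

  count-step-suc : ∀ d {s} → ∃[ k ] s ≡ ℕtoℚ (suc k) → ∃[ k ] (if d then 0ℚ else 1ℚ) ⊹ s ≡ ℕtoℚ (suc k)
  count-step-suc true (k , eq) = k , trans (⊹-identityˡ _) eq
  count-step-suc false (k , eq) = suc k , trans (cong (1ℚ ⊹_) eq) (sym (ℕtoℚ-suc (suc k)))

  count-first : ∀ {d s} → d ≡ false → ∃[ k ] s ≡ ℕtoℚ k → ∃[ k ] (if d then 0ℚ else 1ℚ) ⊹ s ≡ ℕtoℚ (suc k)
  count-first refl (k , eq) = k , trans (cong (1ℚ ⊹_) eq) (sym (ℕtoℚ-suc k))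

  count-unused : ∀ (b : ℕ → Bool) m → ∃[ k ] Σ< m (λ j → if b j then 0ℚ else 1ℚ) ≡ ℕtoℚ k
  count-unused b zero = 0 , refl
  count-unused b (suc m) = count-step (b 0) (count-unused (b ∘ suc) m)

  count-unused-suc : ∀ (b : ℕ → Bool) m i → i < m → b i ≡ false → ∃[ k ] Σ< m (λ j → if b j then 0ℚ else 1ℚ) ≡ ℕtoℚ (suc k)
  count-unused-suc b (suc m) zero _ eq = count-first eq (count-unused (b ∘ suc) m)
  count-unused-suc b (suc m) (suc i) (s≤s i<m) eq = count-step-suc (b 0) (count-unused-suc (b ∘ suc) m i i<m eq)

  module _ {J : V N → Set} (I : IsIdeal J) where
    open IsIdeal I

    J-zero : J 0ᵥ
    J-zero = J-resp (λ β → ·-zeroˡ _) (J-mul 0ℚ (J-t 0ᵥ))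

    J-Σ< : ∀ m (x : ℕ → V N) → (∀ j → j < m → J (x j)) → J (λ β → Σ< m (λ j → x j β))
    J-Σ< zero x p = J-zero
    J-Σ< (suc m) x p = J-add (p 0 (s≤s z≤n)) (J-Σ< m (λ j → x (suc j)) (λ j j<m → p (suc j) (s≤s j<m)))

    -- Averaging over the position of the block: op B (R w x) is the sum of
    -- R (F j ++ w) x over all j, and the terms with a fresh index j agree.
    J-block : ∀ (B : Block) → (∀ y → J (op B y)) → ∀ i w x → i < n → All (_< N) w → usesIndex i w ≡ false →
      (∀ j → j < n → usesIndex j w ≡ true → J (R (F B j ++ w) x)) → J (R (F B i ++ w) x)
    J-block B J-op i w x i<n bd ui rest with count-unused-suc (λ j → usesIndex j w) n i i<n ui
    ... | k , eqk = J-resp (λ β → solved β) (J-mul (invℚ (ℕtoℚ (suc k))) (J-sub (J-op (R w x)) (J-Σ< n others others-J)))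
      where
      Rᵢ : V N
      Rᵢ = R (F B i ++ w) x
      others : ℕ → V N
      others j = (if usesIndex j w then 1ℚ else 0ℚ) ·ᵥ R (F B j ++ w) x
      others-J : ∀ j → j < n → J (others j)
      others-J j j<n with usesIndex j w in eq
      ... | true = J-mul 1ℚ (rest j j<n eq)
      ... | false = J-resp (λ β → sym (·-zeroˡ _)) J-zero
      split : ∀ j → j < n → ∀ β → R (F B j ++ w) x β ≡ (if usesIndex j w then 0ℚ else 1ℚ) · Rᵢ β ⊹ others j β
      split j j<n β with usesIndex j w in eq
      ... | true = ring91 _ _
      ... | false = R-exchange B i j w x i<n j<n bd ui eq β ∙ ring92 _ _
      total : ∀ β → op B (R w x) β ≡ ℕtoℚ (suc k) · Rᵢ β ⊹ Σ< n (λ j → others j β)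
      total β = begin
        op B (R w x) β ≡⟨ op-R B w x β ⟩
        Σ< n (λ j → R (F B j ++ w) x β) ≡⟨ Σ<-cong< n (λ j j<n → split j j<n β) ⟩
        Σ< n (λ j → (if usesIndex j w then 0ℚ else 1ℚ) · Rᵢ β ⊹ others j β) ≡⟨ Σ<-⊹ n (λ j → (if usesIndex j w then 0ℚ else 1ℚ) · Rᵢ β) (λ j → others j β) ⟩
        _
          ≡⟨ cong (_⊹ Σ< n (λ j → others j β)) (Σ<-cong n (λ j → ·-comm _ (Rᵢ β)) ∙ Σ<-· n (Rᵢ β) _ ∙ ·-comm _ _ ∙ cong (_· Rᵢ β) eqk) ⟩
        _ ∎
      solved : ∀ β → invℚ (ℕtoℚ (suc k)) · (op B (R w x) β − Σ< n (λ j → others j β)) ≡ Rᵢ β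
      solved β = cong (λ u → invℚ (ℕtoℚ (suc k)) · (u − Σ< n (λ j → others j β))) (total β)
        ∙ cong (invℚ (ℕtoℚ (suc k)) ·_) (ring50 _ _) ∙ sym (·-assoc _ _ _) ∙ cong (_· Rᵢ β) (·-inverseˡ _ (ℕtoℚ-suc≢0 k)) ∙ ·-identityˡ _

    private
      uses-case : ∀ j w → usesIndex j w ≡ true → (j ∈ w) ⊎ (n + j ∈ w)
      uses-case j w eq with elemB j w in eqj
      ... | true = inj₁ (elemB-true j w eqj)
      ... | false = inj₂ (elemB-true (n + j) w eq)

      J-R-zero : ∀ w x → (∀ σ β → cw (map (h σ) w) x β ≡ 0ℚ) → J (R w x)
      J-R-zero w x z = J-resp (≈-sym (R-zero w x z)) J-zero

    J-θξ-used : ∀ j w x → usesIndex j w ≡ true → J (R (j ∷ n + j ∷ w) x)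
    J-θξ-used j w x eq with uses-case j w eq
    ... | inj₁ j∈ = J-R-zero (j ∷ n + j ∷ w) x (λ σ β → trans (CC-anti (δ (h σ j)) (δ (h σ (n + j))) _ β)
      ((cong −_ (vanish (C-Linear (δ (h σ (n + j)))) (c-cw-∈ x (∈ₚ.∈-map⁺ (h σ) j∈)) β)) ∙ −0≡0))
    ... | inj₂ nj∈ = J-R-zero (j ∷ n + j ∷ w) x (λ σ β → vanish (C-Linear (δ (h σ j))) (c-cw-∈ x (∈ₚ.∈-map⁺ (h σ) nj∈)) β)

    J-θξ : ∀ j w x → j < n → All (_< N) w → J (R (j ∷ n + j ∷ w) x)
    J-θξ j w x j<n bd with usesIndex j w in eq
    ... | true = J-θξ-used j w x eq
    ... | false = J-block θξ-block J-L j w x j<n bd eq (λ i _ u → J-θξ-used i w x u)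

    bounded-remove : ∀ u g v → All (_< N) (u ++ g ∷ v) → All (_< N) (u ++ v)
    bounded-remove u g v bd = Allₚ.++⁺ (Allₚ.++⁻ˡ u bd) (All.tail (Allₚ.++⁻ʳ u bd))

    -- If w repeats θⱼ, the product is 0. If w contains ξⱼ, that letter is moved next to θⱼ at the
    -- price of signs, and the pair is handled by `J-θξ`.
    J-θ-used : ∀ j w x → j < n → All (_< N) w → usesIndex j w ≡ true → J (R (j ∷ w) x)
    J-θ-used j w x j<n bd eq with uses-case j w eq
    ... | inj₁ j∈ = J-R-zero (j ∷ w) x (λ σ → c-cw-∈ x (∈ₚ.∈-map⁺ (h σ) j∈))
    ... | inj₂ nj∈ with ∈ₚ.∈-∃++ nj∈
    ... | u , v , refl = J-resp (≈-sym (R-move (j ∷ u) (n + j) v x)) (J-mul (sgn (length (j ∷ u)))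
      (J-resp (≈-sym (R-move (n + j ∷ []) j (u ++ v) x)) (J-mul (sgn 1) (J-θξ j (u ++ v) x j<n (bounded-remove u (n + j) v bd)))))

    J-ξ-used : ∀ j w x → j < n → All (_< N) w → usesIndex j w ≡ true → J (R (n + j ∷ w) x)
    J-ξ-used j w x j<n bd eq with uses-case j w eq
    ... | inj₂ nj∈ = J-R-zero (n + j ∷ w) x (λ σ → c-cw-∈ x (∈ₚ.∈-map⁺ (h σ) nj∈))
    ... | inj₁ j∈ with ∈ₚ.∈-∃++ j∈
    ... | u , v , refl = J-resp (≈-sym (R-move (n + j ∷ u) j v x)) (J-mul (sgn (length (n + j ∷ u))) (J-θξ j (u ++ v) x j<n (bounded-remove u j v bd)))

    -- Only the first letter matters: if its index is fresh, averaging over the index reduces to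
    -- used indices, and there its partner in w supplies a factor θⱼ ξⱼ, or a repetition gives 0. So
    -- positive-degree invariants lie in the ideal of t, s and L.
    J-R : ∀ g w x → All (_< N) (g ∷ w) → J (R (g ∷ w) x)
    J-R g w x (g<N ∷ bd) with letter g g<N
    ... | θ i i<n with usesIndex i w in eq
    ... | true = J-θ-used i w x i<n bd eq
    ... | false = J-block θ-block (λ y → J-resp (λ β → sym (t≈Σ y β)) (J-t y)) i w x i<n bd eq (λ j j<n u → J-θ-used j w x j<n bd u)
    J-R g w x (g<N ∷ bd) | ξ i i<n with usesIndex i w in eq
    ... | true = J-ξ-used i w x i<n bd eq
    ... | false = J-block ξ-block (λ y → J-resp (λ β → sym (s≈Σ y β)) (J-s y)) i w x i<n bd eq (λ j j<n u → J-ξ-used j w x j<n bd u)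

  -- Conversely t, s and L are Reynolds symmetrisations up to scalars.
  module _ {J : V N → Set} (J-resp : ∀ {x y} → x ≈ y → J x → J y) (J-add : ∀ {x y} → J x → J y → J (x +ᵥ y)) (J-mul : ∀ {x} k → J x → J (k ·ᵥ x))
    (J-gen : ∀ (μ γ : Vec Bool N) → isNonEmpty (mono μ) ≡ true → J (R (mono μ) (e γ))) where

    private
      J-sumV : ∀ {M} (x : Vec Bool M → V N) → (∀ γ → J (x γ)) → J (λ β → sumV (λ γ → x γ β))
      J-sumV {zero} x p = p []
      J-sumV {suc M} x p = J-add (J-sumV (x ∘ (false ∷_)) (λ γ → p (false ∷ γ))) (J-sumV (x ∘ (true ∷_)) (λ γ → p (true ∷ γ)))

      J-R-gen : ∀ μ y → isNonEmpty (mono {N} μ) ≡ true → J (R (mono μ) y)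
      J-R-gen μ y ne = J-resp (λ β → sym (expand (coordinate (R-Linear (mono μ)) β) y)) (J-sumV (λ γ → y γ ·ᵥ R (mono μ) (e γ)) (λ γ → J-mul (y γ) (J-gen μ γ ne)))

      sumL-const : ∀ {A : Set} (xs : List A) k → sumL (λ _ → k) xs ≡ ℕtoℚ (length xs) · k
      sumL-const [] k = sym (·-zeroˡ k)
      sumL-const (x ∷ xs) k = cong (k ⊹_) (sumL-const xs k) ∙ trans (lem′ _ _) (cong (_· k) (sym (ℕtoℚ-suc (length xs))))
        where
        lem′ : ∀ k m → k ⊹ m · k ≡ (1ℚ ⊹ m) · k
        lem′ k m = cong (_⊹ m · k) (sym (·-identityˡ k)) ∙ sym (·-distribʳ k 1ℚ m)
          where
          ·-distribʳ : ∀ k a b → (a ⊹ b) · k ≡ a · k ⊹ b · k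
          ·-distribʳ k a b = ·-comm _ k ∙ ·-distribˡ-⊹ k a b ∙ (cong₂ _⊹_ (·-comm k a) (·-comm k b))

      positive : 0 < n
      positive = ℕₚ.n≢0⇒n>0 n≢0

      perms-nonempty : ∃[ k ] length (perms n) ≡ suc k
      perms-nonempty with perms n | IsPerm⇒∈-perms n {upTo n} ↭-refl
      ... | _ ∷ σs | _ = length σs , refl

      -- Compute `op B (R [] y)` in two ways: `R []` is multiplication by the number of
      -- permutations, and by `R-exchange` the n summands all equal the symmetrised block of index
      -- 0.
      J-op : ∀ (B : Block) (μ : Vec Bool N) → F B 0 ≡ mono μ → isNonEmpty (mono μ) ≡ true → ∀ y → J (op B y)
      J-op B μ eqμ ne y with perms-nonempty
      ... | k , eqk = J-resp solved (J-mul (invℚ (ℕtoℚ (suc k)) · ℕtoℚ n) (J-R-gen μ y ne))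
        where
        R[] : R [] y ≈ ℕtoℚ (suc k) ·ᵥ y
        R[] β = sumL-const (perms n) (y β) ∙ cong (λ m → ℕtoℚ m · y β) eqk
        Σop : ∀ β → op B (R [] y) β ≡ ℕtoℚ n · R (mono μ) y β
        Σop β = op-R B [] y β ∙ Σ<-cong< n (λ j j<n → trans (R-exchange B 0 j [] y positive j<n [] refl refl β)
          (cong (λ w → R w y β) (Listₚ.++-identityʳ (F B 0) ∙ eqμ))) ∙ Σ<-const n (R (mono μ) y β)
        op-linear : ∀ β → op B (R [] y) β ≡ ℕtoℚ (suc k) · op B y β
        op-linear β = Σ<-cong n (λ j → trans (resp (cw-Linear (F B j)) R[] β) (mul (cw-Linear (F B j)) (ℕtoℚ (suc k)) y β)) ∙ Σ<-· n (ℕtoℚ (suc k)) _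
        solved : (invℚ (ℕtoℚ (suc k)) · ℕtoℚ n) ·ᵥ R (mono μ) y ≈ op B y
        solved β = ·-assoc _ _ _ ∙ cong (invℚ (ℕtoℚ (suc k)) ·_) (sym (Σop β) ∙ op-linear β)
          ∙ sym (·-assoc _ _ _) ∙ cong (_· op B y β) (·-inverseˡ _ (ℕtoℚ-suc≢0 k)) ∙ ·-identityˡ _

      word : ∀ w → Increasing w → All (_< N) w → ∃[ μ ] w ≡ mono {N} μ
      word = increasing⇒mono N

    IsIdeal-generated : IsIdeal J
    IsIdeal-generated = record
      { J-resp = J-resp ; J-add = J-add ; J-mul = J-mul
      ; J-t = λ y → let (μ , eq) = word (0 ∷ []) ([] ∷ []) (θ< positive ∷ []) in
          J-resp (λ β → t≈Σ y β) (J-op θ-block μ eq (cong isNonEmpty (sym eq)) y)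
      ; J-s = λ y → let (μ , eq) = word (n + 0 ∷ []) ([] ∷ []) (ξ< positive ∷ []) in
          J-resp (λ β → s≈Σ y β) (J-op ξ-block μ eq (cong isNonEmpty (sym eq)) y)
      ; J-L = λ y → let (μ , eq) = word (0 ∷ n + 0 ∷ []) ((ℕₚ.≤-trans positive (ℕₚ.m≤m+n n 0) ∷ []) ∷ ([] ∷ [])) (θ< positive ∷ ξ< positive ∷ []) in
          J-op θξ-block μ eq (cong isNonEmpty (sym eq)) y }

  -- The character of one bidegree of the quotient.

  module Character (a₀ b₀ : ℕ) where

    private
      indicator : Bool → ℚ
      indicator b = if b then 1ℚ else 0ℚ

    inDegree : Vec Bool N → Bool
    inDegree β = (#kind true κ β ≡ᵇ a₀) ∧ (#kind false κ β ≡ᵇ b₀)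

    bs : List (Vec Bool N)
    bs = filterB inDegree (vecs N)

    basis≡ : basis n a₀ b₀ ≡ map mono bs
    basis≡ = cong (filterB (λ m → (θdeg n m ≡ᵇ a₀) ∧ (ξdeg n m ≡ᵇ b₀))) (sublists-upTo N)
      ∙ filterB-map _ mono (vecs N) ∙ cong (map mono) (filterB-cong (λ β → cong₂ (λ i j → (i ≡ᵇ a₀) ∧ (j ≡ᵇ b₀))
        (countB-mono-true κ β)
        (cong length (filterB-cong (λ g → ≤ᵇ≡not<ᵇ n g) (mono β)) ∙ countB-mono-false κ β)) (vecs N))

    indicator-δ² : ∀ i j → indicator ((i ≡ᵇ a₀) ∧ (j ≡ᵇ b₀)) ≡ δ² a₀ b₀ i j
    indicator-δ² i j = split (i ≡ᵇ a₀) (j ≡ᵇ b₀) ∙ (cong₂ _·_ (δ-sym i a₀) (δ-sym j b₀))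
      where
      split : ∀ p r → indicator (p ∧ r) ≡ indicator p · indicator r
      split true r = sym (·-identityˡ _)
      split false r = sym (·-zeroˡ _)

    π-indicator : ∀ x β → π a₀ b₀ x β ≡ indicator (inDegree β) · x β
    π-indicator x β = diag-scales κ _ x β ∙ cong (_· x β) (sym (indicator-δ² _ _))

    π-e : ∀ β → π a₀ b₀ (e β) ≈ indicator (inDegree β) ·ᵥ e β
    π-e β γ = π-indicator (e β) γ ∙ e-diagonal (indicator ∘ inDegree) β γ

    res : V N → Vec'
    res x = map x bs

    coords≡ : ∀ x → All (Proper N) x → coords n a₀ b₀ x ≡ res (ι x)
    coords≡ x px = cong (map (coordOf x)) basis≡ ∙ sym (Listₚ.map-∘ bs) ∙ Listₚ.map-cong (λ β → coordOf-ι x px β) bs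

    res-cong : ∀ {x y} → x ≈ y → res x ≡ res y
    res-cong p = Listₚ.map-cong p bs

    fromCoords-res : ∀ x → fromCoords bs (indexℚ (res x)) ≈ π a₀ b₀ x
    fromCoords-res x γ = fromCoords-map bs x γ
      ∙ sumL-filterB (λ β → x β · e β γ) inDegree (vecs N) ∙ sumL-vecs {N} _
      ∙ sumV-cong {N} (λ β → sym (·-assoc _ _ _))
      ∙ sym (expand {N} (coordinate Linear-id γ) (λ β → indicator (inDegree β) · x β))
      ∙ sym (π-indicator x γ)

    res-π : ∀ x → res (π a₀ b₀ x) ≡ res x
    res-π x = go bs (λ β∈ → proj₂ (∈-filterB⁻ inDegree (vecs N) β∈))
      where
      go : ∀ cs → (∀ {β} → β ∈ cs → inDegree β ≡ true) → map (π a₀ b₀ x) cs ≡ map x cs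
      go [] _ = refl
      go (β ∷ cs) h = cong₂ _∷_ (π-indicator x β ∙ cong (λ d → indicator d · x β) (h (here refl)) ∙ ·-identityˡ _) (go cs (λ β∈ → h (there β∈)))

    G : List Vec'
    G = idealGens n a₀ b₀

    G-elements : ∀ {v} → v ∈ G → ∃[ μ ] ∃[ γ ] isNonEmpty (mono μ) ≡ true × v ≡ res (R (mono {N} μ) (e γ))
    G-elements v∈ with ∈-concatMap⁻ (λ m → map (λ m′ → coords n a₀ b₀ (mulElem (reynolds n m) ((1ℚ , m′) ∷ []))) (allMonos n)) (filterB isNonEmpty (allMonos n)) v∈
    ... | m , m∈ , r with ∈ₚ.∈-map⁻ (λ m′ → coords n a₀ b₀ (mulElem (reynolds n m) ((1ℚ , m′) ∷ []))) r | ∈-filterB⁻ isNonEmpty (allMonos n) m∈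
    ... | m′ , m′∈ , refl | m∈′ , ne with ∈ₚ.∈-map⁻ mono (subst (m ∈_) (sublists-upTo N) m∈′) | ∈ₚ.∈-map⁻ mono (subst (m′ ∈_) (sublists-upTo N) m′∈)
    ... | μ , _ , refl | γ , _ , refl = μ , γ , ne ,
              trans (coords≡ _ (mulElem-Proper (reynolds n (mono μ)) γ (reynolds-InRange (mono μ) (mono-bounded μ)))) (res-cong (reynolds-R (mono μ) γ))

    G-contains : ∀ (μ γ : Vec Bool N) → isNonEmpty (mono μ) ≡ true → res (R (mono μ) (e γ)) ∈ G
    G-contains μ γ ne = subst (_∈ G)
      (coords≡ _ (mulElem-Proper (reynolds n (mono μ)) γ (reynolds-InRange (mono μ) (mono-bounded μ))) ∙ res-cong (reynolds-R (mono μ) γ))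
      (∈-concatMap⁺ (λ m → map (λ m′ → coords n a₀ b₀ (mulElem (reynolds n m) ((1ℚ , m′) ∷ []))) (allMonos n))
        (∈-filterB⁺ isNonEmpty (in-all μ) ne) (∈ₚ.∈-map⁺ (λ m′ → coords n a₀ b₀ (mulElem (reynolds n (mono μ)) ((1ℚ , m′) ∷ []))) (in-all γ)))
      where
      in-all : ∀ (β : Vec Bool N) → mono β ∈ allMonos n
      in-all β = subst (mono β ∈_) (sym (sublists-upTo N)) (∈ₚ.∈-map⁺ mono (∈-vecs β))

    -- The ideal of the statement in bidegree (a₀ , b₀), pulled back to all vectors along the
    -- restriction of coordinates.
    W : V N → Set
    W x = Span G (indexℚ (res x))

    W-IsIdeal : IsIdeal W
    W-IsIdeal = IsIdeal-generated {W}
      (λ p → Span-resp (λ i → cong (λ l → indexℚ l i) (res-cong p)))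
      (λ {x} {y} s s′ → Span-resp (λ i → sym (indexℚ-map-⊹ x y bs i)) (Span-add s s′))
      (λ {x} k s → Span-resp (λ i → sym (indexℚ-map-· k x bs i)) (Span-mul k s))
      (λ μ γ ne → Span-gen (G-contains μ γ ne))

    open Complement (complement a₀ b₀) renaming (linear to lproj)

    private
      pr : V N → V N
      pr x = proj (π a₀ b₀ x)
      lpr : Linear pr
      lpr = Linear-∘ lproj (lπ a₀ b₀)

    proj-kills-IsIdeal : IsIdeal (λ x → pr x ≈ 0ᵥ)
    proj-kills-IsIdeal = record
      { J-resp = λ p z → ≈-trans (resp lpr (≈-sym p)) z
      ; J-add = λ {x} {y} z z′ β → trans (add lpr x y β) ((cong₂ _⊹_ (z β) (z′ β)) ∙ ⊹-identityˡ 0ℚ)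
      ; J-mul = λ {x} k z β → trans (mul lpr k x β) (cong (k ·_) (z β) ∙ ·-zeroʳ k)
      ; J-t = kills-t ; J-s = kills-s ; J-L = kills-L }

    -- The generators are symmetrised nonempty words, and by `J-R` these lie in every subspace
    -- containing the images of t, s and L, in particular in the kernel of the projection.
    proj-Span : ∀ {u} → Span G u → proj (fromCoords bs u) ≈ 0ᵥ
    proj-Span (null z) = vanish lproj (fromCoords-0 bs z)
    proj-Span (more {u} {u′} {v} k v∈ s d) β with G-elements v∈
    ... | μ , γ , ne , refl = resp lproj (≈-trans (fromCoords-cong bs d) (fromCoords-⊹ bs (λ i → k · indexℚ (res (R (mono μ) (e γ))) i) u′)) β
      ∙ add lproj _ _ β ∙ (cong₂ _⊹_ (resp lproj (≈-trans (fromCoords-· bs k _) (λ ζ → cong (k ·_) (fromCoords-res _ ζ))) β ∙ mul lproj k _ β) (proj-Span s β))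
      ∙ cong (λ t → k · t ⊹ 0ℚ) (killed (mono μ) ne (mono-bounded μ) β)
      ∙ ring106 _
      where
      killed : ∀ m → isNonEmpty m ≡ true → All (_< N) m → pr (R m (e γ)) ≈ 0ᵥ
      killed (g′ ∷ m) _ bd = J-R proj-kills-IsIdeal g′ m (e γ) bd

    module _ {σ : List ℕ} (p : IsPerm n σ) where

      private
        Y : V N → V N
        Y = act N (h σ)
        E : Equivariant Y
        E = act-Equivariant p
        lY : Linear Y
        lY = act-Linear N (h σ)
        B : RBasis
        B = spanBasis G
        D : ℕ
        D = length bs

      traceE≡ : traceE n a₀ b₀ σ ≡ tr (λ x → Y (π a₀ b₀ x))
      traceE≡ = sumℚ≡sumL (λ m → coordOf (actElem n σ ((1ℚ , m) ∷ [])) m) (basis n a₀ b₀)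
        ∙ cong (sumL (λ m → coordOf (actElem n σ ((1ℚ , m) ∷ [])) m)) basis≡ ∙ sumL-map (λ m → coordOf (actElem n σ ((1ℚ , m) ∷ [])) m) mono bs
        ∙ sumL-cong bs (λ β → trans (coordOf-ι (actElem n σ ((1ℚ , mono β) ∷ [])) (actElem-Proper N n σ ((1ℚ , mono β) ∷ []) (h-bounded p) (mono-bounded β ∷ [])) β)
            (actElem-ι N n σ ((1ℚ , mono β) ∷ []) (mono-bounded β ∷ []) β ∙ resp lY (λ γ → trans (⊹-identityʳ _) (·-identityˡ _ ∙ sym (e≈cw-mono β γ))) β))
        ∙ sumL-filterB (λ β → Y (e β) β) inDegree (vecs N) ∙ sumL-vecs {N} _
        ∙ sumV-cong {N} (λ β → sym (resp lY (π-e β) β ∙ mul lY _ (e β) β))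

      private
        G-lengths : All (λ v → length v ≡ D) G
        G-lengths = All.tabulate (λ v∈ → let (μ , γ , _ , eq) = G-elements v∈ in trans (cong length eq) (Listₚ.length-map _ bs))

        module S = Spans (spanBasis-Spans {D} G G-lengths)

        y : Row → V N
        y r = fromCoords bs (row r)

        form : ℕ → V N → ℚ
        form i x = indexℚ (res x) i

        form-LinearForm : ∀ i → LinearForm (form i)
        form-LinearForm i = record
          { respᶠ = λ q → cong (λ l → indexℚ l i) (res-cong q)
          ; addᶠ = λ x z → indexℚ-map-⊹ x z bs i
          ; mulᶠ = λ k x → indexℚ-map-· k x bs i }

        P : V N → V N
        P x = π a₀ b₀ x -ᵥ pr x

        lP : Linear P
        lP = Linear-− (lπ a₀ b₀) lpr

        πP : ∀ x → π a₀ b₀ (P x) ≈ (λ β → sumL (λ r → form (pivot r) (P x) · y r β) B)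
        πP x = ≈-trans (≈-sym (fromCoords-res (P x))) (≈-trans (fromCoords-cong bs (S.fixes (ideal W-IsIdeal x))) (fromCoords-combine bs B (indexℚ (res (P x)))))

        π-idem : ∀ x → π a₀ b₀ (π a₀ b₀ x) ≈ π a₀ b₀ x
        π-idem x = ≈-trans (≈-sym (fromCoords-res (π a₀ b₀ x))) (≈-trans (fromCoords-cong bs (λ i → cong (λ l → indexℚ l i) (res-π x))) (fromCoords-res x))

        lift : ∀ {u} → Span G u → ∃[ x ] ∀ i → u i ≡ form i x
        lift (null z) = 0ᵥ , λ i → trans (z i) (sym (respᶠ (form-LinearForm i) (λ β → sym (·-zeroˡ 0ℚ)) ∙ mulᶠ (form-LinearForm i) 0ℚ 0ᵥ ∙ ·-zeroˡ _))
        lift (more k v∈ s d) with G-elements v∈ | lift s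
        ... | μ , γ , _ , refl | x , eq = (k ·ᵥ R (mono μ) (e γ)) +ᵥ x ,
          λ i → trans (d i) (sym (addᶠ (form-LinearForm i) _ x ∙ (cong₂ _⊹_ (mulᶠ (form-LinearForm i) k _) (sym (eq i)))))

        π-y : ∀ r → r ∈ B → π a₀ b₀ (y r) ≈ y r
        π-y r r∈ = lifted (lift (All⇒∀∈ S.inside r∈))
          where
          lifted : (∃[ x ] ∀ i → row r i ≡ form i x) → π a₀ b₀ (y r) ≈ y r
          lifted (x , eq) = ≈-trans (resp (lπ a₀ b₀) yx) (≈-trans (π-idem x) (≈-sym yx))
            where
            yx : y r ≈ π a₀ b₀ x
            yx = ≈-trans (fromCoords-cong bs eq) (fromCoords-res x)

        P-Y-y : ∀ r → r ∈ B → P (Y (y r)) ≈ Y (y r)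
        P-Y-y r r∈ β = (cong₂ _−_ (πYy β) (resp lproj πYy β ∙ sym (equiv E (y r) β) ∙ vanish lY (proj-Span (All⇒∀∈ S.inside r∈)) β)) ∙ lem _
          where
          πYy : π a₀ b₀ (Y (y r)) ≈ Y (y r)
          πYy = ≈-trans (≈-sym (Equivariant.Y-diag E (δ² a₀ b₀) (y r))) (resp lY (π-y r r∈))
          lem : ∀ a → a − 0ℚ ≡ a
          lem a = cong (a ⊹_) −0≡0 ∙ ⊹-identityʳ a

        Y-sumL : ∀ (k : Row → ℚ) rs → Y (λ β → sumL (λ r → k r · y r β) rs) ≈ (λ β → sumL (λ r → k r · Y (y r) β) rs)
        Y-sumL k [] = zer lY
        Y-sumL k (r ∷ rs) β = add lY (k r ·ᵥ y r) _ β ∙ (cong₂ _⊹_ (mul lY (k r) (y r) β) (Y-sumL k rs β))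

        sumV-sumL : ∀ {M} (φ : Row → Vec Bool M → ℚ) rs → sumV (λ β → sumL (λ r → φ r β) rs) ≡ sumL (λ r → sumV (φ r)) rs
        sumV-sumL {M} φ [] = sumV-zero {M} (λ _ → refl)
        sumV-sumL {M} φ (r ∷ rs) = sumV-⊹ (φ r) (λ β → sumL (λ r → φ r β) rs) ∙ cong (sumV (φ r) ⊹_) (sumV-sumL φ rs)

        -- P maps into the ideal, so `π a₀ b₀ (P x)` is the combination of the rows with
        -- coefficients read at the pivots. Expanding the trace in these rows and using that P fixes
        -- `Y (y r)` gives the pivot sum of `traceSub`.
        trP : tr (λ x → Y (P x)) ≡ sumL (λ r → form (pivot r) (Y (y r))) B
        trP = tr-cong (λ x → resp lY (λ β → cong₂ _−_ (sym (π-idem x β)) (resp lproj (≈-sym (π-idem x)) β)))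
          ∙ tr-cyclic (Linear-∘ lY lP) (lπ a₀ b₀)
          ∙ tr-cong (λ x → ≈-trans (≈-sym (Equivariant.Y-diag E (δ² a₀ b₀) (P x))) (≈-trans (resp lY (πP x)) (Y-sumL (λ r → form (pivot r) (P x)) B)))
          ∙ sumV-sumL (λ r β → form (pivot r) (P (e β)) · Y (y r) β) B
          ∙ sumL-cong∈ B (λ r r∈ → trans (sumV-cong {N} (λ β → ·-comm _ _)) (sym (expand (LinearForm-∘ (form-LinearForm (pivot r)) lP) (Y (y r)))
              ∙ respᶠ (form-LinearForm (pivot r)) (P-Y-y r r∈)))

      traceSub≡ : traceSub n a₀ b₀ σ (spanBasis G) ≡ tr (λ x → Y (π a₀ b₀ x -ᵥ proj (π a₀ b₀ x)))
      traceSub≡ = sumℚ≡sumL (λ r → indexℚ (coords n a₀ b₀ (actElem n σ (toElem n a₀ b₀ (proj₁ r)))) (proj₂ r)) B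
        ∙ sumL-cong∈ B (λ r r∈ → cong (λ l → indexℚ l (pivot r)) (term r r∈)) ∙ sym trP
        where
        term : ∀ r → r ∈ B → coords n a₀ b₀ (actElem n σ (toElem n a₀ b₀ (proj₁ r))) ≡ res (Y (y r))
        term r r∈ = cong (λ l → coords n a₀ b₀ (actElem n σ (zip (proj₁ r) l))) basis≡
          ∙ coords≡ _ (actElem-Proper N n σ _ (h-bounded p) (zip-InRange (proj₁ r) bs))
          ∙ res-cong (≈-trans (actElem-ι N n σ _ (zip-InRange (proj₁ r) bs)) (resp lY (fromCoords-zip (proj₁ r) bs (All⇒∀∈ (Echelon.lengths S.isEchelon) r∈))))

      charR≡trace : charR n a₀ b₀ σ ≡ (if (a₀ + b₀) <ᵇ n then g Y a₀ b₀ − shift₁ (shift₂ (g Y)) a₀ b₀ else 0ℚ)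
      charR≡trace = charR≡ n a₀ b₀ σ
        ∙ cong₂ _−_ traceE≡ (traceSub≡ ∙ tr-cong (λ x β → trans (sub lY (π a₀ b₀ x) (pr x) β) (cong (Y (π a₀ b₀ x) β ⊹_) (−≡-1· _)))
            ∙ tr-+ (λ x → Y (π a₀ b₀ x)) (λ x → (− 1ℚ) ·ᵥ Y (pr x)) ∙ cong (tr (λ x → Y (π a₀ b₀ x)) ⊹_) (tr-· (− 1ℚ) (λ x → Y (pr x))))
        ∙ ring107 _ _
        ∙ trace E

  -- Generating functions of the traces of a permutation.

  module GradedTrace (u v : ℚ) where

    monomial : ℕ → ℕ → ℚ
    monomial i j = pw u i · pw v j

    colour : Bool → ℚ
    colour b = if b then u else v

    bump-monomial : ∀ b i j → bump b monomial i j ≡ colour b · monomial i j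
    bump-monomial true i j = ·-assoc u (pw u i) (pw v j)
    bump-monomial false i j = ring179 _ _ _

    -- Scaling by bidegree is the algebra map that multiplies each generator by u or v. A graded
    -- trace thereby becomes the plain trace of a weighted permutation, which `PermutationTrace`
    -- evaluates.
    hat-colour : ∀ {M} K h k (x : V K) → hat {M} K h (colour ∘ k) x ≈ hat K h (λ _ → 1ℚ) (diag k monomial x)
    hat-colour zero h k x β = cong (_· vac β) (ring180 _)
    hat-colour {M} (suc K) h k x β = cong₂ _⊹_ (hat-colour K (h ∘ suc) (k ∘ suc) (x ∘ (false ∷_)) β) (sym (mul (C-Linear (δ (h 0))) (colour (k 0)) (hat K (h ∘ suc) (colour ∘ k ∘ suc) x₁) β)
      ∙ resp (C-Linear (δ (h 0))) (λ γ → trans (cong (colour (k 0) ·_) (hat-colour K (h ∘ suc) (k ∘ suc) x₁ γ))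
          (sym (mul lh (colour (k 0)) (diag (k ∘ suc) monomial x₁) γ) ∙ resp lh scaled γ)) β
      ∙ sym (·-identityˡ _))
      where
      x₁ : V K
      x₁ = x ∘ (true ∷_)
      lh : Linear (hat {M} K (h ∘ suc) (λ _ → 1ℚ))
      lh = hat-Linear K (h ∘ suc) (λ _ → 1ℚ)
      scaled : colour (k 0) ·ᵥ diag (k ∘ suc) monomial x₁ ≈ diag (k ∘ suc) (bump (k 0) monomial) x₁
      scaled γ = cong (colour (k 0) ·_) (diag-scales (k ∘ suc) monomial x₁ γ) ∙ sym (·-assoc _ _ _)
        ∙ cong (_· x₁ γ) (sym (bump-monomial (k 0) _ _)) ∙ sym (diag-scales (k ∘ suc) (bump (k 0) monomial) x₁ γ)

    -- Bounds all degrees with room for one shift.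
    M : ℕ → ℕ
    M j = suc (suc (j + N))

    tr-Σ< : ∀ m (X : ℕ → V N → V N) → tr (λ x β → Σ< m (λ i → X i x β)) ≡ Σ< m (λ i → tr (X i))
    tr-Σ< zero X = sumV-zero {N} (λ _ → refl)
    tr-Σ< (suc m) X = tr-+ (X 0) (λ x β → Σ< m (λ i → X (suc i) x β)) ∙ cong (tr (X 0) ⊹_) (tr-Σ< m (X ∘ suc))

    #kind< : ∀ k j (β : Vec Bool N) → #kind k κ β < M j
    #kind< k j β = s≤s (ℕₚ.≤-trans (#kind≤ k κ β) (ℕₚ.≤-trans (ℕₚ.m≤n+m N j) (ℕₚ.n≤1+n _)))

    π-vanishes : ∀ a b → (∀ β → δ² a b (#kind true κ β) (#kind false κ β) ≡ 0ℚ) → ∀ x → π a b x ≈ 0ᵥ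
    π-vanishes a b z x β = diag-scales κ (δ² a b) x β ∙ cong (_· x β) (z β) ∙ ·-zeroˡ _

    module _ {Y : V N → V N} (E : Equivariant Y) (j : ℕ) where
      open Equivariant E renaming (linear to lY)

      ev-f : ev (M j) (f Y) u v ≡ tr (λ x → Y (diag κ monomial x))
      ev-f = sym (tr-cong (λ x → ≈-trans (resp lY (split x)) (≈-trans (sumΣ< lY (M j) (λ a β → Σ< (M j) (λ b → monomial a b · π a b x β)))
            (λ β → Σ<-cong (M j) (λ a → trans (sumΣ< lY (M j) (λ b → monomial a b ·ᵥ π a b x) β) (Σ<-cong (M j) (λ b → mul lY (monomial a b) (π a b x) β))))))
        ∙ tr-Σ< (M j) (λ a x β → Σ< (M j) (λ b → monomial a b · Y (π a b x) β)) ∙ Σ<-cong (M j) (λ a →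
            trans (tr-Σ< (M j) (λ b x → monomial a b ·ᵥ Y (π a b x))) (Σ<-cong (M j) (λ b → tr-· (monomial a b) (λ x → Y (π a b x)))))
        ∙ Σ<-cong (M j) (λ a → trans (Σ<-cong (M j) (λ b → ring181 (pw u a) (pw v b) (f Y a b))) (Σ<-· (M j) (pw u a) (λ b → f Y a b · pw v b) ∙ ·-comm (pw u a) (Σ< (M j) (λ b → f Y a b · pw v b)))) ∙ sym (ev-Σ< (M j) (f Y) u v))
        where
        split : ∀ x → diag κ monomial x ≈ (λ β → Σ< (M j) (λ a → Σ< (M j) (λ b → monomial a b · π a b x β)))
        split x β = diag-scales κ monomial x β ∙ sym (Σ<-cong (M j) (λ a → trans (Σ<-cong (M j) (λ b → trans (cong (monomial a b ·_) (diag-scales κ (δ² a b) x β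
              ∙ cong (_· x β) (cong₂ _·_ (δ-sym a k) (δ-sym b l)))) (ring182 (pw u a) (pw v b) (δ k a) (δ l b) (x β))))
              (Σ<-· (M j) (x β · (δ k a · pw u a)) (λ b → δ l b · pw v b) ∙ cong ((x β · (δ k a · pw u a)) ·_) (Σ<-δ (M j) (pw v) (#kind< false j β)) ∙ ·-comm (x β · (δ k a · pw u a)) (pw v l)))
          ∙ Σ<-· (M j) (pw v l) (λ a → x β · (δ k a · pw u a)) ∙ cong (pw v l ·_) (Σ<-· (M j) (x β) (λ a → δ k a · pw u a) ∙ cong (x β ·_) (Σ<-δ (M j) (pw u) (#kind< true j β)))
          ∙ ·-comm _ _ ∙ sym (ring183 _ _ _))
          where
          k l : ℕ
          k = #kind true κ β
          l = #kind false κ β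

      -- The trace on the bidegree (a , b) of the invariant complement, before
      -- truncation to total degree below n.
      K : ℕ → ℕ → ℚ
      K a b = g Y a b − shift₁ (shift₂ (g Y)) a b

      private
        top-row : ∀ b → g Y (suc (j + N)) b ≡ 0ℚ
        top-row b = tr-cong (λ x → vanish lY (vanish lQ (π-vanishes (suc (j + N)) b (λ β → δ²-below (suc (j + N)) b _ _ (s≤s (ℕₚ.≤-trans (#kind≤ true κ β) (ℕₚ.m≤n+m N j)))) x)))
          ∙ sumV-zero {N} (λ _ → refl)

        top-column : ∀ a → g Y a (suc (j + N)) ≡ 0ℚ
        top-column a = tr-cong (λ x → vanish lY (vanish lQ (π-vanishes a (suc (j + N)) (λ β → trans (cong (δ a (#kind true κ β) ·_)
            (δ-≢ (λ eq → ℕₚ.<-irrefl (sym eq) (s≤s (ℕₚ.≤-trans (#kind≤ false κ β) (ℕₚ.m≤n+m N j)))))) (·-zeroʳ _)) x)))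
          ∙ sumV-zero {N} (λ _ → refl)

        m : ℕ
        m = suc (j + N)

        G : ℚ
        G = ev (M j) (g Y) u v

      -- With G the generating function of `g Y`: K has (1 - u v) G by definition, and f has (1 + u)
      -- (1 + v) G by `f≡g`. The last row and column of the arrays vanish, so that shifting within
      -- the bound M is multiplication by u or v.
      ev-K : (1ℚ ⊹ u) · (1ℚ ⊹ v) · ev (M j) K u v ≡ (1ℚ − u · v) · ev (M j) (f Y) u v
      ev-K = cong ((1ℚ ⊹ u) · (1ℚ ⊹ v) ·_) K≡ ∙ trans (ring184 _ _ _) (cong ((1ℚ − u · v) ·_) (sym F≡))
        where
        zero-sum : ∀ {a b} → a ≡ 0ℚ → b ≡ 0ℚ → a ⊹ b ≡ 0ℚ
        zero-sum p q = (cong₂ _⊹_ p q) ∙ ⊹-identityˡ 0ℚ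
        shift₂-top : ∀ b → shift₂ (g Y) m b ≡ 0ℚ
        shift₂-top zero = refl
        shift₂-top (suc b) = top-row b
        shift₁-top : ∀ a → shift₁ (g Y) a m ≡ 0ℚ
        shift₁-top zero = refl
        shift₁-top (suc a) = top-column a
        K≡ : ev (M j) K u v ≡ G ⊹ (− 1ℚ) · (u · (v · G))
        K≡ = trans (ev-cong< (M j) u v (λ a b _ _ → ring156 (g Y a b) (shift₁ (shift₂ (g Y)) a b))) (ev-⊹ (M j) (g Y) (λ a b → (− 1ℚ) · shift₁ (shift₂ (g Y)) a b) u v
              ∙ cong (G ⊹_) (ev-· (M j) (− 1ℚ) (shift₁ (shift₂ (g Y))) u v))
          ∙ cong (λ t → G ⊹ (− 1ℚ) · t) (ev-shift₁ m (shift₂ (g Y)) u v shift₂-top ∙ cong (u ·_) (ev-shift₂ m (g Y) u v top-column))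
        H : ℕ → ℕ → ℚ
        H a b = g Y a b ⊹ shift₁ (g Y) a b
        H≡ : ev (M j) H u v ≡ G ⊹ u · G
        H≡ = ev-⊹ (M j) (g Y) (shift₁ (g Y)) u v ∙ cong (G ⊹_) (ev-shift₁ m (g Y) u v top-row)
        F≡ : ev (M j) (f Y) u v ≡ (G ⊹ u · G) ⊹ v · (G ⊹ u · G)
        F≡ = ev-cong< (M j) u v (λ a b _ _ → f≡g E a b) ∙ ev-⊹ (M j) H (shift₂ H) u v
          ∙ (cong₂ _⊹_ H≡ (ev-shift₂ m H u v (λ a → zero-sum (top-column a) (shift₁-top a)) ∙ cong (v ·_) H≡))

    -- Written with `k ∸ 1` so that each factor is `Hooks.P (k ∸ 1)` by definition.
    factors : List ℕ → ℚ
    factors [] = 1ℚ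
    factors (k ∷ μ) = ((1ℚ ⊹ sgn (k ∸ 1) · pw u (suc (k ∸ 1))) · (1ℚ ⊹ sgn (k ∸ 1) · pw v (suc (k ∸ 1)))) · factors μ

    module _ {cs σ} (D : CycleDecomposition n cs σ) where

      private
        p : IsPerm n σ
        p = isPerm D

      open PermutationTrace {N} (h σ) (colour ∘ κ) (h-injective p) (h-bounded p)

      private
        Θs Ξs : List (List ℕ)
        Θs = cs
        Ξs = map (map (n +_)) cs

        below : ∀ ds → All (IsCycle (lookupD σ)) ds → All (_< n) (concat ds) → Cycles ds × Cycles (map (map (n +_)) ds)
        below [] _ _ = [] , []
        below ((x ∷ xs) ∷ ds) (cyc ∷ cycs) bd with below ds cycs (Allₚ.++⁻ʳ (x ∷ xs) bd)
        ... | r₁ , r₂ = Path-cong (λ y y∈ → sym (h-θ σ (All⇒∀∈ (Allₚ.++⁻ˡ (x ∷ xs) bd) y∈))) (proj₁ cyc) ∷ r₁ , Path-map n (h-ξ σ) (proj₁ cyc) ∷ r₂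

        both : ∀ {as bs} → Cycles as → Cycles bs → Cycles (as ++ bs)
        both [] r = r
        both (p ∷ ps) r = p ∷ both ps r

        prodFactors-++ : ∀ as bs → prodFactors (as ++ bs) ≡ prodFactors as · prodFactors bs
        prodFactors-++ [] bs = sym (·-identityˡ _)
        prodFactors-++ (d ∷ as) bs = cong (factor d ·_) (prodFactors-++ as bs) ∙ sym (·-assoc _ _ _)

        prodFactors≡factors : ∀ ds → All (IsCycle (lookupD σ)) ds → All (_< n) (concat ds) → prodFactors ds · prodFactors (map (map (n +_)) ds) ≡ factors (map length ds)
        prodFactors≡factors [] _ _ = ·-identityˡ _
        prodFactors≡factors ((x ∷ xs) ∷ ds) (_ ∷ cycs) bd = ring115 _ _ _ _
          ∙ cong₂ _·_ (cong₂ (λ a b → (1ℚ ⊹ sgn (length xs) · a) · (1ℚ ⊹ b))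
              (prodL-const (colour ∘ κ) u (x ∷ xs) (λ g g∈ → cong colour (κ-θ (All⇒∀∈ (Allₚ.++⁻ˡ (x ∷ xs) bd) g∈))))
              (cong₂ _·_ (cong sgn (Listₚ.length-map (n +_) xs)) (prodL-const (colour ∘ κ) v (map (n +_) (x ∷ xs)) ξ-colour ∙ cong (pw v) (Listₚ.length-map (n +_) (x ∷ xs)))))
              (prodFactors≡factors ds cycs (Allₚ.++⁻ʳ (x ∷ xs) bd))
          where
          ξ-colour : ∀ g → g ∈ map (n +_) (x ∷ xs) → colour (κ g) ≡ v
          ξ-colour g g∈ with ∈ₚ.∈-map⁻ (n +_) g∈
          ... | y , _ , refl = cong colour (κ-ξ y)

        covered : concat (Θs ++ Ξs) ↭ upTo N
        covered = subst₂ _↭_ (cong (concat Θs ++_) (sym (Listₚ.concat-map cs)) ∙ Listₚ.concat-++ Θs Ξs)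
          (cong (upTo n ++_) (Listₚ.map-upTo (n +_) n) ∙ sym (applyUpTo-+ n n id)) (Permₚ.++⁺ (covers D) (Permₚ.map⁺ (n +_) (covers D)))

      graded-trace : tr (λ x → act N (h σ) (diag κ monomial x)) ≡ factors (map length cs)
      graded-trace = tr-cong (λ x → ≈-sym (hat-colour N (h σ) κ x))
        ∙ tr-permutation (Θs ++ Ξs) (both (proj₁ paths) (proj₂ paths)) covered
        ∙ prodFactors-++ Θs Ξs ∙ prodFactors≡factors cs (cycles D) bd
        where
        bd : All (_< n) (concat cs)
        bd = Permₚ.All-resp-↭ (↭-sym (covers D)) (Allₚ.all-upTo n)
        paths : Cycles Θs × Cycles Ξs
        paths = below cs (cycles D) bd

      ev-K-permutation : ∀ j → (1ℚ ⊹ u) · (1ℚ ⊹ v) · ev (M j) (K (act-Equivariant p) j) u v ≡ (1ℚ − u · v) · factors (map length cs)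
      ev-K-permutation j = ev-K (act-Equivariant p) j ∙ cong ((1ℚ − u · v) ·_) (ev-f (act-Equivariant p) j ∙ graded-trace)

  -- Multiplicities before truncation.

  module Multiplicity (shape : List ℕ) where

    K₀ : List ℕ → ℕ → ℕ → ℚ
    K₀ σ a b = g (act N (h σ)) a b − shift₁ (shift₂ (g (act N (h σ)))) a b

    χ : List (List ℕ) → ℚ
    χ cs = ℤtoℚ (irrChar shape (map length cs))

    -- `frobSchurCoeff` without the cut at a + b < n. These coefficients have a generating function
    -- in closed form, and they agree with the true ones below degree n.
    multiplicity : ℕ → ℕ → ℚ
    multiplicity a b = invℚ (ℕtoℚ (n !)) · sumL (λ d → χ (proj₁ d) · K₀ (proj₂ d) a b) (decompositions n)

    frobSchurCoeff-decompositions : ∀ a b → frobSchurCoeff n shape a b ≡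
      invℚ (ℕtoℚ (n !)) · sumL (λ d → χ (proj₁ d) · (if (a + b) <ᵇ n then K₀ (proj₂ d) a b else 0ℚ)) (decompositions n)
    frobSchurCoeff-decompositions a b = frobSchurCoeff≡ n shape a b ∙ cong (invℚ (ℕtoℚ (n !)) ·_) (sumℚ≡sumL term (perms n)
      ∙ sumL-↭ term (perms↭decompositions n) ∙ sumL-map term proj₂ (decompositions n)
      ∙ sumL-cong∈ (decompositions n) (λ { (cs , σ) d∈ → let D = decompositions-valid n d∈ in
          trans (cong₂ (λ x μ → x · ℤtoℚ (irrChar shape μ)) (Character.charR≡trace a b (isPerm D)) (cycleType≡lengths D)) (·-comm _ _) }))
      where
      term : List ℕ → ℚ
      term σ = charR n a b σ · ℤtoℚ (irrChar shape (cycleType n σ))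

    frobSchurCoeff-low : ∀ a b → a + b < n → frobSchurCoeff n shape a b ≡ multiplicity a b
    frobSchurCoeff-low a b lt = frobSchurCoeff-decompositions a b
      ∙ cong (λ t → invℚ (ℕtoℚ (n !)) · sumL (λ d → χ (proj₁ d) · (if t then K₀ (proj₂ d) a b else 0ℚ)) (decompositions n)) (<⇒<ᵇ lt)

    frobSchurCoeff-high : ∀ a b → n ≤ a + b → frobSchurCoeff n shape a b ≡ 0ℚ
    frobSchurCoeff-high a b ge = frobSchurCoeff-decompositions a b
      ∙ cong (λ t → invℚ (ℕtoℚ (n !)) · sumL (λ d → χ (proj₁ d) · (if t then K₀ (proj₂ d) a b else 0ℚ)) (decompositions n)) (≥⇒<ᵇ-false ge)
        ∙ cong (invℚ (ℕtoℚ (n !)) ·_) (sumL-zero∈ (decompositions n) (λ _ _ → ·-zeroʳ _)) ∙ ·-zeroʳ _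

    module _ (u v : ℚ) (uv≢1 : u · v ≢ 1ℚ) (u≢v : u ≢ v) (r j : ℕ) where
      private
        M : ℕ → ℕ
        M = GradedTrace.M u v

        factors weight : List ℕ → ℚ
        factors = GradedTrace.factors u v
        weight  = Hooks.Beads.weight u v uv≢1 u≢v r

        Av : ℕ → List ℕ → ℚ
        Av = Hooks.Beads.Av u v uv≢1 u≢v r

        W : ℚ
        W = 1ℚ − u · v

        E : ℚ
        E = (1ℚ ⊹ u) · (1ℚ ⊹ v)

        ν! : ℚ
        ν! = invℚ (ℕtoℚ (n !))

      factors≡weight : ∀ μ → factors μ ≡ weight μ
      factors≡weight [] = refl
      factors≡weight (k ∷ μ) = cong (Hooks.P u v uv≢1 u≢v (k ∸ 1) ·_) (factors≡weight μ)

      ev-multiplicity : E · ev (M j) multiplicity u v ≡ W · Av n (betaSet shape)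
      ev-multiplicity = cong (E ·_) (ev-· (M j) ν! (λ a b → sumL (λ d → χ (proj₁ d) · K₀ (proj₂ d) a b) (decompositions n)) u v
            ∙ cong (ν! ·_) (ev-sumL (M j) (λ d a b → χ (proj₁ d) · K₀ (proj₂ d) a b) (decompositions n) u v
            ∙ sumL-cong (decompositions n) (λ d → ev-· (M j) (χ (proj₁ d)) (K₀ (proj₂ d)) u v)))
        ∙ ring2 E ν! _ ∙ cong (ν! ·_) (sym (sumL-· E (λ d → χ (proj₁ d) · ev (M j) (K₀ (proj₂ d)) u v) (decompositions n)))
        ∙ cong (ν! ·_) (sumL-cong∈ (decompositions n) (λ { (cs , σ) d∈ → trans (ring2 E (χ cs) _)
            (cong (χ cs ·_) (GradedTrace.ev-K-permutation u v (decompositions-valid n d∈) j ∙ cong (W ·_) (factors≡weight (map length cs))) ∙ ring191 _ _ _) }))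
        ∙ cong (ν! ·_) (sumL-· W (λ d → weight (map length (proj₁ d)) · χ (proj₁ d)) (decompositions n))
        ∙ ring2 ν! W _

-- λ₂ = y + 2 and λ₁ = λ₂ + k.
module HookMultiplicity (ℓ d y k : ℕ) where

  n : ℕ
  n = d + (2 * ℓ + suc (suc (y + k)) + suc (suc y))

  shape : List ℕ
  shape = suc (suc (y + k)) ∷ suc (suc y) ∷ (replicate ℓ 2 ++ replicate d 1)

  -- The exponent ℓ + λ₂ - 1 of the statement, for λ₂ = y + 2.
  ε : ℕ
  ε = suc (ℓ + y)

  n≡ : n ≡ ε + ε + suc (suc (d + k))
  n≡ = arrange ℓ d y k
    where
    arrange : ∀ ℓ d y k → d + (2 * ℓ + suc (suc (y + k)) + suc (suc y)) ≡ suc (ℓ + y) + suc (ℓ + y) + suc (suc (d + k))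
    arrange = ℕSolver.solve-∀

  n≢0 : n ≢ 0
  n≢0 eq = case ℕₚ.m+n≡0⇒n≡0 (2 * ℓ + suc (suc (y + k))) (ℕₚ.m+n≡0⇒n≡0 d eq) of λ ()

  open Coinvariants.Multiplicity n n≢0 shape

  -- The two parts of (u v)^ε (1 - (u v)^(k + 1)) (1 + u) (1 + v) [d + 1], the closed form of the
  -- multiplicities before truncation.
  Main Tail : Poly
  Main = uvPow* ε (hookPoly d)
  Tail = uvPow* (ε + suc k) (hookPoly d)

  difference : ℕ → ℕ → ℚ
  difference a b = multiplicity a b ⊹ (− 1ℚ) · (coeff Main a b ⊹ (− 1ℚ) · coeff Tail a b)

  -- M is the bound `GradedTrace.M` at `ε + suc k`, see `M≡`, written as a sum from which
  -- `ev-uvPow*` can split off the exponent of either polynomial.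
  m M : ℕ
  m = suc (n + n)
  M = (ε + suc k) + suc m

  M≡ : M ≡ suc (suc ((ε + suc k) + (n + n)))
  M≡ = ℕₚ.+-suc (ε + suc k) m ∙ cong suc (ℕₚ.+-suc (ε + suc k) (n + n))

  d<m : suc d ≤ m
  d<m = s≤s (ℕₚ.≤-trans (ℕₚ.m≤m+n d _) (ℕₚ.m≤m+n n n))

  module _ (i j : ℕ) (2≤j : 2 ≤ j) (j<i : j < i) where

    private
      u v E w : ℚ
      u = ℕtoℚ i
      v = ℕtoℚ j
      E = (1ℚ ⊹ u) · (1ℚ ⊹ v)
      w = u · v

    u≢v : u ≢ v
    u≢v eq = ℕₚ.<-irrefl (sym (ℕtoℚ-injective {i} {j} eq)) j<i

    uv≢1 : u · v ≢ 1ℚ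
    uv≢1 eq = case ℕₚ.≤-trans 2≤j (ℕₚ.≤-reflexive (ℕₚ.m*n≡1⇒n≡1 i j (ℕtoℚ-injective {i * j} {1} (ℕtoℚ-· i j ∙ eq)))) of λ { (s≤s ()) }

    E≢0 : E ≢ 0ℚ
    E≢0 eq = case ℕtoℚ-injective {suc i * suc j} {0} (ℕtoℚ-· (suc i) (suc j) ∙ (cong₂ _·_ (ℕtoℚ-suc i) (ℕtoℚ-suc j)) ∙ eq) of λ ()

    u−v≢0 : u − v ≢ 0ℚ
    u−v≢0 = Hooks.−≢0 u v uv≢1 u≢v u≢v

    ev-K : (u − v) · ev M multiplicity u v ≡ E · (pw w ε · (1ℚ − pw w (suc k)) · (pw u (suc d) − pw v (suc d)))
    ev-K = ·-cancelˡ E E≢0 (trans (ring2 _ _ _) (cong (λ s → (u − v) · (E · ev s multiplicity u v)) M≡)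
      ∙ cong ((u − v) ·_) (ev-multiplicity u v uv≢1 u≢v (suc (suc (ℓ + d))) (ε + suc k)
          ∙ cong (λ β → (1ℚ − u · v) · Hooks.Beads.Av u v uv≢1 u≢v (suc (suc (ℓ + d))) n β) (betaSet-hook (suc (suc (y + k))) (suc (suc y)) ℓ d))
      ∙ sym (·-assoc _ _ _) ∙ Hooks.HookAverage.Av-hook u v uv≢1 u≢v ℓ d y k
      ∙ ·-assoc _ _ _)

    ev-Main : (u − v) · ev M (coeff Main) u v ≡ pw w ε · (E · (pw u (suc d) − pw v (suc d)))
    ev-Main = cong (λ s → (u − v) · ev s (coeff Main) u v) (ℕₚ.+-assoc ε (suc k) (suc m)) ∙ cong ((u − v) ·_) (Evaluation.ev-uvPow* u v ε (suc k + suc m) (hookPoly d))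
      ∙ ring2 _ _ _ ∙ cong (pw w ε ·_) (ev-hookPoly u v d (k + suc m) (ℕₚ.≤-trans d<m (ℕₚ.≤-trans (ℕₚ.n≤1+n m) (ℕₚ.m≤n+m (suc m) k))))

    ev-Tail : (u − v) · ev M (coeff Tail) u v ≡ (pw w ε · pw w (suc k)) · (E · (pw u (suc d) − pw v (suc d)))
    ev-Tail = cong ((u − v) ·_) (Evaluation.ev-uvPow* u v (ε + suc k) (suc m) (hookPoly d))
      ∙ ring2 _ _ _ ∙ (cong₂ _·_ (pw-+ w ε (suc k)) (ev-hookPoly u v d m d<m))

    ev-difference : ev M difference u v ≡ 0ℚ
    ev-difference = ·-cancelˡ (u − v) u−v≢0 (cong ((u − v) ·_) (ev-⊹ M multiplicity (λ a b → (− 1ℚ) · (coeff Main a b ⊹ (− 1ℚ) · coeff Tail a b)) u v ∙ cong (ev M multiplicity u v ⊹_)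
          (ev-· M (− 1ℚ) (λ a b → coeff Main a b ⊹ (− 1ℚ) · coeff Tail a b) u v ∙ cong ((− 1ℚ) ·_)
          (ev-⊹ M (coeff Main) (λ a b → (− 1ℚ) · coeff Tail a b) u v ∙ cong (ev M (coeff Main) u v ⊹_) (ev-· M (− 1ℚ) (coeff Tail) u v))))
      ∙ ring192 _ _ _ _
      ∙ cong₂ _−_ ev-K (cong₂ _−_ ev-Main ev-Tail)
      ∙ ring193 _ _ _ _ (u − v))

  -- The polynomial Tail lives in degrees at least n, where the coefficients of the quotient vanish.
  coefficient-low : ∀ a b → a + b < n → frobSchurCoeff n shape a b ≡ coeff Main a b
  coefficient-low a b lt = frobSchurCoeff-low a b lt ∙ trans (ring194 _ (coeff Main a b) (coeff Tail a b))
    (cong₂ (λ s t → s ⊹ (coeff Main a b ⊹ (− 1ℚ) · t)) (interpolation² M difference ev-difference a b (small (ℕₚ.m≤m+n a b)) (small (ℕₚ.m≤n+m b a))) (cong ℕtoℚ tail≡0) ∙ ring195 _)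
    where
    small : ∀ {i} → i ≤ a + b → i < M
    small i≤ = ℕₚ.≤-trans (ℕₚ.≤-trans (s≤s i≤) (ℕₚ.≤-trans lt (ℕₚ.≤-trans (ℕₚ.m≤m+n n n) (ℕₚ.≤-trans (ℕₚ.n≤1+n _) (ℕₚ.n≤1+n _))))) (ℕₚ.m≤n+m (suc m) (ε + suc k))
    arrange : ∀ ε k d → (ε + suc k) + (ε + suc k) + d ≡ (ε + ε + suc (suc (d + k))) + k
    arrange = ℕSolver.solve-∀
    tail≡0 : Tail a b ≡ 0
    tail≡0 = vanish-below (uvPow*-InDegrees (ε + suc k) (hookPoly-InDegrees d)) a b
      (subst (a + b <_) (sym (arrange ε k d)) (ℕₚ.≤-trans (subst (a + b <_) n≡ lt) (ℕₚ.m≤m+n _ k)))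

  -- The top degree of `Main` is 2 ε + d + 2 = n - k, which lies below n, so the cut leaves it
  -- whole.
  coefficient-distinct : 0 < k → ∀ a b → frobSchurCoeff n shape a b ≡ coeff (uvPow* ε (hookPoly d)) a b
  coefficient-distinct 0<k a b = split (ℕₚ.<-≤-connex (a + b) n)
    where
    above : suc (ε + ε + suc (suc d)) ≤ n
    above = subst₂ _≤_ (ℕₚ.+-suc (ε + ε) (suc (suc d))) (sym n≡) (ℕₚ.+-monoʳ-≤ (ε + ε) (s≤s (s≤s (ℕₚ.m<m+n d 0<k))))
    split : a + b < n ⊎ n ≤ a + b → frobSchurCoeff n shape a b ≡ coeff (uvPow* ε (hookPoly d)) a b
    split (inj₁ lt) = coefficient-low a b lt
    split (inj₂ ge) = frobSchurCoeff-high a b ge ∙ cong ℕtoℚ (sym (vanish-above (uvPow*-InDegrees ε (hookPoly-InDegrees d)) a b (ℕₚ.≤-trans above ge)))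

  -- Now the top degree of `Main` is n itself; the cut deletes just that degree and turns `hookPoly`
  -- into `hookPoly-equal`.
  coefficient-equal : k ≡ 0 → ∀ a b → frobSchurCoeff n shape a b ≡ coeff (uvPow* ε (hookPoly-equal d)) a b
  coefficient-equal k≡0 a b = split (ℕₚ.<-≤-connex (a + b) n)
    where
    degree : n ≡ ε + ε + suc (suc d)
    degree = n≡ ∙ cong (λ t → ε + ε + suc (suc t)) (cong (d +_) k≡0 ∙ ℕₚ.+-identityʳ d)
    split : a + b < n ⊎ n ≤ a + b → frobSchurCoeff n shape a b ≡ coeff (uvPow* ε (hookPoly-equal d)) a b
    split (inj₁ lt) = coefficient-low a b lt ∙ cong ℕtoℚ (uvPow*-cong-below ε (hookPoly-agree d) a b (subst (a + b <_) degree lt))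
    split (inj₂ ge) = frobSchurCoeff-high a b ge ∙ cong ℕtoℚ (sym (vanish-above (uvPow*-InDegrees ε (hookPoly-equal-InDegrees d)) a b
      (ℕₚ.≤-trans (ℕₚ.≤-reflexive (sym (ℕₚ.+-suc (ε + ε) (suc d)) ∙ sym degree)) ge)))

theorem5p2 : (n ℓ λ₁ λ₂ : ℕ) → 2 ≤ λ₂ → λ₂ ≤ λ₁ → 2 * ℓ + λ₁ + λ₂ ≤ n →
  ((λ₁ ≡ λ₂) → (a b : ℕ) →
    frobSchurCoeff n (hookPartition n ℓ λ₁ λ₂) a b
      ≡ ℕtoℚ (uvPow* (ℓ + λ₂ ∸ 1)
                (uvPow* 1 (qint (n ∸ (2 * ℓ + λ₁ + λ₂) + 2 ∸ 2))
                  ⊕ qint (n ∸ (2 * ℓ + λ₁ + λ₂) + 2)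
                  ⊕ qint (n ∸ (2 * ℓ + λ₁ + λ₂) + 2 ∸ 1)) a b))
  × ((λ₂ < λ₁) → (a b : ℕ) →
    frobSchurCoeff n (hookPartition n ℓ λ₁ λ₂) a b
      ≡ ℕtoℚ (uvPow* (ℓ + λ₂ ∸ 1)
                (uvPow* 1 (qint (n ∸ (2 * ℓ + λ₁ + λ₂) + 2 ∸ 1))
                  ⊕ uvPow* 1 (qint (n ∸ (2 * ℓ + λ₁ + λ₂) + 2 ∸ 2))
                  ⊕ qint (n ∸ (2 * ℓ + λ₁ + λ₂) + 2)
                  ⊕ qint (n ∸ (2 * ℓ + λ₁ + λ₂) + 2 ∸ 1)) a b))
theorem5p2 n ℓ λ₁ (suc (suc y)) (s≤s (s≤s z≤n)) λ₂≤λ₁ size≤n =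
  (λ eq → equal λ₁ excess eq n _ n≡) , (λ lt → distinct λ₁ excess lt n _ n≡)
  where
  excess : ∃[ k ] suc (suc y) + k ≡ λ₁
  excess = ℕₚ.m≤n⇒∃[o]m+o≡n λ₂≤λ₁

  n≡ : n ≡ (n ∸ (2 * ℓ + λ₁ + suc (suc y))) + (2 * ℓ + λ₁ + suc (suc y))
  n≡ = sym (ℕₚ.m∸n+n≡m size≤n)

  ε≡ : suc (ℓ + y) ≡ ℓ + suc (suc y) ∸ 1
  ε≡ = sym (cong (_∸ 1) (ℕₚ.+-suc ℓ (suc y) ∙ cong suc (ℕₚ.+-suc ℓ y)))

  -- λ₁, n and the number d of ones are generalised so that matching with `refl` brings the
  -- partition into the form of `HookMultiplicity.shape`; then m is `d + 2`, against `suc (suc d)`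
  -- in `hookPoly-equal`.
  equal : ∀ λ₁ → ∃[ k ] suc (suc y) + k ≡ λ₁ → λ₁ ≡ suc (suc y) → ∀ n d → n ≡ d + (2 * ℓ + λ₁ + suc (suc y)) → ∀ a b →
    frobSchurCoeff n (λ₁ ∷ suc (suc y) ∷ (replicate ℓ 2 ++ replicate d 1)) a b
      ≡ ℕtoℚ (uvPow* (ℓ + suc (suc y) ∸ 1) (uvPow* 1 (qint (d + 2 ∸ 2)) ⊕ qint (d + 2) ⊕ qint (d + 2 ∸ 1)) a b)
  equal _ (k , refl) eq n d refl a b = trans
    (HookMultiplicity.coefficient-equal ℓ d y k (ℕₚ.+-cancelˡ-≡ y k 0 (ℕₚ.suc-injective (ℕₚ.suc-injective eq) ∙ sym (ℕₚ.+-identityʳ y))) a b)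
    (cong₂ (λ x t → ℕtoℚ (uvPow* x (uvPow* 1 (qint (t ∸ 2)) ⊕ qint t ⊕ qint (t ∸ 1)) a b)) ε≡ (ℕₚ.+-comm 2 d))

  distinct : ∀ λ₁ → ∃[ k ] suc (suc y) + k ≡ λ₁ → suc (suc y) < λ₁ → ∀ n d → n ≡ d + (2 * ℓ + λ₁ + suc (suc y)) → ∀ a b →
    frobSchurCoeff n (λ₁ ∷ suc (suc y) ∷ (replicate ℓ 2 ++ replicate d 1)) a b
      ≡ ℕtoℚ (uvPow* (ℓ + suc (suc y) ∸ 1) (uvPow* 1 (qint (d + 2 ∸ 1)) ⊕ uvPow* 1 (qint (d + 2 ∸ 2)) ⊕ qint (d + 2) ⊕ qint (d + 2 ∸ 1)) a b)
  distinct _ (k , refl) (s≤s (s≤s lt)) n d refl a b = trans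
    (HookMultiplicity.coefficient-distinct ℓ d y k (ℕₚ.+-cancelˡ-< y 0 k (subst (_< y + k) (sym (ℕₚ.+-identityʳ y)) lt)) a b)
    (cong₂ (λ x t → ℕtoℚ (uvPow* x (uvPow* 1 (qint (t ∸ 1)) ⊕ uvPow* 1 (qint (t ∸ 2)) ⊕ qint t ⊕ qint (t ∸ 1)) a b)) ε≡ (ℕₚ.+-comm 2 d))
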